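{- Suppose $T$ is a tree on $n\ge 3$ vertices with at least $\rho\binom{n-1}{2}$ paths of length $2$ for some nonnegative real number $\rho$. Then the peak location of the sequence of normalized coefficients $d_0(T),d_1(T),\dots,d_{n-2}(T)$ is at most $\left\lceil\frac{2-\rho}{3-\rho}n\right\rceil$. In particular, since $\rho=0$ applies to every tree, the peak location is at most $\left\lceil\frac{2}{3}n\right\rceil$ for every tree on $n$ vertices.
   Context: A tree is a finite simple undirected connected graph without cycles. The distance matrix $\mathcal{D}(T)$ is indexed by the vertices of $T$, with $(i,j)$-entry equal to the length (number of edges) of a shortest path between $v_i$ and $v_j$. $\delta_k(T)$ denotes the coefficient of $x^k$ in $\det(\mathcal{D}(T)-xI)$, and for $0\le k\le n-2$ the normalized coefficients are $d_k(T)=\frac{1}{2^{n-2}}2^k|\delta_k(T)|$. The number of paths of length $2$ in $T$ is the number of subtrees (subgraphs) of $T$ isomorphic to the path $P_3$ on three vertices. A sequence $a_0,\dots,a_m$ of real numbers is unimodal if there is a $k$ such that $a_{i-1}\le a_i$ for $i\le k$ and $a_i\ge a_{i+1}$ for $i\ge k$ (for all indices for which these make sense). The sequence $d_0(T),\dots,d_{n-2}(T)$ is unimodal for every tree $T$. A peak location of a unimodal sequence is such an index $k$, equivalently an index at which the maximum of the sequence is attained; "the peak location is at most $j$" means that every such $k$ satisfies $k\le j$. -}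

module Defs where

open import Level using (0ℓ)
open import Algebra.Bundles using (RawRing)
import Algebra.Definitions.RawMonoid as RawMonoidOps
import Algebra.Definitions.RawSemiring as RawSemiringOps
open import Data.Empty using (⊥-elim)
open import Data.Fin as Fin using (Fin; zero; suc; toℕ; punchIn)
import Data.Fin.Properties as Finₚ
open import Data.Integer as ℤ using (ℤ; +_)
open import Data.List using (List; []; _∷_; map; length; filter; allFin; cartesianProduct)
open import Data.List.Membership.Propositional using (_∉_)
import Data.List.Membership.DecPropositional as DecMembership
open import Data.List.Relation.Unary.All as All using (All; []; _∷_)
open import Data.List.Relation.Unary.Any using (here; there)
open import Data.List.Relation.Unary.AllPairs using ([]; _∷_)
open import Data.List.Relation.Unary.Unique.Propositional using (Unique)
open import Data.Nat as ℕ using (ℕ; zero; suc; z≤n; s≤s)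
import Data.Nat.Properties as ℕₚ
open import Data.Product using (Σ-syntax; ∃-syntax; _×_; _,_; proj₁; proj₂)
open import Data.Rational as ℚ using (ℚ; 0ℚ; 1ℚ; ½)
import Data.Rational.Properties as ℚₚ
open import Data.Rational.Solver using (module +-*-Solver)
open +-*-Solver using (solve; con; _:=_; _:+_; _:*_; _:-_; :-_)
open import Data.Sum using (_⊎_; inj₁; inj₂)
open import Relation.Binary using (Rel; Decidable; Symmetric)
open import Relation.Binary.PropositionalEquality
open import Relation.Nullary using (¬_; Dec; yes; no)
open import Relation.Nullary.Decidable using (_×-dec_; map′)

------------------------------------------------------------------------
-- Graphs and trees

record Graph (n : ℕ) : Set₁ where
  field
    Adj      : Rel (Fin n) 0ℓ
    adj?     : Decidable Adj
    adj-sym  : Symmetric Adj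
    loopless : ∀ {i} → ¬ Adj i i

module _ {n : ℕ} (G : Graph n) where
  open Graph G
  open DecMembership (Fin._≟_ {n}) using (_∈?_)

  data Walk : Fin n → Fin n → ℕ → Set where
    []  : ∀ {i} → Walk i i 0
    _∷_ : ∀ {i j k l} → Adj i j → Walk j k l → Walk i k (suc l)

  vertices : ∀ {i j l} → Walk i j l → List (Fin n)
  vertices {i} []      = i ∷ []
  vertices {i} (_ ∷ w) = i ∷ vertices w

  Path : Fin n → Fin n → ℕ → Set
  Path i j l = Σ[ w ∈ Walk i j l ] Unique (vertices w)

  Connected : Set
  Connected = ∀ i j → ∃[ l ] Path i j l

  -- A cycle is a path with at least two edges together with an edge
  -- joining its endpoints.
  Acyclic : Set
  Acyclic = ∀ {i j l} → Path i j l → 2 ℕ.≤ l → ¬ Adj j i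

  AvoidingPath : List (Fin n) → Fin n → Fin n → ℕ → Set
  AvoidingPath xs i j l =
    Σ[ w ∈ Walk i j l ] Unique (vertices w) × All (_∉ xs) (vertices w)

  avoidingPath? : ∀ xs i j l → Dec (AvoidingPath xs i j l)
  avoidingPath? xs i j l with i ∈? xs
  avoidingPath? xs i j zero    | yes i∈ = no λ { ([] , _ , i∉ ∷ _) → i∉ i∈ }
  avoidingPath? xs i j (suc l) | yes i∈ = no λ { (_ ∷ _ , _ , i∉ ∷ _) → i∉ i∈ }
  avoidingPath? xs i j zero    | no i∉  =
    map′ (λ { refl → [] , [] ∷ [] , i∉ ∷ [] }) (λ { ([] , _) → refl }) (i Fin.≟ j)
  avoidingPath? xs i j (suc l) | no i∉  =
    map′ to from (Finₚ.any? λ v → adj? i v ×-dec avoidingPath? (i ∷ xs) v j l)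
    where
    to : (∃[ v ] Adj i v × AvoidingPath (i ∷ xs) v j l) → AvoidingPath xs i j (suc l)
    to (_ , a , w , u , av) =
      a ∷ w ,
      All.map (λ v∉ i≡v → v∉ (here (sym i≡v))) av ∷ u ,
      i∉ ∷ All.map (λ v∉ v∈ → v∉ (there v∈)) av
    from : AvoidingPath xs i j (suc l) → ∃[ v ] Adj i v × AvoidingPath (i ∷ xs) v j l
    from (a ∷ w , i≢ ∷ u , _ ∷ av) =
      _ , a , w , u , All.zipWith
        (λ { (i≢v , v∉) (here v≡i) → i≢v (sym v≡i)
           ; (i≢v , v∉) (there v∈) → v∉ v∈ }) (i≢ , av)

  path? : ∀ i j l → Dec (Path i j l)
  path? i j l =
    map′ (λ (w , u , _) → w , u) (λ (w , u) → w , u , All.universal (λ _ ()) _)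
         (avoidingPath? [] i j l)

Least : (ℕ → Set) → Set
Least P = Σ[ d ∈ ℕ ] P d × (∀ m → m ℕ.< d → ¬ P m)

least : {P : ℕ → Set} → (∀ m → Dec (P m)) → ∀ m → P m → Least P
least P? zero    p = 0 , p , λ _ ()
least P? (suc m) p with P? 0
... | yes p₀ = 0 , p₀ , λ _ ()
... | no ¬p₀ with least (λ i → P? (suc i)) m p
...   | d , pd , min =
  suc d , pd , λ { zero _ → ¬p₀ ; (suc i) (s≤s i<d) → min i i<d }

record Tree (n : ℕ) : Set₁ where
  field
    graph     : Graph n
    connected : Connected graph
    acyclic   : Acyclic graph
  open Graph graph public

module _ {n : ℕ} (T : Tree n) where
  open Tree T

  shortestPath : ∀ i j → Least (Path graph i j)
  shortestPath i j =
    let l , p = connected i j in least (path? graph i j) l p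

  dist : Fin n → Fin n → ℕ
  dist i j = proj₁ (shortestPath i j)

  -- A subgraph isomorphic to P₃ is given by its middle vertex v and the
  -- unordered pair {u , w} of its ends; u < w picks one ordering.
  IsP₃ : Fin n × Fin n × Fin n → Set
  IsP₃ (u , v , w) = u Fin.< w × Adj u v × Adj v w

  isP₃? : ∀ t → Dec (IsP₃ t)
  isP₃? (u , v , w) = u Fin.<? w ×-dec adj? u v ×-dec adj? v w

  numP₃ : ℕ
  numP₃ = length (filter isP₃?
    (cartesianProduct (allFin n) (cartesianProduct (allFin n) (allFin n))))

------------------------------------------------------------------------
-- Determinants and integer polynomials

module Determinant {c ℓ} (R : RawRing c ℓ) where
  open RawRing R
  open RawMonoidOps +-rawMonoid using (sum)
  open RawSemiringOps rawSemiring using (_^_)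

  -- Laplace expansion along the first row.
  det : ∀ {n} → (Fin n → Fin n → Carrier) → Carrier
  det {zero}  M = 1#
  det {suc n} M = sum λ j →
    (- 1#) ^ toℕ j * (M zero j * det λ r s → M (suc r) (punchIn j s))

-- Coefficient lists, constant term first; trailing zeros are allowed.
Poly : Set
Poly = List ℤ

coeff : Poly → ℕ → ℤ
coeff []      k       = ℤ.0ℤ
coeff (a ∷ p) zero    = a
coeff (a ∷ p) (suc k) = coeff p k

infixl 6 _+ᴾ_
infixl 7 _*ᴾ_
infix  8 -ᴾ_

_+ᴾ_ : Poly → Poly → Poly
[]      +ᴾ q       = q
(a ∷ p) +ᴾ []      = a ∷ p
(a ∷ p) +ᴾ (b ∷ q) = a ℤ.+ b ∷ p +ᴾ q

-ᴾ_ : Poly → Poly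
-ᴾ p = map (λ a → ℤ.- a) p

_*ᴾ_ : Poly → Poly → Poly
[]      *ᴾ q = []
(a ∷ p) *ᴾ q = map (a ℤ.*_) q +ᴾ (ℤ.0ℤ ∷ p *ᴾ q)

polyRawRing : RawRing 0ℓ 0ℓ
polyRawRing = record
  { Carrier = Poly
  ; _≈_ = λ p q → ∀ k → coeff p k ≡ coeff q k
  ; _+_ = _+ᴾ_ ; _*_ = _*ᴾ_ ; -_ = -ᴾ_
  ; 0# = [] ; 1# = ℤ.1ℤ ∷ []
  }

open Determinant polyRawRing using () renaming (det to detᴾ) public

constᴾ : ℤ → Poly
constᴾ a = a ∷ []

xI : ∀ {n} → Fin n → Fin n → Poly
xI i j with i Fin.≟ j
... | yes _ = ℤ.0ℤ ∷ ℤ.1ℤ ∷ []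
... | no  _ = []

------------------------------------------------------------------------
-- Normalized coefficients and peaks

module _ {n : ℕ} (T : Tree n) where

  charPoly : Poly
  charPoly = detᴾ λ i j → constᴾ (+ dist T i j) +ᴾ -ᴾ xI i j

  δ : ℕ → ℤ
  δ k = coeff charPoly k

  d : ℕ → ℚ
  d k = ℚ._/_ (+ (2 ℕ.^ k ℕ.* ℤ.∣ δ k ∣)) (2 ℕ.^ (n ℕ.∸ 2)) {{ℕₚ.m^n≢0 2 (n ℕ.∸ 2)}}

-- k is a peak location of a 0 , … , a m.
IsPeak : (ℕ → ℚ) → ℕ → ℕ → Set
IsPeak a m k =
  k ℕ.≤ m ×
  (∀ i → i ℕ.< k → a i ℚ.≤ a (suc i)) ×
  (∀ i → k ℕ.≤ i → i ℕ.< m → a i ℚ.≥ a (suc i))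

------------------------------------------------------------------------
-- Real numbers as Cauchy sequences of rationals

IsCauchy : (ℕ → ℚ) → Set
IsCauchy a = ∀ ε → 0ℚ ℚ.< ε →
  ∃[ N ] ∀ i j → N ℕ.≤ i → N ℕ.≤ j → ℚ.∣ a i ℚ.- a j ∣ ℚ.< ε

record ℝ : Set where
  constructor _,_
  field
    seq    : ℕ → ℚ
    cauchy : IsCauchy seq
open ℝ public

infix 4 _<ᴿ_ _≤ᴿ_

_<ᴿ_ : ℝ → ℝ → Set
x <ᴿ y = ∃[ ε ] 0ℚ ℚ.< ε × ∃[ N ] ∀ i → N ℕ.≤ i → seq x i ℚ.+ ε ℚ.< seq y i

_≤ᴿ_ : ℝ → ℝ → Set
x ≤ᴿ y = ¬ (y <ᴿ x)

fromℚ : ℚ → ℝ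
fromℚ q = (λ _ → q) , λ ε 0<ε → 0 , λ _ _ _ _ →
  subst (ℚ._< ε) (sym (cong ℚ.∣_∣ (ℚₚ.+-inverseʳ q))) 0<ε

fromℤ : ℤ → ℝ
fromℤ m = fromℚ (m ℚ./ 1)

fromℕ : ℕ → ℝ
fromℕ m = fromℤ (+ m)

0ᴿ : ℝ
0ᴿ = fromℕ 0

_≠0 : ℝ → Set
x ≠0 = x <ᴿ 0ᴿ ⊎ 0ᴿ <ᴿ x

open ℚₚ.≤-Reasoning

private
  halve : ∀ ε → ½ ℚ.* ε ℚ.+ ½ ℚ.* ε ≡ ε
  halve ε = trans (sym (ℚₚ.*-distribʳ-+ ε ½ ½)) (ℚₚ.*-identityˡ ε)

  *-pos : ∀ {p q} → 0ℚ ℚ.< p → 0ℚ ℚ.< q → 0ℚ ℚ.< p ℚ.* q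
  *-pos {p} {q} 0<p 0<q =
    subst (ℚ._< p ℚ.* q) (ℚₚ.*-zeroʳ p)
      (ℚₚ.*-monoʳ-<-pos p {{ℚ.positive 0<p}} 0<q)

  0<½ : 0ℚ ℚ.< ½
  0<½ = ℚₚ.positive⁻¹ ½

  half-pos : ∀ {ε} → 0ℚ ℚ.< ε → 0ℚ ℚ.< ½ ℚ.* ε
  half-pos = *-pos 0<½

  *-mono-abs : ∀ {a b B δ} → 0ℚ ℚ.< B → ℚ.∣ a ∣ ℚ.≤ B → ℚ.∣ b ∣ ℚ.< δ →
               ℚ.∣ a ℚ.* b ∣ ℚ.< B ℚ.* δ
  *-mono-abs {a} {b} {B} {δ} 0<B a≤ b< = begin-strict
    ℚ.∣ a ℚ.* b ∣       ≡⟨ ℚₚ.∣p*q∣≡∣p∣*∣q∣ a b ⟩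
    ℚ.∣ a ∣ ℚ.* ℚ.∣ b ∣ ≤⟨ ℚₚ.*-monoʳ-≤-nonNeg ℚ.∣ b ∣ {{ℚₚ.∣-∣-nonNeg b}} a≤ ⟩
    B ℚ.* ℚ.∣ b ∣       <⟨ ℚₚ.*-monoʳ-<-pos B {{ℚ.positive 0<B}} b< ⟩
    B ℚ.* δ             ∎

  Bounded : (ℕ → ℚ) → Set
  Bounded a = ∃[ B ] 0ℚ ℚ.< B × ∃[ N ] ∀ i → N ℕ.≤ i → ℚ.∣ a i ∣ ℚ.≤ B

  bounded : ∀ x → Bounded (seq x)
  bounded (a , ca) =
    let N , h = ca 1ℚ (ℚₚ.positive⁻¹ 1ℚ) in
    ℚ.∣ a N ∣ ℚ.+ 1ℚ ,
    ℚₚ.+-mono-≤-< (ℚₚ.0≤∣p∣ (a N)) (ℚₚ.positive⁻¹ 1ℚ) ,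
    N , λ i N≤i → begin
      ℚ.∣ a i ∣                         ≡⟨ cong ℚ.∣_∣ (split (a i) (a N)) ⟩
      ℚ.∣ a N ℚ.+ (a i ℚ.- a N) ∣       ≤⟨ ℚₚ.∣p+q∣≤∣p∣+∣q∣ (a N) (a i ℚ.- a N) ⟩
      ℚ.∣ a N ∣ ℚ.+ ℚ.∣ a i ℚ.- a N ∣   ≤⟨ ℚₚ.+-monoʳ-≤ ℚ.∣ a N ∣ (ℚₚ.<⇒≤ (h i N N≤i ℕₚ.≤-refl)) ⟩
      ℚ.∣ a N ∣ ℚ.+ 1ℚ                  ∎
    where
    split : ∀ p q → p ≡ q ℚ.+ (p ℚ.- q)
    split = solve 2 (λ p q → p := q :+ (p :- q)) refl

  *-1/-cancel : ∀ p .{{_ : ℚ.NonZero p}} q → p ℚ.* (ℚ.1/ p ℚ.* q) ≡ q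
  *-1/-cancel p q =
    trans (sym (ℚₚ.*-assoc p (ℚ.1/ p) q))
      (trans (cong (ℚ._* q) (ℚₚ.*-inverseʳ p)) (ℚₚ.*-identityˡ q))

  shrink : ∀ {p ε} → 0ℚ ℚ.< p → 0ℚ ℚ.< ε → ∃[ η ] 0ℚ ℚ.< η × p ℚ.* η ≡ ε
  shrink {p} {ε} 0<p 0<ε = 1/p ℚ.* ε , *-pos 0<1/p 0<ε , *-1/-cancel p {{nz}} ε
    where
    pos   = ℚ.positive 0<p
    nz    = ℚₚ.pos⇒nonZero p {{pos}}
    1/p   = ℚ.1/_ p {{nz}}
    0<1/p = ℚₚ.positive⁻¹ 1/p {{ℚₚ.1/pos⇒pos p {{pos}}}}

infixl 6 _+ᴿ_ _-ᴿ_
infixl 7 _*ᴿ_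
infix  8 -ᴿ_

_+ᴿ_ : ℝ → ℝ → ℝ
(a , ca) +ᴿ (b , cb) = (λ i → a i ℚ.+ b i) , λ ε 0<ε →
  let M , f = ca (½ ℚ.* ε) (half-pos 0<ε)
      N , g = cb (½ ℚ.* ε) (half-pos 0<ε)
  in M ℕ.⊔ N , λ i j i≥ j≥ → begin-strict
    ℚ.∣ (a i ℚ.+ b i) ℚ.- (a j ℚ.+ b j) ∣        ≡⟨ cong ℚ.∣_∣ (regroup (a i) (b i) (a j) (b j)) ⟩
    ℚ.∣ (a i ℚ.- a j) ℚ.+ (b i ℚ.- b j) ∣        ≤⟨ ℚₚ.∣p+q∣≤∣p∣+∣q∣ (a i ℚ.- a j) (b i ℚ.- b j) ⟩
    ℚ.∣ a i ℚ.- a j ∣ ℚ.+ ℚ.∣ b i ℚ.- b j ∣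
      <⟨ ℚₚ.+-mono-< (f i j (ℕₚ.m⊔n≤o⇒m≤o M N i≥) (ℕₚ.m⊔n≤o⇒m≤o M N j≥))
                     (g i j (ℕₚ.m⊔n≤o⇒n≤o M N i≥) (ℕₚ.m⊔n≤o⇒n≤o M N j≥)) ⟩
    ½ ℚ.* ε ℚ.+ ½ ℚ.* ε                          ≡⟨ halve ε ⟩
    ε                                            ∎
  where
  regroup : ∀ p q r s → (p ℚ.+ q) ℚ.- (r ℚ.+ s) ≡ (p ℚ.- r) ℚ.+ (q ℚ.- s)
  regroup = solve 4 (λ p q r s → (p :+ q) :- (r :+ s) := (p :- r) :+ (q :- s)) refl

_*ᴿ_ : ℝ → ℝ → ℝ
x@(a , ca) *ᴿ y@(b , cb) = (λ i → a i ℚ.* b i) , λ ε 0<ε →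
  let A , 0<A , K , bdA = bounded x
      B , 0<B , L , bdB = bounded y
      η , 0<η , Bη≡     = shrink 0<B (half-pos 0<ε)
      θ , 0<θ , Aθ≡     = shrink 0<A (half-pos 0<ε)
      M , f             = ca η 0<η
      N , g             = cb θ 0<θ
      P                 = (K ℕ.⊔ L) ℕ.⊔ (M ℕ.⊔ N)
      K≤ = ℕₚ.≤-trans (ℕₚ.m≤m⊔n K L) (ℕₚ.m≤m⊔n (K ℕ.⊔ L) (M ℕ.⊔ N))
      L≤ = ℕₚ.≤-trans (ℕₚ.m≤n⊔m K L) (ℕₚ.m≤m⊔n (K ℕ.⊔ L) (M ℕ.⊔ N))
      M≤ = ℕₚ.≤-trans (ℕₚ.m≤m⊔n M N) (ℕₚ.m≤n⊔m (K ℕ.⊔ L) (M ℕ.⊔ N))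
      N≤ = ℕₚ.≤-trans (ℕₚ.m≤n⊔m M N) (ℕₚ.m≤n⊔m (K ℕ.⊔ L) (M ℕ.⊔ N))
  in P , λ i j i≥ j≥ → begin-strict
    ℚ.∣ a i ℚ.* b i ℚ.- a j ℚ.* b j ∣
      ≡⟨ cong ℚ.∣_∣ (regroup (a i) (b i) (a j) (b j)) ⟩
    ℚ.∣ a i ℚ.* (b i ℚ.- b j) ℚ.+ b j ℚ.* (a i ℚ.- a j) ∣
      ≤⟨ ℚₚ.∣p+q∣≤∣p∣+∣q∣ (a i ℚ.* (b i ℚ.- b j)) (b j ℚ.* (a i ℚ.- a j)) ⟩
    ℚ.∣ a i ℚ.* (b i ℚ.- b j) ∣ ℚ.+ ℚ.∣ b j ℚ.* (a i ℚ.- a j) ∣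
      <⟨ ℚₚ.+-mono-<
           (*-mono-abs 0<A (bdA i (ℕₚ.≤-trans K≤ i≥))
             (g i j (ℕₚ.≤-trans N≤ i≥) (ℕₚ.≤-trans N≤ j≥)))
           (*-mono-abs 0<B (bdB j (ℕₚ.≤-trans L≤ j≥))
             (f i j (ℕₚ.≤-trans M≤ i≥) (ℕₚ.≤-trans M≤ j≥))) ⟩
    A ℚ.* θ ℚ.+ B ℚ.* η     ≡⟨ cong₂ ℚ._+_ Aθ≡ Bη≡ ⟩
    ½ ℚ.* ε ℚ.+ ½ ℚ.* ε     ≡⟨ halve ε ⟩
    ε                       ∎
  where
  regroup : ∀ p q r s → p ℚ.* q ℚ.- r ℚ.* s ≡ p ℚ.* (q ℚ.- s) ℚ.+ s ℚ.* (p ℚ.- r)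
  regroup = solve 4 (λ p q r s → p :* q :- r :* s := p :* (q :- s) :+ s :* (p :- r)) refl

-ᴿ_ : ℝ → ℝ
-ᴿ (a , ca) = (λ i → ℚ.- a i) , λ ε 0<ε →
  let N , f = ca ε 0<ε
  in N , λ i j i≥ j≥ → subst (ℚ._< ε) (flip (a i) (a j)) (f i j i≥ j≥)
  where
  flip : ∀ p q → ℚ.∣ p ℚ.- q ∣ ≡ ℚ.∣ ℚ.- p ℚ.- (ℚ.- q) ∣
  flip p q = trans (sym (ℚₚ.∣-p∣≡∣p∣ (p ℚ.- q))) (cong ℚ.∣_∣ (lemma p q))
    where
    lemma : ∀ p q → ℚ.- (p ℚ.- q) ≡ ℚ.- p ℚ.- (ℚ.- q)
    lemma = solve 2 (λ p q → :- (p :- q) := :- p :- (:- q)) refl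

_-ᴿ_ : ℝ → ℝ → ℝ
x -ᴿ y = x +ᴿ (-ᴿ y)

-- The value at 0 is junk: only finitely many terms of x are 0 if x ≠0.
invℚ : ℚ → ℚ
invℚ q with q ℚ.≟ 0ℚ
... | yes _  = 0ℚ
... | no q≢0 = ℚ.1/_ q {{ℚ.≢-nonZero q≢0}}

private
  *-invℚ : ∀ q → q ≢ 0ℚ → q ℚ.* invℚ q ≡ 1ℚ
  *-invℚ q q≢0 with q ℚ.≟ 0ℚ
  ... | yes q≡0 = ⊥-elim (q≢0 q≡0)
  ... | no q≢0′ = ℚₚ.*-inverseʳ q {{ℚ.≢-nonZero q≢0′}}

  p≤∣p∣ : ∀ p → p ℚ.≤ ℚ.∣ p ∣
  p≤∣p∣ p with ℚₚ.≤-total 0ℚ p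
  ... | inj₁ 0≤p = ℚₚ.≤-reflexive (sym (ℚₚ.0≤p⇒∣p∣≡p 0≤p))
  ... | inj₂ p≤0 = ℚₚ.≤-trans p≤0 (ℚₚ.0≤∣p∣ p)

  awayFromZero : ∀ x → x ≠0 →
    ∃[ η ] 0ℚ ℚ.< η × ∃[ N ] ∀ i → N ℕ.≤ i → η ℚ.< ℚ.∣ seq x i ∣
  awayFromZero x (inj₂ (η , 0<η , N , h)) = η , 0<η , N , λ i i≥ →
    ℚₚ.<-≤-trans (subst (ℚ._< seq x i) (ℚₚ.+-identityˡ η) (h i i≥)) (p≤∣p∣ (seq x i))
  awayFromZero x (inj₁ (η , 0<η , N , h)) = η , 0<η , N , λ i i≥ →
    let p = seq x i in begin-strict
      η                        ≡⟨ move p η ⟩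
      ℚ.- p ℚ.+ (p ℚ.+ η)      <⟨ ℚₚ.+-monoʳ-< (ℚ.- p) (h i i≥) ⟩
      ℚ.- p ℚ.+ 0ℚ             ≡⟨ ℚₚ.+-identityʳ (ℚ.- p) ⟩
      ℚ.- p                    ≤⟨ p≤∣p∣ (ℚ.- p) ⟩
      ℚ.∣ ℚ.- p ∣              ≡⟨ ℚₚ.∣-p∣≡∣p∣ p ⟩
      ℚ.∣ p ∣                  ∎
    where
    move : ∀ p q → q ≡ ℚ.- p ℚ.+ (p ℚ.+ q)
    move = solve 2 (λ p q → q := :- p :+ (p :+ q)) refl

  -- ∣p∣⁻¹ * ∣q∣⁻¹ scales ∣p - q∣ to ∣p⁻¹ - q⁻¹∣; here in multiplied-out form.
  inv-diff : ∀ p q → p ≢ 0ℚ → q ≢ 0ℚ →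
    ℚ.∣ p ∣ ℚ.* ℚ.∣ q ∣ ℚ.* ℚ.∣ invℚ p ℚ.- invℚ q ∣ ≡ ℚ.∣ p ℚ.- q ∣
  inv-diff p q p≢0 q≢0 = begin-equality
    ℚ.∣ p ∣ ℚ.* ℚ.∣ q ∣ ℚ.* ℚ.∣ p′ ℚ.- q′ ∣
      ≡⟨ cong (ℚ._* ℚ.∣ p′ ℚ.- q′ ∣) (ℚₚ.∣p*q∣≡∣p∣*∣q∣ p q) ⟨
    ℚ.∣ p ℚ.* q ∣ ℚ.* ℚ.∣ p′ ℚ.- q′ ∣
      ≡⟨ ℚₚ.∣p*q∣≡∣p∣*∣q∣ (p ℚ.* q) (p′ ℚ.- q′) ⟨
    ℚ.∣ p ℚ.* q ℚ.* (p′ ℚ.- q′) ∣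
      ≡⟨ cong ℚ.∣_∣ (expand p q p′ q′) ⟩
    ℚ.∣ q ℚ.* (p ℚ.* p′) ℚ.- p ℚ.* (q ℚ.* q′) ∣
      ≡⟨ cong₂ (λ u v → ℚ.∣ q ℚ.* u ℚ.- p ℚ.* v ∣) (*-invℚ p p≢0) (*-invℚ q q≢0) ⟩
    ℚ.∣ q ℚ.* 1ℚ ℚ.- p ℚ.* 1ℚ ∣
      ≡⟨ cong ℚ.∣_∣ (swap p q) ⟩
    ℚ.∣ ℚ.- (p ℚ.- q) ∣
      ≡⟨ ℚₚ.∣-p∣≡∣p∣ (p ℚ.- q) ⟩
    ℚ.∣ p ℚ.- q ∣ ∎
    where
    p′ = invℚ p
    q′ = invℚ q
    expand : ∀ p q r s → p ℚ.* q ℚ.* (r ℚ.- s) ≡ q ℚ.* (p ℚ.* r) ℚ.- p ℚ.* (q ℚ.* s)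
    expand = solve 4 (λ p q r s → p :* q :* (r :- s) := q :* (p :* r) :- p :* (q :* s)) refl
    swap : ∀ p q → q ℚ.* 1ℚ ℚ.- p ℚ.* 1ℚ ≡ ℚ.- (p ℚ.- q)
    swap = solve 2 (λ p q → q :* con 1ℚ :- p :* con 1ℚ := :- (p :- q)) refl

inv : (x : ℝ) → x ≠0 → ℝ
inv x@(a , ca) x≠0 = (λ i → invℚ (a i)) , λ ε 0<ε →
  let η , 0<η , K , far = awayFromZero x x≠0
      instance
        _ = ℚ.positive 0<η
        _ = ℚ.nonNegative (ℚₚ.<⇒≤ 0<η)
      0<ηη = *-pos 0<η 0<η
      M , f = ca (η ℚ.* η ℚ.* ε) (*-pos 0<ηη 0<ε)
  in K ℕ.⊔ M , λ i j i≥ j≥ →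
    let η<i = far i (ℕₚ.m⊔n≤o⇒m≤o K M i≥)
        η<j = far j (ℕₚ.m⊔n≤o⇒m≤o K M j≥)
        D   = ℚ.∣ invℚ (a i) ℚ.- invℚ (a j) ∣
        instance
          _ = ℚ.positive 0<ηη
          _ = ℚ.nonNegative (ℚₚ.0≤∣p∣ (a i))
          _ = ℚ.nonNegative (ℚₚ.0≤∣p∣ (invℚ (a i) ℚ.- invℚ (a j)))
    in ℚₚ.*-cancelˡ-<-nonNeg (η ℚ.* η) {{ℚ.nonNegative (ℚₚ.<⇒≤ 0<ηη)}} (begin-strict
      η ℚ.* η ℚ.* D
        ≤⟨ ℚₚ.*-monoʳ-≤-nonNeg D (ℚₚ.≤-trans
             (ℚₚ.*-monoʳ-≤-nonNeg η (ℚₚ.<⇒≤ η<i))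
             (ℚₚ.*-monoˡ-≤-nonNeg ℚ.∣ a i ∣ (ℚₚ.<⇒≤ η<j))) ⟩
      ℚ.∣ a i ∣ ℚ.* ℚ.∣ a j ∣ ℚ.* D
        ≡⟨ inv-diff (a i) (a j) (nonzero 0<η η<i) (nonzero 0<η η<j) ⟩
      ℚ.∣ a i ℚ.- a j ∣
        <⟨ f i j (ℕₚ.m⊔n≤o⇒n≤o K M i≥) (ℕₚ.m⊔n≤o⇒n≤o K M j≥) ⟩
      η ℚ.* η ℚ.* ε ∎)
  where
  nonzero : ∀ {η p} → 0ℚ ℚ.< η → η ℚ.< ℚ.∣ p ∣ → p ≢ 0ℚ
  nonzero 0<η η<∣p∣ refl = ℚₚ.<-asym 0<η η<∣p∣

-- m = ⌈ x ⌉, as a relation: the ceiling is not computable from a Cauchy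
-- sequence.
IsCeiling : ℝ → ℤ → Set
IsCeiling x m = fromℤ (m ℤ.- ℤ.1ℤ) <ᴿ x × x ≤ᴿ fromℤ m

module Submission where

-- Let D be the distance matrix of T, let δ₀, δ₁, … be the coefficients of
-- det (D - x I), and let N be the number of paths of length 2.
--
-- Newton's inequalities for a symmetric matrix D can be had without
-- eigenvalues.  Write det ((D - b I) (D - c I) + w I) = Σ h(r,j,i) wʳ cʲ bⁱ.
-- By the Cauchy–Binet formula for [D - b I | I] and [D - c I | w I] the
-- diagonal coefficients P(r,l) = h(r,l,l) are sums of squares of
-- coefficients of minors.  The determinant depends on b, c and w only through
-- b + c and b c + w, so Δ(r,l) = h(r,l,l) - h(r,l+1,l-1) satisfies
--   (l + 1) Δ(r,l) = P(r,l) + (r + 1) Δ(r+1,l-1).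
-- As Δ(0,k) = δₖ² - δₖ₋₁ δₖ₊₁, this gives log-concavity, and bounding the
-- P(r,l) below by the Cauchy–Schwarz inequality (the other factor being
-- the binomial coefficients of det ((1 + w) I)) gives Newton's constant.
--
-- With L the Laplacian and τ = 2 - deg, the matrix M = τ τᵀ - (n - 1) L
-- satisfies D M = 2 (n - 1) I, and hence
--   2 (n - 1) δ₁ = (2 n (n - 1) - 2 N - 4) δ₀.
-- Moreover 8 D is a matrix of squared Euclidean distances, so a principal
-- minor of D of order s has the sign of (-1)ˢ⁻¹ or vanishes, and
-- δ₀, …, δₙ₋₂ have the same sign.  Newton's inequalities then bound
-- |δₖ₊₁ / δₖ| by (n - k) / (n (k + 1)) |δ₁ / δ₀|, which is less than 1/2 as
-- soon as k ≥ (2 - ρ) n / (3 - ρ), where ρ = N / C(n - 1, 2): from there on the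
-- normalized coefficients decrease.

open import Defs using (module Determinant)
open import Level using (0ℓ)
open import Algebra.Bundles using (CommutativeRing; RawRing)
import Algebra.Definitions.RawMonoid as RawMonoidOps
import Algebra.Definitions.RawSemiring as RawSemiringOps
import Algebra.Properties.AbelianGroup as AbelianGroupProperties
import Algebra.Properties.CommutativeMonoid.Mult as CommutativeMonoidMult
import Algebra.Properties.Monoid.Mult.TCOptimised as MonoidMult
import Algebra.Properties.Ring as RingProperties
import Algebra.Properties.Semiring.Mult as NaturalMult
import Algebra.Properties.Semiring.Mult.TCOptimised as SemiringMult
import Algebra.Properties.Semiring.Sum as SemiringSum
import Algebra.Solver.Ring as RingSolver
open import Algebra.Solver.Ring.AlmostCommutativeRing using (fromCommutativeRing; _-Raw-AlmostCommutative⟶_)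
open import Data.Fin as Fin using (Fin; zero; suc; toℕ; punchIn; punchOut)
import Data.Fin.Properties as Finₚ
open import Data.Integer as ℤ using (ℤ; +_; -[1+_]; _⊖_)
import Data.Integer.DivMod as ℤDivMod
import Data.Integer.Properties as ℤₚ
open import Data.Integer.Solver using (module +-*-Solver)
open import Data.List as List using (List; []; _∷_; allFin; tabulate; _++_; cartesianProduct)
import Data.List.Membership.DecPropositional as DecMembership
open import Data.List.Membership.Propositional using (_∈_)
open import Data.List.Relation.Unary.All as All using (All; []; _∷_)
import Data.List.Relation.Unary.All.Properties as Allₚ
open import Data.List.Relation.Unary.AllPairs using ([]; _∷_)
open import Data.List.Relation.Unary.Any using (here; there)
open import Data.List.Relation.Unary.Unique.Propositional using (Unique)
open import Data.Maybe using (Maybe; just; nothing)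
open import Data.Nat as ℕ using (ℕ; zero; suc; _∸_; _≤_; _!; z≤n; s≤s)
open import Data.Nat.Combinatorics using (_C_)
import Data.Nat.Combinatorics as Combinatorics
import Data.Nat.Properties as ℕₚ
import Data.Nat.Solver as ℕSolver
open import Data.Product using (Σ-syntax; ∃-syntax; ∃₂; ∃; _×_; _,_; proj₁; proj₂)
open import Data.Rational as ℚ using (ℚ; 0ℚ; 1ℚ; ½; _/_; ceiling)
import Data.Rational.Properties as ℚₚ
import Data.Rational.Solver as ℚSolver
import Data.Rational.Unnormalised as ℚᵘ
import Data.Rational.Unnormalised.Properties as ℚᵘₚ
open import Data.Sum using (_⊎_; inj₁; inj₂; [_,_]′)
open import Data.Unit using (⊤; tt)
open import Data.Vec as Vec using (Vec; []; _∷_; lookup)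
open import Data.Vec.Functional as Vector using (Vector; insertAt; removeAt; tail) renaming (_∷_ to _⨾_)
import Data.Vec.Functional.Properties as Vectorₚ
import Data.Vec.Properties as Vecₚ
open import Function using (_∘_)
open import Relation.Binary using (tri<; tri≈; tri>)
open import Relation.Binary.PropositionalEquality as ≡ using (_≡_; _≢_; _≗_)
import Relation.Binary.Reasoning.Setoid as SetoidReasoning
open import Relation.Nullary using (Dec; yes; no; ¬_; contradiction)
open import Relation.Nullary.Decidable using (_×-dec_)

-- The sign argument leaves open that some δₖ vanish. Since D is invertible, Cauchy-Schwarz against
-- the blocks M and 2 (n - 1) I gives P(r,0) > 0. This makes log-concavity strict, and then a zero
-- δₖ would force its two neighbours to have opposite signs.
--
-- The vectors behind 8 D have a coordinate for every arc (u, v), equal to +1 or -1 according to the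
-- side of the edge: i and j differ, by 2, exactly in the 2 d(i,j) arcs between them.
--
-- The threshold 1/2 comes from the normalization, as two consecutive normalized coefficients have
-- the quotient 2 |δₖ₊₁ / δₖ|.
--
-- The real ρ enters only at the end. The function (2 - x) / (3 - x) decreases in x, so the exact
-- quotient N / C(n - 1, 2) gives the sharpest bound, and for it the condition on k is an inequality
-- of integers. The order of the reals is a negation and the ceiling is only a relation, so the
-- comparison runs by contraposition: an integer that violates the integer inequality lies strictly
-- below the real bound.

-- A ring solver with integer coefficients for any commutative ring

module IntegerCoefficients (R : CommutativeRing 0ℓ 0ℓ) where
  open CommutativeRing R
  open RingProperties ring
  open SemiringMult semiring using (×-homo-+; ×1-homo-*) renaming (_×_ to _·_)
  open MonoidMult +-monoid using (1+×)
  open AbelianGroupProperties +-abelianGroup using (⁻¹-∙-comm)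
  open SetoidReasoning setoid

  fromℤ′ : ℤ → Carrier
  fromℤ′ (+ n)    = n · 1#
  fromℤ′ -[1+ n ] = - (suc n · 1#)

  cancel-1+ : ∀ x y → (1# + x) - (1# + y) ≈ x - y
  cancel-1+ x y = begin
    (1# + x) - (1# + y)       ≈⟨ +-congˡ (⁻¹-∙-comm 1# y) ⟨
    (1# + x) + (- 1# - y)     ≈⟨ +-congʳ (+-comm 1# x) ⟩
    (x + 1#) + (- 1# - y)     ≈⟨ +-assoc x 1# _ ⟩
    x + (1# + (- 1# - y))     ≈⟨ +-congˡ (+-assoc 1# (- 1#) (- y)) ⟨
    x + ((1# - 1#) - y)       ≈⟨ +-congˡ (+-congʳ (-‿inverseʳ 1#)) ⟩
    x + (0# - y)              ≈⟨ +-congˡ (+-identityˡ (- y)) ⟩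
    x - y                     ∎

  ⊖-homo : ∀ m n → fromℤ′ (m ⊖ n) ≈ m · 1# - n · 1#
  ⊖-homo zero    zero    = sym (-‿inverseʳ 0#)
  ⊖-homo zero    (suc n) = sym (+-identityˡ _)
  ⊖-homo (suc m) zero    = sym (trans (+-congˡ -0#≈0#) (+-identityʳ _))
  ⊖-homo (suc m) (suc n) = begin
    fromℤ′ (suc m ⊖ suc n)         ≡⟨ ≡.cong fromℤ′ (ℤₚ.[1+m]⊖[1+n]≡m⊖n m n) ⟩
    fromℤ′ (m ⊖ n)                 ≈⟨ ⊖-homo m n ⟩
    m · 1# - n · 1#                ≈⟨ cancel-1+ _ _ ⟨
    (1# + m · 1#) - (1# + n · 1#)  ≈⟨ +-cong (1+× m 1#) (-‿cong (1+× n 1#)) ⟨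
    suc m · 1# - suc n · 1#        ∎

  +-homo : ∀ i j → fromℤ′ (i ℤ.+ j) ≈ fromℤ′ i + fromℤ′ j
  +-homo (+ m)    (+ n)    = ×-homo-+ 1# m n
  +-homo (+ m)    -[1+ n ] = ⊖-homo m (suc n)
  +-homo -[1+ m ] (+ n)    = trans (⊖-homo n (suc m)) (+-comm _ _)
  +-homo -[1+ m ] -[1+ n ] = begin
    - (suc (suc (m ℕ.+ n)) · 1#)         ≡⟨ ≡.cong (λ k → - (suc k · 1#)) (ℕₚ.+-suc m n) ⟨
    - ((suc m ℕ.+ suc n) · 1#)           ≈⟨ -‿cong (×-homo-+ 1# (suc m) (suc n)) ⟩
    - (suc m · 1# + suc n · 1#)          ≈⟨ ⁻¹-∙-comm _ _ ⟨
    - (suc m · 1#) - suc n · 1#          ∎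

  -‿homo : ∀ i → fromℤ′ (ℤ.- i) ≈ - fromℤ′ i
  -‿homo (+ zero)  = sym -0#≈0#
  -‿homo (+ suc n) = refl
  -‿homo -[1+ n ]  = sym (-‿involutive _)

  +-*-homo : ∀ m j → fromℤ′ (+ m ℤ.* j) ≈ m · 1# * fromℤ′ j
  +-*-homo m (+ n) = begin
    fromℤ′ (+ m ℤ.* + n)   ≡⟨ ≡.cong fromℤ′ (ℤₚ.pos-* m n) ⟨
    (m ℕ.* n) · 1#         ≈⟨ ×1-homo-* m n ⟩
    m · 1# * n · 1#        ∎
  +-*-homo m -[1+ n ] = begin
    fromℤ′ (+ m ℤ.* -[1+ n ])      ≡⟨ ≡.cong fromℤ′ (ℤₚ.neg-distribʳ-* (+ m) (+ suc n)) ⟨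
    fromℤ′ (ℤ.- (+ m ℤ.* + suc n)) ≈⟨ -‿homo (+ m ℤ.* + suc n) ⟩
    - fromℤ′ (+ m ℤ.* + suc n)     ≈⟨ -‿cong (+-*-homo m (+ suc n)) ⟩
    - (m · 1# * suc n · 1#)        ≈⟨ -‿distribʳ-* _ _ ⟩
    m · 1# * - (suc n · 1#)        ∎

  *-homo : ∀ i j → fromℤ′ (i ℤ.* j) ≈ fromℤ′ i * fromℤ′ j
  *-homo (+ m)    j = +-*-homo m j
  *-homo -[1+ m ] j = begin
    fromℤ′ (-[1+ m ] ℤ.* j)       ≡⟨ ≡.cong fromℤ′ (ℤₚ.neg-distribˡ-* (+ suc m) j) ⟨
    fromℤ′ (ℤ.- (+ suc m ℤ.* j))  ≈⟨ -‿homo (+ suc m ℤ.* j) ⟩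
    - fromℤ′ (+ suc m ℤ.* j)      ≈⟨ -‿cong (+-*-homo (suc m) j) ⟩
    - (suc m · 1# * fromℤ′ j)     ≈⟨ -‿distribˡ-* _ _ ⟩
    - (suc m · 1#) * fromℤ′ j     ∎

  private
    homomorphism : CommutativeRing.rawRing ℤₚ.+-*-commutativeRing
                     -Raw-AlmostCommutative⟶ fromCommutativeRing R
    homomorphism = record
      { ⟦_⟧ = fromℤ′ ; +-homo = +-homo ; *-homo = *-homo ; -‿homo = -‿homo
      ; 0-homo = refl ; 1-homo = refl }

    _coeff≟_ : ∀ i j → Maybe (fromℤ′ i ≈ fromℤ′ j)
    i coeff≟ j with i ℤ.≟ j
    ... | yes ≡.refl = just refl
    ... | no _       = nothing

  open RingSolver _ _ homomorphism _coeff≟_ public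
    using (solve; con; _:=_; _:+_; _:*_; :-_; _:-_)

-- Determinants over a commutative ring

insertAt-∘ : ∀ {A B : Set} (f : A → B) {n} (xs : Vector A n) i v p →
             f (insertAt xs i v p) ≡ insertAt (f ∘ xs) i (f v) p
insertAt-∘ f {n}     xs zero    v zero    = ≡.refl
insertAt-∘ f {n}     xs zero    v (suc p) = ≡.refl
insertAt-∘ f {suc n} xs (suc i) v zero    = ≡.refl
insertAt-∘ f {suc n} xs (suc i) v (suc p) = insertAt-∘ f (tail xs) i v p

lookup-insertAt : ∀ {A : Set} {n} (φ : Vec A n) j e p →
                  lookup (Vec.insertAt φ j e) p ≡ insertAt (lookup φ) j e p
lookup-insertAt φ       zero    e zero    = ≡.refl
lookup-insertAt φ       zero    e (suc p) = ≡.refl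
lookup-insertAt (x ∷ φ) (suc j) e zero    = ≡.refl
lookup-insertAt (x ∷ φ) (suc j) e (suc p) = lookup-insertAt φ j e p

module Determinants (R : CommutativeRing 0ℓ 0ℓ) where
  open CommutativeRing R hiding (zero)
  open IntegerCoefficients R using (solve; con; _:=_; _:+_; _:*_; :-_; _:-_)
  open RingProperties ring using (-0#≈0#; -‿+-comm)
  open SemiringSum semiring using (sum; sum-cong-≋; ∑-distrib-+; ∑-comm; sum-replicate; sum-replicate-zero; *-distribˡ-sum)
  open NaturalMult semiring using () renaming (_×_ to _·_)
  open RawSemiringOps (RawRing.rawSemiring rawRing) using (_^_)
  open Determinant rawRing using (det)
  open SetoidReasoning setoid

  -- Opaque copies of sum and det: the originals unfold as soon as the
  -- dimension is a successor, which defeats unification.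
  opaque
    ∑ : ∀ {n} → Vector Carrier n → Carrier
    ∑ = sum

    ∑-cong : ∀ {n} {f g : Vector Carrier n} → (∀ i → f i ≈ g i) → ∑ f ≈ ∑ g
    ∑-cong {f = f} {g} h = sum-cong-≋ {x = f} {y = g} h

    ∑-nil : ∀ {f : Vector Carrier 0} → ∑ f ≈ 0#
    ∑-nil = refl

    ∑-cons : ∀ {n} {f : Vector Carrier (suc n)} → ∑ f ≈ f zero + ∑ (tail f)
    ∑-cons = refl

    ∑-+ : ∀ {n} {f g : Vector Carrier n} → ∑ (λ i → f i + g i) ≈ ∑ f + ∑ g
    ∑-+ {f = f} {g} = ∑-distrib-+ f g

    ∑-*ˡ : ∀ {n} {x} {f : Vector Carrier n} → ∑ (λ i → x * f i) ≈ x * ∑ f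
    ∑-*ˡ {x = x} {f} = sym (*-distribˡ-sum x f)

    ∑-swap : ∀ {m n} {f : Fin m → Vector Carrier n} → ∑ (λ i → ∑ λ j → f i j) ≈ ∑ (λ j → ∑ λ i → f i j)
    ∑-swap {f = f} = ∑-comm f

    ∑-const : ∀ n {x} → ∑ {n} (λ _ → x) ≈ n · x
    ∑-const n {x} = sum-replicate n {x}

    ∑-zero : ∀ {n} {f : Vector Carrier n} → (∀ i → f i ≈ 0#) → ∑ f ≈ 0#
    ∑-zero {n} {f} h = trans (sum-cong-≋ {x = f} h) (sum-replicate-zero n)

    ∑-neg : ∀ {n} {f : Vector Carrier n} → ∑ (λ i → - f i) ≈ - ∑ f
    ∑-neg {n = zero}  = sym -0#≈0#
    ∑-neg {n = suc n} {f} = trans (+-congˡ (∑-neg {f = tail f})) (-‿+-comm (f zero) (∑ (tail f)))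

    ∑≡sum : ∀ {n} (f : Vector Carrier n) → ∑ f ≡ sum f
    ∑≡sum f = ≡.refl

  Matrix : ℕ → Set
  Matrix n = Fin n → Fin n → Carrier

  minor : ∀ {n} → Matrix (suc n) → Fin (suc n) → Matrix n
  minor A j r s = A (suc r) (punchIn j s)

  sgn : ∀ {n} → Fin n → Carrier
  sgn j = (- 1#) ^ toℕ j

  opaque
    unfolding ∑

    Det : ∀ {n} → Matrix n → Carrier
    Det = det

    Det≡det : ∀ {n} (A : Matrix n) → Det A ≡ det A
    Det≡det A = ≡.refl

    Det-nil : ∀ {A : Matrix 0} → Det A ≈ 1#
    Det-nil = refl

    laplace : ∀ {n} {A : Matrix (suc n)} → Det A ≈ ∑ λ j → sgn j * (A zero j * Det (minor A j))
    laplace = refl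

  kron : ∀ {n} → Matrix n
  kron zero    zero    = 1#
  kron zero    (suc j) = 0#
  kron (suc i) zero    = 0#
  kron (suc i) (suc j) = kron i j

  ∑-*ʳ : ∀ {n} {x} {f : Vector Carrier n} → ∑ (λ i → f i * x) ≈ ∑ f * x
  ∑-*ʳ {x = x} {f} = trans (∑-cong λ i → *-comm (f i) x) (trans ∑-*ˡ (*-comm x _))

  sgn² : ∀ {n} (j : Fin n) → sgn j * sgn j ≈ 1#
  sgn² zero    = *-identityˡ 1#
  sgn² (suc j) = trans
    (solve 1 (λ s → (:- con (+ 1) :* s) :* (:- con (+ 1) :* s) := s :* s) refl (sgn j)) (sgn² j)

  ∑-kron : ∀ {n} (v : Fin n) (f : Vector Carrier n) → ∑ (λ j → kron v j * f j) ≈ f v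
  ∑-kron zero f = trans ∑-cons (trans
    (+-cong (*-identityˡ _) (∑-zero λ j → zeroˡ (f (suc j)))) (+-identityʳ _))
  ∑-kron (suc v) f = trans ∑-cons (trans (+-cong (zeroˡ _) (∑-kron v (tail f))) (+-identityˡ _))

  kron-sym : ∀ {n} (i j : Fin n) → kron i j ≡ kron j i
  kron-sym zero    zero    = ≡.refl
  kron-sym zero    (suc j) = ≡.refl
  kron-sym (suc i) zero    = ≡.refl
  kron-sym (suc i) (suc j) = kron-sym i j

  kron-diagonal : ∀ {n} (i : Fin n) → kron i i ≡ 1#
  kron-diagonal zero    = ≡.refl
  kron-diagonal (suc i) = kron-diagonal i

  kron-off : ∀ {n} {i j : Fin n} → i ≢ j → kron i j ≡ 0#
  kron-off {i = zero}  {zero}  i≢j = contradiction ≡.refl i≢j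
  kron-off {i = zero}  {suc j} i≢j = ≡.refl
  kron-off {i = suc i} {zero}  i≢j = ≡.refl
  kron-off {i = suc i} {suc j} i≢j = kron-off (i≢j ∘ ≡.cong suc)

  kron-punchIn : ∀ {n} (v : Fin (suc n)) r s → kron (punchIn v r) (punchIn v s) ≡ kron r s
  kron-punchIn zero    r       s       = ≡.refl
  kron-punchIn (suc v) zero    zero    = ≡.refl
  kron-punchIn (suc v) zero    (suc s) = ≡.refl
  kron-punchIn (suc v) (suc r) zero    = ≡.refl
  kron-punchIn (suc v) (suc r) (suc s) = kron-punchIn v r s

  ∑-kronʳ : ∀ {n} (v : Fin n) (f : Vector Carrier n) → ∑ (λ j → f j * kron j v) ≈ f v
  ∑-kronʳ v f = trans
    (∑-cong λ j → trans (*-comm _ _) (*-congʳ (reflexive (kron-sym j v)))) (∑-kron v f)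

  Det-cong : ∀ {n} {A B : Matrix n} → (∀ i j → A i j ≈ B i j) → Det A ≈ Det B
  Det-cong {zero}  h = trans Det-nil (sym Det-nil)
  Det-cong {suc n} h = trans laplace (trans
    (∑-cong λ j → *-congˡ (*-cong (h zero j) (Det-cong λ r s → h (suc r) (punchIn j s)))) (sym laplace))

  laplace-cons : ∀ {n} (a : Vector Carrier (suc n)) B →
                 Det (a ⨾ B) ≈ ∑ λ j → sgn j * (a j * Det (λ r s → B r (punchIn j s)))
  laplace-cons a B = laplace

  module _ {n : ℕ} where
    -- Laplace expansion along two rows at once. The remaining minor is abstracted to a function `m`
    -- of the embedding of the surviving columns; this lets an induction remove columns without any
    -- reference to the other rows.
    double : (a b : Vector Carrier (2 ℕ.+ n)) → ((Fin n → Fin (2 ℕ.+ n)) → Carrier) → Carrier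
    double a b m = ∑ λ j → sgn j *
      (a j * ∑ λ k → sgn k * (b (punchIn j k) * m (punchIn j ∘ punchIn k)))

    lead : Vector Carrier (2 ℕ.+ n) → ((Fin n → Fin (2 ℕ.+ n)) → Carrier) → Carrier
    lead b m = ∑ λ k → sgn k * (b (suc k) * m (suc ∘ punchIn k))

    rest : (a b : Vector Carrier (2 ℕ.+ n)) → ((Fin n → Fin (2 ℕ.+ n)) → Carrier) → Carrier
    rest a b m = ∑ λ j → sgn j * (a (suc j) * ∑ λ k →
      sgn k * (b (suc (punchIn j k)) * m (punchIn (suc j) ∘ punchIn (suc k))))

    -- Separates the terms in which `a` or `b` is evaluated in column 0. They are visibly
    -- antisymmetric, and `rest` is again a double expansion, of the two tails.
    double-split : ∀ a b m → double a b m ≈ (a zero * lead b m - b zero * lead a m) + rest a b m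
    double-split a b m = begin
      double a b m
        ≈⟨ ∑-cons ⟩
      1# * (a₀ * lead b m) + ∑ (λ j → sgn (suc j) * (a (suc j) * ∑ λ k → sgn k * (b (punchIn (suc j) k) * m (punchIn (suc j) ∘ punchIn k))))
        ≈⟨ +-cong (*-identityˡ _) (∑-cong inner) ⟩
      a₀ * lead b m + ∑ (λ j → - (b₀ * L j) + S j)
        ≈⟨ +-congˡ ∑-+ ⟩
      a₀ * lead b m + (∑ (λ j → - (b₀ * L j)) + rest a b m)
        ≈⟨ +-congˡ (+-congʳ (trans ∑-neg (-‿cong ∑-*ˡ))) ⟩
      a₀ * lead b m + (- (b₀ * lead a m) + rest a b m)
        ≈⟨ +-assoc _ _ _ ⟨
      (a₀ * lead b m - b₀ * lead a m) + rest a b m ∎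
      where
      a₀ = a zero
      b₀ = b zero
      L S : Vector Carrier (suc n)
      L j = sgn j * (a (suc j) * m (suc ∘ punchIn j))
      t : Fin (suc n) → Fin n → Carrier
      t j k = b (suc (punchIn j k)) * m (punchIn (suc j) ∘ punchIn (suc k))
      S j = sgn j * (a (suc j) * ∑ λ k → sgn k * t j k)
      flip : ∀ j → ∑ (λ k → sgn (suc k) * t j k) ≈ - ∑ (λ k → sgn k * t j k)
      flip j = trans
        (∑-cong λ k → solve 2 (λ s x → (:- con (+ 1) :* s) :* x := :- (s :* x)) refl (sgn k) (t j k))
        ∑-neg
      inner : ∀ j → sgn (suc j) * (a (suc j) * ∑ λ k → sgn k * (b (punchIn (suc j) k) * m (punchIn (suc j) ∘ punchIn k)))
                  ≈ - (b₀ * L j) + S j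
      inner j = trans (*-congˡ (*-congˡ (trans ∑-cons (+-congˡ (flip j)))))
        (solve 5 (λ s x y z w → (:- con (+ 1) :* s) :* (x :* (con (+ 1) :* (y :* z) :+ :- w))
                    := :- (y :* (s :* (x :* z))) :+ s :* (x :* w))
               refl (sgn j) (a (suc j)) b₀ (m (suc ∘ punchIn j)) (∑ λ k → sgn k * t j k))

  -- Embeddings of columns are functions, equal only pointwise, so `m` has to respect pointwise
  -- equality.
  Cong : ∀ {m n} → ((Fin m → Fin n) → Carrier) → Set
  Cong m = ∀ {θ θ′} → θ ≗ θ′ → m θ ≈ m θ′

  rest-zero : ∀ a b m → rest {zero} a b m ≈ 0#
  rest-zero a b m = ∑-zero λ j → trans (*-congˡ (trans (*-congˡ ∑-nil) (zeroʳ _))) (zeroʳ (sgn j))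

  rest-suc : ∀ {n} a b m → Cong m → rest {suc n} a b m ≈ double (tail a) (tail b) (m ∘ Fin.lift 1)
  rest-suc a b m m-cong = ∑-cong λ j → *-congˡ (*-congˡ (∑-cong λ k → *-congˡ
    (*-congˡ (m-cong {punchIn (suc j) ∘ punchIn (suc k)} {Fin.lift 1 (punchIn j ∘ punchIn k)}
      λ { zero → ≡.refl ; (suc s) → ≡.refl }))))

  lift-cong : ∀ {m n} {θ θ′ : Fin m → Fin n} → θ ≗ θ′ → Fin.lift 1 θ ≗ Fin.lift 1 θ′
  lift-cong h zero    = ≡.refl
  lift-cong h (suc s) = ≡.cong suc (h s)

  double-antisym : ∀ {n} a b (m : (Fin n → Fin (2 ℕ.+ n)) → Carrier) → Cong m →
                   double a b m ≈ - double b a m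
  double-antisym {zero} a b m m-cong = begin
    double a b m                                           ≈⟨ double-split a b m ⟩
    (a₀ * lead b m - b₀ * lead a m) + rest a b m           ≈⟨ +-congˡ (rest-zero a b m) ⟩
    (a₀ * lead b m - b₀ * lead a m) + 0#
      ≈⟨ solve 2 (λ x y → (x :- y) :+ con (+ 0) := :- ((y :- x) :+ con (+ 0))) refl (a₀ * lead b m) (b₀ * lead a m) ⟩
    - ((b₀ * lead a m - a₀ * lead b m) + 0#)               ≈⟨ -‿cong (+-congˡ (rest-zero b a m)) ⟨
    - ((b₀ * lead a m - a₀ * lead b m) + rest b a m)       ≈⟨ -‿cong (double-split b a m) ⟨
    - double b a m ∎
    where
    a₀ = a zero
    b₀ = b zero
  double-antisym {suc n} a b m m-cong = begin
    double a b m                                           ≈⟨ double-split a b m ⟩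
    (a₀ * lead b m - b₀ * lead a m) + rest a b m           ≈⟨ +-congˡ (rest-suc a b m m-cong) ⟩
    (a₀ * lead b m - b₀ * lead a m) + T a b
      ≈⟨ +-congˡ (double-antisym (tail a) (tail b) (m ∘ Fin.lift 1) (m-cong ∘ lift-cong)) ⟩
    (a₀ * lead b m - b₀ * lead a m) - T b a
      ≈⟨ solve 3 (λ x y z → (x :- y) :- z := :- ((y :- x) :+ z)) refl (a₀ * lead b m) (b₀ * lead a m) (T b a) ⟩
    - ((b₀ * lead a m - a₀ * lead b m) + T b a)            ≈⟨ -‿cong (+-congˡ (rest-suc b a m m-cong)) ⟨
    - ((b₀ * lead a m - a₀ * lead b m) + rest b a m)       ≈⟨ -‿cong (double-split b a m) ⟨
    - double b a m ∎
    where
    a₀ = a zero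
    b₀ = b zero
    T : (a b : Vector Carrier (3 ℕ.+ n)) → Carrier
    T a b = double (tail a) (tail b) (m ∘ Fin.lift 1)

  double-self : ∀ {n} a (m : (Fin n → Fin (2 ℕ.+ n)) → Carrier) → Cong m → double a a m ≈ 0#
  double-self {n} a m m-cong = begin
    double a a m                                                    ≈⟨ double-split a a m ⟩
    (a zero * lead a m - a zero * lead a m) + rest a a m            ≈⟨ +-cong (-‿inverseʳ _) (rest≈0 n a m m-cong) ⟩
    0# + 0#                                                         ≈⟨ +-identityˡ 0# ⟩
    0# ∎
    where
    rest≈0 : ∀ n a (m : (Fin n → Fin (2 ℕ.+ n)) → Carrier) → Cong m → rest a a m ≈ 0#
    rest≈0 zero    a m m-cong = rest-zero a a m
    rest≈0 (suc n) a m m-cong = trans (rest-suc a a m m-cong)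
      (double-self (tail a) (m ∘ Fin.lift 1) (m-cong ∘ lift-cong))

  columns : ∀ {n l} → (Fin n → Fin l → Carrier) → (Fin n → Fin l) → Carrier
  columns B θ = Det λ r s → B r (θ s)

  columns-cong : ∀ {n l} (B : Fin n → Fin l → Carrier) → Cong (columns B)
  columns-cong B h = Det-cong λ r s → reflexive (≡.cong (B r) (h s))

  Det-double : ∀ {n} a b (B : Fin n → Fin (2 ℕ.+ n) → Carrier) → Det (a ⨾ (b ⨾ B)) ≈ double a b (columns B)
  Det-double a b B = trans laplace (∑-cong λ j → *-congˡ (*-congˡ laplace))

  Det-swap : ∀ {n} a b (B : Fin n → Fin (2 ℕ.+ n) → Carrier) → Det (a ⨾ (b ⨾ B)) ≈ - Det (b ⨾ (a ⨾ B))
  Det-swap a b B = begin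
    Det (a ⨾ (b ⨾ B))           ≈⟨ Det-double a b B ⟩
    double a b (columns B)      ≈⟨ double-antisym a b (columns B) (columns-cong B) ⟩
    - double b a (columns B)    ≈⟨ -‿cong (Det-double b a B) ⟨
    - Det (b ⨾ (a ⨾ B)) ∎

  -- The row inserted at `i` moves to the front past `i` other rows, one `Det-swap` each. Later row
  -- manipulations are reduced to this rule, so that no permutations are needed.
  Det-insertAt : ∀ {n} (B : Fin n → Fin (suc n) → Carrier) i r → Det (insertAt B i r) ≈ sgn i * Det (r ⨾ B)
  Det-insertAt B zero r = trans
    (Det-cong λ { zero s → refl ; (suc p) s → refl }) (sym (*-identityˡ _))
  Det-insertAt {suc n} B (suc i) r = begin
    Det (insertAt B (suc i) r)
      ≈⟨ laplace ⟩
    ∑ (λ j → sgn j * (B zero j * Det (λ p s → insertAt (tail B) i r p (punchIn j s))))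
      ≈⟨ ∑-cong (λ j → *-congˡ (*-congˡ (minor′ j))) ⟩
    ∑ (λ j → sgn j * (B zero j * (sgn i * d j)))
      ≈⟨ ∑-cong (λ j → solve 4 (λ s x t y → s :* (x :* (t :* y)) := t :* (s :* (x :* y)))
                         refl (sgn j) (B zero j) (sgn i) (d j)) ⟩
    ∑ (λ j → sgn i * (sgn j * (B zero j * d j)))
      ≈⟨ ∑-*ˡ ⟩
    sgn i * ∑ (λ j → sgn j * (B zero j * d j))
      ≈⟨ *-congˡ (∑-cong λ j → *-congˡ (*-congˡ (Det-cong λ { zero s → refl ; (suc p) s → refl }))) ⟩
    sgn i * ∑ (λ j → sgn j * (B zero j * Det (λ p s → (r ⨾ tail B) p (punchIn j s))))
      ≈⟨ *-congˡ (laplace-cons (B zero) (r ⨾ tail B)) ⟨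
    sgn i * Det (B zero ⨾ (r ⨾ tail B))
      ≈⟨ *-congˡ (Det-swap (B zero) r (tail B)) ⟩
    sgn i * - Det (r ⨾ (B zero ⨾ tail B))
      ≈⟨ solve 2 (λ s x → s :* :- x := (:- con (+ 1) :* s) :* x) refl (sgn i) _ ⟩
    sgn (suc i) * Det (r ⨾ (B zero ⨾ tail B))
      ≈⟨ *-congˡ (Det-cong λ { zero s → refl ; (suc zero) s → refl ; (suc (suc p)) s → refl }) ⟩
    sgn (suc i) * Det (r ⨾ B) ∎
    where
    d : Vector Carrier (2 ℕ.+ n)
    d j = Det ((r ∘ punchIn j) ⨾ λ p s → B (suc p) (punchIn j s))
    minor′ : ∀ j → Det (λ p s → insertAt (tail B) i r p (punchIn j s)) ≈ sgn i * d j
    minor′ j = trans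
      (Det-cong λ p s → reflexive (≡.cong (λ row → row s) (insertAt-∘ (_∘ punchIn j) (tail B) i r p)))
      (Det-insertAt (λ p s → B (suc p) (punchIn j s)) i (r ∘ punchIn j))

  Det-repeat-head : ∀ {n} (B : Fin n → Fin (suc n) → Carrier) k → Det (B k ⨾ B) ≈ 0#
  Det-repeat-head {suc n} B k = begin
    Det (B k ⨾ B)                                ≈⟨ Det-cong rows ⟩
    Det (insertAt (B k ⨾ B′) (suc k) (B k))      ≈⟨ Det-insertAt (B k ⨾ B′) (suc k) (B k) ⟩
    sgn (suc k) * Det (B k ⨾ (B k ⨾ B′))         ≈⟨ *-congˡ (Det-double (B k) (B k) B′) ⟩
    sgn (suc k) * double (B k) (B k) (columns B′) ≈⟨ *-congˡ (double-self (B k) (columns B′) (columns-cong B′)) ⟩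
    sgn (suc k) * 0#                             ≈⟨ zeroʳ _ ⟩
    0# ∎
    where
    B′ = removeAt B k
    rows : ∀ p s → (B k ⨾ B) p s ≈ insertAt (B k ⨾ B′) (suc k) (B k) p s
    rows zero    s = refl
    rows (suc p) s = reflexive (≡.cong (λ row → row s) (≡.sym (Vectorₚ.insertAt-removeAt B k p)))

  Det-expand : ∀ {n} (A : Matrix (suc n)) i → Det A ≈ sgn i * Det (A i ⨾ removeAt A i)
  Det-expand A i = trans
    (Det-cong λ p s → reflexive (≡.cong (λ row → row s) (≡.sym (Vectorₚ.insertAt-removeAt A i p))))
    (Det-insertAt (removeAt A i) i (A i))

  Det-repeat : ∀ {n} (A : Matrix n) {i j} → i ≢ j → (∀ s → A i s ≈ A j s) → Det A ≈ 0#
  Det-repeat {suc n} A {i} {j} i≢j h = begin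
    Det A                                 ≈⟨ Det-expand A i ⟩
    sgn i * Det (A i ⨾ A′)                ≈⟨ *-congˡ (Det-cong rows) ⟩
    sgn i * Det (A′ k ⨾ A′)               ≈⟨ *-congˡ (Det-repeat-head A′ k) ⟩
    sgn i * 0#                            ≈⟨ zeroʳ _ ⟩
    0# ∎
    where
    k = punchOut i≢j
    A′ = removeAt A i
    rows : ∀ p s → (A i ⨾ A′) p s ≈ (A′ k ⨾ A′) p s
    rows zero    s = trans (h s) (reflexive (≡.cong (λ l → A l s) (≡.sym (Finₚ.punchIn-punchOut i≢j))))
    rows (suc p) s = refl

  Det-zeroColumn : ∀ {n} (A : Matrix (suc n)) → (∀ i → A i zero ≈ 0#) → Det A ≈ 0#
  Det-zeroColumn {n} A h = trans laplace (∑-zero term)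
    where
    minor≈0 : ∀ {n} (A : Matrix (suc n)) → (∀ i → A i zero ≈ 0#) → ∀ (j : Fin n) → Det (minor A (suc j)) ≈ 0#
    minor≈0 {suc n} A h j = Det-zeroColumn (minor A (suc j)) (h ∘ suc)
    term : ∀ j → sgn j * (A zero j * Det (minor A j)) ≈ 0#
    term zero    = trans (*-congˡ (trans (*-congʳ (h zero)) (zeroˡ _))) (zeroʳ _)
    term (suc j) = trans (*-congˡ (trans (*-congˡ (minor≈0 A h j)) (zeroʳ _))) (zeroʳ _)

  Det-kron-head : ∀ {n} v (B : Fin n → Fin (suc n) → Carrier) →
                  Det (kron v ⨾ B) ≈ sgn v * Det (λ r s → B r (punchIn v s))
  Det-kron-head v B = begin
    Det (kron v ⨾ B)                              ≈⟨ laplace-cons (kron v) B ⟩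
    ∑ (λ j → sgn j * (kron v j * d j))
      ≈⟨ ∑-cong (λ j → solve 3 (λ s x y → s :* (x :* y) := x :* (s :* y)) refl (sgn j) (kron v j) (d j)) ⟩
    ∑ (λ j → kron v j * (sgn j * d j))            ≈⟨ ∑-kron v (λ j → sgn j * d j) ⟩
    sgn v * d v ∎
    where
    d : ∀ j → Carrier
    d j = Det (λ r s → B r (punchIn j s))

  -- The way principal minors arise below: the sign for moving row `v` to the front cancels the sign
  -- of its only nonzero entry.
  Det-insert-kron : ∀ {n} (A : Matrix (suc n)) v →
                    Det (insertAt (removeAt A v) v (kron v)) ≈ Det (λ r s → A (punchIn v r) (punchIn v s))
  Det-insert-kron A v = begin
    Det (insertAt (removeAt A v) v (kron v))    ≈⟨ Det-insertAt (removeAt A v) v (kron v) ⟩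
    sgn v * Det (kron v ⨾ removeAt A v)         ≈⟨ *-congˡ (Det-kron-head v (removeAt A v)) ⟩
    sgn v * (sgn v * d)                         ≈⟨ *-assoc (sgn v) (sgn v) d ⟨
    sgn v * sgn v * d                           ≈⟨ *-congʳ (sgn² v) ⟩
    1# * d                                      ≈⟨ *-identityˡ d ⟩
    d ∎
    where d = Det (λ r s → A (punchIn v r) (punchIn v s))

  Det-kron : ∀ n → Det (kron {n}) ≈ 1#
  Det-kron zero    = Det-nil
  Det-kron (suc n) = begin
    Det (kron {suc n})                   ≈⟨ Det-cong {A = kron} {B = kron zero ⨾ tail kron} (λ { zero s → refl ; (suc r) s → refl }) ⟩
    Det (kron zero ⨾ tail kron)          ≈⟨ Det-kron-head zero (tail (kron {suc n})) ⟩
    1# * Det (kron {n})                  ≈⟨ trans (*-identityˡ _) (Det-kron n) ⟩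
    1# ∎

  ∏ : ∀ {n} → Vector Carrier n → Carrier
  ∏ {zero}  c = 1#
  ∏ {suc n} c = c zero * ∏ (tail c)

  Det-scale : ∀ {n} (c : Vector Carrier n) A → Det (λ i j → c i * A i j) ≈ ∏ c * Det A
  Det-scale {zero}  c A = trans Det-nil (sym (trans (*-identityˡ _) Det-nil))
  Det-scale {suc n} c A = begin
    Det (λ i j → c i * A i j)
      ≈⟨ laplace ⟩
    ∑ (λ j → sgn j * ((c zero * A zero j) * Det (λ r s → tail c r * minor A j r s)))
      ≈⟨ ∑-cong (λ j → *-congˡ (*-congˡ (Det-scale (tail c) (minor A j)))) ⟩
    ∑ (λ j → sgn j * ((c zero * A zero j) * (∏ (tail c) * Det (minor A j))))
      ≈⟨ ∑-cong (λ j → solve 5 (λ s a x p y → s :* ((a :* x) :* (p :* y)) := (a :* p) :* (s :* (x :* y)))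
                         refl (sgn j) (c zero) (A zero j) (∏ (tail c)) (Det (minor A j))) ⟩
    ∑ (λ j → ∏ c * (sgn j * (A zero j * Det (minor A j))))
      ≈⟨ trans ∑-*ˡ (*-congˡ (sym laplace)) ⟩
    ∏ c * Det A ∎

-- The Cauchy–Binet formula

-- Either 0 is not an entry of φ, or it can be taken out.
findZero : ∀ {m n} (φ : Vec (Fin (suc m)) n) →
           (∃ λ ψ → φ ≡ Vec.map suc ψ) ⊎
           (∃ λ n′ → ∃₂ λ (i : Fin (suc n′)) ψ → ∃ λ (e : n ≡ suc n′) → ≡.subst (Vec (Fin (suc m))) e φ ≡ Vec.insertAt ψ i zero)
findZero [] = inj₁ ([] , ≡.refl)
findZero (zero ∷ φ) = inj₂ (_ , zero , φ , ≡.refl , ≡.refl)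
findZero (suc a ∷ φ) with findZero φ
... | inj₁ (ψ , eq) = inj₁ (a ∷ ψ , ≡.cong (suc a ∷_) eq)
... | inj₂ (n′ , i , ψ , ≡.refl , eq) = inj₂ (suc n′ , suc i , suc a ∷ ψ , ≡.refl , ≡.cong (suc a ∷_) eq)

module CauchyBinet (R : CommutativeRing 0ℓ 0ℓ) where
  open CommutativeRing R hiding (zero)
  open IntegerCoefficients R using (solve; con; _:=_; _:+_; _:*_; :-_; _:-_)
  open NaturalMult semiring using (×-congʳ; ×-assocˡ; ×-comm-*) renaming (_×_ to _·_)
  open CommutativeMonoidMult +-commutativeMonoid using (×-distrib-+)
  open Determinants R
  open SetoidReasoning setoid

  ∑ᴸ : ∀ {I : Set} → List I → (I → Carrier) → Carrier
  ∑ᴸ []       f = 0#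
  ∑ᴸ (x ∷ xs) f = f x + ∑ᴸ xs f

  module _ {I : Set} where
    ∑ᴸ-cong : ∀ (xs : List I) {f g : I → Carrier} → (∀ x → f x ≈ g x) → ∑ᴸ xs f ≈ ∑ᴸ xs g
    ∑ᴸ-cong []       h = refl
    ∑ᴸ-cong (x ∷ xs) h = +-cong (h x) (∑ᴸ-cong xs h)

    ∑ᴸ-+ : ∀ (xs : List I) {f g : I → Carrier} → ∑ᴸ xs (λ x → f x + g x) ≈ ∑ᴸ xs f + ∑ᴸ xs g
    ∑ᴸ-+ []       = sym (+-identityˡ 0#)
    ∑ᴸ-+ (x ∷ xs) {f} {g} = trans (+-congˡ (∑ᴸ-+ xs))
      (solve 4 (λ a b c d → (a :+ b) :+ (c :+ d) := (a :+ c) :+ (b :+ d)) refl (f x) (g x) _ _)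

    ∑ᴸ-0 : ∀ (xs : List I) → ∑ᴸ xs (λ _ → 0#) ≈ 0#
    ∑ᴸ-0 []       = refl
    ∑ᴸ-0 (x ∷ xs) = trans (+-identityˡ _) (∑ᴸ-0 xs)

    ∑ᴸ-*ˡ : ∀ (xs : List I) {a} {f : I → Carrier} → ∑ᴸ xs (λ x → a * f x) ≈ a * ∑ᴸ xs f
    ∑ᴸ-*ˡ []       {a} = sym (zeroʳ a)
    ∑ᴸ-*ˡ (x ∷ xs) {a} {f} = trans (+-congˡ (∑ᴸ-*ˡ xs)) (sym (distribˡ a (f x) _))

    ∑ᴸ-∑ : ∀ (xs : List I) {n} {f : I → Vector Carrier n} →
           ∑ᴸ xs (λ x → ∑ (f x)) ≈ ∑ (λ j → ∑ᴸ xs λ x → f x j)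
    ∑ᴸ-∑ []       = sym (∑-zero λ _ → refl)
    ∑ᴸ-∑ (x ∷ xs) = trans (+-congˡ (∑ᴸ-∑ xs)) (sym ∑-+)

    ∑ᴸ-swap : ∀ (xs ys : List I) {f : I → I → Carrier} →
              ∑ᴸ xs (λ x → ∑ᴸ ys (f x)) ≈ ∑ᴸ ys (λ y → ∑ᴸ xs λ x → f x y)
    ∑ᴸ-swap []       ys = sym (∑ᴸ-0 ys)
    ∑ᴸ-swap (x ∷ xs) ys = trans (+-congˡ (∑ᴸ-swap xs ys)) (sym (∑ᴸ-+ ys))

    ∑ᴸ-tabulate : ∀ {n} (g : Fin n → I) {f : I → Carrier} → ∑ᴸ (tabulate g) f ≈ ∑ (f ∘ g)
    ∑ᴸ-tabulate {zero}  g = sym ∑-nil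
    ∑ᴸ-tabulate {suc n} g = trans (+-congˡ (∑ᴸ-tabulate (g ∘ suc))) (sym ∑-cons)

    ∑ᴸ-++ : ∀ (xs ys : List I) {f : I → Carrier} → ∑ᴸ (xs List.++ ys) f ≈ ∑ᴸ xs f + ∑ᴸ ys f
    ∑ᴸ-++ []       ys = sym (+-identityˡ _)
    ∑ᴸ-++ (x ∷ xs) ys = trans (+-congˡ (∑ᴸ-++ xs ys)) (sym (+-assoc _ _ _))

    ∑ⱽ : List I → ∀ n → (Vec I n → Carrier) → Carrier
    ∑ⱽ xs zero    F = F []
    ∑ⱽ xs (suc n) F = ∑ᴸ xs λ e → ∑ⱽ xs n λ φ → F (e ∷ φ)

    module _ (xs : List I) where
      ∑ⱽ-cong : ∀ n {F G : Vec I n → Carrier} → (∀ φ → F φ ≈ G φ) → ∑ⱽ xs n F ≈ ∑ⱽ xs n G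
      ∑ⱽ-cong zero    h = h []
      ∑ⱽ-cong (suc n) h = ∑ᴸ-cong xs λ e → ∑ⱽ-cong n λ φ → h (e ∷ φ)

      ∑ⱽ-*ˡ : ∀ n {a} {F : Vec I n → Carrier} → ∑ⱽ xs n (λ φ → a * F φ) ≈ a * ∑ⱽ xs n F
      ∑ⱽ-*ˡ zero    = refl
      ∑ⱽ-*ˡ (suc n) = trans (∑ᴸ-cong xs λ e → ∑ⱽ-*ˡ n) (∑ᴸ-*ˡ xs)

      ∑ⱽ-*ʳ : ∀ n {a} {F : Vec I n → Carrier} → ∑ⱽ xs n (λ φ → F φ * a) ≈ ∑ⱽ xs n F * a
      ∑ⱽ-*ʳ n {a} = trans (∑ⱽ-cong n λ φ → *-comm _ a) (trans (∑ⱽ-*ˡ n) (*-comm a _))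

      ∑ⱽ-∑ : ∀ n {m} {F : Vec I n → Vector Carrier m} →
             ∑ⱽ xs n (λ φ → ∑ (F φ)) ≈ ∑ (λ j → ∑ⱽ xs n λ φ → F φ j)
      ∑ⱽ-∑ zero    = refl
      ∑ⱽ-∑ (suc n) = trans (∑ᴸ-cong xs λ e → ∑ⱽ-∑ n) (∑ᴸ-∑ xs)

      ∑ⱽ-insertAt : ∀ n (j : Fin (suc n)) (F : Vec I (suc n) → Carrier) →
                    ∑ⱽ xs (suc n) F ≈ ∑ᴸ xs λ e → ∑ⱽ xs n λ φ → F (Vec.insertAt φ j e)
      ∑ⱽ-insertAt n       zero    F = refl
      ∑ⱽ-insertAt (suc n) (suc j) F = trans
        (∑ᴸ-cong xs λ e → ∑ⱽ-insertAt n j (F ∘ (e ∷_))) (∑ᴸ-swap xs xs)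

    term : ∀ {n} → (Fin n → I → Carrier) → Vec I n → Carrier
    term M []      = 1#
    term M (e ∷ φ) = M zero e * term (tail M) φ

    term-insertAt : ∀ {n} (M : Fin (suc n) → I → Carrier) j e φ →
                    term M (Vec.insertAt φ j e) ≈ M j e * term (removeAt M j) φ
    term-insertAt M zero    e φ       = refl
    term-insertAt M (suc j) e (x ∷ φ) = trans (*-congˡ (term-insertAt (tail M) j e φ))
      (solve 3 (λ a b c → a :* (b :* c) := b :* (a :* c)) refl (M zero x) (M (suc j) e) _)

    rows : ∀ {n m} → (I → Fin m → Carrier) → Vec I n → Fin n → Fin m → Carrier
    rows N φ i j = N (lookup φ i) j

    rows-insertAt : ∀ {n m} (N : I → Fin m → Carrier) (φ : Vec I n) j e i s →
                    rows N (Vec.insertAt φ j e) i s ≡ insertAt (rows N φ) j (N e) i s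
    rows-insertAt N φ j e i s = ≡.trans (≡.cong (λ x → N x s) (lookup-insertAt φ j e i))
      (≡.cong (λ r → r s) (insertAt-∘ N (lookup φ) j e i))

    -- Multilinearity in the rows alone: the words `φ` may repeat letters, and the alternating
    -- property is not yet involved.
    Det-product : ∀ (xs : List I) {n} (M : Fin n → I → Carrier) (N : I → Fin n → Carrier) →
                  Det (λ i j → ∑ᴸ xs λ e → M i e * N e j) ≈ ∑ⱽ xs n λ φ → term M φ * Det (rows N φ)
    Det-product xs {zero}  M N = trans Det-nil (sym (trans (*-identityˡ _) Det-nil))
    Det-product xs {suc n} M N = begin
      Det (λ i j → ∑ᴸ xs λ e → M i e * N e j)
        ≈⟨ laplace ⟩
      ∑ (λ j → sgn j * ((∑ᴸ xs λ e → M zero e * N e j) * Det (λ r s → ∑ᴸ xs λ e → M (suc r) e * N e (punchIn j s))))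
        ≈⟨ ∑-cong (λ j → *-congˡ (*-congˡ (Det-product xs (tail M) (λ e s → N e (punchIn j s))))) ⟩
      ∑ (λ j → sgn j * ((∑ᴸ xs λ e → M zero e * N e j) * ∑ⱽ xs n λ φ → t φ * d φ j))
        ≈⟨ ∑-cong (λ j → spread j) ⟩
      ∑ (λ j → ∑ᴸ xs λ e → ∑ⱽ xs n λ φ → (M zero e * t φ) * (sgn j * (N e j * d φ j)))
        ≈⟨ trans (∑ᴸ-cong xs λ e → ∑ⱽ-∑ xs n) (∑ᴸ-∑ xs) ⟨
      (∑ᴸ xs λ e → ∑ⱽ xs n λ φ → ∑ λ j → (M zero e * t φ) * (sgn j * (N e j * d φ j)))
        ≈⟨ (∑ᴸ-cong xs λ e → ∑ⱽ-cong xs n λ φ → trans ∑-*ˡ (*-congˡ (sym laplace))) ⟩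
      (∑ⱽ xs (suc n) λ φ → term M φ * Det (rows N φ)) ∎
      where
      t : Vec I n → Carrier
      t = term (tail M)
      d : Vec I n → Fin (suc n) → Carrier
      d φ j = Det (λ r s → N (lookup φ r) (punchIn j s))
      spread : ∀ j → sgn j * ((∑ᴸ xs λ e → M zero e * N e j) * ∑ⱽ xs n λ φ → t φ * d φ j)
                   ≈ ∑ᴸ xs λ e → ∑ⱽ xs n λ φ → (M zero e * t φ) * (sgn j * (N e j * d φ j))
      spread j = begin
        sgn j * (X * Y)                                     ≈⟨ solve 3 (λ s x y → s :* (x :* y) := (s :* y) :* x) refl (sgn j) X Y ⟩
        (sgn j * Y) * X                                     ≈⟨ ∑ᴸ-*ˡ xs ⟨
        (∑ᴸ xs λ e → (sgn j * Y) * (M zero e * N e j))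
          ≈⟨ (∑ᴸ-cong xs λ e → solve 4 (λ s y a b → (s :* y) :* (a :* b) := (s :* (a :* b)) :* y) refl (sgn j) Y (M zero e) (N e j)) ⟩
        (∑ᴸ xs λ e → (sgn j * (M zero e * N e j)) * Y)
          ≈⟨ (∑ᴸ-cong xs λ e → sym (∑ⱽ-*ˡ xs n)) ⟩
        (∑ᴸ xs λ e → ∑ⱽ xs n λ φ → (sgn j * (M zero e * N e j)) * (t φ * d φ j))
          ≈⟨ (∑ᴸ-cong xs λ e → ∑ⱽ-cong xs n λ φ → solve 5 (λ s a b u v → (s :* (a :* b)) :* (u :* v) := (a :* u) :* (s :* (b :* v)))
                refl (sgn j) (M zero e) (N e j) (t φ) (d φ j)) ⟩
        (∑ᴸ xs λ e → ∑ⱽ xs n λ φ → (M zero e * t φ) * (sgn j * (N e j * d φ j))) ∎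
        where
        X = ∑ᴸ xs λ e → M zero e * N e j
        Y = ∑ⱽ xs n λ φ → t φ * d φ j

    -- Alternation in terms of moving one entry to the front, the form in which `Det-insertAt`
    -- provides it.
    Alternating : ∀ {n} → (Vec I n → Carrier) → Set
    Alternating {zero}  ν = ⊤
    Alternating {suc n} ν = ∀ j e φ → ν (Vec.insertAt φ j e) ≈ sgn j * ν (e ∷ φ)

    -- Move `e′` to the front of everything, then exchange it with `e`; the two signs combine to
    -- `sgn j`.
    Alternating-∷ : ∀ {n} {ν : Vec I (suc n) → Carrier} → Alternating ν → ∀ e → Alternating (ν ∘ (e ∷_))
    Alternating-∷ {zero}  alt e = tt
    Alternating-∷ {suc n} {ν} alt e j e′ φ = begin
      ν (e ∷ Vec.insertAt φ j e′)          ≈⟨ alt (suc j) e′ (e ∷ φ) ⟩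
      sgn (suc j) * ν (e′ ∷ e ∷ φ)
        ≈⟨ solve 2 (λ s x → (:- con (+ 1) :* s) :* x := s :* ((:- con (+ 1) :* con (+ 1)) :* x)) refl (sgn j) _ ⟩
      sgn j * (sgn {suc (suc n)} (suc zero) * ν (e′ ∷ e ∷ φ))    ≈⟨ *-congˡ (alt (suc zero) e′ (e ∷ φ)) ⟨
      sgn j * ν (e ∷ e′ ∷ φ)               ∎

    Alternating-Det : ∀ n (N : I → Fin n → Carrier) → Alternating {n} (λ φ → Det (rows N φ))
    Alternating-Det zero    N = tt
    Alternating-Det (suc n) N j e φ = begin
      Det (rows N (Vec.insertAt φ j e))        ≈⟨ Det-cong (λ i s → reflexive (rows-insertAt N φ j e i s)) ⟩
      Det (insertAt (rows N φ) j (N e))        ≈⟨ Det-insertAt (rows N φ) j (N e) ⟩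
      sgn j * Det (N e ⨾ rows N φ)             ≈⟨ *-congˡ (Det-cong λ { zero s → refl ; (suc i) s → refl }) ⟩
      sgn j * Det (rows N (e ∷ φ)) ∎

    -- Expand the determinant along the row of the first letter `e`. In the summand of column `j`,
    -- alternation of `ν` lets `e` return to position `j` and absorbs `sgn j`, so all columns
    -- contribute the same sum; the factors n + 1, n, ... multiply to the factorial.
    antisymmetrise : ∀ (xs : List I) {n} (M : Fin n → I → Carrier) (ν : Vec I n → Carrier) → Alternating ν →
                     ∑ⱽ xs n (λ φ → Det (rows (λ e i → M i e) φ) * ν φ) ≈ (n !) · ∑ⱽ xs n (λ φ → term M φ * ν φ)
    antisymmetrise xs {zero}  M ν alt = trans (*-congʳ Det-nil) (sym (+-identityʳ _))
    antisymmetrise xs {suc n} M ν alt = begin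
      (∑ᴸ xs λ e → ∑ⱽ xs n λ φ → Det (rows Mᵀ (e ∷ φ)) * ν (e ∷ φ))
        ≈⟨ (∑ᴸ-cong xs λ e → ∑ⱽ-cong xs n λ φ → expand e φ) ⟩
      (∑ᴸ xs λ e → ∑ⱽ xs n λ φ → ∑ λ j → (sgn j * M j e) * (d j φ * ν (e ∷ φ)))
        ≈⟨ trans (∑ᴸ-cong xs λ e → ∑ⱽ-∑ xs n) (∑ᴸ-∑ xs) ⟩
      ∑ (λ j → ∑ᴸ xs λ e → ∑ⱽ xs n λ φ → (sgn j * M j e) * (d j φ * ν (e ∷ φ)))
        ≈⟨ ∑-cong perColumn ⟩
      ∑ {suc n} (λ j → (n !) · T)
        ≈⟨ ∑-const (suc n) ⟩
      suc n · ((n !) · T)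
        ≈⟨ ×-assocˡ T (suc n) (n !) ⟩
      (suc n !) · T ∎
      where
      Mᵀ : I → Fin (suc n) → Carrier
      Mᵀ e i = M i e
      T = ∑ⱽ xs (suc n) λ φ → term M φ * ν φ
      d : Fin (suc n) → Vec I n → Carrier
      d j φ = Det (rows (λ e i → removeAt M j i e) φ)
      expand : ∀ e φ → Det (rows Mᵀ (e ∷ φ)) * ν (e ∷ φ) ≈ ∑ λ j → (sgn j * M j e) * (d j φ * ν (e ∷ φ))
      expand e φ = begin
        Det (rows Mᵀ (e ∷ φ)) * ν (e ∷ φ)                          ≈⟨ *-congʳ laplace ⟩
        ∑ (λ j → sgn j * (M j e * d j φ)) * ν (e ∷ φ)              ≈⟨ ∑-*ʳ ⟨
        ∑ (λ j → (sgn j * (M j e * d j φ)) * ν (e ∷ φ))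
          ≈⟨ ∑-cong (λ j → solve 4 (λ s a b c → (s :* (a :* b)) :* c := (s :* a) :* (b :* c)) refl (sgn j) (M j e) (d j φ) (ν (e ∷ φ))) ⟩
        ∑ (λ j → (sgn j * M j e) * (d j φ * ν (e ∷ φ))) ∎
      ·-∑ᴸ : ∀ k ys {f : I → Carrier} → ∑ᴸ ys (λ e → k · f e) ≈ k · ∑ᴸ ys f
      ·-∑ᴸ k []       = sym (trans (×-congʳ k (sym (zeroʳ 0#))) (trans (sym (×-comm-* k 0# 0#)) (zeroˡ _)))
      ·-∑ᴸ k (y ∷ ys) = trans (+-congˡ (·-∑ᴸ k ys)) (sym (×-distrib-+ _ _ k))
      perColumn : ∀ j → ∑ᴸ xs (λ e → ∑ⱽ xs n λ φ → (sgn j * M j e) * (d j φ * ν (e ∷ φ))) ≈ (n !) · T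
      perColumn j = begin
        ∑ᴸ xs (λ e → ∑ⱽ xs n λ φ → (sgn j * M j e) * (d j φ * ν (e ∷ φ)))
          ≈⟨ (∑ᴸ-cong xs λ e → ∑ⱽ-*ˡ xs n) ⟩
        ∑ᴸ xs (λ e → (sgn j * M j e) * ∑ⱽ xs n λ φ → d j φ * ν (e ∷ φ))
          ≈⟨ (∑ᴸ-cong xs λ e → *-congˡ (antisymmetrise xs (removeAt M j) (ν ∘ (e ∷_)) (Alternating-∷ {ν = ν} alt e))) ⟩
        ∑ᴸ xs (λ e → (sgn j * M j e) * ((n !) · ∑ⱽ xs n λ φ → t φ * ν (e ∷ φ)))
          ≈⟨ (∑ᴸ-cong xs λ e → trans (×-comm-* (n !) _ _) (×-congʳ (n !) (sym (∑ⱽ-*ˡ xs n)))) ⟩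
        ∑ᴸ xs (λ e → (n !) · ∑ⱽ xs n λ φ → (sgn j * M j e) * (t φ * ν (e ∷ φ)))
          ≈⟨ ·-∑ᴸ (n !) xs ⟩
        (n !) · ∑ᴸ xs (λ e → ∑ⱽ xs n λ φ → (sgn j * M j e) * (t φ * ν (e ∷ φ)))
          ≈⟨ ×-congʳ (n !) (∑ᴸ-cong xs λ e → ∑ⱽ-cong xs n λ φ → regroup e φ) ⟩
        (n !) · ∑ᴸ xs (λ e → ∑ⱽ xs n λ φ → term M (Vec.insertAt φ j e) * ν (Vec.insertAt φ j e))
          ≈⟨ ×-congʳ (n !) (∑ⱽ-insertAt xs n j λ φ → term M φ * ν φ) ⟨
        (n !) · T ∎
        where
        t : Vec I n → Carrier
        t = term (removeAt M j)
        regroup : ∀ e φ → (sgn j * M j e) * (t φ * ν (e ∷ φ)) ≈ term M (Vec.insertAt φ j e) * ν (Vec.insertAt φ j e)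
        regroup e φ = begin
          (sgn j * M j e) * (t φ * ν (e ∷ φ))
            ≈⟨ solve 4 (λ s a b c → (s :* a) :* (b :* c) := (a :* b) :* (s :* c)) refl (sgn j) (M j e) (t φ) (ν (e ∷ φ)) ⟩
          (M j e * t φ) * (sgn j * ν (e ∷ φ))
            ≈⟨ *-cong (term-insertAt M j e φ) (alt j e φ) ⟨
          term M (Vec.insertAt φ j e) * ν (Vec.insertAt φ j e) ∎

    -- The sum runs over all words instead of the increasing ones, which avoids subsets at the price
    -- of the factor `n !`. The factor is harmless over the integers, where it can be cancelled.
    cauchyBinet : ∀ (xs : List I) {n} (M N : I → Fin n → Carrier) →
                  (n !) · Det (λ i j → ∑ᴸ xs λ e → M e i * N e j) ≈ ∑ⱽ xs n λ φ → Det (rows M φ) * Det (rows N φ)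
    cauchyBinet xs {n} M N = trans
      (×-congʳ (n !) (Det-product xs (λ i e → M e i) N))
      (sym (antisymmetrise xs (λ i e → M e i) (λ φ → Det (rows N φ)) (Alternating-Det n N)))

  -- Required besides `Alternating`: for a repeated entry alternation only yields x = - x, which
  -- does not force x = 0 in a general ring.
  Degenerate : ∀ {m n} → (Vec (Fin m) n → Carrier) → Set
  Degenerate α = ∀ φ {i j} → i ≢ j → lookup φ i ≡ lookup φ j → α φ ≈ 0#

  Degenerate-Det : ∀ {m n} (N : Fin m → Fin n → Carrier) → Degenerate {m} {n} (λ φ → Det (rows N φ))
  Degenerate-Det N φ i≢j eq = Det-repeat (rows N φ) i≢j λ s → reflexive (≡.cong (λ e → N e s) eq)

  -- Uniqueness of the determinant as an alternating form. Bring the letter 0 to the front; the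
  -- letters behind it lie in a copy of `Fin n`, where the induction hypothesis applies.
  alternating-unique : ∀ n (α : Vec (Fin n) n → Carrier) → Alternating α → Degenerate α →
                       ∀ φ → α φ ≈ Det (rows kron φ) * α (Vec.allFin n)
  alternating-unique zero    α alt deg [] = sym (trans (*-congʳ Det-nil) (*-identityˡ _))
  alternating-unique (suc n) α alt deg φ with findZero φ
  ... | inj₁ (ψ , ≡.refl) =
    -- Without the letter 0 there are n + 1 entries for n letters, so two coincide and both sides
    -- vanish.
    let i , j , i<j , eq = Finₚ.pigeonhole (ℕₚ.n<1+n n) (lookup ψ)
        i≢j = λ i≡j → ℕₚ.<⇒≢ i<j (≡.cong toℕ i≡j)
        eq′ = ≡.trans (Vecₚ.lookup-map i suc ψ) (≡.trans (≡.cong suc eq) (≡.sym (Vecₚ.lookup-map j suc ψ)))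
    in trans (deg φ i≢j eq′) (sym (trans (*-congʳ (Degenerate-Det kron φ i≢j eq′)) (zeroˡ _)))
  ... | inj₂ (_ , i , χ , ≡.refl , ≡.refl) = begin
    α (Vec.insertAt χ i zero)                              ≈⟨ alt i zero χ ⟩
    sgn i * α (zero ∷ χ)                                   ≈⟨ *-congˡ (front χ) ⟩
    sgn i * (Det (rows kron (zero ∷ χ)) * α id)            ≈⟨ *-assoc _ _ _ ⟨
    sgn i * Det (rows kron (zero ∷ χ)) * α id              ≈⟨ *-congʳ (Alternating-Det (suc n) kron i zero χ) ⟨
    Det (rows kron (Vec.insertAt χ i zero)) * α id ∎
    where
    id = Vec.allFin (suc n)
    α′ : Vec (Fin n) n → Carrier
    α′ ψ = α (zero ∷ Vec.map suc ψ)
    alternating : ∀ n (α : Vec (Fin (suc n)) (suc n) → Carrier) → Alternating α → Alternating (λ ψ → α (zero ∷ Vec.map suc ψ))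
    alternating zero    α alt = tt
    alternating (suc n) α alt j e ψ = trans
      (reflexive (≡.cong (λ χ → α (zero ∷ χ)) (Vecₚ.map-insertAt suc e ψ j)))
      (Alternating-∷ {ν = α} alt zero j (suc e) (Vec.map suc ψ))
    degenerate : Degenerate α′
    degenerate ψ {a} {b} a≢b eq = deg (zero ∷ Vec.map suc ψ) {suc a} {suc b} (a≢b ∘ Finₚ.suc-injective)
      (≡.trans (Vecₚ.lookup-map a suc ψ) (≡.trans (≡.cong suc eq) (≡.sym (Vecₚ.lookup-map b suc ψ))))
    front : ∀ χ → α (zero ∷ χ) ≈ Det (rows kron (zero ∷ χ)) * α id
    front χ with findZero χ
    ... | inj₁ (ψ , ≡.refl) = begin
      α (zero ∷ Vec.map suc ψ)                             ≈⟨ alternating-unique n α′ (alternating n α alt) degenerate ψ ⟩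
      Det (rows kron ψ) * α′ (Vec.allFin n)
        ≈⟨ *-cong (sym kronDet) (reflexive (≡.cong (λ χ → α (zero ∷ χ)) (≡.sym (Vecₚ.tabulate-∘ suc (λ i → i))))) ⟩
      Det (rows kron (zero ∷ Vec.map suc ψ)) * α id ∎
      where
      kronDet : Det (rows kron (zero ∷ Vec.map suc ψ)) ≈ Det (rows kron ψ)
      kronDet = begin
        Det (rows kron (zero ∷ Vec.map suc ψ))             ≈⟨ Det-cong (λ { zero s → refl ; (suc r) s → refl }) ⟩
        Det (kron zero ⨾ rows kron (Vec.map suc ψ))        ≈⟨ Det-kron-head zero (rows kron (Vec.map suc ψ)) ⟩
        1# * Det (λ r s → kron (lookup (Vec.map suc ψ) r) (suc s))
          ≈⟨ trans (*-identityˡ _) (Det-cong λ r s → reflexive (≡.cong (λ e → kron e (suc s)) (Vecₚ.lookup-map r suc ψ))) ⟩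
        Det (rows kron ψ) ∎
    ... | inj₂ (_ , j , ψ , ≡.refl , ≡.refl) =
      -- A second 0 behind the leading one: again both sides vanish.
      let eq = ≡.sym (Vecₚ.insertAt-lookup ψ j zero)
      in trans (deg (zero ∷ Vec.insertAt ψ j zero) {zero} {suc j} (λ ()) eq)
               (sym (trans (*-congʳ (Degenerate-Det kron (zero ∷ Vec.insertAt ψ j zero) {zero} {suc j} (λ ()) eq)) (zeroˡ _)))

  -- By `alternating-unique` the expansion of the product differs from the expansion of `A` times
  -- the identity only by the constant factor `Det B`.
  Det-* : ∀ {n} (A B : Matrix n) → Det (λ i j → ∑ λ e → A i e * B e j) ≈ Det A * Det B
  Det-* {n} A B = begin
    Det (λ i j → ∑ λ e → A i e * B e j)                    ≈⟨ expand B ⟩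
    (∑ⱽ xs n λ φ → term A φ * Det (rows B φ))
      ≈⟨ ∑ⱽ-cong xs n (λ φ → trans (*-congˡ (alternating-unique n (λ φ → Det (rows B φ)) (Alternating-Det n B) (Degenerate-Det B) φ)) (sym (*-assoc _ _ _))) ⟩
    (∑ⱽ xs n λ φ → (term A φ * Det (rows kron φ)) * Det (rows B (Vec.allFin n)))
      ≈⟨ ∑ⱽ-*ʳ xs n ⟩
    (∑ⱽ xs n λ φ → term A φ * Det (rows kron φ)) * Det (rows B (Vec.allFin n))
      ≈⟨ *-cong (trans (sym (expand kron)) (Det-cong λ i j → ∑-kronʳ j (A i)))
                (Det-cong λ i s → reflexive (≡.cong (λ e → B e s) (Vecₚ.lookup-allFin i))) ⟩
    Det A * Det B ∎
    where
    xs = allFin n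
    expand : ∀ B → Det (λ i j → ∑ λ e → A i e * B e j) ≈ ∑ⱽ xs n λ φ → term A φ * Det (rows B φ)
    expand B = trans (Det-cong λ i j → sym (∑ᴸ-tabulate (λ e → e))) (Det-product xs A B)

-- Homomorphisms, derivations and power series

record Hom (R : RawRing 0ℓ 0ℓ) (S : CommutativeRing 0ℓ 0ℓ) : Set where
  private
    module R = RawRing R
    module S = CommutativeRing S
  field
    ⟦_⟧    : R.Carrier → S.Carrier
    ⟦⟧-cong : ∀ {x y} → x R.≈ y → ⟦ x ⟧ S.≈ ⟦ y ⟧
    +-homo : ∀ x y → ⟦ x R.+ y ⟧ S.≈ ⟦ x ⟧ S.+ ⟦ y ⟧
    *-homo : ∀ x y → ⟦ x R.* y ⟧ S.≈ ⟦ x ⟧ S.* ⟦ y ⟧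
    -‿homo : ∀ x → ⟦ R.- x ⟧ S.≈ S.- ⟦ x ⟧
    0-homo : ⟦ R.0# ⟧ S.≈ S.0#
    1-homo : ⟦ R.1# ⟧ S.≈ S.1#

module HomDet {R : RawRing 0ℓ 0ℓ} {S : CommutativeRing 0ℓ 0ℓ} (h : Hom R S) where
  open Hom h
  private
    module R = RawRing R
  open CommutativeRing S hiding (zero)
  open Determinants S
  open RawMonoidOps R.+-rawMonoid using (sum)
  open RawSemiringOps R.rawSemiring using (_^_)
  open Determinant R using (det)

  sum-homo : ∀ {n} (f : Fin n → R.Carrier) → ⟦ sum f ⟧ ≈ ∑ (λ i → ⟦ f i ⟧)
  sum-homo {zero}  f = trans 0-homo (sym ∑-nil)
  sum-homo {suc n} f = trans (+-homo _ _) (trans (+-congˡ (sum-homo (tail f))) (sym ∑-cons))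

  sgn-homo : ∀ {n} (j : Fin n) → ⟦ (R.- R.1#) ^ toℕ j ⟧ ≈ sgn j
  sgn-homo zero    = 1-homo
  sgn-homo (suc j) = trans (*-homo _ _) (*-cong (trans (-‿homo _) (-‿cong 1-homo)) (sgn-homo j))

  det-homo : ∀ {n} (A : Fin n → Fin n → R.Carrier) → ⟦ det A ⟧ ≈ Det (λ i j → ⟦ A i j ⟧)
  det-homo {zero}  A = trans 1-homo (sym Det-nil)
  det-homo {suc n} A = trans
    (sum-homo λ j → (R.- R.1#) ^ toℕ j R.* (A zero j R.* det λ r s → A (suc r) (punchIn j s)))
    (trans
      (∑-cong λ j → trans (*-homo _ _) (*-cong (sgn-homo j) (trans (*-homo _ _)
        (*-congˡ (det-homo λ r s → A (suc r) (punchIn j s))))))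
      (sym laplace))

module HomDet′ {R S : CommutativeRing 0ℓ 0ℓ} (h : Hom (CommutativeRing.rawRing R) S) where
  open Hom h
  private
    module R = CommutativeRing R
    module DR = Determinants R
  open CommutativeRing S
  open Determinants S using (Det)

  Det-homo : ∀ {n} (A : Fin n → Fin n → R.Carrier) → ⟦ DR.Det A ⟧ ≈ Det (λ i j → ⟦ A i j ⟧)
  Det-homo A = trans (reflexive (≡.cong ⟦_⟧ (DR.Det≡det A))) (HomDet.det-homo h A)

record Derivation (R : CommutativeRing 0ℓ 0ℓ) : Set where
  open CommutativeRing R
  field
    D      : Carrier → Carrier
    D-cong : ∀ {x y} → x ≈ y → D x ≈ D y
    D-+    : ∀ x y → D (x + y) ≈ D x + D y
    D-*    : ∀ x y → D (x * y) ≈ D x * y + x * D y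

module DerivationProperties {R : CommutativeRing 0ℓ 0ℓ} (δ : Derivation R) where
  open CommutativeRing R hiding (zero)
  open Derivation δ
  open IntegerCoefficients R using (solve; con; _:=_; :-_)
  open RingProperties ring using (+-cancelˡ)
  open Determinants R
  open SetoidReasoning setoid

  D-0 : D 0# ≈ 0#
  D-0 = +-cancelˡ (D 0#) (D 0#) 0# (trans (sym (D-+ 0# 0#)) (trans (D-cong (+-identityˡ 0#)) (sym (+-identityʳ _))))

  D-neg : ∀ x → D (- x) ≈ - D x
  D-neg x = +-cancelˡ (D x) (D (- x)) (- D x) (begin
    D x + D (- x)    ≈⟨ D-+ x (- x) ⟨
    D (x - x)        ≈⟨ D-cong (-‿inverseʳ x) ⟩
    D 0#             ≈⟨ D-0 ⟩
    0#               ≈⟨ -‿inverseʳ (D x) ⟨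
    D x - D x        ∎)

  D-1 : D 1# ≈ 0#
  D-1 = +-cancelˡ (D 1#) (D 1#) 0# (begin
    D 1# + D 1#                ≈⟨ +-cong (*-identityʳ _) (*-identityˡ _) ⟨
    D 1# * 1# + 1# * D 1#      ≈⟨ D-* 1# 1# ⟨
    D (1# * 1#)                ≈⟨ D-cong (*-identityˡ 1#) ⟩
    D 1#                       ≈⟨ +-identityʳ _ ⟨
    D 1# + 0#                  ∎)

  D-*-constˡ : ∀ {c} x → D c ≈ 0# → D (c * x) ≈ c * D x
  D-*-constˡ {c} x Dc≈0 = trans (D-* c x) (trans (+-congʳ (trans (*-congʳ Dc≈0) (zeroˡ x))) (+-identityˡ _))

  D-sgn : ∀ {n} (j : Fin n) → D (sgn j) ≈ 0#
  D-sgn zero    = D-1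
  D-sgn (suc j) = trans (D-*-constˡ (sgn j) (trans (D-neg 1#) (trans (-‿cong D-1) (solve 0 (:- con (+ 0) := con (+ 0)) refl))))
    (trans (*-congˡ (D-sgn j)) (zeroʳ _))

  D-kron : ∀ {n} (i j : Fin n) → D (kron i j) ≈ 0#
  D-kron zero    zero    = D-1
  D-kron zero    (suc j) = D-0
  D-kron (suc i) zero    = D-0
  D-kron (suc i) (suc j) = D-kron i j

  D-∑ : ∀ {n} (f : Vector Carrier n) → D (∑ f) ≈ ∑ (λ i → D (f i))
  D-∑ {zero}  f = trans (D-cong ∑-nil) (trans D-0 (sym ∑-nil))
  D-∑ {suc n} f = trans (D-cong ∑-cons) (trans (D-+ _ _) (trans (+-congˡ (D-∑ (tail f))) (sym ∑-cons)))

  differentiateRow : ∀ {n} → Matrix n → Fin n → Matrix n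
  differentiateRow {suc n} Y v = insertAt (removeAt Y v) v (D ∘ Y v)

  laplace-differentiate : ∀ {n} (Y : Matrix (suc n)) (v : Fin n) → Det (differentiateRow Y (suc v)) ≈
                          ∑ λ j → sgn j * (Y zero j * Det (differentiateRow (minor Y j) v))
  laplace-differentiate {suc n} Y v = trans laplace (∑-cong λ j → *-congˡ (*-congˡ (Det-cong λ r s →
    reflexive (≡.cong (λ row → row s) (insertAt-∘ (_∘ punchIn j) (removeAt (tail Y) v) v (D ∘ Y (suc v)) r)))))

  D-Det : ∀ {n} (Y : Matrix n) → D (Det Y) ≈ ∑ λ v → Det (differentiateRow Y v)
  D-Det {zero}  Y = trans (D-cong Det-nil) (trans D-1 (sym ∑-nil))
  D-Det {suc n} Y = begin
    D (Det Y)                                                                ≈⟨ D-cong laplace ⟩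
    D (∑ λ j → sgn j * (Y zero j * d j))                                     ≈⟨ D-∑ (λ j → sgn j * (Y zero j * d j)) ⟩
    ∑ (λ j → D (sgn j * (Y zero j * d j)))                                   ≈⟨ ∑-cong step ⟩
    ∑ (λ j → sgn j * (D (Y zero j) * d j) + ∑ (λ v → sgn j * (Y zero j * e j v)))
      ≈⟨ ∑-+ ⟩
    ∑ (λ j → sgn j * (D (Y zero j) * d j)) + ∑ (λ j → ∑ (λ v → sgn j * (Y zero j * e j v)))
      ≈⟨ +-cong (trans (sym (laplace-cons (D ∘ Y zero) (tail Y))) (Det-cong λ { zero s → refl ; (suc r) s → refl }))
                (trans ∑-swap (∑-cong λ v → sym (laplace-differentiate Y v))) ⟩
    Det (differentiateRow Y zero) + ∑ (λ v → Det (differentiateRow Y (suc v)))    ≈⟨ ∑-cons ⟨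
    ∑ (λ v → Det (differentiateRow Y v)) ∎
    where
    d : Vector Carrier (suc n)
    d j = Det (minor Y j)
    e : Fin (suc n) → Fin n → Carrier
    e j v = Det (differentiateRow (minor Y j) v)
    step : ∀ j → D (sgn j * (Y zero j * d j)) ≈ sgn j * (D (Y zero j) * d j) + ∑ (λ v → sgn j * (Y zero j * e j v))
    step j = begin
      D (sgn j * (Y zero j * d j))                                 ≈⟨ D-*-constˡ _ (D-sgn j) ⟩
      sgn j * D (Y zero j * d j)                                   ≈⟨ *-congˡ (D-* _ _) ⟩
      sgn j * (D (Y zero j) * d j + Y zero j * D (d j))            ≈⟨ distribˡ _ _ _ ⟩
      sgn j * (D (Y zero j) * d j) + sgn j * (Y zero j * D (d j))
        ≈⟨ +-congˡ (trans (*-congˡ (trans (*-congˡ (D-Det (minor Y j))) (sym ∑-*ˡ))) (sym ∑-*ˡ)) ⟩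
      sgn j * (D (Y zero j) * d j) + ∑ (λ v → sgn j * (Y zero j * e j v)) ∎

  D-Det≈0 : ∀ {n} (Y : Matrix n) → (∀ i j → D (Y i j) ≈ 0#) → D (Det Y) ≈ 0#
  D-Det≈0 {zero}  Y h = trans (D-cong Det-nil) D-1
  D-Det≈0 {suc n} Y h = begin
    D (Det Y)                                            ≈⟨ D-cong laplace ⟩
    D (∑ λ j → sgn j * (Y zero j * Det (minor Y j)))     ≈⟨ D-∑ (λ j → sgn j * (Y zero j * Det (minor Y j))) ⟩
    ∑ (λ j → D (sgn j * (Y zero j * Det (minor Y j))))   ≈⟨ ∑-zero term ⟩
    0# ∎
    where
    term : ∀ j → D (sgn j * (Y zero j * Det (minor Y j))) ≈ 0#
    term j = trans (D-*-constˡ _ (D-sgn j)) (trans (*-congˡ (trans (D-*-constˡ _ (h zero j))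
      (trans (*-congˡ (D-Det≈0 (minor Y j) λ r s → h (suc r) (punchIn j s))) (zeroʳ _)))) (zeroʳ _))

module _ {R : CommutativeRing 0ℓ 0ℓ} where
  open CommutativeRing R
  open IntegerCoefficients R using (solve; _:=_; _:+_; _:*_; _:-_)

  infixl 6 _-ᴰ_
  infixr 7 _*ᴰ_

  _-ᴰ_ : Derivation R → Derivation R → Derivation R
  δ -ᴰ ε = record
    { D      = λ x → δ.D x - ε.D x
    ; D-cong = λ x≈y → +-cong (δ.D-cong x≈y) (-‿cong (ε.D-cong x≈y))
    ; D-+    = λ x y → trans (+-cong (δ.D-+ x y) (-‿cong (ε.D-+ x y)))
        (solve 4 (λ a b c d → (a :+ b) :- (c :+ d) := (a :- c) :+ (b :- d)) refl _ _ _ _)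
    ; D-*    = λ x y → trans (+-cong (δ.D-* x y) (-‿cong (ε.D-* x y)))
        (solve 6 (λ x y a b c d → (a :* y :+ x :* b) :- (c :* y :+ x :* d) := (a :- c) :* y :+ x :* (b :- d))
          refl x y (δ.D x) (δ.D y) (ε.D x) (ε.D y))
    }
    where
    module δ = Derivation δ
    module ε = Derivation ε

  _*ᴰ_ : Carrier → Derivation R → Derivation R
  c *ᴰ δ = record
    { D      = λ x → c * δ.D x
    ; D-cong = λ x≈y → *-congˡ (δ.D-cong x≈y)
    ; D-+    = λ x y → trans (*-congˡ (δ.D-+ x y)) (distribˡ _ _ _)
    ; D-*    = λ x y → trans (*-congˡ (δ.D-* x y))
        (solve 5 (λ c x y a b → c :* (a :* y :+ x :* b) := (c :* a) :* y :+ x :* (c :* b)) refl c x y (δ.D x) (δ.D y))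
    }
    where
    module δ = Derivation δ

module PowerSeries (R : CommutativeRing 0ℓ 0ℓ) where
  open CommutativeRing R hiding (zero)
  open IntegerCoefficients R using (solve; con; _:=_; _:+_; _:*_; :-_; _:-_)
  open NaturalMult semiring using (×-congʳ; ×-comm-*) renaming (_×_ to _·_)
  open CommutativeMonoidMult +-commutativeMonoid using (×-distrib-+)
  open SetoidReasoning setoid

  -- Power series stand in for polynomials: a coefficient is a function value, and neither degrees
  -- nor trailing zeros have to be tracked.
  Series : Set
  Series = ℕ → Carrier

  opaque
    conv : Series → Series → Series
    conv f g zero    = f 0 * g 0
    conv f g (suc n) = f 0 * g (suc n) + conv (f ∘ suc) g n

    conv-zero : ∀ {f g} → conv f g 0 ≈ f 0 * g 0
    conv-zero = refl

    conv-suc : ∀ {f g} n → conv f g (suc n) ≈ f 0 * g (suc n) + conv (f ∘ suc) g n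
    conv-suc n = refl

  conv-cong : ∀ {f f′ g g′} → (∀ n → f n ≈ f′ n) → (∀ n → g n ≈ g′ n) → ∀ n → conv f g n ≈ conv f′ g′ n
  conv-cong p q zero    = trans conv-zero (trans (*-cong (p 0) (q 0)) (sym conv-zero))
  conv-cong p q (suc n) = trans (conv-suc n)
    (trans (+-cong (*-cong (p 0) (q (suc n))) (conv-cong (p ∘ suc) q n)) (sym (conv-suc n)))

  conv-sucʳ : ∀ {f g} n → conv f g (suc n) ≈ conv f (g ∘ suc) n + f (suc n) * g 0
  conv-sucʳ zero    = trans (conv-suc 0) (+-cong (sym conv-zero) conv-zero)
  conv-sucʳ (suc n) = trans (conv-suc (suc n))
    (trans (+-congˡ (conv-sucʳ n)) (trans (sym (+-assoc _ _ _)) (+-congʳ (sym (conv-suc n)))))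

  conv-comm : ∀ f g n → conv f g n ≈ conv g f n
  conv-comm f g zero    = trans conv-zero (trans (*-comm _ _) (sym conv-zero))
  conv-comm f g (suc n) = trans (conv-suc n)
    (trans (+-cong (*-comm _ _) (conv-comm (f ∘ suc) g n)) (trans (+-comm _ _) (sym (conv-sucʳ n))))

  conv-distribʳ : ∀ h f g n → conv (λ k → f k + g k) h n ≈ conv f h n + conv g h n
  conv-distribʳ h f g zero    = trans conv-zero (trans (distribʳ _ _ _) (sym (+-cong conv-zero conv-zero)))
  conv-distribʳ h f g (suc n) = trans (conv-suc n) (trans (+-congˡ (conv-distribʳ h (f ∘ suc) (g ∘ suc) n))
    (trans (solve 5 (λ a b c d e → (a :+ b) :* c :+ (d :+ e) := (a :* c :+ d) :+ (b :* c :+ e)) refl _ _ _ _ _)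
      (sym (+-cong (conv-suc n) (conv-suc n)))))

  conv-scale : ∀ c f g n → conv (λ k → c * f k) g n ≈ c * conv f g n
  conv-scale c f g zero    = trans conv-zero (trans (*-assoc _ _ _) (*-congˡ (sym conv-zero)))
  conv-scale c f g (suc n) = trans (conv-suc n) (trans (+-congˡ (conv-scale c (f ∘ suc) g n))
    (trans (solve 4 (λ c a b d → (c :* a) :* b :+ c :* d := c :* (a :* b :+ d)) refl _ _ _ _) (*-congˡ (sym (conv-suc n)))))

  conv-zeroˡ : ∀ g n → conv (λ _ → 0#) g n ≈ 0#
  conv-zeroˡ g zero    = trans conv-zero (zeroˡ _)
  conv-zeroˡ g (suc n) = trans (conv-suc n) (trans (+-cong (zeroˡ _) (conv-zeroˡ g n)) (+-identityˡ 0#))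

  conv-assoc : ∀ f g h n → conv (conv f g) h n ≈ conv f (conv g h) n
  conv-assoc f g h zero    = trans conv-zero (trans (*-congʳ conv-zero) (trans (*-assoc _ _ _)
    (sym (trans conv-zero (*-congˡ conv-zero)))))
  conv-assoc f g h (suc n) = begin
    conv (conv f g) h (suc n)
      ≈⟨ conv-suc n ⟩
    conv f g 0 * h (suc n) + conv (conv f g ∘ suc) h n
      ≈⟨ +-cong (*-congʳ conv-zero) (conv-cong {g = h} conv-suc (λ _ → refl) n) ⟩
    f 0 * g 0 * h (suc n) + conv (λ k → f 0 * g (suc k) + conv (f ∘ suc) g k) h n
      ≈⟨ +-congˡ (trans (conv-distribʳ h (λ k → f 0 * g (suc k)) (conv (f ∘ suc) g) n)
                        (+-cong (conv-scale (f 0) (g ∘ suc) h n) (conv-assoc (f ∘ suc) g h n))) ⟩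
    f 0 * g 0 * h (suc n) + (f 0 * conv (g ∘ suc) h n + conv (f ∘ suc) (conv g h) n)
      ≈⟨ solve 5 (λ a b c d e → a :* b :* c :+ (a :* d :+ e) := a :* (b :* c :+ d) :+ e) refl _ _ _ _ _ ⟩
    f 0 * (g 0 * h (suc n) + conv (g ∘ suc) h n) + conv (f ∘ suc) (conv g h) n
      ≈⟨ +-congʳ (*-congˡ (conv-suc n)) ⟨
    f 0 * conv g h (suc n) + conv (f ∘ suc) (conv g h) n
      ≈⟨ conv-suc n ⟨
    conv f (conv g h) (suc n) ∎

  const : Carrier → Series
  const a zero    = a
  const a (suc n) = 0#

  conv-const : ∀ a g n → conv (const a) g n ≈ a * g n
  conv-const a g zero    = conv-zero
  conv-const a g (suc n) = trans (conv-suc n) (trans (+-congˡ (conv-zeroˡ g n)) (+-identityʳ _))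

  conv-identityˡ : ∀ g n → conv (const 1#) g n ≈ g n
  conv-identityˡ g n = trans (conv-const 1# g n) (*-identityˡ _)

  powerSeries : CommutativeRing 0ℓ 0ℓ
  powerSeries = record
    { Carrier = Series
    ; _≈_ = λ f g → ∀ n → f n ≈ g n
    ; _+_ = λ f g n → f n + g n
    ; _*_ = conv
    ; -_  = λ f n → - f n
    ; 0#  = λ _ → 0#
    ; 1#  = const 1#
    ; isCommutativeRing = record
      { isRing = record
        { +-isAbelianGroup = record
          { isGroup = record
            { isMonoid = record
              { isSemigroup = record
                { isMagma = record
                  { isEquivalence = record
                    { refl = λ n → refl ; sym = λ p n → sym (p n) ; trans = λ p q n → trans (p n) (q n) }
                  ; ∙-cong = λ p q n → +-cong (p n) (q n) }
                ; assoc = λ f g h n → +-assoc _ _ _ }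
              ; identity = (λ f n → +-identityˡ _) , (λ f n → +-identityʳ _) }
            ; inverse = (λ f n → -‿inverseˡ _) , (λ f n → -‿inverseʳ _)
            ; ⁻¹-cong = λ p n → -‿cong (p n) }
          ; comm = λ f g n → +-comm _ _ }
        ; *-cong = conv-cong
        ; *-assoc = conv-assoc
        ; *-identity = conv-identityˡ , (λ f n → trans (conv-comm f (const 1#) n) (conv-identityˡ f n))
        ; distrib = (λ f g h n → trans (conv-comm f (λ k → g k + h k) n) (trans (conv-distribʳ f g h n)
                      (+-cong (conv-comm g f n) (conv-comm h f n))))
                  , conv-distribʳ }
      ; *-comm = conv-comm }
    }

  X : Series
  X zero          = 0#
  X (suc zero)    = 1#
  X (suc (suc n)) = 0#

  conv-X-zero : ∀ g → conv X g 0 ≈ 0#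
  conv-X-zero g = trans conv-zero (zeroˡ _)

  conv-X-suc : ∀ g n → conv X g (suc n) ≈ g n
  conv-X-suc g n = trans (conv-suc n) (trans (+-cong (zeroˡ _) (trans (conv-cong {g = g} shift (λ _ → refl) n) (conv-identityˡ g n))) (+-identityˡ _))
    where
    shift : ∀ k → X (suc k) ≈ const 1# k
    shift zero    = refl
    shift (suc k) = refl

  constHom : Hom rawRing powerSeries
  constHom = record
    { ⟦_⟧ = const
    ; ⟦⟧-cong = λ { p zero → p ; p (suc n) → refl }
    ; +-homo = λ { x y zero → refl ; x y (suc n) → sym (+-identityˡ 0#) }
    ; *-homo = λ { x y zero → sym (conv-const x (const y) 0) ; x y (suc n) → sym (trans (conv-const x (const y) (suc n)) (zeroʳ x)) }
    ; -‿homo = λ { x zero → refl ; x (suc n) → solve 0 (con (+ 0) := :- con (+ 0)) refl }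
    ; 0-homo = λ { zero → refl ; (suc n) → refl }
    ; 1-homo = λ n → refl
    }

  constantTerm : Hom (CommutativeRing.rawRing powerSeries) R
  constantTerm = record
    { ⟦_⟧ = λ f → f 0
    ; ⟦⟧-cong = λ p → p 0
    ; +-homo = λ f g → refl
    ; *-homo = λ f g → conv-zero
    ; -‿homo = λ f → refl
    ; 0-homo = refl
    ; 1-homo = refl
    }

  ∂-* : ∀ f g n → suc n · conv f g (suc n) ≈ conv (λ k → suc k · f (suc k)) g n + conv f (λ k → suc k · g (suc k)) n
  ∂-* f g zero = begin
    1 · conv f g 1                               ≈⟨ +-identityʳ _ ⟩
    conv f g 1                                   ≈⟨ trans (conv-suc 0) (+-congˡ conv-zero) ⟩
    f 0 * g 1 + f 1 * g 0
      ≈⟨ solve 4 (λ a b c d → a :* b :+ c :* d := (c :+ con (+ 0)) :* d :+ a :* (b :+ con (+ 0))) refl _ _ _ _ ⟩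
    1 · f 1 * g 0 + f 0 * 1 · g 1                ≈⟨ +-cong conv-zero conv-zero ⟨
    conv (λ k → suc k · f (suc k)) g 0 + conv f (λ k → suc k · g (suc k)) 0 ∎
  ∂-* f g (suc n) = begin
    suc (suc n) · conv f g (suc (suc n))
      ≈⟨ ×-congʳ (suc (suc n)) (conv-suc (suc n)) ⟩
    suc (suc n) · (f 0 * g (suc (suc n)) + C)
      ≈⟨ ×-distrib-+ _ _ (suc (suc n)) ⟩
    suc (suc n) · (f 0 * g (suc (suc n))) + (C + suc n · C)
      ≈⟨ +-cong (sym (×-comm-* (suc (suc n)) (f 0) _)) (+-congˡ (∂-* (f ∘ suc) g n)) ⟩
    f 0 * G (suc n) + (C + (conv F′ g n + conv (f ∘ suc) G n))
      ≈⟨ +-congˡ (+-congʳ (conv-suc n)) ⟩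
    f 0 * G (suc n) + ((f 1 * g (suc n) + conv (λ k → f (suc (suc k))) g n) + (conv F′ g n + conv (f ∘ suc) G n))
      ≈⟨ solve 6 (λ a b c d e f → a :+ ((b :* c :+ d) :+ (e :+ f)) := ((b :+ con (+ 0)) :* c :+ (d :+ e)) :+ (a :+ f)) refl _ _ _ _ _ _ ⟩
    (F 0 * g (suc n) + (conv (λ k → f (suc (suc k))) g n + conv F′ g n)) + (f 0 * G (suc n) + conv (f ∘ suc) G n)
      ≈⟨ +-congʳ (+-congˡ (conv-distribʳ g (λ k → f (suc (suc k))) F′ n)) ⟨
    (F 0 * g (suc n) + conv (F ∘ suc) g n) + (f 0 * G (suc n) + conv (f ∘ suc) G n)
      ≈⟨ +-cong (conv-suc n) (conv-suc n) ⟨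
    conv F g (suc n) + conv f G (suc n) ∎
    where
    C = conv (f ∘ suc) g (suc n)
    F F′ G : Series
    F k = suc k · f (suc k)
    F′ k = suc k · f (suc (suc k))
    G k = suc k · g (suc k)

  ∂ : Derivation powerSeries
  ∂ = record
    { D = λ f n → suc n · f (suc n)
    ; D-cong = λ p n → ×-congʳ (suc n) (p (suc n))
    ; D-+ = λ f g n → ×-distrib-+ _ _ (suc n)
    ; D-* = ∂-*
    }

  liftᴰ : Derivation R → Derivation powerSeries
  liftᴰ δ = record
    { D = λ f n → D (f n)
    ; D-cong = λ p n → D-cong (p n)
    ; D-+ = λ f g n → D-+ _ _
    ; D-* = leibniz
    }
    where
    open Derivation δ
    leibniz : ∀ f g n → D (conv f g n) ≈ conv (λ k → D (f k)) g n + conv f (λ k → D (g k)) n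
    leibniz f g zero    = trans (D-cong conv-zero) (trans (D-* _ _) (sym (+-cong conv-zero conv-zero)))
    leibniz f g (suc n) = trans (D-cong (conv-suc n)) (trans (D-+ _ _) (trans (+-cong (D-* _ _) (leibniz (f ∘ suc) g n))
      (trans (solve 4 (λ a b c d → (a :+ b) :+ (c :+ d) := (a :+ c) :+ (b :+ d)) refl _ _ _ _)
        (sym (+-cong (conv-suc n) (conv-suc n))))))

open PowerSeries using (powerSeries)

module _ {R S : CommutativeRing 0ℓ 0ℓ} (h : Hom (CommutativeRing.rawRing R) S) where
  private
    module R = CommutativeRing R
    module PR = PowerSeries R
    module PS = PowerSeries S
  open CommutativeRing S hiding (zero)
  open Hom h

  mapHom : Hom (CommutativeRing.rawRing (powerSeries R)) (powerSeries S)
  mapHom = record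
    { ⟦_⟧ = λ f n → ⟦ f n ⟧
    ; ⟦⟧-cong = λ p n → ⟦⟧-cong (p n)
    ; +-homo = λ f g n → +-homo _ _
    ; *-homo = conv-homo
    ; -‿homo = λ f n → -‿homo _
    ; 0-homo = λ n → 0-homo
    ; 1-homo = λ { zero → 1-homo ; (suc n) → 0-homo }
    }
    where
    conv-homo : ∀ f g n → ⟦ PR.conv f g n ⟧ ≈ PS.conv (λ k → ⟦ f k ⟧) (λ k → ⟦ g k ⟧) n
    conv-homo f g zero    = trans (⟦⟧-cong PR.conv-zero) (trans (*-homo _ _) (sym PS.conv-zero))
    conv-homo f g (suc n) = trans (⟦⟧-cong (PR.conv-suc n)) (trans (+-homo _ _)
      (trans (+-cong (*-homo _ _) (conv-homo (f ∘ suc) g n)) (sym (PS.conv-suc n))))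

infixr 9 _∘ᴴ_

_∘ᴴ_ : ∀ {R : RawRing 0ℓ 0ℓ} {S T : CommutativeRing 0ℓ 0ℓ} →
       Hom (CommutativeRing.rawRing S) T → Hom R S → Hom R T
_∘ᴴ_ {T = T} g f = record
  { ⟦_⟧ = λ x → g.⟦ f.⟦ x ⟧ ⟧
  ; ⟦⟧-cong = λ p → g.⟦⟧-cong (f.⟦⟧-cong p)
  ; +-homo = λ x y → trans (g.⟦⟧-cong (f.+-homo x y)) (g.+-homo _ _)
  ; *-homo = λ x y → trans (g.⟦⟧-cong (f.*-homo x y)) (g.*-homo _ _)
  ; -‿homo = λ x → trans (g.⟦⟧-cong (f.-‿homo x)) (g.-‿homo _)
  ; 0-homo = trans (g.⟦⟧-cong f.0-homo) g.0-homo
  ; 1-homo = trans (g.⟦⟧-cong f.1-homo) g.1-homo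
  }
  where
  open CommutativeRing T
  module f = Hom f
  module g = Hom g

module KronHom {R S : CommutativeRing 0ℓ 0ℓ} (h : Hom (CommutativeRing.rawRing R) S) where
  open Hom h
  open CommutativeRing S using (_≈_)

  kron-homo : ∀ {n} (i j : Fin n) → ⟦ Determinants.kron R i j ⟧ ≈ Determinants.kron S i j
  kron-homo zero    zero    = 1-homo
  kron-homo zero    (suc j) = 0-homo
  kron-homo (suc i) zero    = 0-homo
  kron-homo (suc i) (suc j) = kron-homo i j

module DerivationValues (R : CommutativeRing 0ℓ 0ℓ) where
  open CommutativeRing R hiding (zero)
  open PowerSeries R hiding (powerSeries)
  open NaturalMult semiring using (×-congʳ; ×-comm-*) renaming (_×_ to _·_)
  open CommutativeRing (powerSeries R) using () renaming (_≈_ to _≈ˢ_; 0# to 0ˢ; 1# to 1ˢ)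

  ·-0 : ∀ k → k · 0# ≈ 0#
  ·-0 k = trans (×-congʳ k (sym (zeroʳ 0#))) (trans (sym (×-comm-* k 0# 0#)) (zeroˡ _))

  ∂-const : ∀ a → Derivation.D ∂ (const a) ≈ˢ 0ˢ
  ∂-const a n = ·-0 (suc n)

  ∂-X : Derivation.D ∂ X ≈ˢ 1ˢ
  ∂-X zero    = +-identityʳ 1#
  ∂-X (suc n) = ·-0 (suc (suc n))

  module _ (δ : Derivation R) where
    open Derivation δ
    open DerivationProperties δ using (D-0; D-1)

    liftᴰ-const : ∀ a → Derivation.D (liftᴰ δ) (const a) ≈ˢ const (D a)
    liftᴰ-const a zero    = refl
    liftᴰ-const a (suc n) = D-0

    liftᴰ-X : Derivation.D (liftᴰ δ) X ≈ˢ 0ˢ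
    liftᴰ-X zero          = D-0
    liftᴰ-X (suc zero)    = D-1
    liftᴰ-X (suc (suc n)) = D-0

-- Newton's inequalities for the characteristic polynomial of a symmetric matrix

-- Series in three variables: f r j i is the coefficient of w^r c^j b^i.
ℤᴿ ℤ⟦b⟧ ℤ⟦b,c⟧ ℤ⟦b,c,w⟧ : CommutativeRing 0ℓ 0ℓ
ℤᴿ       = ℤₚ.+-*-commutativeRing
ℤ⟦b⟧     = PowerSeries.powerSeries ℤᴿ
ℤ⟦b,c⟧   = PowerSeries.powerSeries ℤ⟦b⟧
ℤ⟦b,c,w⟧ = PowerSeries.powerSeries ℤ⟦b,c⟧

module Z  = CommutativeRing ℤᴿ
module U  = CommutativeRing ℤ⟦b⟧
module V  = CommutativeRing ℤ⟦b,c⟧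
module B  = CommutativeRing ℤ⟦b,c,w⟧
module PZ = PowerSeries ℤᴿ
module PU = PowerSeries ℤ⟦b⟧
module PV = PowerSeries ℤ⟦b,c⟧
module DZ = Determinants ℤᴿ
module DU = Determinants ℤ⟦b⟧
module DV = Determinants ℤ⟦b,c⟧
module DB = Determinants ℤ⟦b,c,w⟧
module CZ = CauchyBinet ℤᴿ
module CB = CauchyBinet ℤ⟦b,c,w⟧
open CauchyBinet ℤ⟦b⟧ using (rows)
open NaturalMult Z.semiring using () renaming (_×_ to _·ᶻ_) public
open NaturalMult U.semiring using () renaming (_×_ to _·ᵁ_) public
open NaturalMult V.semiring using () renaming (_×_ to _·ⱽ_) public
open NaturalMult B.semiring using () renaming (_×_ to _·ᴮ_) public

bHomⱽ cHomⱽ : Hom U.rawRing ℤ⟦b,c⟧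
bHomⱽ = PU.constHom
cHomⱽ = mapHom PZ.constHom

bHom cHom : Hom U.rawRing ℤ⟦b,c,w⟧
bHom = PV.constHom ∘ᴴ bHomⱽ
cHom = PV.constHom ∘ᴴ cHomⱽ

open Hom bHom using () renaming (⟦_⟧ to ⟦_⟧ᵇ) public
open Hom cHom using () renaming (⟦_⟧ to ⟦_⟧ᶜ) public

w : B.Carrier
w = PV.X

-- The coefficient of w^r in w^m.
indicator : ℕ → ℕ → ℤ
indicator zero    zero    = ℤ.1ℤ
indicator zero    (suc r) = ℤ.0ℤ
indicator (suc m) zero    = ℤ.0ℤ
indicator (suc m) (suc r) = indicator m r

open RawSemiringOps (RawRing.rawSemiring B.rawRing) using (_^_)

power-coeff : ∀ m a r j i → (w ^ m B.* PV.const a) r j i ≡ indicator m r ℤ.* a j i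
power-coeff zero a zero j i = ≡.trans (B.*-identityˡ (PV.const a) zero j i) (≡.sym (ℤₚ.*-identityˡ _))
power-coeff zero a (suc r) j i = B.*-identityˡ (PV.const a) (suc r) j i
power-coeff (suc m) a zero j i = ≡.trans (B.*-assoc w (w ^ m) (PV.const a) zero j i) (PV.conv-X-zero _ j i)
power-coeff (suc m) a (suc r) j i = ≡.trans (B.*-assoc w (w ^ m) (PV.const a) (suc r) j i)
  (≡.trans (PV.conv-X-suc (w ^ m B.* PV.const a) r j i) (power-coeff m a r j i))

-- ⟦ p ⟧ᵇ and ⟦ q ⟧ᶜ have separate variables.
bc-coeff : ∀ (p q : U.Carrier) j i → (Hom.⟦_⟧ bHomⱽ p V.* Hom.⟦_⟧ cHomⱽ q) j i ≡ p i ℤ.* q j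
bc-coeff p q j i = ≡.trans (PU.conv-const p (Hom.⟦_⟧ cHomⱽ q) j i)
  (≡.trans (U.*-comm p (PZ.const (q j)) i) (≡.trans (PZ.conv-const (q j) p i) (ℤₚ.*-comm (q j) (p i))))

bcw-coeff : ∀ p q m r j i → (⟦ p ⟧ᵇ B.* (w ^ m B.* ⟦ q ⟧ᶜ)) r j i ≡ indicator m r ℤ.* (p i ℤ.* q j)
bcw-coeff p q m r j i = begin
  (⟦ p ⟧ᵇ B.* (w ^ m B.* ⟦ q ⟧ᶜ)) r j i
    ≡⟨ shuffle r j i ⟩
  (w ^ m B.* PV.const (p′ V.* q′)) r j i
    ≡⟨ power-coeff m (p′ V.* q′) r j i ⟩
  indicator m r ℤ.* (p′ V.* q′) j i
    ≡⟨ ≡.cong (indicator m r ℤ.*_) (bc-coeff p q j i) ⟩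
  indicator m r ℤ.* (p i ℤ.* q j) ∎
  where
  open ≡.≡-Reasoning
  p′ = Hom.⟦_⟧ bHomⱽ p
  q′ = Hom.⟦_⟧ cHomⱽ q
  shuffle : ⟦ p ⟧ᵇ B.* (w ^ m B.* ⟦ q ⟧ᶜ) B.≈ w ^ m B.* PV.const (p′ V.* q′)
  shuffle = B.trans (B.sym (B.*-assoc ⟦ p ⟧ᵇ (w ^ m) ⟦ q ⟧ᶜ)) (B.trans (B.*-congʳ (B.*-comm ⟦ p ⟧ᵇ (w ^ m)))
    (B.trans (B.*-assoc (w ^ m) ⟦ p ⟧ᵇ ⟦ q ⟧ᶜ) (B.*-congˡ {w ^ m} (B.sym (Hom.*-homo PV.constHom p′ q′)))))

·ᴮ-coeff : ∀ k f r j i → (k ·ᴮ f) r j i ≡ k ·ᶻ f r j i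
·ᴮ-coeff zero    f r j i = ≡.refl
·ᴮ-coeff (suc k) f r j i = ≡.cong (ℤ._+_ (f r j i)) (·ᴮ-coeff k f r j i)

·ⱽ-coeff : ∀ k f j i → (k ·ⱽ f) j i ≡ k ·ᶻ f j i
·ⱽ-coeff zero    f j i = ≡.refl
·ⱽ-coeff (suc k) f j i = ≡.cong (ℤ._+_ (f j i)) (·ⱽ-coeff k f j i)

·ᵁ-coeff : ∀ k f i → (k ·ᵁ f) i ≡ k ·ᶻ f i
·ᵁ-coeff zero    f i = ≡.refl
·ᵁ-coeff (suc k) f i = ≡.cong (ℤ._+_ (f i)) (·ᵁ-coeff k f i)

∑ᴸ-coeff : ∀ {I : Set} (xs : List I) F r j i → CB.∑ᴸ xs F r j i ≡ CZ.∑ᴸ xs (λ x → F x r j i)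
∑ᴸ-coeff []       F r j i = ≡.refl
∑ᴸ-coeff (x ∷ xs) F r j i = ≡.cong (ℤ._+_ (F x r j i)) (∑ᴸ-coeff xs F r j i)

∑ⱽ-coeff : ∀ {I : Set} (xs : List I) n F r j i → CB.∑ⱽ xs n F r j i ≡ CZ.∑ⱽ xs n (λ φ → F φ r j i)
∑ⱽ-coeff xs zero    F r j i = ≡.refl
∑ⱽ-coeff xs (suc n) F r j i = ≡.trans (∑ᴸ-coeff xs (λ e → CB.∑ⱽ xs n (F ∘ (e ∷_))) r j i)
  (CZ.∑ᴸ-cong xs λ e → ∑ⱽ-coeff xs n (F ∘ (e ∷_)) r j i)

weight : ∀ {n} → Fin n ⊎ Fin n → ℕ
weight (inj₁ _) = 0
weight (inj₂ _) = 1

weights : ∀ {n m} → Vec (Fin n ⊎ Fin n) m → ℕ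
weights []      = 0
weights (e ∷ φ) = weight e ℕ.+ weights φ

module _ {n : ℕ} where
  both : List (Fin n ⊎ Fin n)
  both = tabulate inj₁ ++ tabulate inj₂

  Rows : Set
  Rows = Fin n ⊎ Fin n → Fin n → U.Carrier

  -- The product Xᵀ diag(I, w I) Z of two stacked 2n × n matrices, X in the variable b and Z in the
  -- variable c. All determinants compared by Cauchy-Schwarz have this shape, for various choices of
  -- the two blocks.
  mixed : Rows → Rows → Fin n → Fin n → B.Carrier
  mixed ξ ζ i j = CB.∑ᴸ both λ x → ⟦ ξ x i ⟧ᵇ B.* (w ^ weight x B.* ⟦ ζ x j ⟧ᶜ)

  ∏-weights : ∀ {m} (φ : Vec (Fin n ⊎ Fin n) m) → DB.∏ (λ i → w ^ weight (lookup φ i)) B.≈ w ^ weights φ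
  ∏-weights []            = B.refl
  ∏-weights (inj₁ _ ∷ φ)  = B.trans (B.*-identityˡ _) (∏-weights φ)
  ∏-weights (inj₂ _ ∷ φ)  = B.trans (B.*-congʳ {DB.∏ (λ i → w ^ weight (lookup φ i))} (B.*-identityʳ w)) (B.*-congˡ {w} (∏-weights φ))

  -- In the Cauchy-Binet expansion the first minor involves only b, the second only c, and the power
  -- of w counts the letters of `φ` from the second block. Hence each coefficient is an inner
  -- product of two lists of integers, indexed by the words; for `ξ = ζ` and `i = j` it is a sum of
  -- squares.
  mixed-coeff : ∀ (ξ ζ : Rows) r j i → (n !) ·ᶻ DB.Det (mixed ξ ζ) r j i ≡
    CZ.∑ⱽ both n λ φ → indicator (weights φ) r ℤ.* (DU.Det (rows ξ φ) i ℤ.* DU.Det (rows ζ φ) j)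
  mixed-coeff ξ ζ r j i = begin
    (n !) ·ᶻ DB.Det (mixed ξ ζ) r j i
      ≡⟨ ·ᴮ-coeff (n !) (DB.Det (mixed ξ ζ)) r j i ⟨
    ((n !) ·ᴮ DB.Det (mixed ξ ζ)) r j i
      ≡⟨ CB.cauchyBinet both (λ x i → ⟦ ξ x i ⟧ᵇ) (λ x j → w ^ weight x B.* ⟦ ζ x j ⟧ᶜ) r j i ⟩
    CB.∑ⱽ both n (λ φ → DB.Det (CB.rows (λ x i → ⟦ ξ x i ⟧ᵇ) φ) B.* DB.Det (CB.rows (λ x j → w ^ weight x B.* ⟦ ζ x j ⟧ᶜ) φ)) r j i
      ≡⟨ CB.∑ⱽ-cong both n split r j i ⟩
    CB.∑ⱽ both n (λ φ → ⟦ DU.Det (rows ξ φ) ⟧ᵇ B.* (w ^ weights φ B.* ⟦ DU.Det (rows ζ φ) ⟧ᶜ)) r j i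
      ≡⟨ ∑ⱽ-coeff both n (λ φ → ⟦ DU.Det (rows ξ φ) ⟧ᵇ B.* (w ^ weights φ B.* ⟦ DU.Det (rows ζ φ) ⟧ᶜ)) r j i ⟩
    CZ.∑ⱽ both n (λ φ → (⟦ DU.Det (rows ξ φ) ⟧ᵇ B.* (w ^ weights φ B.* ⟦ DU.Det (rows ζ φ) ⟧ᶜ)) r j i)
      ≡⟨ CZ.∑ⱽ-cong both n (λ φ → bcw-coeff (DU.Det (rows ξ φ)) (DU.Det (rows ζ φ)) (weights φ) r j i) ⟩
    CZ.∑ⱽ both n (λ φ → indicator (weights φ) r ℤ.* (DU.Det (rows ξ φ) i ℤ.* DU.Det (rows ζ φ) j)) ∎
    where
    open ≡.≡-Reasoning
    split : ∀ φ → DB.Det (CB.rows (λ x i → ⟦ ξ x i ⟧ᵇ) φ) B.* DB.Det (CB.rows (λ x j → w ^ weight x B.* ⟦ ζ x j ⟧ᶜ) φ)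
                  B.≈ ⟦ DU.Det (rows ξ φ) ⟧ᵇ B.* (w ^ weights φ B.* ⟦ DU.Det (rows ζ φ) ⟧ᶜ)
    split φ = B.*-cong
      (B.sym (HomDet′.Det-homo bHom (rows ξ φ)))
      (B.trans (DB.Det-scale (λ i → w ^ weight (lookup φ i)) (λ i j → ⟦ ζ (lookup φ i) j ⟧ᶜ))
        (B.*-cong (∏-weights φ) (B.sym (HomDet′.Det-homo cHom (rows ζ φ)))))

module VU = DerivationValues ℤᴿ
module VV = DerivationValues ℤ⟦b⟧
module VB = DerivationValues ℤ⟦b,c⟧

∂ᵇ ∂ᶜ ∂ʷ : Derivation ℤ⟦b,c,w⟧
∂ᵇ = PV.liftᴰ (PU.liftᴰ PZ.∂)
∂ᶜ = PV.liftᴰ PU.∂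
∂ʷ = PV.∂

module ∂ᵇ = Derivation ∂ᵇ
module ∂ᶜ = Derivation ∂ᶜ
module ∂ʷ = Derivation ∂ʷ
module ∂ = Derivation PZ.∂
module HB = Hom bHom
module HC = Hom cHom
module constV = Hom PV.constHom

∂ᵇ-b : ∀ p → ∂ᵇ.D ⟦ p ⟧ᵇ B.≈ ⟦ ∂.D p ⟧ᵇ
∂ᵇ-b p = B.trans (VB.liftᴰ-const (PU.liftᴰ PZ.∂) _) (constV.⟦⟧-cong (VV.liftᴰ-const PZ.∂ p))

∂ᶜ-b : ∀ p → ∂ᶜ.D ⟦ p ⟧ᵇ B.≈ B.0#
∂ᶜ-b p = B.trans (VB.liftᴰ-const PU.∂ _) (B.trans (constV.⟦⟧-cong (VV.∂-const p)) constV.0-homo)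

∂ʷ-b : ∀ p → ∂ʷ.D ⟦ p ⟧ᵇ B.≈ B.0#
∂ʷ-b p = VB.∂-const (Hom.⟦_⟧ bHomⱽ p)

∂ᵇ-c : ∀ q → ∂ᵇ.D ⟦ q ⟧ᶜ B.≈ B.0#
∂ᵇ-c q = B.trans (VB.liftᴰ-const (PU.liftᴰ PZ.∂) _) (B.trans (constV.⟦⟧-cong (λ j → VU.∂-const (q j))) constV.0-homo)

const-· : ∀ k a → k ·ᵁ PZ.const a U.≈ PZ.const (k ·ᶻ a)
const-· zero    a = U.sym (Hom.0-homo PZ.constHom)
const-· (suc k) a = U.trans (U.+-congˡ {PZ.const a} (const-· k a)) (U.sym (Hom.+-homo PZ.constHom a (k ·ᶻ a)))

∂ᶜ-c : ∀ q → ∂ᶜ.D ⟦ q ⟧ᶜ B.≈ ⟦ ∂.D q ⟧ᶜ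
∂ᶜ-c q = B.trans (VB.liftᴰ-const PU.∂ _) (constV.⟦⟧-cong (λ j → const-· (suc j) (q (suc j))))

∂ʷ-c : ∀ q → ∂ʷ.D ⟦ q ⟧ᶜ B.≈ B.0#
∂ʷ-c q = VB.∂-const (Hom.⟦_⟧ cHomⱽ q)

∂ᵇ-w : ∂ᵇ.D w B.≈ B.0#
∂ᵇ-w = VB.liftᴰ-X (PU.liftᴰ PZ.∂)

∂ᶜ-w : ∂ᶜ.D w B.≈ B.0#
∂ᶜ-w = VB.liftᴰ-X PU.∂

∂ʷ-w : ∂ʷ.D w B.≈ B.1#
∂ʷ-w = VB.∂-X

b c : B.Carrier
b = ⟦ PZ.X ⟧ᵇ
c = ⟦ PZ.X ⟧ᶜ

module KB = KronHom {ℤ⟦b⟧} {ℤ⟦b,c,w⟧} bHom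
module KC = KronHom {ℤ⟦b⟧} {ℤ⟦b,c,w⟧} cHom

b*-zero : ∀ g r j → (b B.* g) r j 0 ≡ ℤ.0ℤ
b*-zero g r j = ≡.trans (PV.conv-const (PU.const PZ.X) g r j 0) (≡.trans (PU.conv-const PZ.X (g r) j 0) (PZ.conv-X-zero (g r j)))

b*-suc : ∀ g r j i → (b B.* g) r j (suc i) ≡ g r j i
b*-suc g r j i = ≡.trans (PV.conv-const (PU.const PZ.X) g r j (suc i))
  (≡.trans (PU.conv-const PZ.X (g r) j (suc i)) (PZ.conv-X-suc (g r j) i))

c*-suc : ∀ g r j i → (c B.* g) r (suc j) i ≡ g r j i
c*-suc g r j i = ≡.trans (PV.conv-const (Hom.⟦_⟧ cHomⱽ PZ.X) g r (suc j) i)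
  (≡.trans (V.*-congʳ {g r} X≈ (suc j) i) (PU.conv-X-suc (g r) j i))
  where
  X≈ : Hom.⟦_⟧ cHomⱽ PZ.X V.≈ PU.X
  X≈ zero          = Hom.0-homo PZ.constHom
  X≈ (suc zero)    = Hom.1-homo PZ.constHom
  X≈ (suc (suc j)) = Hom.0-homo PZ.constHom

-- Kills b + c and b c + w.
Δ : Derivation ℤ⟦b,c,w⟧
Δ = (∂ᵇ -ᴰ ∂ᶜ) -ᴰ (c B.- b) *ᴰ ∂ʷ

-- Kills b + w.
Δ′ : Derivation ℤ⟦b,c,w⟧
Δ′ = ∂ᵇ -ᴰ ∂ʷ

module _ {n : ℕ} where
  pencil : (Fin n → Fin n → ℤ) → Fin n → Fin n → U.Carrier
  pencil A e j = PZ.const (A e j) U.- DU.kron e j U.* PZ.X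

  χ : (Fin n → Fin n → ℤ) → U.Carrier
  χ A = DU.Det (pencil A)

  ∂-pencil : ∀ A e j → ∂.D (pencil A e j) U.≈ U.- DU.kron e j
  ∂-pencil A e j = begin
    ∂.D (pencil A e j)
      ≈⟨ ∂.D-+ (PZ.const (A e j)) (U.- (DU.kron e j U.* PZ.X)) ⟩
    ∂.D (PZ.const (A e j)) U.+ ∂.D (U.- (DU.kron e j U.* PZ.X))
      ≈⟨ U.+-cong (VU.∂-const (A e j)) (U.trans (P.D-neg (DU.kron e j U.* PZ.X)) (U.-‿cong (P.D-*-constˡ PZ.X (P.D-kron e j)))) ⟩
    U.0# U.- DU.kron e j U.* ∂.D PZ.X
      ≈⟨ U.trans (U.+-identityˡ _) (U.-‿cong (U.trans (U.*-congˡ {DU.kron e j} VU.∂-X) (U.*-identityʳ _))) ⟩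
    U.- DU.kron e j ∎
    where
    module P = DerivationProperties PZ.∂
    open SetoidReasoning U.setoid

  mixed-split : ∀ (ξ ζ : Rows {n}) i j → mixed ξ ζ i j B.≈
    DB.∑ (λ e → ⟦ ξ (inj₁ e) i ⟧ᵇ B.* ⟦ ζ (inj₁ e) j ⟧ᶜ) B.+ w B.* DB.∑ (λ e → ⟦ ξ (inj₂ e) i ⟧ᵇ B.* ⟦ ζ (inj₂ e) j ⟧ᶜ)
  mixed-split ξ ζ i j = B.trans (CB.∑ᴸ-++ (tabulate inj₁) (tabulate inj₂) {f}) (B.+-cong
    (B.trans (CB.∑ᴸ-tabulate inj₁ {f}) (DB.∑-cong λ e → B.*-congˡ {⟦ ξ (inj₁ e) i ⟧ᵇ} (B.*-identityˡ ⟦ ζ (inj₁ e) j ⟧ᶜ)))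
    (B.trans (CB.∑ᴸ-tabulate inj₂ {f}) (B.trans (DB.∑-cong λ e → pull ⟦ ξ (inj₂ e) i ⟧ᵇ ⟦ ζ (inj₂ e) j ⟧ᶜ) DB.∑-*ˡ)))
    where
    f : Fin n ⊎ Fin n → B.Carrier
    f x = ⟦ ξ x i ⟧ᵇ B.* (w ^ weight x B.* ⟦ ζ x j ⟧ᶜ)
    pull : ∀ x z → x B.* (w B.* B.1# B.* z) B.≈ w B.* (x B.* z)
    pull = solve 3 (λ w x z → x :* (w :* con (+ 1) :* z) := w :* (x :* z)) B.refl w
      where open IntegerCoefficients ℤ⟦b,c,w⟧

  kronᵇ-∑ : ∀ (ζ : Fin n → B.Carrier) i → DB.∑ (λ e → ⟦ DU.kron e i ⟧ᵇ B.* ζ e) B.≈ ζ i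
  kronᵇ-∑ ζ i = B.trans (DB.∑-cong λ e → B.*-congʳ {ζ e} (B.trans (KB.kron-homo e i) (B.reflexive (DB.kron-sym e i)))) (DB.∑-kron i ζ)

  kronᶜ-∑ : ∀ (ξ : Fin n → B.Carrier) j → DB.∑ (λ e → ξ e B.* ⟦ DU.kron e j ⟧ᶜ) B.≈ ξ j
  kronᶜ-∑ ξ j = B.trans (DB.∑-cong λ e → B.*-congˡ {ξ e} (KC.kron-homo e j)) (DB.∑-kronʳ j ξ)

  -- With the minus sign, `mixed (pencilRows A) unitRows` is A - (b + w) I for symmetric A, while in
  -- `mixed unitRows unitRows` the sign cancels and (1 + w) I remains.
  unitRows : Rows {n}
  unitRows (inj₁ e) j = DU.kron e j
  unitRows (inj₂ e) j = U.- DU.kron e j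

  pencilRows : (Fin n → Fin n → ℤ) → Rows {n}
  pencilRows A (inj₁ e) j = pencil A e j
  pencilRows A (inj₂ e) j = DU.kron e j

  module _ (A : Fin n → Fin n → ℤ) (A-sym : ∀ i j → A i j ≡ A j i) where
    open IntegerCoefficients ℤ⟦b,c,w⟧ using (solve; con; _:=_; _:+_; _:*_; :-_; _:-_)

    constᵇ≈constᶜ : ∀ a → ⟦ PZ.const a ⟧ᵇ B.≈ ⟦ PZ.const a ⟧ᶜ
    constᵇ≈constᶜ a = constV.⟦⟧-cong λ { zero → U.refl ; (suc j) → U.sym (Hom.0-homo PZ.constHom) }

    pencilᵇ : ∀ e i → ⟦ pencil A e i ⟧ᵇ B.≈ ⟦ PZ.const (A e i) ⟧ᵇ B.- DB.kron e i B.* b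
    pencilᵇ e i = B.trans (HB.+-homo (PZ.const (A e i)) (U.- (DU.kron e i U.* PZ.X)))
      (B.+-congˡ {⟦ PZ.const (A e i) ⟧ᵇ} (B.trans (HB.-‿homo (DU.kron e i U.* PZ.X)) (B.-‿cong
        (B.trans (HB.*-homo (DU.kron e i) PZ.X) (B.*-congʳ {b} (KB.kron-homo e i))))))

    pencilᶜ : ∀ e i → ⟦ pencil A e i ⟧ᶜ B.≈ ⟦ PZ.const (A e i) ⟧ᵇ B.- DB.kron e i B.* c
    pencilᶜ e i = B.trans (HC.+-homo (PZ.const (A e i)) (U.- (DU.kron e i U.* PZ.X)))
      (B.+-cong (B.sym (constᵇ≈constᶜ (A e i))) (B.trans (HC.-‿homo (DU.kron e i U.* PZ.X)) (B.-‿cong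
        (B.trans (HC.*-homo (DU.kron e i) PZ.X) (B.*-congʳ {c} (KC.kron-homo e i))))))

    pencil-sym : ∀ i j → pencil A i j U.≈ pencil A j i
    pencil-sym i j = U.+-cong (U.reflexive (≡.cong PZ.const (A-sym i j)))
      (U.-‿cong (U.*-congʳ {PZ.X} (U.reflexive (DU.kron-sym i j))))

    -- The determinant of (A - b I) (A - c I) + w I.
    pairDet : B.Carrier
    pairDet = DB.Det (mixed (pencilRows A) (pencilRows A))

    pairDet-entry : ∀ i j → mixed (pencilRows A) (pencilRows A) i j B.≈
              DB.∑ (λ e → ⟦ pencil A e i ⟧ᵇ B.* ⟦ pencil A e j ⟧ᶜ) B.+ w B.* DB.kron i j
    pairDet-entry i j = B.trans (mixed-split (pencilRows A) (pencilRows A) i j)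
      (B.+-congˡ {DB.∑ (λ e → ⟦ pencil A e i ⟧ᵇ B.* ⟦ pencil A e j ⟧ᶜ)} (B.*-congˡ {w} (B.trans (kronᵇ-∑ (λ e → ⟦ DU.kron e j ⟧ᶜ) i) (KC.kron-homo i j))))

    Δ-b : ∀ e i → Derivation.D Δ ⟦ pencil A e i ⟧ᵇ B.≈ B.- DB.kron e i
    Δ-b e i = begin
      Derivation.D Δ p
        ≈⟨ B.+-cong (B.+-cong (B.trans (∂ᵇ-b (pencil A e i)) (B.trans (HB.⟦⟧-cong (∂-pencil A e i)) (B.trans (HB.-‿homo (DU.kron e i)) (B.-‿cong (KB.kron-homo e i)))))
                              (B.-‿cong (∂ᶜ-b (pencil A e i))))
                    (B.-‿cong (B.*-congˡ {c B.- b} (∂ʷ-b (pencil A e i)))) ⟩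
      ((B.- DB.kron e i) B.- B.0#) B.- (c B.- b) B.* B.0#
        ≈⟨ solve 2 (λ k x → (:- k :- con (+ 0)) :- x :* con (+ 0) := :- k) B.refl (DB.kron e i) (c B.- b) ⟩
      B.- DB.kron e i ∎
      where
      p = ⟦ pencil A e i ⟧ᵇ
      open SetoidReasoning B.setoid

    Δ-c : ∀ e i → Derivation.D Δ ⟦ pencil A e i ⟧ᶜ B.≈ DB.kron e i
    Δ-c e i = begin
      Derivation.D Δ p
        ≈⟨ B.+-cong (B.+-cong (∂ᵇ-c (pencil A e i))
                              (B.-‿cong (B.trans (∂ᶜ-c (pencil A e i)) (B.trans (HC.⟦⟧-cong (∂-pencil A e i)) (B.trans (HC.-‿homo (DU.kron e i)) (B.-‿cong (KC.kron-homo e i)))))))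
                    (B.-‿cong (B.*-congˡ {c B.- b} (∂ʷ-c (pencil A e i)))) ⟩
      (B.0# B.- (B.- DB.kron e i)) B.- (c B.- b) B.* B.0#
        ≈⟨ solve 2 (λ k x → (con (+ 0) :- (:- k)) :- x :* con (+ 0) := k) B.refl (DB.kron e i) (c B.- b) ⟩
      DB.kron e i ∎
      where
      p = ⟦ pencil A e i ⟧ᶜ
      open SetoidReasoning B.setoid

    Δ-w : Derivation.D Δ w B.≈ b B.- c
    Δ-w = B.trans (B.+-cong (B.+-cong ∂ᵇ-w (B.-‿cong ∂ᶜ-w)) (B.-‿cong (B.*-congˡ {c B.- b} ∂ʷ-w)))
      (solve 2 (λ b c → (con (+ 0) :- con (+ 0)) :- (c :- b) :* con (+ 1) := b :- c) B.refl b c)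

    -- Every single entry is killed. By symmetry of `A` the matrix product contributes -(A - c I) +
    -- (A - b I) = (c - b) I, and `Δ` sends w to b - c.
    Δ-pairDet : Derivation.D Δ pairDet B.≈ B.0#
    Δ-pairDet = P.D-Det≈0 (mixed (pencilRows A) (pencilRows A)) λ i j → begin
      Δ.D (mixed (pencilRows A) (pencilRows A) i j)
        ≈⟨ Δ.D-cong (pairDet-entry i j) ⟩
      Δ.D (DB.∑ (λ e → pᵇ e i B.* pᶜ e j) B.+ w B.* k i j)
        ≈⟨ Δ.D-+ (DB.∑ (λ e → pᵇ e i B.* pᶜ e j)) (w B.* k i j) ⟩
      Δ.D (DB.∑ (λ e → pᵇ e i B.* pᶜ e j)) B.+ Δ.D (w B.* k i j)
        ≈⟨ B.+-cong (sumPart i j) (B.trans (Δ.D-* w (k i j)) (B.+-cong (B.*-congʳ {k i j} Δ-w) (B.*-congˡ {w} (P.D-kron i j)))) ⟩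
      (B.- pᶜ i j B.+ pᵇ j i) B.+ ((b B.- c) B.* k i j B.+ w B.* B.0#)
        ≈⟨ B.+-congʳ (B.+-cong (B.-‿cong (pencilᶜ i j))
             (B.trans (HB.⟦⟧-cong (pencil-sym j i)) (pencilᵇ i j))) ⟩
      (B.- (a i j B.- k i j B.* c) B.+ (a i j B.- k i j B.* b)) B.+ ((b B.- c) B.* k i j B.+ w B.* B.0#)
        ≈⟨ solve 5 (λ a k b c w → (:- (a :- k :* c) :+ (a :- k :* b)) :+ ((b :- c) :* k :+ w :* con (+ 0)) := con (+ 0)) B.refl
             (a i j) (k i j) b c w ⟩
      B.0# ∎
      where
      module Δ = Derivation Δ
      module P = DerivationProperties Δ
      open SetoidReasoning B.setoid
      k : Fin n → Fin n → B.Carrier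
      k = DB.kron
      a pᵇ pᶜ : Fin n → Fin n → B.Carrier
      a i j = ⟦ PZ.const (A i j) ⟧ᵇ
      pᵇ e i = ⟦ pencil A e i ⟧ᵇ
      pᶜ e j = ⟦ pencil A e j ⟧ᶜ
      sumPart : ∀ i j → Δ.D (DB.∑ (λ e → pᵇ e i B.* pᶜ e j)) B.≈ B.- pᶜ i j B.+ pᵇ j i
      sumPart i j = begin
        Δ.D (DB.∑ (λ e → pᵇ e i B.* pᶜ e j))
          ≈⟨ P.D-∑ (λ e → pᵇ e i B.* pᶜ e j) ⟩
        DB.∑ (λ e → Δ.D (pᵇ e i B.* pᶜ e j))
          ≈⟨ DB.∑-cong (λ e → B.trans (Δ.D-* (pᵇ e i) (pᶜ e j)) (B.+-cong (B.*-congʳ {pᶜ e j} (Δ-b e i)) (B.*-congˡ {pᵇ e i} (Δ-c e j)))) ⟩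
        DB.∑ (λ e → (B.- k e i) B.* pᶜ e j B.+ pᵇ e i B.* k e j)
          ≈⟨ DB.∑-+ ⟩
        DB.∑ (λ e → (B.- k e i) B.* pᶜ e j) B.+ DB.∑ (λ e → pᵇ e i B.* k e j)
          ≈⟨ B.+-cong (B.trans (DB.∑-cong λ e → solve 2 (λ x y → :- x :* y := :- (x :* y)) B.refl (k e i) (pᶜ e j))
                        (B.trans DB.∑-neg (B.-‿cong (B.trans (DB.∑-cong λ e → B.*-congʳ {pᶜ e j} (B.reflexive (DB.kron-sym e i))) (DB.∑-kron i (λ e → pᶜ e j))))))
                      (DB.∑-kronʳ j (λ e → pᵇ e i)) ⟩
        B.- pᶜ i j B.+ pᵇ j i ∎

    -- The determinant of A - (b + w) I.
    shiftDet : B.Carrier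
    shiftDet = DB.Det (mixed (pencilRows A) unitRows)

    shiftDet-entry : ∀ i j → mixed (pencilRows A) unitRows i j B.≈ ⟦ pencil A j i ⟧ᵇ B.- w B.* DB.kron i j
    shiftDet-entry i j = B.trans (mixed-split (pencilRows A) unitRows i j) (B.+-cong
      (kronᶜ-∑ (λ e → ⟦ pencil A e i ⟧ᵇ) j)
      (B.trans (B.*-congˡ {w} (B.trans (kronᵇ-∑ (λ e → ⟦ U.- DU.kron e j ⟧ᶜ) i) (B.trans (HC.-‿homo (DU.kron i j)) (B.-‿cong (KC.kron-homo i j)))))
        (solve 2 (λ w k → w :* (:- k) := :- (w :* k)) B.refl w (DB.kron i j))))

    Δ′-shiftDet : Derivation.D Δ′ shiftDet B.≈ B.0#
    Δ′-shiftDet = P.D-Det≈0 (mixed (pencilRows A) unitRows) λ i j → begin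
      Δ′.D (mixed (pencilRows A) unitRows i j)
        ≈⟨ Δ′.D-cong (shiftDet-entry i j) ⟩
      Δ′.D (⟦ pencil A j i ⟧ᵇ B.- w B.* k i j)
        ≈⟨ Δ′.D-+ ⟦ pencil A j i ⟧ᵇ (B.- (w B.* k i j)) ⟩
      Δ′.D ⟦ pencil A j i ⟧ᵇ B.+ Δ′.D (B.- (w B.* k i j))
        ≈⟨ B.+-cong (B.+-cong (B.trans (∂ᵇ-b (pencil A j i)) (B.trans (HB.⟦⟧-cong (∂-pencil A j i)) (B.trans (HB.-‿homo (DU.kron j i)) (B.-‿cong (B.trans (KB.kron-homo j i) (B.reflexive (DB.kron-sym j i)))))))
                              (B.-‿cong (∂ʷ-b (pencil A j i))))
             (B.trans (P.D-neg (w B.* k i j)) (B.-‿cong (B.trans (Δ′.D-* w (k i j))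
               (B.+-cong (B.*-congʳ {k i j} (B.+-cong ∂ᵇ-w (B.-‿cong ∂ʷ-w))) (B.*-congˡ {w} (P.D-kron i j)))))) ⟩
      ((B.- k i j) B.- B.0#) B.- ((B.0# B.- B.1#) B.* k i j B.+ w B.* B.0#)
        ≈⟨ solve 2 (λ k w → (:- k :- con (+ 0)) :- ((con (+ 0) :- con (+ 1)) :* k :+ w :* con (+ 0)) := con (+ 0)) B.refl (k i j) w ⟩
      B.0# ∎
      where
      module Δ′ = Derivation Δ′
      module P = DerivationProperties Δ′
      open SetoidReasoning B.setoid
      k : Fin n → Fin n → B.Carrier
      k = DB.kron

    -- At w = 0 the matrix is a product, so the determinant factors into a series in b and one in c.
    pairDet-const : ∀ j i → pairDet 0 j i ≡ χ A i ℤ.* χ A j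
    pairDet-const j i = ≡.trans (lemma j i) (bc-coeff (χ A) (χ A) j i)
      where
      open SetoidReasoning V.setoid
      module H = Hom PV.constantTerm
      lemma : pairDet 0 V.≈ Hom.⟦_⟧ bHomⱽ (χ A) V.* Hom.⟦_⟧ cHomⱽ (χ A)
      lemma = begin
        pairDet 0
          ≈⟨ HomDet′.Det-homo PV.constantTerm (mixed (pencilRows A) (pencilRows A)) ⟩
        DV.Det (λ i j → mixed (pencilRows A) (pencilRows A) i j 0)
          ≈⟨ DV.Det-cong entry ⟩
        DV.Det (λ i j → DV.∑ λ e → Hom.⟦_⟧ bHomⱽ (pencil A i e) V.* Hom.⟦_⟧ cHomⱽ (pencil A e j))
          ≈⟨ CauchyBinet.Det-* ℤ⟦b,c⟧ (λ i e → Hom.⟦_⟧ bHomⱽ (pencil A i e)) (λ e j → Hom.⟦_⟧ cHomⱽ (pencil A e j)) ⟩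
        DV.Det (λ i e → Hom.⟦_⟧ bHomⱽ (pencil A i e)) V.* DV.Det (λ e j → Hom.⟦_⟧ cHomⱽ (pencil A e j))
          ≈⟨ V.*-cong (HomDet′.Det-homo bHomⱽ (pencil A)) (HomDet′.Det-homo cHomⱽ (pencil A)) ⟨
        Hom.⟦_⟧ bHomⱽ (χ A) V.* Hom.⟦_⟧ cHomⱽ (χ A) ∎
        where
        ∑-homo : ∀ (f : Fin n → B.Carrier) → DB.∑ f 0 V.≈ DV.∑ λ e → f e 0
        ∑-homo f = V.trans (V.reflexive (≡.cong (λ x → x 0) (DB.∑≡sum f))) (HomDet.sum-homo PV.constantTerm f)
        entry : ∀ i j → mixed (pencilRows A) (pencilRows A) i j 0 V.≈ DV.∑ λ e → Hom.⟦_⟧ bHomⱽ (pencil A i e) V.* Hom.⟦_⟧ cHomⱽ (pencil A e j)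
        entry i j = begin
          mixed (pencilRows A) (pencilRows A) i j 0
            ≈⟨ pairDet-entry i j 0 ⟩
          DB.∑ (λ e → ⟦ pencil A e i ⟧ᵇ B.* ⟦ pencil A e j ⟧ᶜ) 0 V.+ (w B.* DB.kron i j) 0
            ≈⟨ V.+-cong (∑-homo λ e → ⟦ pencil A e i ⟧ᵇ B.* ⟦ pencil A e j ⟧ᶜ) (PV.conv-X-zero (DB.kron i j)) ⟩
          DV.∑ (λ e → (⟦ pencil A e i ⟧ᵇ B.* ⟦ pencil A e j ⟧ᶜ) 0) V.+ V.0#
            ≈⟨ V.+-identityʳ _ ⟩
          DV.∑ (λ e → (⟦ pencil A e i ⟧ᵇ B.* ⟦ pencil A e j ⟧ᶜ) 0)
            ≈⟨ DV.∑-cong (λ e → V.trans PV.conv-zero (V.*-congʳ {Hom.⟦_⟧ cHomⱽ (pencil A e j)} (Hom.⟦⟧-cong bHomⱽ (pencil-sym e i)))) ⟩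
          DV.∑ (λ e → Hom.⟦_⟧ bHomⱽ (pencil A i e) V.* Hom.⟦_⟧ cHomⱽ (pencil A e j)) ∎

    shiftDet-const : ∀ i → shiftDet 0 0 i ≡ χ A i
    shiftDet-const i = lemma 0 i
      where
      lemma : shiftDet 0 V.≈ Hom.⟦_⟧ bHomⱽ (χ A)
      lemma = V.trans (HomDet′.Det-homo PV.constantTerm (mixed (pencilRows A) unitRows))
        (V.trans (DV.Det-cong entry) (V.sym (HomDet′.Det-homo bHomⱽ (pencil A))))
        where
        entry : ∀ i j → mixed (pencilRows A) unitRows i j 0 V.≈ Hom.⟦_⟧ bHomⱽ (pencil A i j)
        entry i j = V.trans (shiftDet-entry i j 0)
          (V.trans (V.+-cong (Hom.⟦⟧-cong bHomⱽ (pencil-sym j i)) (V.-‿cong (PV.conv-X-zero (DB.kron i j))))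
            (V.trans (V.+-congˡ {Hom.⟦_⟧ bHomⱽ (pencil A i j)} (λ _ _ → ≡.refl)) (V.+-identityʳ _)))

    -- The recurrences obtained by comparing coefficients in Δ pairDet = 0 and Δ′ shiftDet = 0.
    diagonal offDiagonal : ℕ → ℕ → ℤ
    diagonal r l = pairDet r l l
    -- Stands for the nonexistent coefficient of b^(-1), so that the recurrence also covers its
    -- lowest case.
    offDiagonal r zero    = ℤ.0ℤ
    offDiagonal r (suc l) = pairDet r (suc (suc l)) l

    pairDet-recurrence : ∀ r l → (suc l ·ᶻ diagonal r (suc l) ℤ.- suc (suc l) ·ᶻ offDiagonal r (suc l)) ≡ suc r ·ᶻ diagonal (suc r) l ℤ.- suc r ·ᶻ offDiagonal (suc r) l
    -- The coefficient of w^r c^(l+1) b^l: the factors l + 1, l + 2 and r + 1 come from the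
    -- derivatives in b, c and w.
    pairDet-recurrence r l = begin
      suc l ·ᶻ diagonal r (suc l) ℤ.- suc (suc l) ·ᶻ offDiagonal r (suc l)
        ≡⟨ ≡.cong (λ x → suc l ·ᶻ diagonal r (suc l) ℤ.- x) (·ᵁ-coeff (suc (suc l)) (pairDet r (suc (suc l))) l) ⟨
      ∂ᵇ.D pairDet r (suc l) l ℤ.- ∂ᶜ.D pairDet r (suc l) l
        ≡⟨ ℤₚ.i-j≡0⇒i≡j _ _ (Δ-pairDet r (suc l) l) ⟩
      ((c B.- b) B.* ∂ʷ.D pairDet) r (suc l) l
        ≡⟨ solve 3 (λ c b x → (c :- b) :* x := c :* x :- b :* x) B.refl c b (∂ʷ.D pairDet) r (suc l) l ⟩
      (c B.* ∂ʷ.D pairDet) r (suc l) l ℤ.- (b B.* ∂ʷ.D pairDet) r (suc l) l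
        ≡⟨ ≡.cong₂ ℤ._-_ (≡.trans (c*-suc (∂ʷ.D pairDet) r l l) (·ⱽ-coeff (suc r) (pairDet (suc r)) l l)) (bPart l) ⟩
      suc r ·ᶻ diagonal (suc r) l ℤ.- suc r ·ᶻ offDiagonal (suc r) l ∎
      where
      open ≡.≡-Reasoning
      bPart : ∀ l → (b B.* ∂ʷ.D pairDet) r (suc l) l ≡ suc r ·ᶻ offDiagonal (suc r) l
      bPart zero    = ≡.trans (b*-zero (∂ʷ.D pairDet) r 1) (≡.sym (VU.·-0 (suc r)))
      bPart (suc l) = ≡.trans (b*-suc (∂ʷ.D pairDet) r (suc (suc l)) l) (·ⱽ-coeff (suc r) (pairDet (suc r)) (suc (suc l)) l)

    shiftDet-recurrence : ∀ r i → suc i ·ᶻ shiftDet r 0 (suc i) ≡ suc r ·ᶻ shiftDet (suc r) 0 i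
    shiftDet-recurrence r i = ≡.trans (ℤₚ.i-j≡0⇒i≡j _ _ (Δ′-shiftDet r 0 i)) (·ⱽ-coeff (suc r) (shiftDet (suc r)) 0 i)

-- The Cauchy-Schwarz inequality for integer sums

open +-*-Solver using (solve; con; _:=_; _:+_; _:*_; :-_; _:-_)

·ᶻ-* : ∀ k x → k ·ᶻ x ≡ + k ℤ.* x
·ᶻ-* zero    x = ≡.sym (ℤₚ.*-zeroˡ x)
·ᶻ-* (suc k) x = ≡.trans (≡.cong (ℤ._+_ x) (·ᶻ-* k x)) (≡.sym (ℤₚ.suc-* (+ k) x))

*-nonneg : ∀ {x y} → ℤ.0ℤ ℤ.≤ x → ℤ.0ℤ ℤ.≤ y → ℤ.0ℤ ℤ.≤ x ℤ.* y
*-nonneg {x} {y} 0≤x 0≤y = ≡.subst (ℤ._≤ x ℤ.* y) (ℤₚ.*-zeroʳ x) (ℤₚ.*-monoˡ-≤-nonNeg x {{ℤ.nonNegative 0≤x}} 0≤y)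

*-pos : ∀ {x y} → ℤ.0ℤ ℤ.< x → ℤ.0ℤ ℤ.< y → ℤ.0ℤ ℤ.< x ℤ.* y
*-pos {x} {y} 0<x 0<y = ≡.subst (ℤ._< x ℤ.* y) (ℤₚ.*-zeroʳ x) (ℤₚ.*-monoˡ-<-pos x {{ℤ.positive 0<x}} 0<y)

square-nonneg : ∀ x → ℤ.0ℤ ℤ.≤ x ℤ.* x
square-nonneg x with ℤₚ.≤-total ℤ.0ℤ x
... | inj₁ 0≤x = *-nonneg 0≤x 0≤x
... | inj₂ x≤0 = ≡.subst (ℤ._≤_ ℤ.0ℤ) (solve 1 (λ x → :- x :* :- x := x :* x) ≡.refl x)
                   (*-nonneg (ℤₚ.neg-mono-≤ x≤0) (ℤₚ.neg-mono-≤ x≤0))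

*-mono-nonneg : ∀ {a b c d} → ℤ.0ℤ ℤ.≤ a → ℤ.0ℤ ℤ.≤ d → a ℤ.≤ b → c ℤ.≤ d → a ℤ.* c ℤ.≤ b ℤ.* d
*-mono-nonneg {a} {b} {c} {d} 0≤a 0≤d a≤b c≤d = ℤₚ.≤-trans
  (ℤₚ.*-monoˡ-≤-nonNeg a {{ℤ.nonNegative 0≤a}} c≤d) (ℤₚ.*-monoʳ-≤-nonNeg d {{ℤ.nonNegative 0≤d}} a≤b)

0≤+ : ∀ n → ℤ.0ℤ ℤ.≤ + n
0≤+ n = ℤ.+≤+ ℕ.z≤n

-- Positive semidefiniteness of the symmetric 2 × 2 matrix with diagonal a, b and off-diagonal entry
-- c. Such matrices are closed under addition, which turns the inequality for sums into an induction
-- over the summands.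
record CauchySchwarz (a b c : ℤ) : Set where
  constructor cs
  field
    0≤a : ℤ.0ℤ ℤ.≤ a
    0≤b : ℤ.0ℤ ℤ.≤ b
    c²≤ab : c ℤ.* c ℤ.≤ a ℤ.* b

cs-+ : ∀ {a b c a′ b′ c′} → CauchySchwarz a b c → CauchySchwarz a′ b′ c′ →
       CauchySchwarz (a ℤ.+ a′) (b ℤ.+ b′) (c ℤ.+ c′)
cs-+ {a} {b} {c} {a′} {b′} {c′} (cs 0≤a 0≤b p) (cs 0≤a′ 0≤b′ p′) =
  cs (ℤₚ.+-mono-≤ 0≤a 0≤a′) (ℤₚ.+-mono-≤ 0≤b 0≤b′) (begin
    (c ℤ.+ c′) ℤ.* (c ℤ.+ c′)
      ≡⟨ solve 2 (λ c d → (c :+ d) :* (c :+ d) := c :* c :+ d :* d :+ con (+ 2) :* (c :* d)) ≡.refl c c′ ⟩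
    c ℤ.* c ℤ.+ c′ ℤ.* c′ ℤ.+ + 2 ℤ.* (c ℤ.* c′)
      ≤⟨ ℤₚ.+-mono-≤ (ℤₚ.+-mono-≤ p p′) cross ⟩
    a ℤ.* b ℤ.+ a′ ℤ.* b′ ℤ.+ (a ℤ.* b′ ℤ.+ a′ ℤ.* b)
      ≡⟨ solve 4 (λ a b x y → a :* b :+ x :* y :+ (a :* y :+ x :* b) := (a :+ x) :* (b :+ y)) ≡.refl a b a′ b′ ⟩
    (a ℤ.+ a′) ℤ.* (b ℤ.+ b′) ∎)
  where
  open ℤₚ.≤-Reasoning
  x = + 2 ℤ.* (c ℤ.* c′)
  y = a ℤ.* b′ ℤ.+ a′ ℤ.* b
  0≤y : ℤ.0ℤ ℤ.≤ y
  0≤y = ℤₚ.+-mono-≤ (*-nonneg 0≤a 0≤b′) (*-nonneg 0≤a′ 0≤b)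
  -- 4 (c c′)² ≤ 4 (a b) (a′ b′) ≤ (a b′ + a′ b)²
  x²≤y² : x ℤ.* x ℤ.≤ y ℤ.* y
  x²≤y² = begin
    x ℤ.* x
      ≡⟨ solve 2 (λ c d → (con (+ 2) :* (c :* d)) :* (con (+ 2) :* (c :* d)) := con (+ 4) :* ((c :* c) :* (d :* d))) ≡.refl c c′ ⟩
    + 4 ℤ.* ((c ℤ.* c) ℤ.* (c′ ℤ.* c′))
      ≤⟨ ℤₚ.*-monoˡ-≤-nonNeg (+ 4) (*-mono-nonneg (square-nonneg c) (*-nonneg 0≤a′ 0≤b′) p p′) ⟩
    + 4 ℤ.* ((a ℤ.* b) ℤ.* (a′ ℤ.* b′))
      ≡⟨ ℤₚ.+-identityʳ _ ⟨
    + 4 ℤ.* ((a ℤ.* b) ℤ.* (a′ ℤ.* b′)) ℤ.+ ℤ.0ℤ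
      ≤⟨ ℤₚ.+-monoʳ-≤ (+ 4 ℤ.* ((a ℤ.* b) ℤ.* (a′ ℤ.* b′))) (square-nonneg (a ℤ.* b′ ℤ.- a′ ℤ.* b)) ⟩
    + 4 ℤ.* ((a ℤ.* b) ℤ.* (a′ ℤ.* b′)) ℤ.+ (a ℤ.* b′ ℤ.- a′ ℤ.* b) ℤ.* (a ℤ.* b′ ℤ.- a′ ℤ.* b)
      ≡⟨ solve 4 (λ a b x y → con (+ 4) :* ((a :* b) :* (x :* y)) :+ (a :* y :- x :* b) :* (a :* y :- x :* b)
            := (a :* y :+ x :* b) :* (a :* y :+ x :* b)) ≡.refl a b a′ b′ ⟩
    y ℤ.* y ∎
  cross : x ℤ.≤ y
  cross with x ℤ.≤? y
  ... | yes x≤y = x≤y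
  ... | no x≰y = contradiction x²≤y² (ℤₚ.<⇒≱ (begin-strict
    y ℤ.* y ≤⟨ ℤₚ.*-monoˡ-≤-nonNeg y {{ℤ.nonNegative 0≤y}} (ℤₚ.<⇒≤ y<x) ⟩
    y ℤ.* x <⟨ ℤₚ.*-monoʳ-<-pos x {{ℤ.positive (ℤₚ.≤-<-trans 0≤y y<x)}} y<x ⟩
    x ℤ.* x ∎))
    where
    y<x : y ℤ.< x
    y<x = ℤₚ.≰⇒> x≰y

cs-∑ᴸ : ∀ {I : Set} (xs : List I) {F G H : I → ℤ} → (∀ x → CauchySchwarz (F x) (G x) (H x)) →
        CauchySchwarz (CZ.∑ᴸ xs F) (CZ.∑ᴸ xs G) (CZ.∑ᴸ xs H)
cs-∑ᴸ []       p = cs ℤₚ.≤-refl ℤₚ.≤-refl ℤₚ.≤-refl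
cs-∑ᴸ (x ∷ xs) p = cs-+ (p x) (cs-∑ᴸ xs p)

cs-∑ⱽ : ∀ {I : Set} (xs : List I) n {F G H : Vec I n → ℤ} → (∀ φ → CauchySchwarz (F φ) (G φ) (H φ)) →
        CauchySchwarz (CZ.∑ⱽ xs n F) (CZ.∑ⱽ xs n G) (CZ.∑ⱽ xs n H)
cs-∑ⱽ xs zero    p = p []
cs-∑ⱽ xs (suc n) p = cs-∑ᴸ xs λ e → cs-∑ⱽ xs n λ φ → p (e ∷ φ)

indicator-nonneg : ∀ m r → ℤ.0ℤ ℤ.≤ indicator m r
indicator-nonneg zero    zero    = 0≤+ 1
indicator-nonneg zero    (suc r) = ℤₚ.≤-refl
indicator-nonneg (suc m) zero    = ℤₚ.≤-refl
indicator-nonneg (suc m) (suc r) = indicator-nonneg m r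

cs-product : ∀ {t} u v → ℤ.0ℤ ℤ.≤ t → CauchySchwarz (t ℤ.* (u ℤ.* u)) (t ℤ.* (v ℤ.* v)) (t ℤ.* (u ℤ.* v))
cs-product {t} u v 0≤t = cs (*-nonneg 0≤t (square-nonneg u)) (*-nonneg 0≤t (square-nonneg v))
  (ℤₚ.≤-reflexive (solve 3 (λ t u v → (t :* (u :* v)) :* (t :* (u :* v)) := (t :* (u :* u)) :* (t :* (v :* v))) ≡.refl t u v))

cs-cancel : ∀ k .{{_ : ℕ.NonZero k}} {a b c} → CauchySchwarz (+ k ℤ.* a) (+ k ℤ.* b) (+ k ℤ.* c) → CauchySchwarz a b c
cs-cancel k@(suc _) {a} {b} {c} (cs p q r) = cs (cancel p) (cancel q)
  (ℤₚ.*-cancelˡ-≤-pos (c ℤ.* c) (a ℤ.* b) (+ k) (ℤₚ.*-cancelˡ-≤-pos _ _ (+ k)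
    (≡.subst₂ ℤ._≤_ (regroup c c) (regroup a b) r)))
  where
  cancel : ∀ {x} → ℤ.0ℤ ℤ.≤ + k ℤ.* x → ℤ.0ℤ ℤ.≤ x
  cancel {x} p = ℤₚ.*-cancelˡ-≤-pos ℤ.0ℤ x (+ k) (≡.subst (ℤ._≤ + k ℤ.* x) (≡.sym (ℤₚ.*-zeroʳ (+ k))) p)
  regroup : ∀ x y → (+ k ℤ.* x) ℤ.* (+ k ℤ.* y) ≡ + k ℤ.* (+ k ℤ.* (x ℤ.* y))
  regroup = solve 3 (λ k x y → (k :* x) :* (k :* y) := k :* (k :* (x :* y))) ≡.refl (+ k)

module _ {n : ℕ} (ξ ζ : Rows {n}) (r l m : ℕ) where
  private
    u v : Vec (Fin n ⊎ Fin n) n → ℤ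
    u φ = DU.Det (rows ξ φ) l
    v φ = DU.Det (rows ζ φ) m

  -- Word by word, `mixed-coeff` gives the triple t u², t v², t u v with t ≥ 0; summation preserves
  -- the inequality and the common factor `n !` cancels.
  cs-mixed : CauchySchwarz (DB.Det (mixed ξ ξ) r l l) (DB.Det (mixed ζ ζ) r m m) (DB.Det (mixed ξ ζ) r m l)
  cs-mixed = cs-cancel (n !) {{n ℕₚ.!≢0}} (≡.subst₂ (λ x y → CauchySchwarz x y (+ (n !) ℤ.* DB.Det (mixed ξ ζ) r m l))
    (eq ξ ξ l l) (eq ζ ζ m m) (≡.subst (CauchySchwarz _ _) (eq ξ ζ m l)
      (cs-∑ⱽ both n λ φ → cs-product (u φ) (v φ) (indicator-nonneg (weights φ) r))))
    where
    eq : ∀ (ξ ζ : Rows {n}) j i → CZ.∑ⱽ both n (λ φ → indicator (weights φ) r ℤ.*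
           (DU.Det (rows ξ φ) i ℤ.* DU.Det (rows ζ φ) j)) ≡ + (n !) ℤ.* DB.Det (mixed ξ ζ) r j i
    eq ξ ζ j i = ≡.trans (≡.sym (mixed-coeff ξ ζ r j i)) (·ᶻ-* (n !) _)

-- Binomial coefficients as coefficients of determinants

κHom : Hom Z.rawRing ℤ⟦b,c,w⟧
κHom = bHom ∘ᴴ PZ.constHom

module κ = Hom κHom

scaled-coeff : ∀ a (g : B.Carrier) r → (κ.⟦ a ⟧ B.* (B.1# B.+ w) B.* g) (suc r) 0 0 ≡ a ℤ.* (g (suc r) 0 0 ℤ.+ g r 0 0)
scaled-coeff a g r = begin
  (κ.⟦ a ⟧ B.* (B.1# B.+ w) B.* g) (suc r) 0 0
    ≡⟨ B.*-assoc κ.⟦ a ⟧ (B.1# B.+ w) g (suc r) 0 0 ⟩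
  (κ.⟦ a ⟧ B.* ((B.1# B.+ w) B.* g)) (suc r) 0 0
    ≡⟨ κ-coeff a ((B.1# B.+ w) B.* g) (suc r) ⟩
  a ℤ.* ((B.1# B.+ w) B.* g) (suc r) 0 0
    ≡⟨ ≡.cong (a ℤ.*_) (≡.trans (B.distribʳ g B.1# w (suc r) 0 0)
         (≡.cong₂ ℤ._+_ (B.*-identityˡ g (suc r) 0 0) (PV.conv-X-suc g r 0 0))) ⟩
  a ℤ.* (g (suc r) 0 0 ℤ.+ g r 0 0) ∎
  where
  open ≡.≡-Reasoning
  κ-coeff : ∀ a g r → (κ.⟦ a ⟧ B.* g) r 0 0 ≡ a ℤ.* g r 0 0
  κ-coeff a g r = ≡.trans (PV.conv-const (PU.const (PZ.const a)) g r 0 0)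
    (≡.trans (PU.conv-const (PZ.const a) (g r) 0 0) (PZ.conv-const a (g r 0) 0))

scaled-coeff-zero : ∀ a (g : B.Carrier) → (κ.⟦ a ⟧ B.* (B.1# B.+ w) B.* g) 0 0 0 ≡ a ℤ.* g 0 0 0
scaled-coeff-zero a g = begin
  (κ.⟦ a ⟧ B.* (B.1# B.+ w) B.* g) 0 0 0
    ≡⟨ B.*-assoc κ.⟦ a ⟧ (B.1# B.+ w) g 0 0 0 ⟩
  (κ.⟦ a ⟧ B.* ((B.1# B.+ w) B.* g)) 0 0 0
    ≡⟨ ≡.trans (PV.conv-const (PU.const (PZ.const a)) ((B.1# B.+ w) B.* g) 0 0 0)
        (≡.trans (PU.conv-const (PZ.const a) (((B.1# B.+ w) B.* g) 0) 0 0) (PZ.conv-const a (((B.1# B.+ w) B.* g) 0 0) 0)) ⟩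
  a ℤ.* ((B.1# B.+ w) B.* g) 0 0 0
    ≡⟨ ≡.cong (a ℤ.*_) (≡.trans (B.distribʳ g B.1# w 0 0 0)
         (≡.trans (≡.cong₂ ℤ._+_ (B.*-identityˡ g 0 0 0) (PV.conv-X-zero g 0 0)) (ℤₚ.+-identityʳ _))) ⟩
  a ℤ.* g 0 0 0 ∎
  where open ≡.≡-Reasoning

binomial-coeff : ∀ a n r → DB.∏ {n} (λ _ → κ.⟦ a ⟧ B.* (B.1# B.+ w)) r 0 0 ≡ a ℤ.^ n ℤ.* + (n C r)
binomial-coeff a zero    zero    = ≡.refl
binomial-coeff a zero    (suc r) = ≡.refl
binomial-coeff a (suc n) zero    = begin
  _                                        ≡⟨ scaled-coeff-zero a g ⟩
  a ℤ.* g 0 0 0                            ≡⟨ ≡.cong (a ℤ.*_) (binomial-coeff a n 0) ⟩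
  a ℤ.* (a ℤ.^ n ℤ.* ℤ.1ℤ)                 ≡⟨ ℤₚ.*-assoc a (a ℤ.^ n) ℤ.1ℤ ⟨
  a ℤ.* a ℤ.^ n ℤ.* ℤ.1ℤ ∎
  where
  open ≡.≡-Reasoning
  g : B.Carrier
  g = DB.∏ {n} λ _ → κ.⟦ a ⟧ B.* (B.1# B.+ w)
binomial-coeff a (suc n) (suc r) = begin
  _                                        ≡⟨ scaled-coeff a g r ⟩
  a ℤ.* (g (suc r) 0 0 ℤ.+ g r 0 0)                          ≡⟨ ≡.cong₂ (λ x y → a ℤ.* (x ℤ.+ y)) (binomial-coeff a n (suc r)) (binomial-coeff a n r) ⟩
  a ℤ.* (p ℤ.* + (n C suc r) ℤ.+ p ℤ.* + (n C r))
    ≡⟨ solve 4 (λ a p x y → a :* (p :* x :+ p :* y) := (a :* p) :* (y :+ x)) ≡.refl a p (+ (n C suc r)) (+ (n C r)) ⟩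
  a ℤ.* p ℤ.* (+ (n C r) ℤ.+ + (n C suc r))
    ≡⟨ ≡.cong (a ℤ.* p ℤ.*_) (≡.trans (≡.sym (ℤₚ.pos-+ (n C r) (n C suc r))) (≡.cong +_ (Combinatorics.nCk+nC[k+1]≡[n+1]C[k+1] n r))) ⟩
  a ℤ.* p ℤ.* + (suc n C suc r) ∎
  where
  open ≡.≡-Reasoning
  p = a ℤ.^ n
  g : B.Carrier
  g = DB.∏ {n} λ _ → κ.⟦ a ⟧ B.* (B.1# B.+ w)

-- The identity (r + 1) C(n, r + 1) = (n - r) C(n, r), with r C(n, r) moved to the left to avoid
-- truncated subtraction.
C-recurrence : ∀ n r → suc r ℕ.* (n C suc r) ℕ.+ r ℕ.* (n C r) ≡ n ℕ.* (n C r)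
C-recurrence zero    zero    = ≡.refl
C-recurrence zero    (suc r) = ≡.cong₂ ℕ._+_ (ℕₚ.*-zeroʳ (suc (suc r))) (ℕₚ.*-zeroʳ (suc r))
C-recurrence (suc n) zero    = ≡.trans (ℕₚ.+-identityʳ _) (≡.trans (ℕₚ.+-identityʳ _)
  (≡.trans (Combinatorics.nC1≡n (suc n)) (≡.sym (ℕₚ.*-identityʳ (suc n)))))
C-recurrence (suc n) (suc r) = begin
  suc (suc r) ℕ.* (suc n C suc (suc r)) ℕ.+ suc r ℕ.* (suc n C suc r)
    ≡⟨ ≡.cong₂ (λ x y → suc (suc r) ℕ.* x ℕ.+ suc r ℕ.* y) (pascal (suc r)) (pascal r) ⟨
  suc (suc r) ℕ.* (q ℕ.+ s) ℕ.+ suc r ℕ.* (p ℕ.+ q)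
    ≡⟨ ℕ+*.solve 4 (λ r p q s → (conʳ 2 :+ʳ r) :*ʳ (q :+ʳ s) :+ʳ (conʳ 1 :+ʳ r) :*ʳ (p :+ʳ q)
         :=ʳ ((conʳ 2 :+ʳ r) :*ʳ s :+ʳ (conʳ 1 :+ʳ r) :*ʳ q) :+ʳ (q :+ʳ (((conʳ 1 :+ʳ r) :*ʳ q :+ʳ r :*ʳ p) :+ʳ p))) ≡.refl r p q s ⟩
  (suc (suc r) ℕ.* s ℕ.+ suc r ℕ.* q) ℕ.+ (q ℕ.+ ((suc r ℕ.* q ℕ.+ r ℕ.* p) ℕ.+ p))
    ≡⟨ ≡.cong₂ (λ x y → x ℕ.+ (q ℕ.+ (y ℕ.+ p))) (C-recurrence n (suc r)) (C-recurrence n r) ⟩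
  n ℕ.* q ℕ.+ (q ℕ.+ (n ℕ.* p ℕ.+ p))
    ≡⟨ ℕ+*.solve 3 (λ n p q → n :*ʳ q :+ʳ (q :+ʳ (n :*ʳ p :+ʳ p)) :=ʳ (conʳ 1 :+ʳ n) :*ʳ (p :+ʳ q)) ≡.refl n p q ⟩
  suc n ℕ.* (p ℕ.+ q)
    ≡⟨ ≡.cong (suc n ℕ.*_) (pascal r) ⟩
  suc n ℕ.* (suc n C suc r) ∎
  where
  open ≡.≡-Reasoning
  module ℕ+* = ℕSolver.+-*-Solver
  open ℕ+* using () renaming (con to conʳ; _:+_ to _:+ʳ_; _:*_ to _:*ʳ_; _:=_ to _:=ʳ_)
  pascal = λ r → Combinatorics.nCk+nC[k+1]≡[n+1]C[k+1] n r
  p = n C r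
  q = n C suc r
  s = n C suc (suc r)

C-positive : ∀ n r → r ℕ.≤ n → 0 ℕ.< n C r
C-positive n       zero    r≤n       = ℕ.s≤s ℕ.z≤n
C-positive (suc n) (suc r) (ℕ.s≤s p) = ≡.subst (0 ℕ.<_) (Combinatorics.nCk+nC[k+1]≡[n+1]C[k+1] n r)
  (ℕₚ.<-≤-trans (C-positive n r p) (ℕₚ.m≤m+n _ _))

Det-binomial : ∀ {n} a (Y : Fin n → Fin n → B.Carrier) → (∀ i j → Y i j B.≈ κ.⟦ a ⟧ B.* (B.1# B.+ w) B.* DB.kron i j) →
               ∀ r → DB.Det Y r 0 0 ≡ a ℤ.^ n ℤ.* + (n C r)
Det-binomial {n} a Y h r = ≡.trans
  (B.trans (DB.Det-cong h) (B.trans (DB.Det-scale (λ _ → s) DB.kron) (B.trans (B.*-congˡ {DB.∏ {n} λ _ → s} (DB.Det-kron n)) (B.*-identityʳ _))) r 0 0)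
  (binomial-coeff a n r)
  where
  s : B.Carrier
  s = κ.⟦ a ⟧ B.* (B.1# B.+ w)

module _ {n : ℕ} where
  module Bsolve = IntegerCoefficients ℤ⟦b,c,w⟧

  γ : ℕ → ℤ
  γ r = DB.Det (mixed (unitRows {n}) unitRows) r 0 0

  γ≡ : ∀ r → γ r ≡ + (n C r)
  γ≡ r = ≡.trans (Det-binomial ℤ.1ℤ (mixed unitRows unitRows) entry r)
    (≡.trans (≡.cong (ℤ._* + (n C r)) (ℤₚ.^-zeroˡ n)) (ℤₚ.*-identityˡ _))
    where
    entry : ∀ i j → mixed (unitRows {n}) unitRows i j B.≈ κ.⟦ ℤ.1ℤ ⟧ B.* (B.1# B.+ w) B.* DB.kron i j
    entry i j = begin
      mixed unitRows unitRows i j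
        ≈⟨ mixed-split unitRows unitRows i j ⟩
      DB.∑ (λ e → ⟦ DU.kron e i ⟧ᵇ B.* ⟦ DU.kron e j ⟧ᶜ) B.+ w B.* DB.∑ (λ e → ⟦ U.- DU.kron e i ⟧ᵇ B.* ⟦ U.- DU.kron e j ⟧ᶜ)
        ≈⟨ B.+-cong first (B.*-congˡ {w} (B.trans (DB.∑-cong signs) first)) ⟩
      DB.kron i j B.+ w B.* DB.kron i j
        ≈⟨ solveᴮ 2 (λ w k → k :+ᴮ w :*ᴮ k :=ᴮ conᴮ (+ 1) :*ᴮ (conᴮ (+ 1) :+ᴮ w) :*ᴮ k) B.refl w (DB.kron i j) ⟩
      B.1# B.* (B.1# B.+ w) B.* DB.kron i j
        ≈⟨ B.*-congʳ {DB.kron i j} (B.*-congʳ {B.1# B.+ w} κ.1-homo) ⟨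
      κ.⟦ ℤ.1ℤ ⟧ B.* (B.1# B.+ w) B.* DB.kron i j ∎
      where
      open SetoidReasoning B.setoid
      open Bsolve using () renaming (solve to solveᴮ; con to conᴮ; _:=_ to _:=ᴮ_; _:+_ to _:+ᴮ_; _:*_ to _:*ᴮ_; :-_ to :-ᴮ_)
      first : DB.∑ (λ e → ⟦ DU.kron e i ⟧ᵇ B.* ⟦ DU.kron e j ⟧ᶜ) B.≈ DB.kron i j
      first = B.trans (kronᵇ-∑ (λ e → ⟦ DU.kron e j ⟧ᶜ) i) (KC.kron-homo i j)
      signs : ∀ e → ⟦ U.- DU.kron e i ⟧ᵇ B.* ⟦ U.- DU.kron e j ⟧ᶜ B.≈ ⟦ DU.kron e i ⟧ᵇ B.* ⟦ DU.kron e j ⟧ᶜ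
      signs e = B.trans (B.*-cong (HB.-‿homo (DU.kron e i)) (HC.-‿homo (DU.kron e j)))
        (solveᴮ 2 (λ x y → :-ᴮ x :*ᴮ :-ᴮ y :=ᴮ x :*ᴮ y) B.refl ⟦ DU.kron e i ⟧ᵇ ⟦ DU.kron e j ⟧ᶜ)

  γ-recurrence : ∀ r s → n ≡ r ℕ.+ s → + suc r ℤ.* γ (suc r) ≡ + s ℤ.* γ r
  γ-recurrence r s n≡r+s = begin
    + suc r ℤ.* γ (suc r)              ≡⟨ ≡.cong (+ suc r ℤ.*_) (γ≡ (suc r)) ⟩
    + suc r ℤ.* + (n C suc r)          ≡⟨ ℤₚ.pos-* (suc r) (n C suc r) ⟨
    + (suc r ℕ.* (n C suc r))          ≡⟨ ≡.cong +_ natural ⟩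
    + (s ℕ.* (n C r))                  ≡⟨ ℤₚ.pos-* s (n C r) ⟩
    + s ℤ.* + (n C r)                  ≡⟨ ≡.cong (+ s ℤ.*_) (γ≡ r) ⟨
    + s ℤ.* γ r ∎
    where
    open ≡.≡-Reasoning
    natural : suc r ℕ.* (n C suc r) ≡ s ℕ.* (n C r)
    natural = ℕₚ.+-cancelʳ-≡ (r ℕ.* (n C r)) _ _ (≡.trans (C-recurrence n r)
      (≡.trans (≡.cong (ℕ._* (n C r)) (≡.trans n≡r+s (ℕₚ.+-comm r s))) (ℕₚ.*-distribʳ-+ (n C r) s r)))

-- Newton's inequalities with the sharp constant

module Newton {n : ℕ} (A : Fin n → Fin n → ℤ) (A-sym : ∀ i j → A i j ≡ A j i) where
  private
    P′ Q′ Δ″ : ℕ → ℕ → ℤ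
    P′ = diagonal A A-sym
    Q′ = offDiagonal A A-sym
    Δ″ r l = P′ r l ℤ.- Q′ r l
    κ′ : ℕ → ℕ → ℤ
    κ′ r l = shiftDet A A-sym r 0 l

  cauchySchwarz : ∀ r l → CauchySchwarz (P′ r l) (γ {n} r) (κ′ r l)
  cauchySchwarz r l = cs-mixed (pencilRows A) unitRows r l 0

  Δ-recurrence : ∀ r l → + suc (suc l) ℤ.* Δ″ r (suc l) ≡ P′ r (suc l) ℤ.+ + suc r ℤ.* Δ″ (suc r) l
  Δ-recurrence r l = begin
    + suc (suc l) ℤ.* (p ℤ.- q)
      ≡⟨ solve 3 (λ k p q → (con (+ 1) :+ k) :* (p :- q) := p :+ (k :* p :- (con (+ 1) :+ k) :* q)) ≡.refl (+ suc l) p q ⟩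
    p ℤ.+ (+ suc l ℤ.* p ℤ.- + suc (suc l) ℤ.* q)
      ≡⟨ ≡.cong (ℤ._+_ p) (≡.cong₂ ℤ._-_ (·ᶻ-* (suc l) p) (·ᶻ-* (suc (suc l)) q)) ⟨
    p ℤ.+ (suc l ·ᶻ p ℤ.- suc (suc l) ·ᶻ q)
      ≡⟨ ≡.cong (ℤ._+_ p) (pairDet-recurrence A A-sym r l) ⟩
    p ℤ.+ (suc r ·ᶻ p′ ℤ.- suc r ·ᶻ q′)
      ≡⟨ ≡.cong (ℤ._+_ p) (≡.cong₂ ℤ._-_ (·ᶻ-* (suc r) p′) (·ᶻ-* (suc r) q′)) ⟩
    p ℤ.+ (+ suc r ℤ.* p′ ℤ.- + suc r ℤ.* q′)
      ≡⟨ solve 4 (λ k p p′ q′ → p :+ (k :* p′ :- k :* q′) := p :+ k :* (p′ :- q′)) ≡.refl (+ suc r) p p′ q′ ⟩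
    p ℤ.+ + suc r ℤ.* (p′ ℤ.- q′) ∎
    where
    open ≡.≡-Reasoning
    p = P′ r (suc l)
    q = Q′ r (suc l)
    p′ = P′ (suc r) l
    q′ = Q′ (suc r) l

  κ-recurrence : ∀ r l → + suc l ℤ.* κ′ r (suc l) ≡ + suc r ℤ.* κ′ (suc r) l
  κ-recurrence r l = ≡.trans (≡.sym (·ᶻ-* (suc l) (κ′ r (suc l))))
    (≡.trans (shiftDet-recurrence A A-sym r l) (·ᶻ-* (suc r) (κ′ (suc r) l)))

  -- Here q = n - r - l, and the bound results from unrolling `Δ-recurrence` with every P replaced
  -- by its lower bound κ² / γ. While r + l stays fixed, κ and γ change by known factors, so each
  -- term is a multiple of κ(r,l)². In the induction step P contributes q + 1 and the hypothesis l +
  -- 1 to the factor l + q + 2.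
  Δ-bound : ∀ l r q → n ≡ r ℕ.+ (l ℕ.+ q) →
    + suc (l ℕ.+ q) ℤ.* (κ′ r l ℤ.* κ′ r l) ℤ.≤ γ {n} r ℤ.* (+ suc l ℤ.* + suc q) ℤ.* Δ″ r l
  Δ-bound zero r q n≡ = begin
    + suc q ℤ.* (k ℤ.* k)                        ≤⟨ ℤₚ.*-monoˡ-≤-nonNeg (+ suc q) (CauchySchwarz.c²≤ab (cauchySchwarz r 0)) ⟩
    + suc q ℤ.* (p ℤ.* g)
      ≡⟨ solve 3 (λ q p g → q :* (p :* g) := g :* (con (+ 1) :* q) :* (p :- con (+ 0))) ≡.refl (+ suc q) p g ⟩
    g ℤ.* (+ 1 ℤ.* + suc q) ℤ.* Δ″ r 0 ∎
    where
    open ℤₚ.≤-Reasoning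
    k = κ′ r 0
    p = P′ r 0
    g = γ {n} r
  Δ-bound (suc l) r q n≡ = begin
    + suc (suc l ℕ.+ q) ℤ.* K
      ≡⟨ ≡.cong (ℤ._* K) (≡.trans (≡.cong +_ (ℕₚ.+-comm (suc (suc l)) q)) (≡.trans (≡.cong +_ (ℕₚ.+-suc q (suc l))) (ℤₚ.pos-+ (suc q) (suc l)))) ⟩
    (+ suc q ℤ.+ + suc l) ℤ.* K
      ≡⟨ ℤₚ.*-distribʳ-+ K (+ suc q) (+ suc l) ⟩
    + suc q ℤ.* K ℤ.+ + suc l ℤ.* K
      ≤⟨ ℤₚ.+-mono-≤ (ℤₚ.*-monoˡ-≤-nonNeg (+ suc q) (CauchySchwarz.c²≤ab (cauchySchwarz r (suc l)))) second ⟩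
    + suc q ℤ.* (p ℤ.* g) ℤ.+ g ℤ.* + suc q ℤ.* (+ suc r ℤ.* d)
      ≡⟨ solve 5 (λ q p g r d → q :* (p :* g) :+ g :* q :* (r :* d) := g :* q :* (p :+ r :* d)) ≡.refl (+ suc q) p g (+ suc r) d ⟩
    g ℤ.* + suc q ℤ.* (p ℤ.+ + suc r ℤ.* d)
      ≡⟨ ≡.cong (g ℤ.* + suc q ℤ.*_) (Δ-recurrence r l) ⟨
    g ℤ.* + suc q ℤ.* (+ suc (suc l) ℤ.* Δ″ r (suc l))
      ≡⟨ solve 4 (λ g q l d → g :* q :* (l :* d) := g :* (l :* q) :* d) ≡.refl g (+ suc q) (+ suc (suc l)) (Δ″ r (suc l)) ⟩
    g ℤ.* (+ suc (suc l) ℤ.* + suc q) ℤ.* Δ″ r (suc l) ∎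
    where
    open ℤₚ.≤-Reasoning
    k k′ g g′ p d K s : ℤ
    k = κ′ r (suc l)
    k′ = κ′ (suc r) l
    g = γ {n} r
    g′ = γ {n} (suc r)
    p = P′ r (suc l)
    d = Δ″ (suc r) l
    K = k ℤ.* k
    s = + suc (l ℕ.+ q)
    -- Multiply the induction hypothesis by (r + 1)² and use the
    -- recurrences of γ and κ; then cancel s (l + 1).
    scaled : s ℤ.* (+ suc l ℤ.* (+ suc l ℤ.* K)) ℤ.≤ s ℤ.* (+ suc l ℤ.* (g ℤ.* + suc q ℤ.* (+ suc r ℤ.* d)))
    scaled = begin
      s ℤ.* (+ suc l ℤ.* (+ suc l ℤ.* (k ℤ.* k)))
        ≡⟨ solve 3 (λ s l k → s :* (l :* (l :* (k :* k))) := s :* ((l :* k) :* (l :* k))) ≡.refl s (+ suc l) k ⟩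
      s ℤ.* ((+ suc l ℤ.* k) ℤ.* (+ suc l ℤ.* k))
        ≡⟨ ≡.cong (λ x → s ℤ.* (x ℤ.* x)) (κ-recurrence r l) ⟩
      s ℤ.* ((+ suc r ℤ.* k′) ℤ.* (+ suc r ℤ.* k′))
        ≡⟨ solve 3 (λ s r k → s :* ((r :* k) :* (r :* k)) := r :* r :* (s :* (k :* k))) ≡.refl s (+ suc r) k′ ⟩
      + suc r ℤ.* + suc r ℤ.* (s ℤ.* (k′ ℤ.* k′))
        ≤⟨ ℤₚ.*-monoˡ-≤-nonNeg (+ suc r ℤ.* + suc r) (Δ-bound l (suc r) q (≡.trans n≡ (ℕₚ.+-suc r (l ℕ.+ q)))) ⟩
      + suc r ℤ.* + suc r ℤ.* (g′ ℤ.* (+ suc l ℤ.* + suc q) ℤ.* d)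
        ≡⟨ solve 5 (λ r g l q d → r :* r :* (g :* (l :* q) :* d) := (r :* g) :* (l :* (q :* (r :* d)))) ≡.refl (+ suc r) g′ (+ suc l) (+ suc q) d ⟩
      + suc r ℤ.* g′ ℤ.* (+ suc l ℤ.* (+ suc q ℤ.* (+ suc r ℤ.* d)))
        ≡⟨ ≡.cong (ℤ._* (+ suc l ℤ.* (+ suc q ℤ.* (+ suc r ℤ.* d)))) (γ-recurrence {n} r (suc (l ℕ.+ q)) n≡) ⟩
      s ℤ.* g ℤ.* (+ suc l ℤ.* (+ suc q ℤ.* (+ suc r ℤ.* d)))
        ≡⟨ solve 5 (λ s g l q x → s :* g :* (l :* (q :* x)) := s :* (l :* (g :* q :* x))) ≡.refl s g (+ suc l) (+ suc q) (+ suc r ℤ.* d) ⟩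
      s ℤ.* (+ suc l ℤ.* (g ℤ.* + suc q ℤ.* (+ suc r ℤ.* d))) ∎
    second : + suc l ℤ.* K ℤ.≤ g ℤ.* + suc q ℤ.* (+ suc r ℤ.* d)
    second = ℤₚ.*-cancelˡ-≤-pos _ _ (+ suc l) (ℤₚ.*-cancelˡ-≤-pos _ _ s scaled)

  -- The case r = 0 of `Δ-bound`, where γ is 1 and κ is the coefficient itself. With l = k + 1 the
  -- constant on the right arises as (l + 1) (q + 1) - (l + q + 1) = l q.
  newton : ∀ k q → n ≡ suc k ℕ.+ q →
    + suc (suc k) ℤ.* + suc q ℤ.* (χ A k ℤ.* χ A (suc (suc k))) ℤ.≤ + suc k ℤ.* + q ℤ.* (χ A (suc k) ℤ.* χ A (suc k))
  newton k q n≡ = ℤₚ.0≤i-j⇒j≤i (≡.subst (ℤ.0ℤ ℤ.≤_) rearrange (ℤₚ.i≤j⇒0≤j-i (Δ-bound (suc k) 0 q n≡)))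
    where
    open ≡.≡-Reasoning
    x y t : ℤ
    x = χ A (suc k)
    y = χ A k
    t = χ A (suc (suc k))
    rearrange : γ {n} 0 ℤ.* (+ suc (suc k) ℤ.* + suc q) ℤ.* Δ″ 0 (suc k) ℤ.- + suc (suc k ℕ.+ q) ℤ.* (κ′ 0 (suc k) ℤ.* κ′ 0 (suc k))
              ≡ + suc k ℤ.* + q ℤ.* (x ℤ.* x) ℤ.- + suc (suc k) ℤ.* + suc q ℤ.* (y ℤ.* t)
    rearrange = begin
      γ {n} 0 ℤ.* (+ suc (suc k) ℤ.* + suc q) ℤ.* Δ″ 0 (suc k) ℤ.- + suc (suc k ℕ.+ q) ℤ.* (κ′ 0 (suc k) ℤ.* κ′ 0 (suc k))
        ≡⟨ ≡.cong₂ ℤ._-_ (≡.cong₂ (λ u v → u ℤ.* (+ suc (suc k) ℤ.* + suc q) ℤ.* v) (γ≡ 0)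
             (≡.cong₂ ℤ._-_ (pairDet-const A A-sym (suc k) (suc k)) (pairDet-const A A-sym (suc (suc k)) k)))
             (≡.cong₂ (λ u v → u ℤ.* (v ℤ.* v)) (≡.trans (≡.cong (λ m → + suc (suc m)) ≡.refl) (ℤₚ.pos-+ (suc (suc k)) q)) (shiftDet-const A A-sym (suc k))) ⟩
      + 1 ℤ.* (+ suc (suc k) ℤ.* + suc q) ℤ.* (x ℤ.* x ℤ.- y ℤ.* t) ℤ.- (+ suc (suc k) ℤ.+ + q) ℤ.* (x ℤ.* x)
        ≡⟨ solve 5 (λ k q x y t → con (+ 1) :* ((con (+ 1) :+ k) :* (con (+ 1) :+ q)) :* (x :* x :- y :* t) :- ((con (+ 1) :+ k) :+ q) :* (x :* x)
             := k :* q :* (x :* x) :- (con (+ 1) :+ k) :* (con (+ 1) :+ q) :* (y :* t)) ≡.refl (+ suc k) (+ q) x y t ⟩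
      + suc k ℤ.* + q ℤ.* (x ℤ.* x) ℤ.- + suc (suc k) ℤ.* + suc q ℤ.* (y ℤ.* t) ∎



-- Strict log-concavity for an invertible matrix

square-pos : ∀ {x} → x ≢ ℤ.0ℤ → ℤ.0ℤ ℤ.< x ℤ.* x
square-pos {x} x≢0 = ℤₚ.≤∧≢⇒< (square-nonneg x) λ 0≡x² → [ x≢0 , x≢0 ]′ (ℤₚ.i*j≡0⇒i≡0∨j≡0 x (≡.sym 0≡x²))

0<i-j⇒j<i : ∀ i j → ℤ.0ℤ ℤ.< i ℤ.- j → j ℤ.< i
0<i-j⇒j<i i j 0<i-j = ≡.subst₂ ℤ._<_ (ℤₚ.+-identityˡ j)
  (solve 2 (λ i j → (i :- j) :+ j := i) ≡.refl i j) (ℤₚ.+-monoˡ-< j 0<i-j)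

^-≢0 : ∀ {x} n → x ≢ ℤ.0ℤ → x ℤ.^ n ≢ ℤ.0ℤ
^-≢0     zero    x≢0 ()
^-≢0 {x} (suc n) x≢0 eq = [ x≢0 , ^-≢0 n x≢0 ]′ (ℤₚ.i*j≡0⇒i≡0∨j≡0 x eq)

cs-positive : ∀ {a b c} → CauchySchwarz a b c → c ≢ ℤ.0ℤ → ℤ.0ℤ ℤ.< a
cs-positive {a} {b} {c} (cs 0≤a 0≤b c²≤ab) c≢0 = ℤₚ.≤∧≢⇒< 0≤a λ 0≡a → ℤₚ.<⇒≱ (square-pos c≢0)
  (ℤₚ.≤-trans c²≤ab (ℤₚ.≤-reflexive (≡.trans (≡.cong (ℤ._* b) (≡.sym 0≡a)) (ℤₚ.*-zeroˡ b))))

module StrictNewton {n : ℕ} (A : Fin n → Fin n → ℤ) (A-sym : ∀ i j → A i j ≡ A j i)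
    (M : Fin n → Fin n → ℤ) (a : ℤ) (a≢0 : a ≢ ℤ.0ℤ)
    (A*M : ∀ i j → DZ.∑ (λ e → A i e ℤ.* M e j) ≡ a ℤ.* DZ.kron i j) where

  -- Chosen so that their mixed product is A M + a w I = a (1 + w) I, whose determinant has nonzero
  -- coefficients at w^0, ..., w^n.
  constRows inverseRows : Rows {n}
  constRows (inj₁ e) j = PZ.const (A e j)
  constRows (inj₂ e) j = DU.kron e j
  inverseRows (inj₁ e) j = PZ.const (M e j)
  inverseRows (inj₂ e) j = PZ.const a U.* DU.kron e j

  constRows-entry : ∀ i j → mixed constRows inverseRows i j B.≈ κ.⟦ a ⟧ B.* (B.1# B.+ w) B.* DB.kron i j
  constRows-entry i j = begin
    mixed constRows inverseRows i j
      ≈⟨ mixed-split constRows inverseRows i j ⟩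
    DB.∑ (λ e → κ.⟦ A e i ⟧ B.* ⟦ PZ.const (M e j) ⟧ᶜ) B.+ w B.* DB.∑ (λ e → ⟦ DU.kron e i ⟧ᵇ B.* ⟦ PZ.const a U.* DU.kron e j ⟧ᶜ)
      ≈⟨ B.+-cong (B.trans (DB.∑-cong first) product) (B.*-congˡ {w} (B.trans (kronᵇ-∑ (λ e → ⟦ PZ.const a U.* DU.kron e j ⟧ᶜ) i)
           (B.trans (HC.*-homo (PZ.const a) (DU.kron i j)) (B.*-cong (B.sym (constᵇ≈constᶜ A A-sym a)) (KC.kron-homo i j))))) ⟩
    κ.⟦ a ⟧ B.* DB.kron i j B.+ w B.* (κ.⟦ a ⟧ B.* DB.kron i j)
      ≈⟨ solveᴮ 3 (λ a w k → a :*ᴮ k :+ᴮ w :*ᴮ (a :*ᴮ k) :=ᴮ a :*ᴮ (conᴮ (+ 1) :+ᴮ w) :*ᴮ k) B.refl κ.⟦ a ⟧ w (DB.kron i j) ⟩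
    κ.⟦ a ⟧ B.* (B.1# B.+ w) B.* DB.kron i j ∎
    where
    open SetoidReasoning B.setoid
    open IntegerCoefficients ℤ⟦b,c,w⟧ using () renaming (solve to solveᴮ; con to conᴮ; _:=_ to _:=ᴮ_; _:+_ to _:+ᴮ_; _:*_ to _:*ᴮ_)
    first : ∀ e → κ.⟦ A e i ⟧ B.* ⟦ PZ.const (M e j) ⟧ᶜ B.≈ κ.⟦ A i e ℤ.* M e j ⟧
    first e = B.trans (B.*-cong (κ.⟦⟧-cong (A-sym e i)) (B.sym (constᵇ≈constᶜ A A-sym (M e j)))) (B.sym (κ.*-homo (A i e) (M e j)))
    product : DB.∑ (λ e → κ.⟦ A i e ℤ.* M e j ⟧) B.≈ κ.⟦ a ⟧ B.* DB.kron i j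
    product = begin
      DB.∑ (λ e → κ.⟦ A i e ℤ.* M e j ⟧)           ≈⟨ HomDet.sum-homo κHom (λ e → A i e ℤ.* M e j) ⟨
      κ.⟦ _ ⟧                                       ≈⟨ κ.⟦⟧-cong (≡.trans (≡.sym (DZ.∑≡sum λ e → A i e ℤ.* M e j)) (A*M i j)) ⟩
      κ.⟦ a ℤ.* DZ.kron i j ⟧                       ≈⟨ κ.*-homo a (DZ.kron i j) ⟩
      κ.⟦ a ⟧ B.* κ.⟦ DZ.kron i j ⟧                 ≈⟨ B.*-congˡ {κ.⟦ a ⟧} (KronHom.kron-homo {ℤᴿ} {ℤ⟦b,c,w⟧} κHom i j) ⟩
      κ.⟦ a ⟧ B.* DB.kron i j ∎

  constantTerm-rows : ∀ φ → DU.Det (rows constRows φ) 0 ≡ DU.Det (rows (pencilRows A) φ) 0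
  constantTerm-rows φ = ≡.trans (HomDet′.Det-homo PZ.constantTerm (rows constRows φ))
    (≡.trans (DZ.Det-cong λ i j → entry (lookup φ i) j) (≡.sym (HomDet′.Det-homo PZ.constantTerm (rows (pencilRows A) φ))))
    where
    entry : ∀ x j → constRows x j 0 ≡ pencilRows A x j 0
    entry (inj₁ e) j = ≡.sym (≡.trans (≡.cong (λ t → A e j ℤ.- t) (≡.trans (U.*-comm (DU.kron e j) PZ.X 0) (PZ.conv-X-zero (DU.kron e j)))) (ℤₚ.+-identityʳ _))
    entry (inj₂ e) j = ≡.refl

  -- Only the coefficient of b^0 is taken, and every minor of the pencil has there the value
  -- obtained from `A` itself. So `pencilRows A` can be exchanged for `constRows` inside the
  -- Cauchy-Binet sum.
  mixed-pencil-inverse : ∀ r → DB.Det (mixed (pencilRows A) inverseRows) r 0 0 ≡ a ℤ.^ n ℤ.* + (n C r)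
  mixed-pencil-inverse r = ≡.trans
    (ℤₚ.*-cancelˡ-≡ (+ (n !)) _ _ {{ℤ.≢-nonZero λ eq → ℕ.≢-nonZero⁻¹ (n !) {{n ℕₚ.!≢0}} (ℤₚ.+-injective eq)}} (begin
      + (n !) ℤ.* DB.Det (mixed (pencilRows A) inverseRows) r 0 0    ≡⟨ ·ᶻ-* (n !) _ ⟨
      (n !) ·ᶻ DB.Det (mixed (pencilRows A) inverseRows) r 0 0       ≡⟨ mixed-coeff (pencilRows A) inverseRows r 0 0 ⟩
      _                                                              ≡⟨ CZ.∑ⱽ-cong both n (λ φ → ≡.cong (λ u → indicator (weights φ) r ℤ.* (u ℤ.* DU.Det (rows inverseRows φ) 0)) (constantTerm-rows φ)) ⟨
      _                                                              ≡⟨ mixed-coeff constRows inverseRows r 0 0 ⟨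
      (n !) ·ᶻ DB.Det (mixed constRows inverseRows) r 0 0            ≡⟨ ·ᶻ-* (n !) _ ⟩
      + (n !) ℤ.* DB.Det (mixed constRows inverseRows) r 0 0 ∎))
    (Det-binomial a (mixed constRows inverseRows) constRows-entry r)
    where open ≡.≡-Reasoning

  diagonal-positive : ∀ r → r ℕ.≤ n → ℤ.0ℤ ℤ.< diagonal A A-sym r 0
  diagonal-positive r r≤n = cs-positive (cs-mixed (pencilRows A) inverseRows r 0 0) z≢0
    where
    z≢0 : DB.Det (mixed (pencilRows A) inverseRows) r 0 0 ≢ ℤ.0ℤ
    z≢0 eq = [ ^-≢0 n a≢0 , (λ C≡0 → ℕₚ.<⇒≢ (C-positive n r r≤n) (≡.sym (ℤₚ.+-injective C≡0))) ]′
      (ℤₚ.i*j≡0⇒i≡0∨j≡0 (a ℤ.^ n) (≡.trans (≡.sym (mixed-pencil-inverse r)) eq))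

  -- Strictness comes from the last term P(r + l, 0) of the unrolled recurrence; the other terms P
  -- are nonnegative.
  Δ-positive : ∀ l r → r ℕ.+ l ℕ.≤ n → ℤ.0ℤ ℤ.< diagonal A A-sym r l ℤ.- offDiagonal A A-sym r l
  Δ-positive zero r r+l≤n = ≡.subst (ℤ.0ℤ ℤ.<_) (≡.sym (ℤₚ.+-identityʳ _))
    (diagonal-positive r (≡.subst (ℕ._≤ n) (ℕₚ.+-identityʳ r) r+l≤n))
  Δ-positive (suc l) r r+l≤n = ℤₚ.*-cancelˡ-<-nonNeg (+ suc (suc l)) (≡.subst₂ ℤ._<_
    (≡.sym (ℤₚ.*-zeroʳ (+ suc (suc l)))) (≡.sym (Newton.Δ-recurrence A A-sym r l))
    (ℤₚ.+-mono-≤-< {ℤ.0ℤ} {diagonal A A-sym r (suc l)} {ℤ.0ℤ} {+ suc r ℤ.* d}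
      (CauchySchwarz.0≤a (Newton.cauchySchwarz A A-sym r (suc l)))
      (*-pos {+ suc r} {d} (ℤ.+<+ (ℕ.s≤s ℕ.z≤n)) (Δ-positive l (suc r) (≡.subst (ℕ._≤ n) (ℕₚ.+-suc r l) r+l≤n)))))
    where
    d : ℤ
    d = diagonal A A-sym (suc r) l ℤ.- offDiagonal A A-sym (suc r) l

  newton-strict : ∀ k → suc k ℕ.≤ n → χ A k ℤ.* χ A (suc (suc k)) ℤ.< χ A (suc k) ℤ.* χ A (suc k)
  newton-strict k k<n = 0<i-j⇒j<i _ _ (≡.subst (ℤ.0ℤ ℤ.<_)
    (≡.cong₂ ℤ._-_ (pairDet-const A A-sym (suc k) (suc k)) (pairDet-const A A-sym (suc (suc k)) k)) (Δ-positive (suc k) 0 k<n))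

  χ₀≢0 : χ A 0 ≢ ℤ.0ℤ
  χ₀≢0 eq = ℤₚ.<⇒≢ (Δ-positive 0 0 ℕ.z≤n) (≡.sym (≡.trans (ℤₚ.+-identityʳ _)
    (≡.trans (pairDet-const A A-sym 0 0) (≡.trans (≡.cong (ℤ._* χ A 0) eq) (ℤₚ.*-zeroˡ (χ A 0))))))


-- Signs of the coefficients

∑ᴸ-nonneg : ∀ {I : Set} (xs : List I) {F : I → ℤ} → (∀ x → ℤ.0ℤ ℤ.≤ F x) → ℤ.0ℤ ℤ.≤ CZ.∑ᴸ xs F
∑ᴸ-nonneg []       p = ℤₚ.≤-refl
∑ᴸ-nonneg (x ∷ xs) p = ℤₚ.+-mono-≤ (p x) (∑ᴸ-nonneg xs p)

∑ⱽ-nonneg : ∀ {I : Set} (xs : List I) n {F : Vec I n → ℤ} → (∀ φ → ℤ.0ℤ ℤ.≤ F φ) → ℤ.0ℤ ℤ.≤ CZ.∑ⱽ xs n F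
∑ⱽ-nonneg xs zero    p = p []
∑ⱽ-nonneg xs (suc n) p = ∑ᴸ-nonneg xs λ e → ∑ⱽ-nonneg xs n λ φ → p (e ∷ φ)

∑-nonneg : ∀ {n} {f : Fin n → ℤ} → (∀ i → ℤ.0ℤ ℤ.≤ f i) → ℤ.0ℤ ℤ.≤ DZ.∑ f
∑-nonneg {zero}  p = ℤₚ.≤-reflexive (≡.sym DZ.∑-nil)
∑-nonneg {suc n} p = ℤₚ.≤-trans (ℤₚ.+-mono-≤ (p zero) (∑-nonneg (p ∘ suc))) (ℤₚ.≤-reflexive (≡.sym DZ.∑-cons))

findNothing : ∀ {E : Set} {n} (φ : Vec (Maybe E) n) →
              (∃ λ ψ → φ ≡ Vec.map just ψ) ⊎
              (∃ λ n′ → ∃₂ λ (i : Fin (suc n′)) ψ → ∃ λ (e : n ≡ suc n′) → ≡.subst (Vec (Maybe E)) e φ ≡ Vec.insertAt ψ i nothing)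
findNothing [] = inj₁ ([] , ≡.refl)
findNothing (nothing ∷ φ) = inj₂ (_ , zero , φ , ≡.refl , ≡.refl)
findNothing (just a ∷ φ) with findNothing φ
... | inj₁ (ψ , eq) = inj₁ (a ∷ ψ , ≡.cong (just a ∷_) eq)
... | inj₂ (n′ , i , ψ , ≡.refl , eq) = inj₂ (suc n′ , suc i , just a ∷ ψ , ≡.refl , ≡.cong (just a ∷_) eq)

module BorderedGram {s : ℕ} {E : Set} (xs : List E) (d : Fin s → ℤ) (G : E → Fin s → ℤ) where
  -- The columns of M, indexed by Maybe E, are d and the vectors of G.
  Mᵀ : Maybe E → Fin s → ℤ
  Mᵀ nothing  j = d j
  Mᵀ (just e) j = G e j

  top : Fin (suc s) → ℤ
  top = ℤ.0ℤ ⨾ d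

  v : Maybe E → Fin (suc s) → ℤ
  v nothing  j       = ℤ.-1ℤ
  v (just e) zero    = ℤ.0ℤ
  v (just e) (suc j) = G e j

  indices : List (Maybe E)
  indices = nothing ∷ List.map just xs

  -- In blocks: first row (0, d), below it the column -d and the matrix GᵀG - d 1ᵀ. A matrix of half
  -- squared distances takes this form when each later row is subtracted from the first one and that
  -- difference put in its place; d then lists the entries for the base point, and `G` the
  -- coordinates relative to it.
  W : Fin (suc s) → Fin (suc s) → ℤ
  W = top ⨾ λ i j → CZ.∑ᴸ indices λ x → Mᵀ x i ℤ.* v x j

  ν : Vec (Maybe E) s → ℤ
  ν φ = DZ.Det (top ⨾ CZ.rows v φ)

  expandW : DZ.Det W ≡ CZ.∑ⱽ indices s λ φ → CZ.term (λ i x → Mᵀ x i) φ ℤ.* ν φ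
  expandW = begin
    DZ.Det W
      ≡⟨ DZ.laplace-cons top (λ i j → CZ.∑ᴸ indices λ x → Mᵀ x i ℤ.* v x j) ⟩
    DZ.∑ (λ j → DZ.sgn j ℤ.* (top j ℤ.* DZ.Det (λ r c → CZ.∑ᴸ indices λ x → Mᵀ x r ℤ.* v x (punchIn j c))))
      ≡⟨ DZ.∑-cong (λ j → ≡.trans (≡.cong (λ x → DZ.sgn j ℤ.* (top j ℤ.* x)) (CZ.Det-product indices (λ i x → Mᵀ x i) (λ x c → v x (punchIn j c)))) (push j)) ⟩
    DZ.∑ (λ j → CZ.∑ⱽ indices s λ φ → t φ ℤ.* (DZ.sgn j ℤ.* (top j ℤ.* δ j φ)))
      ≡⟨ CZ.∑ⱽ-∑ indices s ⟨
    (CZ.∑ⱽ indices s λ φ → DZ.∑ (λ j → t φ ℤ.* (DZ.sgn j ℤ.* (top j ℤ.* δ j φ))))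
      ≡⟨ CZ.∑ⱽ-cong indices s (λ φ → ≡.trans (DZ.∑-*ˡ {x = t φ} {f = λ j → DZ.sgn j ℤ.* (top j ℤ.* δ j φ)}) (≡.cong (t φ ℤ.*_) (≡.sym (DZ.laplace-cons top (CZ.rows v φ))))) ⟩
    (CZ.∑ⱽ indices s λ φ → t φ ℤ.* ν φ) ∎
    where
    open ≡.≡-Reasoning
    t : Vec (Maybe E) s → ℤ
    t = CZ.term (λ i x → Mᵀ x i)
    δ : Fin (suc s) → Vec (Maybe E) s → ℤ
    δ j φ = DZ.Det (CZ.rows (λ x c → v x (punchIn j c)) φ)
    push : ∀ j → DZ.sgn j ℤ.* (top j ℤ.* CZ.∑ⱽ indices s (λ φ → t φ ℤ.* δ j φ)) ≡ CZ.∑ⱽ indices s λ φ → t φ ℤ.* (DZ.sgn j ℤ.* (top j ℤ.* δ j φ))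
    push j = ≡.trans (≡.sym (ℤₚ.*-assoc (DZ.sgn j) (top j) _)) (≡.trans (≡.sym (CZ.∑ⱽ-*ˡ indices s {DZ.sgn j ℤ.* top j} {λ φ → t φ ℤ.* δ j φ}))
      (CZ.∑ⱽ-cong indices s λ φ → solve 4 (λ s x t d → (s :* x) :* (t :* d) := t :* (s :* (x :* d))) ≡.refl (DZ.sgn j) (top j) (t φ) (δ j φ)))

ν-alternating : ∀ {s} {I : Set} (top : Fin (suc s) → ℤ) (v : I → Fin (suc s) → ℤ) →
                CZ.Alternating {n = s} (λ φ → DZ.Det (top ⨾ CZ.rows v φ))
ν-alternating {zero}  top v = tt
ν-alternating {suc s} top v j e φ = begin
  DZ.Det (top ⨾ CZ.rows v (Vec.insertAt φ j e))
    ≡⟨ DZ.Det-cong (λ { zero c → ≡.refl ; (suc r) c → CZ.rows-insertAt v φ j e r c }) ⟩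
  DZ.Det (insertAt (top ⨾ CZ.rows v φ) (suc j) (v e))
    ≡⟨ DZ.Det-insertAt (top ⨾ CZ.rows v φ) (suc j) (v e) ⟩
  DZ.sgn (suc j) ℤ.* DZ.Det (v e ⨾ (top ⨾ CZ.rows v φ))
    ≡⟨ ≡.cong (DZ.sgn (suc j) ℤ.*_) (DZ.Det-swap (v e) top (CZ.rows v φ)) ⟩
  DZ.sgn (suc j) ℤ.* ℤ.- DZ.Det (top ⨾ (v e ⨾ CZ.rows v φ))
    ≡⟨ solve 2 (λ s x → (con (ℤ.-1ℤ) :* s) :* :- x := s :* x) ≡.refl (DZ.sgn j) _ ⟩
  DZ.sgn j ℤ.* DZ.Det (top ⨾ (v e ⨾ CZ.rows v φ))
    ≡⟨ ≡.cong (DZ.sgn j ℤ.*_) (DZ.Det-cong λ { zero c → ≡.refl ; (suc zero) c → ≡.refl ; (suc (suc r)) c → ≡.refl }) ⟩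
  DZ.sgn j ℤ.* DZ.Det (top ⨾ CZ.rows v (e ∷ φ)) ∎
  where open ≡.≡-Reasoning

module _ {s : ℕ} {E : Set} (xs : List E) (d : Fin s → ℤ) (G : E → Fin s → ℤ) where
  open BorderedGram xs d G

  -- The summands of the symmetrised Cauchy–Binet expansion of W are squares or 0.
  summand-nonneg : ∀ φ → ℤ.0ℤ ℤ.≤ DZ.Det (CZ.rows Mᵀ φ) ℤ.* ν φ
  summand-nonneg φ with findNothing φ
  -- Without the letter `nothing` the matrix of `ν` has first column 0.
  ... | inj₁ (ψ , ≡.refl) = ℤₚ.≤-reflexive (≡.sym (≡.trans (≡.cong (DZ.Det (CZ.rows Mᵀ φ) ℤ.*_)
    (DZ.Det-zeroColumn (top ⨾ CZ.rows v φ) λ { zero → ≡.refl ; (suc r) → ≡.cong (λ x → v x zero) (Vecₚ.lookup-map r just ψ) }))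
    (ℤₚ.*-zeroʳ (DZ.Det (CZ.rows Mᵀ φ)))))
  ... | inj₂ (s′ , i , ψ , ≡.refl , ≡.refl) = ≡.subst (ℤ.0ℤ ℤ.≤_) (≡.sym pull) (front ψ)
    where
    φ₀ : Vec (Maybe E) s
    φ₀ = nothing ∷ ψ
    pull : DZ.Det (CZ.rows Mᵀ (Vec.insertAt ψ i nothing)) ℤ.* ν (Vec.insertAt ψ i nothing) ≡ DZ.Det (CZ.rows Mᵀ φ₀) ℤ.* ν φ₀
    pull = begin
      DZ.Det (CZ.rows Mᵀ (Vec.insertAt ψ i nothing)) ℤ.* ν (Vec.insertAt ψ i nothing)
        ≡⟨ ≡.cong₂ ℤ._*_ (CZ.Alternating-Det s Mᵀ i nothing ψ) (ν-alternating top v i nothing ψ) ⟩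
      (DZ.sgn i ℤ.* DZ.Det (CZ.rows Mᵀ φ₀)) ℤ.* (DZ.sgn i ℤ.* ν φ₀)
        ≡⟨ solve 3 (λ s x y → (s :* x) :* (s :* y) := (s :* s) :* (x :* y)) ≡.refl (DZ.sgn i) (DZ.Det (CZ.rows Mᵀ φ₀)) (ν φ₀) ⟩
      (DZ.sgn i ℤ.* DZ.sgn i) ℤ.* (DZ.Det (CZ.rows Mᵀ φ₀) ℤ.* ν φ₀)
        ≡⟨ ≡.trans (≡.cong (ℤ._* (DZ.Det (CZ.rows Mᵀ φ₀) ℤ.* ν φ₀)) (DZ.sgn² i)) (ℤₚ.*-identityˡ _) ⟩
      DZ.Det (CZ.rows Mᵀ φ₀) ℤ.* ν φ₀ ∎
      where open ≡.≡-Reasoning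
    front : ∀ ψ → ℤ.0ℤ ℤ.≤ DZ.Det (CZ.rows Mᵀ (nothing ∷ ψ)) ℤ.* ν (nothing ∷ ψ)
    front ψ with findNothing ψ
    -- Two letters `nothing` repeat the row `d` in the other factor.
    ... | inj₂ (_ , j , χ , ≡.refl , ≡.refl) = ℤₚ.≤-reflexive (≡.sym (≡.trans (≡.cong (ℤ._* ν (nothing ∷ Vec.insertAt χ j nothing))
      (DZ.Det-repeat (CZ.rows Mᵀ (nothing ∷ Vec.insertAt χ j nothing)) {zero} {suc j} (λ ())
        λ c → ≡.cong (λ x → Mᵀ x c) (≡.sym (Vecₚ.insertAt-lookup χ j nothing)))) (ℤₚ.*-zeroˡ (ν (nothing ∷ Vec.insertAt χ j nothing)))))
    ... | inj₁ (χ , ≡.refl) = ≡.subst (λ x → ℤ.0ℤ ℤ.≤ DZ.Det (CZ.rows Mᵀ (nothing ∷ ψ)) ℤ.* x) (≡.sym ν≡μ) (square-nonneg (DZ.Det (CZ.rows Mᵀ (nothing ∷ ψ))))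
      where
      open ≡.≡-Reasoning
      T : Fin s → Fin (suc s) → ℤ
      T = top ⨾ CZ.rows v ψ
      column₀ : ∀ r → T r zero ≡ ℤ.0ℤ
      column₀ zero    = ≡.refl
      column₀ (suc r) = ≡.cong (λ x → v x zero) (Vecₚ.lookup-map r just χ)
      entry : ∀ r c → T r (suc c) ≡ CZ.rows Mᵀ (nothing ∷ ψ) r c
      entry zero    c = ≡.refl
      entry (suc r) c rewrite Vecₚ.lookup-map r just χ = ≡.refl
      -- With exactly one `nothing`, in front, the first column is zero except for the -1 in the row
      -- of `nothing`. The sign of exchanging this row with `top` cancels the sign of the entry, so
      -- both factors agree and the summand is a square.
      ν≡μ : ν (nothing ∷ ψ) ≡ DZ.Det (CZ.rows Mᵀ (nothing ∷ ψ))
      ν≡μ = begin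
        DZ.Det (top ⨾ CZ.rows v (nothing ∷ ψ))
          ≡⟨ DZ.Det-cong (λ { zero c → ≡.refl ; (suc zero) c → ≡.refl ; (suc (suc r)) c → ≡.refl }) ⟩
        DZ.Det (top ⨾ (v nothing ⨾ CZ.rows v ψ))
          ≡⟨ DZ.Det-swap top (v nothing) (CZ.rows v ψ) ⟩
        ℤ.- DZ.Det (v nothing ⨾ T)
          ≡⟨ ≡.cong ℤ.-_ (≡.trans (DZ.laplace-cons (v nothing) T) DZ.∑-cons) ⟩
        ℤ.- (ℤ.1ℤ ℤ.* (ℤ.-1ℤ ℤ.* DZ.Det (λ r c → T r (suc c))) ℤ.+ DZ.∑ (λ j → DZ.sgn (suc j) ℤ.* (ℤ.-1ℤ ℤ.* DZ.Det (λ r c → T r (punchIn (suc j) c)))))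
          ≡⟨ ≡.cong (λ x → ℤ.- (ℤ.1ℤ ℤ.* (ℤ.-1ℤ ℤ.* DZ.Det (λ r c → T r (suc c))) ℤ.+ x)) (DZ.∑-zero λ j →
               ≡.trans (≡.cong (λ x → DZ.sgn (suc j) ℤ.* (ℤ.-1ℤ ℤ.* x)) (DZ.Det-zeroColumn (λ r c → T r (punchIn (suc j) c)) column₀)) (ℤₚ.*-zeroʳ (DZ.sgn (suc j)))) ⟩
        ℤ.- (ℤ.1ℤ ℤ.* (ℤ.-1ℤ ℤ.* DZ.Det (λ r c → T r (suc c))) ℤ.+ ℤ.0ℤ)
          ≡⟨ solve 1 (λ x → :- (con ℤ.1ℤ :* (con ℤ.-1ℤ :* x) :+ con ℤ.0ℤ) := x) ≡.refl (DZ.Det (λ r c → T r (suc c))) ⟩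
        DZ.Det (λ r c → T r (suc c))
          ≡⟨ DZ.Det-cong entry ⟩
        DZ.Det (CZ.rows Mᵀ (nothing ∷ ψ)) ∎

  Det-W-nonneg : ℤ.0ℤ ℤ.≤ DZ.Det W
  Det-W-nonneg = ℤₚ.*-cancelˡ-≤-pos ℤ.0ℤ (DZ.Det W) (+ (s !)) {{ℤ.positive (ℤ.+<+ (ℕ.>-nonZero⁻¹ (s !) {{s ℕₚ.!≢0}}))}}
    (≡.subst₂ ℤ._≤_ (≡.sym (ℤₚ.*-zeroʳ (+ (s !)))) total (∑ⱽ-nonneg indices s summand-nonneg))
    where
    total : CZ.∑ⱽ indices s (λ φ → DZ.Det (CZ.rows Mᵀ φ) ℤ.* ν φ) ≡ + (s !) ℤ.* DZ.Det W
    total = ≡.trans (CZ.antisymmetrise indices (λ i x → Mᵀ x i) ν (ν-alternating top v))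
      (≡.trans (≡.cong (λ x → (s !) ·ᶻ x) (≡.sym expandW)) (·ᶻ-* (s !) (DZ.Det W)))

∏-const : ∀ x s → DZ.∏ {s} (λ _ → x) ≡ x ℤ.^ s
∏-const x zero    = ≡.refl
∏-const x (suc s) = ≡.cong (x ℤ.*_) (∏-const x s)

-- Left multiplication by a triangular matrix with diagonal 1, -1, ..., -1.
Det-subtract-rows : ∀ {s} (S : Fin (suc s) → Fin (suc s) → ℤ) →
                    DZ.Det (S zero ⨾ λ i j → S zero j ℤ.- S (suc i) j) ≡ ℤ.-1ℤ ℤ.^ s ℤ.* DZ.Det S
Det-subtract-rows {s} S = begin
  DZ.Det (S zero ⨾ λ i j → S zero j ℤ.- S (suc i) j)    ≡⟨ DZ.Det-cong entries ⟨
  DZ.Det (λ i j → DZ.∑ λ e → L i e ℤ.* S e j)           ≡⟨ CZ.Det-* L S ⟩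
  DZ.Det L ℤ.* DZ.Det S                                 ≡⟨ ≡.cong (ℤ._* DZ.Det S) det-L ⟩
  ℤ.-1ℤ ℤ.^ s ℤ.* DZ.Det S ∎
  where
  open ≡.≡-Reasoning
  L : Fin (suc s) → Fin (suc s) → ℤ
  L = DZ.kron zero ⨾ λ i j → DZ.kron zero j ℤ.- DZ.kron (suc i) j
  entries : ∀ i j → DZ.∑ (λ e → L i e ℤ.* S e j) ≡ (S zero ⨾ λ i j → S zero j ℤ.- S (suc i) j) i j
  entries zero    j = DZ.∑-kron zero (λ e → S e j)
  entries (suc i) j = begin
    DZ.∑ (λ e → (DZ.kron zero e ℤ.- DZ.kron (suc i) e) ℤ.* S e j)
      ≡⟨ DZ.∑-cong (λ e → solve 3 (λ a b x → (a :- b) :* x := a :* x :+ :- (b :* x)) ≡.refl (DZ.kron zero e) (DZ.kron (suc i) e) (S e j)) ⟩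
    DZ.∑ (λ e → DZ.kron zero e ℤ.* S e j ℤ.+ ℤ.- (DZ.kron (suc i) e ℤ.* S e j))
      ≡⟨ ≡.trans DZ.∑-+ (≡.cong₂ ℤ._+_ (DZ.∑-kron zero (λ e → S e j)) (≡.trans DZ.∑-neg (≡.cong ℤ.-_ (DZ.∑-kron (suc i) (λ e → S e j))))) ⟩
    S zero j ℤ.- S (suc i) j ∎
  det-L : DZ.Det L ≡ ℤ.-1ℤ ℤ.^ s
  det-L = begin
    DZ.Det L
      ≡⟨ DZ.Det-kron-head zero (λ i j → DZ.kron zero j ℤ.- DZ.kron (suc i) j) ⟩
    ℤ.1ℤ ℤ.* DZ.Det {s} (λ r c → ℤ.0ℤ ℤ.- DZ.kron r c)
      ≡⟨ ≡.trans (ℤₚ.*-identityˡ _) (DZ.Det-cong λ r c → solve 1 (λ k → con ℤ.0ℤ :- k := con ℤ.-1ℤ :* k) ≡.refl (DZ.kron r c)) ⟩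
    DZ.Det {s} (λ r c → ℤ.-1ℤ ℤ.* DZ.kron r c)
      ≡⟨ ≡.trans (DZ.Det-scale (λ _ → ℤ.-1ℤ) DZ.kron) (≡.trans (≡.cong₂ ℤ._*_ (∏-const ℤ.-1ℤ s) (DZ.Det-kron s)) (ℤₚ.*-identityʳ _)) ⟩
    ℤ.-1ℤ ℤ.^ s ∎

∑ᴸ-map : ∀ {I J : Set} (g : I → J) xs {f : J → ℤ} → CZ.∑ᴸ (List.map g xs) f ≡ CZ.∑ᴸ xs (f ∘ g)
∑ᴸ-map g []       = ≡.refl
∑ᴸ-map g (x ∷ xs) {f} = ≡.cong (ℤ._+_ (f (g x))) (∑ᴸ-map g xs {f})

-- gram says that K i j is half the squared distance of the vectors λ e → C e i and λ e → C e j.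
module NegativeType {n : ℕ} (K : Fin n → Fin n → ℤ) (K-diagonal : ∀ i → K i i ≡ ℤ.0ℤ) (K-sym : ∀ i j → K i j ≡ K j i)
    {E : Set} (xs : List E) (C : E → Fin n → ℤ)
    (gram : ∀ o i j → CZ.∑ᴸ xs (λ e → (C e i ℤ.- C e o) ℤ.* (C e j ℤ.- C e o)) ≡ K i o ℤ.+ K o j ℤ.- K i j) where

  submatrix-sign : ∀ {s} (φ : Fin (suc s) → Fin n) → ℤ.0ℤ ℤ.≤ ℤ.-1ℤ ℤ.^ s ℤ.* DZ.Det (λ i j → K (φ i) (φ j))
  submatrix-sign {s} φ = ≡.subst (ℤ.0ℤ ℤ.≤_) (≡.trans (DZ.Det-cong entries) (Det-subtract-rows λ i j → K (φ i) (φ j)))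
    (Det-W-nonneg xs d G)
    where
    open ≡.≡-Reasoning
    o : Fin n
    o = φ zero
    d : Fin s → ℤ
    d j = K o (φ (suc j))
    G : E → Fin s → ℤ
    G e j = C e (φ (suc j)) ℤ.- C e o
    open BorderedGram xs d G
    v-entry : ∀ e j → v (just e) j ≡ C e (φ j) ℤ.- C e o
    v-entry e zero    = ≡.sym (ℤₚ.+-inverseʳ (C e o))
    v-entry e (suc j) = ≡.refl
    entries : ∀ i j → W i j ≡ ((λ j → K o (φ j)) ⨾ λ i j → K o (φ j) ℤ.- K (φ (suc i)) (φ j)) i j
    entries zero    zero    = ≡.sym (K-diagonal o)
    entries zero    (suc j) = ≡.refl
    entries (suc i) j = begin
      d i ℤ.* v nothing j ℤ.+ CZ.∑ᴸ (List.map just xs) (λ x → Mᵀ x i ℤ.* v x j)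
        ≡⟨ ≡.cong (ℤ._+_ (d i ℤ.* ℤ.-1ℤ)) (≡.trans (∑ᴸ-map just xs {λ x → Mᵀ x i ℤ.* v x j}) (≡.trans (CZ.∑ᴸ-cong xs λ e → ≡.cong (G e i ℤ.*_) (v-entry e j)) (gram o (φ (suc i)) (φ j)))) ⟩
      d i ℤ.* ℤ.-1ℤ ℤ.+ (K (φ (suc i)) o ℤ.+ K o (φ j) ℤ.- K (φ (suc i)) (φ j))
        ≡⟨ ≡.cong (λ x → d i ℤ.* ℤ.-1ℤ ℤ.+ (x ℤ.+ K o (φ j) ℤ.- K (φ (suc i)) (φ j))) (K-sym (φ (suc i)) o) ⟩
      d i ℤ.* ℤ.-1ℤ ℤ.+ (d i ℤ.+ K o (φ j) ℤ.- K (φ (suc i)) (φ j))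
        ≡⟨ solve 3 (λ d x y → d :* con ℤ.-1ℤ :+ (d :+ x :- y) := x :- y) ≡.refl (d i) (K o (φ j)) (K (φ (suc i)) (φ j)) ⟩
      K o (φ j) ℤ.- K (φ (suc i)) (φ j) ∎

-- The derivative of the characteristic polynomial

Det-neg-head : ∀ {n} (r : Fin (suc n) → U.Carrier) B → DU.Det ((λ j → U.- r j) ⨾ B) U.≈ U.- DU.Det (r ⨾ B)
Det-neg-head r B = begin
  DU.Det ((λ j → U.- r j) ⨾ B)
    ≈⟨ DU.laplace-cons (λ j → U.- r j) B ⟩
  DU.∑ (λ j → DU.sgn j U.* ((U.- r j) U.* m j))
    ≈⟨ DU.∑-cong (λ j → solveᵁ 3 (λ s x y → s :*ᵁ ((:-ᵁ x) :*ᵁ y) :=ᵁ :-ᵁ (s :*ᵁ (x :*ᵁ y))) U.refl (DU.sgn j) (r j) (m j)) ⟩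
  DU.∑ (λ j → U.- (DU.sgn j U.* (r j U.* m j)))
    ≈⟨ U.trans DU.∑-neg (U.-‿cong (U.sym (DU.laplace-cons r B))) ⟩
  U.- DU.Det (r ⨾ B) ∎
  where
  open SetoidReasoning U.setoid
  open IntegerCoefficients ℤ⟦b⟧ using () renaming (solve to solveᵁ; _:=_ to _:=ᵁ_; _:*_ to _:*ᵁ_; :-_ to :-ᵁ_)
  m : ∀ j → U.Carrier
  m j = DU.Det (λ r s → B r (punchIn j s))

deleteVertex : ∀ {n} → (Fin (suc n) → Fin (suc n) → ℤ) → Fin (suc n) → Fin n → Fin n → ℤ
deleteVertex A v r s = A (punchIn v r) (punchIn v s)

-- Differentiating row `v` of A - x I leaves minus a unit vector, and expanding along it deletes row
-- and column `v`.
χ-derivative : ∀ {n} (A : Fin (suc n) → Fin (suc n) → ℤ) k →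
               + suc k ℤ.* χ A (suc k) ≡ ℤ.- DZ.∑ (λ v → χ (deleteVertex A v) k)
χ-derivative {n} A k = begin
  + suc k ℤ.* χ A (suc k)
    ≡⟨ ·ᶻ-* (suc k) (χ A (suc k)) ⟨
  suc k ·ᶻ χ A (suc k)
    ≡⟨ DerivationProperties.D-Det PZ.∂ (pencil A) k ⟩
  DU.∑ (λ v → DU.Det (insertAt (removeAt (pencil A) v) v (λ j → ∂.D (pencil A v j)))) k
    ≡⟨ DU.∑-cong rowDerivative k ⟩
  DU.∑ (λ v → U.- χ (deleteVertex A v)) k
    ≡⟨ DU.∑-neg {f = λ v → χ (deleteVertex A v)} k ⟩
  ℤ.- DU.∑ (λ v → χ (deleteVertex A v)) k
    ≡⟨ ≡.cong ℤ.-_ (∑-coeff (λ v → χ (deleteVertex A v)) k) ⟩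
  ℤ.- DZ.∑ (λ v → χ (deleteVertex A v) k) ∎
  where
  open ≡.≡-Reasoning
  ∑-coeff : ∀ {m} (f : Fin m → U.Carrier) k → DU.∑ f k ≡ DZ.∑ λ v → f v k
  ∑-coeff {zero}  f k = ≡.trans (DU.∑-nil k) (≡.sym DZ.∑-nil)
  ∑-coeff {suc m} f k = ≡.trans (DU.∑-cons k) (≡.trans (≡.cong (ℤ._+_ (f zero k)) (∑-coeff (f ∘ suc) k)) (≡.sym DZ.∑-cons))
  rowDerivative : ∀ v → DU.Det (insertAt (removeAt (pencil A) v) v (λ j → ∂.D (pencil A v j))) U.≈ U.- χ (deleteVertex A v)
  rowDerivative v = R.begin
    DU.Det (insertAt (removeAt (pencil A) v) v (λ j → ∂.D (pencil A v j)))
      R.≈⟨ DU.Det-insertAt (removeAt (pencil A) v) v (λ j → ∂.D (pencil A v j)) ⟩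
    DU.sgn v U.* DU.Det ((λ j → ∂.D (pencil A v j)) ⨾ removeAt (pencil A) v)
      R.≈⟨ U.*-congˡ {DU.sgn v} (U.trans (DU.Det-cong λ { zero s → ∂-pencil A v s ; (suc r) s → U.refl })
             (Det-neg-head (DU.kron v) (removeAt (pencil A) v))) ⟩
    DU.sgn v U.* U.- DU.Det (DU.kron v ⨾ removeAt (pencil A) v)
      R.≈⟨ solveᵁ 2 (λ s x → s :*ᵁ (:-ᵁ x) :=ᵁ :-ᵁ (s :*ᵁ x)) U.refl (DU.sgn v) _ ⟩
    U.- (DU.sgn v U.* DU.Det (DU.kron v ⨾ removeAt (pencil A) v))
      R.≈⟨ U.-‿cong (U.trans (U.sym (DU.Det-insertAt (removeAt (pencil A) v) v (DU.kron v))) (U.trans (DU.Det-insert-kron (pencil A) v)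
             (DU.Det-cong λ r s → U.+-congˡ {PZ.const (A (punchIn v r) (punchIn v s))} (U.-‿cong (U.*-congʳ {PZ.X} (U.reflexive (DU.kron-punchIn v r s))))))) ⟩
    U.- χ (deleteVertex A v) R.∎
    where
    module R = SetoidReasoning U.setoid
    open IntegerCoefficients ℤ⟦b⟧ using () renaming (solve to solveᵁ; _:=_ to _:=ᵁ_; _:*_ to _:*ᵁ_; :-_ to :-ᵁ_)

χ-zero : ∀ {n} (A : Fin n → Fin n → ℤ) → χ A 0 ≡ DZ.Det A
χ-zero A = ≡.trans (HomDet′.Det-homo PZ.constantTerm (pencil A)) (DZ.Det-cong λ e j →
  ≡.trans (≡.cong (λ t → A e j ℤ.- t) (≡.trans (U.*-comm (DU.kron e j) PZ.X 0) (PZ.conv-X-zero (DU.kron e j)))) (ℤₚ.+-identityʳ _))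

-- Induction on k through `χ-derivative`: deleting an index lowers the order by one, and the change
-- of (-1)^s makes up for the minus sign of the derivative. As `φ` is an arbitrary map, deletion is
-- composition with `punchIn`.
χ-sign : ∀ {n} (A : Fin n → Fin n → ℤ) →
         (∀ {s} (φ : Fin (suc s) → Fin n) → ℤ.0ℤ ℤ.≤ ℤ.-1ℤ ℤ.^ s ℤ.* DZ.Det (λ i j → A (φ i) (φ j))) →
         ∀ k {s} (φ : Fin (suc s) → Fin n) → suc k ℕ.≤ s → ℤ.0ℤ ℤ.≤ ℤ.-1ℤ ℤ.^ s ℤ.* χ (λ i j → A (φ i) (φ j)) k
χ-sign A sign zero    {s} φ k<s = ≡.subst (λ x → ℤ.0ℤ ℤ.≤ ℤ.-1ℤ ℤ.^ s ℤ.* x) (≡.sym (χ-zero (λ i j → A (φ i) (φ j)))) (sign φ)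
χ-sign A sign (suc k) {suc s} φ (ℕ.s≤s k<s) = ℤₚ.*-cancelˡ-≤-pos ℤ.0ℤ _ (+ suc k) (≡.subst₂ ℤ._≤_
  (≡.sym (ℤₚ.*-zeroʳ (+ suc k))) rearrange (∑-nonneg λ v → χ-sign A sign k (φ ∘ punchIn v) k<s))
  where
  open ≡.≡-Reasoning
  B′ : Fin (suc (suc s)) → Fin (suc (suc s)) → ℤ
  B′ i j = A (φ i) (φ j)
  f : Fin (suc (suc s)) → ℤ
  f v = χ (deleteVertex B′ v) k
  e : ℤ
  e = ℤ.-1ℤ ℤ.^ s
  rearrange : DZ.∑ (λ v → e ℤ.* f v) ≡ + suc k ℤ.* (ℤ.-1ℤ ℤ.^ suc s ℤ.* χ B′ (suc k))
  rearrange = begin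
    DZ.∑ (λ v → e ℤ.* f v)                            ≡⟨ DZ.∑-*ˡ {x = e} {f = f} ⟩
    e ℤ.* DZ.∑ f                                      ≡⟨ solve 2 (λ e x → e :* x := (con ℤ.-1ℤ :* e) :* (:- x)) ≡.refl e (DZ.∑ f) ⟩
    (ℤ.-1ℤ ℤ.* e) ℤ.* ℤ.- DZ.∑ f                      ≡⟨ ≡.cong (ℤ.-1ℤ ℤ.* e ℤ.*_) (χ-derivative B′ k) ⟨
    (ℤ.-1ℤ ℤ.* e) ℤ.* (+ suc k ℤ.* χ B′ (suc k))      ≡⟨ solve 3 (λ e k x → e :* (k :* x) := k :* (e :* x)) ≡.refl (ℤ.-1ℤ ℤ.* e) (+ suc k) (χ B′ (suc k)) ⟩
    + suc k ℤ.* (ℤ.-1ℤ ℤ.^ suc s ℤ.* χ B′ (suc k)) ∎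

open import Defs

-- Distances in a tree

module Walks {n : ℕ} (G : Graph n) where
  open Graph G
  open DecMembership (Fin._≟_ {n}) using (_∈?_)

  module _ {P : Fin n → Set} where
    suffix : ∀ {i j k l} (w : Walk G k j l) → i ∈ vertices G w → All P (vertices G w) → Unique (vertices G w) →
             ∃[ l′ ] Σ[ p ∈ Path G i j l′ ] l′ ℕ.≤ l × All P (vertices G (proj₁ p))
    suffix []      (here ≡.refl) av u = _ , ([] , u) , z≤n , av
    suffix (a ∷ w) (here ≡.refl) av u = _ , (a ∷ w , u) , ℕₚ.≤-refl , av
    suffix (a ∷ w) (there i∈)    (_ ∷ av) (_ ∷ u) =
      let l′ , p , l′≤l , av′ = suffix w i∈ av u in l′ , p , ℕₚ.m≤n⇒m≤1+n l′≤l , av′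

    -- The predicate `P` is carried along because in `nearer-unique` the resulting path must still
    -- avoid a given vertex.
    loopErase : ∀ {i j l} (w : Walk G i j l) → All P (vertices G w) →
                ∃[ l′ ] Σ[ p ∈ Path G i j l′ ] l′ ℕ.≤ l × All P (vertices G (proj₁ p))
    loopErase []      av = 0 , ([] , [] ∷ []) , z≤n , av
    loopErase {i} (a ∷ w) (Pi ∷ av) with loopErase w av
    ... | l′ , (p , u) , l′≤l , av′ with i ∈? vertices G p
    ...   | yes i∈ = let l″ , q , l″≤l′ , av″ = suffix p i∈ av′ u
                     in l″ , q , ℕₚ.m≤n⇒m≤1+n (ℕₚ.≤-trans l″≤l′ l′≤l) , av″
    ...   | no i∉  = suc l′ , (a ∷ p , Allₚ.¬Any⇒All¬ _ i∉ ∷ u) , s≤s l′≤l , Pi ∷ av′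

    append : ∀ {i j k l m} (w : Walk G i j l) (x : Walk G j k m) → All P (vertices G w) → All P (vertices G x) →
             Σ[ y ∈ Walk G i k (l ℕ.+ m) ] All P (vertices G y)
    append []      x _         ax = x , ax
    append (a ∷ w) x (Pi ∷ aw) ax = let y , ay = append w x aw ax in a ∷ y , Pi ∷ ay

    head∈ : ∀ {i j l} (w : Walk G i j l) → All P (vertices G w) → P i
    head∈ []      (Pi ∷ _) = Pi
    head∈ (a ∷ w) (Pi ∷ _) = Pi

    reverse : ∀ {i j l} (w : Walk G i j l) → All P (vertices G w) → Σ[ y ∈ Walk G j i l ] All P (vertices G y)
    reverse []              aw        = [] , aw
    reverse {i} {j} (_∷_ {l = l} a w) (Pi ∷ aw) =
      let x , ax = reverse w aw
          y , ay = append x (adj-sym a ∷ []) ax (head∈ w aw ∷ Pi ∷ [])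
      in ≡.subst (λ m → Σ[ y ∈ Walk G j i m ] All P (vertices G y)) (ℕₚ.+-comm l 1) (y , ay)

  -- A trivially true instance of the predicate, for walks without a vertex to avoid.
  anyVertices : ∀ {i j l} (w : Walk G i j l) → All (λ _ → i ≡ i) (vertices G w)
  anyVertices w = All.universal (λ _ → ≡.refl) _

  prefix : ∀ {i j k l} (w : Walk G i k l) → j ∈ vertices G w → j ≡ k ⊎ (∃[ l′ ] l′ ℕ.< l × Walk G i j l′)
  prefix []      (here eq)     = inj₁ eq
  prefix (a ∷ w) (here ≡.refl) = inj₂ (0 , s≤s z≤n , [])
  prefix (a ∷ w) (there j∈) with prefix w j∈
  ... | inj₁ eq               = inj₁ eq
  ... | inj₂ (l′ , l′<l , x)  = inj₂ (suc l′ , s≤s l′<l , a ∷ x)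

  lastStep : ∀ {i j l} → Walk G i j (suc l) → ∃[ k ] Walk G i k l × Adj k j
  lastStep (a ∷ [])      = _ , [] , a
  lastStep (a ∷ (b ∷ w)) = let k , x , c = lastStep (b ∷ w) in k , a ∷ x , c

module Distances {n : ℕ} (T : Tree n) where
  open Tree T
  open Walks graph

  geodesic : ∀ i j → Path graph i j (dist T i j)
  geodesic i j = proj₁ (proj₂ (shortestPath T i j))

  dist≤ : ∀ {i j l} → Walk graph i j l → dist T i j ℕ.≤ l
  dist≤ {i} {j} w =
    let l′ , p , l′≤l , _ = loopErase w (anyVertices w)
    in ℕₚ.≤-trans (ℕₚ.≮⇒≥ λ l′<d → proj₂ (proj₂ (shortestPath T i j)) l′ l′<d p) l′≤l

  dist-refl : ∀ i → dist T i i ≡ 0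
  dist-refl i = ℕₚ.n≤0⇒n≡0 (dist≤ [])

  dist-sym : ∀ i j → dist T i j ≡ dist T j i
  dist-sym i j = ℕₚ.≤-antisym (half i j) (half j i)
    where
    half : ∀ i j → dist T i j ℕ.≤ dist T j i
    half i j = let w = proj₁ (geodesic j i) in dist≤ (proj₁ (reverse w (anyVertices w)))

  dist-step : ∀ i {j k} → Adj j k → dist T i k ℕ.≤ suc (dist T i j)
  dist-step i {j} {k} a =
    let w = proj₁ (geodesic i j)
        x = a ∷ []
    in ≡.subst (dist T i k ℕ.≤_) (ℕₚ.+-comm (dist T i j) 1)
         (dist≤ (proj₁ (append {P = λ _ → i ≡ i} w x (anyVertices w) (≡.refl ∷ ≡.refl ∷ []))))

  dist>0 : ∀ {i j} → i ≢ j → 0 ℕ.< dist T i j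
  dist>0 {i} {j} i≢j with dist T i j | geodesic i j
  ... | zero  | [] , _ = contradiction ≡.refl i≢j
  ... | suc d | _      = s≤s z≤n

  parent : ∀ i j → i ≢ j → ∃[ p ] Adj p j × suc (dist T i p) ≡ dist T i j
  parent i j i≢j with dist T i j in eq | geodesic i j
  ... | zero  | [] , _ = contradiction ≡.refl i≢j
  ... | suc d | w , _  =
    let p , x , a = lastStep w
    in p , a , ℕₚ.≤-antisym (s≤s (dist≤ x)) (≡.subst (ℕ._≤ suc (dist T i p)) eq (dist-step i a))

  -- A geodesic from i that meets j before its end k would make j strictly nearer to i than k.
  avoids : ∀ i {j k} → j ≢ k → dist T i k ℕ.≤ dist T i j → All (_≢ j) (vertices graph (proj₁ (geodesic i k)))
  avoids i {j} {k} j≢k d≤ = All.map (λ j≢ eq → j≢ (≡.sym eq)) (Allₚ.¬Any⇒All¬ _ λ j∈ → impossible (prefix (proj₁ (geodesic i k)) j∈))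
    where
    impossible : ¬ (j ≡ k ⊎ (∃[ l′ ] l′ ℕ.< dist T i k × Walk graph i j l′))
    impossible (inj₁ eq) = j≢k eq
    impossible (inj₂ (l′ , l′<d , w)) = ℕₚ.<⇒≱ l′<d (ℕₚ.≤-trans d≤ (dist≤ w))

  adj⇒≢ : ∀ {i j} → Adj i j → i ≢ j
  adj⇒≢ a ≡.refl = loopless a

  -- Two neighbours of j which are not further from i than j would close a cycle through j.
  nearer-unique : ∀ i {j k k′} → Adj j k → Adj j k′ → k ≢ k′ → dist T i k ℕ.≤ dist T i j → ¬ dist T i k′ ℕ.≤ dist T i j
  nearer-unique i {j} {k} {k′} a a′ k≢k′ d≤ d′≤ = cycle (loopErase y ay)
    where
    x = reverse (proj₁ (geodesic i k)) (avoids i (adj⇒≢ a) d≤)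
    y = proj₁ (append (proj₁ x) (proj₁ (geodesic i k′)) (proj₂ x) (avoids i (adj⇒≢ a′) d′≤))
    ay = proj₂ (append (proj₁ x) (proj₁ (geodesic i k′)) (proj₂ x) (avoids i (adj⇒≢ a′) d′≤))
    cycle : ¬ (∃[ l ] Σ[ p ∈ Path graph k k′ l ] l ℕ.≤ _ × All (_≢ j) (vertices graph (proj₁ p)))
    cycle (zero  , ([] , _) , _ , _) = k≢k′ ≡.refl
    cycle (suc l , (p , u) , _ , av) =
      acyclic (a ∷ p , All.map (λ v≢j eq → v≢j (≡.sym eq)) av ∷ u) (s≤s (s≤s z≤n)) (adj-sym a′)

  dist-neighbour : ∀ i {j k p} → Adj p j → suc (dist T i p) ≡ dist T i j → Adj j k → k ≢ p → dist T i k ≡ suc (dist T i j)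
  dist-neighbour i {j} {k} {p} b eq a k≢p = ℕₚ.≤-antisym (dist-step i a)
    (ℕₚ.≰⇒> (nearer-unique i (adj-sym b) a (k≢p ∘ ≡.sym) (≡.subst (dist T i p ℕ.≤_) eq (ℕₚ.n≤1+n _))))

  dist-adj : ∀ {i k} → Adj i k → dist T i k ≡ 1
  dist-adj {i} {k} a = ℕₚ.≤-antisym (≡.subst (λ d → dist T i k ℕ.≤ suc d) (dist-refl i) (dist-step i a)) (dist>0 (adj⇒≢ a))


-- The distance matrix of a tree and its inverse

∑-*ᶻ : ∀ {n} x (f : Fin n → ℤ) → DZ.∑ (λ i → x ℤ.* f i) ≡ x ℤ.* DZ.∑ f
∑-*ᶻ x f = DZ.∑-*ˡ {x = x} {f = f}

∑-+ᶻ : ∀ {n} (f g : Fin n → ℤ) → DZ.∑ (λ i → f i ℤ.+ g i) ≡ DZ.∑ f ℤ.+ DZ.∑ g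
∑-+ᶻ f g = DZ.∑-+ {f = f} {g = g}

∑-constᶻ : ∀ n x → DZ.∑ {n} (λ _ → x) ≡ + n ℤ.* x
∑-constᶻ n x = ≡.trans (DZ.∑-const n) (·ᶻ-* n x)

∑-swapᶻ : ∀ {m n} (f : Fin m → Fin n → ℤ) → DZ.∑ (λ i → DZ.∑ λ j → f i j) ≡ DZ.∑ (λ j → DZ.∑ λ i → f i j)
∑-swapᶻ f = DZ.∑-swap {f = f}

char : ∀ {P : Set} → Dec P → ℤ
char (yes _) = ℤ.1ℤ
char (no _)  = ℤ.0ℤ

char-cong : ∀ {P Q : Set} (p? : Dec P) (q? : Dec Q) → (P → Q) → (Q → P) → char p? ≡ char q?
char-cong (yes p) (yes q) f g = ≡.refl
char-cong (yes p) (no ¬q) f g = contradiction (f p) ¬q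
char-cong (no ¬p) (yes q) f g = contradiction (g q) ¬p
char-cong (no ¬p) (no ¬q) f g = ≡.refl

module TreeMatrices {n : ℕ} (T : Tree n) where
  open Tree T
  private
    module Dist = Distances T

  -- Opaque, since dist unfolds to a search for paths.
  opaque
    ℓ : Fin n → Fin n → ℕ
    ℓ = dist T

    ℓ≡dist : ∀ i j → ℓ i j ≡ dist T i j
    ℓ≡dist i j = ≡.refl

    ℓ-refl : ∀ i → ℓ i i ≡ 0
    ℓ-refl = Dist.dist-refl

    ℓ-sym : ∀ i j → ℓ i j ≡ ℓ j i
    ℓ-sym = Dist.dist-sym

    ℓ>0 : ∀ {i j} → i ≢ j → 0 ℕ.< ℓ i j
    ℓ>0 = Dist.dist>0

    parent : ∀ i j → i ≢ j → ∃[ p ] Adj p j × suc (ℓ i p) ≡ ℓ i j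
    parent = Dist.parent

    ℓ-neighbour : ∀ i {j k p} → Adj p j → suc (ℓ i p) ≡ ℓ i j → Adj j k → k ≢ p → ℓ i k ≡ suc (ℓ i j)
    ℓ-neighbour = Dist.dist-neighbour

    ℓ-adj : ∀ {i k} → Adj i k → ℓ i k ≡ 1
    ℓ-adj = Dist.dist-adj

  D a : Fin n → Fin n → ℤ
  D i j = + ℓ i j
  a i j = char (adj? i j)

  deg τ : Fin n → ℤ
  deg j = DZ.∑ (a j)
  τ j = + 2 ℤ.- deg j

  D-sym : ∀ i j → D i j ≡ D j i
  D-sym i j = ≡.cong +_ (ℓ-sym i j)

  D-diagonal : ∀ i → D i i ≡ ℤ.0ℤ
  D-diagonal i = ≡.cong +_ (ℓ-refl i)

  a-sym : ∀ i j → a i j ≡ a j i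
  a-sym i j = char-cong (adj? i j) (adj? j i) adj-sym adj-sym

  a² : ∀ i j → a i j ℤ.* a i j ≡ a i j
  a² i j with adj? i j
  ... | yes _ = ≡.refl
  ... | no _  = ≡.refl

  -- Here and in `neighbours-other` the function `g` is arbitrary because both the distance and its
  -- square are summed over neighbours.
  neighbours-self : ∀ (g : ℕ → ℤ) i → DZ.∑ (λ k → a i k ℤ.* g (ℓ i k)) ≡ deg i ℤ.* g 1
  neighbours-self g i = ≡.trans (DZ.∑-cong term) (≡.trans (∑-*ᶻ (g 1) (a i)) (ℤₚ.*-comm (g 1) (deg i)))
    where
    term : ∀ k → a i k ℤ.* g (ℓ i k) ≡ g 1 ℤ.* a i k
    term k with adj? i k
    ... | yes b = ≡.trans (ℤₚ.*-identityˡ _) (≡.trans (≡.cong g (ℓ-adj b)) (≡.sym (ℤₚ.*-identityʳ (g 1))))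
    ... | no _  = ≡.trans (ℤₚ.*-zeroˡ (g (ℓ i k))) (≡.sym (ℤₚ.*-zeroʳ (g 1)))

  -- Exactly one neighbour of j is nearer to i than j.
  neighbours-other : ∀ (g : ℕ → ℤ) i j e → i ≢ j → suc e ≡ ℓ i j →
    DZ.∑ (λ k → a j k ℤ.* g (ℓ i k)) ≡ deg j ℤ.* g (suc (ℓ i j)) ℤ.+ (g e ℤ.- g (suc (ℓ i j)))
  neighbours-other g i j e i≢j se≡d = begin
    DZ.∑ (λ k → a j k ℤ.* g (ℓ i k))                     ≡⟨ DZ.∑-cong term ⟩
    DZ.∑ (λ k → G ℤ.* a j k ℤ.+ DZ.kron p k ℤ.* (g e ℤ.- G))
      ≡⟨ ∑-+ᶻ (λ k → G ℤ.* a j k) (λ k → DZ.kron p k ℤ.* (g e ℤ.- G)) ⟩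
    DZ.∑ (λ k → G ℤ.* a j k) ℤ.+ DZ.∑ (λ k → DZ.kron p k ℤ.* (g e ℤ.- G))
      ≡⟨ ≡.cong₂ ℤ._+_ (≡.trans (∑-*ᶻ G (a j)) (ℤₚ.*-comm G (deg j))) (DZ.∑-kron p (λ _ → g e ℤ.- G)) ⟩
    deg j ℤ.* G ℤ.+ (g e ℤ.- G) ∎
    where
    open ≡.≡-Reasoning
    G = g (suc (ℓ i j))
    p = proj₁ (parent i j i≢j)
    p~j = proj₁ (proj₂ (parent i j i≢j))
    sp≡d = proj₂ (proj₂ (parent i j i≢j))
    p≡e : ℓ i p ≡ e
    p≡e = ℕₚ.suc-injective (≡.trans sp≡d (≡.sym se≡d))
    term : ∀ k → a j k ℤ.* g (ℓ i k) ≡ G ℤ.* a j k ℤ.+ DZ.kron p k ℤ.* (g e ℤ.- G)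
    term k with k Fin.≟ p | adj? j k
    ... | yes ≡.refl | yes _ rewrite DZ.kron-diagonal k | p≡e =
      solve 2 (λ x y → con ℤ.1ℤ :* x := y :* con ℤ.1ℤ :+ con ℤ.1ℤ :* (x :- y)) ≡.refl (g e) G
    ... | yes ≡.refl | no ¬b = contradiction (adj-sym p~j) ¬b
    ... | no k≢p | yes b rewrite DZ.kron-off {i = p} {k} (k≢p ∘ ≡.sym) | ℓ-neighbour i p~j sp≡d b k≢p =
      solve 2 (λ x y → con ℤ.1ℤ :* y := y :* con ℤ.1ℤ :+ con ℤ.0ℤ :* (x :- y)) ≡.refl (g e) G
    ... | no k≢p | no _ rewrite DZ.kron-off {i = p} {k} (k≢p ∘ ≡.sym) =
      solve 3 (λ x y z → con ℤ.0ℤ :* z := y :* con ℤ.0ℤ :+ con ℤ.0ℤ :* (x :- y)) ≡.refl (g e) G (g (ℓ i k))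

  -- One neighbour of j is a step nearer to i and deg j - 1 are a step further, a balance of deg j -
  -- 2. For i = j no neighbour is nearer, which the Kronecker term corrects by 2.
  neighbours-D : ∀ i j → DZ.∑ (λ k → a j k ℤ.* D i k) ≡ deg j ℤ.* D i j ℤ.+ (deg j ℤ.- + 2 ℤ.+ + 2 ℤ.* DZ.kron i j)
  neighbours-D i j with i Fin.≟ j
  ... | yes ≡.refl rewrite DZ.kron-diagonal i | ℓ-refl i = ≡.trans (neighbours-self +_ i)
    (solve 1 (λ d → d :* con ℤ.1ℤ := d :* con ℤ.0ℤ :+ (d :- con (+ 2) :+ con (+ 2) :* con ℤ.1ℤ)) ≡.refl (deg i))
  ... | no i≢j rewrite DZ.kron-off i≢j with ℓ i j in eq | ℓ>0 i≢j
  ...   | suc e | _ = ≡.trans (neighbours-other +_ i j e i≢j (≡.sym eq)) (begin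
    deg j ℤ.* + suc (ℓ i j) ℤ.+ (+ e ℤ.- + suc (ℓ i j))  ≡⟨ ≡.cong (λ d → deg j ℤ.* + suc d ℤ.+ (+ e ℤ.- + suc d)) eq ⟩
    deg j ℤ.* (+ 2 ℤ.+ + e) ℤ.+ (+ e ℤ.- (+ 2 ℤ.+ + e))
      ≡⟨ solve 2 (λ d e → d :* (con (+ 2) :+ e) :+ (e :- (con (+ 2) :+ e))
            := d :* (con (+ 1) :+ e) :+ (d :- con (+ 2) :+ con (+ 2) :* con ℤ.0ℤ)) ≡.refl (deg j) (+ e) ⟩
    deg j ℤ.* (+ 1 ℤ.+ + e) ℤ.+ (deg j ℤ.- + 2 ℤ.+ + 2 ℤ.* ℤ.0ℤ) ∎)
    where open ≡.≡-Reasoning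

  neighbours-D² : ∀ i j → DZ.∑ (λ k → a j k ℤ.* (D i k ℤ.* D i k)) ≡ deg j ℤ.* ((D i j ℤ.+ ℤ.1ℤ) ℤ.* (D i j ℤ.+ ℤ.1ℤ)) ℤ.- + 4 ℤ.* D i j
  neighbours-D² i j with i Fin.≟ j
  ... | yes ≡.refl rewrite ℓ-refl i = ≡.trans (neighbours-self (λ d → + d ℤ.* + d) i)
    (solve 1 (λ d → d :* (con ℤ.1ℤ :* con ℤ.1ℤ) := d :* ((con ℤ.0ℤ :+ con ℤ.1ℤ) :* (con ℤ.0ℤ :+ con ℤ.1ℤ)) :- con (+ 4) :* con ℤ.0ℤ) ≡.refl (deg i))
  ... | no i≢j with ℓ i j in eq | ℓ>0 i≢j
  ...   | suc e | _ = ≡.trans (neighbours-other (λ d → + d ℤ.* + d) i j e i≢j (≡.sym eq)) (begin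
    deg j ℤ.* (+ suc (ℓ i j) ℤ.* + suc (ℓ i j)) ℤ.+ (+ e ℤ.* + e ℤ.- + suc (ℓ i j) ℤ.* + suc (ℓ i j))
      ≡⟨ ≡.cong (λ d → deg j ℤ.* (+ suc d ℤ.* + suc d) ℤ.+ (+ e ℤ.* + e ℤ.- + suc d ℤ.* + suc d)) eq ⟩
    deg j ℤ.* ((+ 2 ℤ.+ + e) ℤ.* (+ 2 ℤ.+ + e)) ℤ.+ (+ e ℤ.* + e ℤ.- (+ 2 ℤ.+ + e) ℤ.* (+ 2 ℤ.+ + e))
      ≡⟨ solve 2 (λ d e → d :* ((con (+ 2) :+ e) :* (con (+ 2) :+ e)) :+ (e :* e :- (con (+ 2) :+ e) :* (con (+ 2) :+ e))
            := d :* (((con (+ 1) :+ e) :+ con ℤ.1ℤ) :* ((con (+ 1) :+ e) :+ con ℤ.1ℤ)) :- con (+ 4) :* (con (+ 1) :+ e)) ≡.refl (deg j) (+ e) ⟩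
    deg j ℤ.* (((+ 1 ℤ.+ + e) ℤ.+ ℤ.1ℤ) ℤ.* ((+ 1 ℤ.+ + e) ℤ.+ ℤ.1ℤ)) ℤ.- + 4 ℤ.* (+ 1 ℤ.+ + e) ∎)
    where open ≡.≡-Reasoning

  ∑-edges : ∀ (f : Fin n → ℤ) → DZ.∑ (λ j → DZ.∑ λ k → a j k ℤ.* f k) ≡ DZ.∑ (λ k → deg k ℤ.* f k)
  ∑-edges f = ≡.trans (∑-swapᶻ (λ j k → a j k ℤ.* f k)) (DZ.∑-cong λ k →
    ≡.trans (DZ.∑-cong λ j → ≡.trans (≡.cong (ℤ._* f k) (a-sym j k)) (ℤₚ.*-comm (a k j) (f k)))
      (≡.trans (∑-*ᶻ (f k) (a k)) (ℤₚ.*-comm (f k) (deg k))))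

  module _ (i : Fin n) where
    private
      sD sdD : ℤ
      sD = DZ.∑ (D i)
      sdD = DZ.∑ (λ j → deg j ℤ.* D i j)

    -- Summing `neighbours-D` over j and exchanging the summations puts the same sum of deg j · D i
    -- j on both sides. What remains is the degree sum, with neither an enumeration of edges nor an
    -- induction on trees.
    ∑-deg : DZ.∑ deg ≡ + 2 ℤ.* + n ℤ.- + 2
    ∑-deg = begin
      DZ.∑ deg
        ≡⟨ solve 3 (λ x d c → d := ((x :+ (d :- c)) :- x) :+ c) ≡.refl sdD (DZ.∑ deg) (+ n ℤ.* + 2 ℤ.- + 2 ℤ.* ℤ.1ℤ) ⟩
      ((sdD ℤ.+ (DZ.∑ deg ℤ.- (+ n ℤ.* + 2 ℤ.- + 2 ℤ.* ℤ.1ℤ))) ℤ.- sdD) ℤ.+ (+ n ℤ.* + 2 ℤ.- + 2 ℤ.* ℤ.1ℤ)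
        ≡⟨ ≡.cong (λ x → (x ℤ.- sdD) ℤ.+ (+ n ℤ.* + 2 ℤ.- + 2 ℤ.* ℤ.1ℤ)) balance ⟩
      (sdD ℤ.- sdD) ℤ.+ (+ n ℤ.* + 2 ℤ.- + 2 ℤ.* ℤ.1ℤ)
        ≡⟨ solve 2 (λ x n → (x :- x) :+ (n :* con (+ 2) :- con (+ 2) :* con ℤ.1ℤ) := con (+ 2) :* n :- con (+ 2)) ≡.refl sdD (+ n) ⟩
      + 2 ℤ.* + n ℤ.- + 2 ∎
      where
      open ≡.≡-Reasoning
      balance : sdD ℤ.+ (DZ.∑ deg ℤ.- (+ n ℤ.* + 2 ℤ.- + 2 ℤ.* ℤ.1ℤ)) ≡ sdD
      balance = begin
        sdD ℤ.+ (DZ.∑ deg ℤ.- (+ n ℤ.* + 2 ℤ.- + 2 ℤ.* ℤ.1ℤ))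
          ≡⟨ solve 4 (λ x d c k → x :+ (d :- (c :- k)) := (x :+ d) :+ (:- c :+ k)) ≡.refl sdD (DZ.∑ deg) (+ n ℤ.* + 2) (+ 2 ℤ.* ℤ.1ℤ) ⟩
        (sdD ℤ.+ DZ.∑ deg) ℤ.+ (ℤ.- (+ n ℤ.* + 2) ℤ.+ + 2 ℤ.* ℤ.1ℤ)
          ≡⟨ ≡.cong₂ ℤ._+_ (∑-+ᶻ (λ j → deg j ℤ.* D i j) deg) (≡.cong₂ ℤ._+_ (≡.trans DZ.∑-neg (≡.cong ℤ.-_ (∑-constᶻ n (+ 2))))
               (≡.trans (∑-*ᶻ (+ 2) (DZ.kron i)) (≡.cong (+ 2 ℤ.*_) ∑kron))) ⟨
        DZ.∑ (λ j → deg j ℤ.* D i j ℤ.+ deg j) ℤ.+ (DZ.∑ {n} (λ _ → ℤ.- + 2) ℤ.+ DZ.∑ (λ j → + 2 ℤ.* DZ.kron i j))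
          ≡⟨ ≡.trans (∑-+ᶻ _ (λ j → ℤ.- + 2 ℤ.+ + 2 ℤ.* DZ.kron i j)) (≡.cong (ℤ._+_ (DZ.∑ (λ j → deg j ℤ.* D i j ℤ.+ deg j))) (∑-+ᶻ (λ _ → ℤ.- + 2) (λ j → + 2 ℤ.* DZ.kron i j))) ⟨
        DZ.∑ (λ j → (deg j ℤ.* D i j ℤ.+ deg j) ℤ.+ (ℤ.- + 2 ℤ.+ + 2 ℤ.* DZ.kron i j))
          ≡⟨ DZ.∑-cong (λ j → ≡.trans (solve 3 (λ x d k → (x :+ d) :+ (:- con (+ 2) :+ con (+ 2) :* k) := x :+ (d :- con (+ 2) :+ con (+ 2) :* k)) ≡.refl (deg j ℤ.* D i j) (deg j) (DZ.kron i j)) (≡.sym (neighbours-D i j))) ⟩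
        DZ.∑ (λ j → DZ.∑ λ k → a j k ℤ.* D i k)
          ≡⟨ ∑-edges (D i) ⟩
        sdD ∎
        where
        ∑kron : DZ.∑ (DZ.kron i) ≡ ℤ.1ℤ
        ∑kron = ≡.trans (DZ.∑-cong λ j → ≡.sym (ℤₚ.*-identityʳ (DZ.kron i j))) (DZ.∑-kron i (λ _ → ℤ.1ℤ))

    -- The same summation of `neighbours-D²` cancels the sum of deg j · (D i j)² and leaves 4 ∑ D -
    -- 2 ∑ deg D = ∑ deg, whose left side is twice the sum sought.
    ∑-D-τ : DZ.∑ (λ k → D i k ℤ.* τ k) ≡ + n ℤ.- ℤ.1ℤ
    ∑-D-τ = ℤₚ.*-cancelˡ-≡ (+ 2) _ _ (begin
      + 2 ℤ.* DZ.∑ (λ k → D i k ℤ.* τ k)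
        ≡⟨ ≡.cong (+ 2 ℤ.*_) (≡.trans (DZ.∑-cong λ k → solve 2 (λ x d → x :* (con (+ 2) :- d) := con (+ 2) :* x :+ con ℤ.-1ℤ :* (d :* x)) ≡.refl (D i k) (deg k))
             (≡.trans (∑-+ᶻ (λ k → + 2 ℤ.* D i k) (λ k → ℤ.-1ℤ ℤ.* (deg k ℤ.* D i k))) (≡.cong₂ ℤ._+_ (∑-*ᶻ (+ 2) (D i)) (∑-*ᶻ ℤ.-1ℤ (λ k → deg k ℤ.* D i k))))) ⟩
      + 2 ℤ.* (+ 2 ℤ.* sD ℤ.+ ℤ.-1ℤ ℤ.* sdD)
        ≡⟨ solve 4 (λ s x e q → con (+ 2) :* (con (+ 2) :* s :+ con ℤ.-1ℤ :* x) := e :- (((q :+ con (+ 2) :* x) :+ (e :+ :- (con (+ 4) :* s))) :- q)) ≡.refl sD sdD (DZ.∑ deg) sddD ⟩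
      DZ.∑ deg ℤ.- (((sddD ℤ.+ + 2 ℤ.* sdD) ℤ.+ (DZ.∑ deg ℤ.+ ℤ.- (+ 4 ℤ.* sD))) ℤ.- sddD)
        ≡⟨ ≡.cong₂ (λ x y → x ℤ.- (y ℤ.- sddD)) ∑-deg balance ⟩
      (+ 2 ℤ.* + n ℤ.- + 2) ℤ.- (sddD ℤ.- sddD)
        ≡⟨ solve 2 (λ n q → (con (+ 2) :* n :- con (+ 2)) :- (q :- q) := con (+ 2) :* (n :- con ℤ.1ℤ)) ≡.refl (+ n) sddD ⟩
      + 2 ℤ.* (+ n ℤ.- ℤ.1ℤ) ∎)
      where
      open ≡.≡-Reasoning
      sddD : ℤ
      sddD = DZ.∑ (λ j → deg j ℤ.* (D i j ℤ.* D i j))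
      balance : (sddD ℤ.+ + 2 ℤ.* sdD) ℤ.+ (DZ.∑ deg ℤ.+ ℤ.- (+ 4 ℤ.* sD)) ≡ sddD
      balance = begin
        (sddD ℤ.+ + 2 ℤ.* sdD) ℤ.+ (DZ.∑ deg ℤ.+ ℤ.- (+ 4 ℤ.* sD))
          ≡⟨ ≡.cong₂ ℤ._+_ (≡.trans (∑-+ᶻ (λ j → deg j ℤ.* (D i j ℤ.* D i j)) (λ j → + 2 ℤ.* (deg j ℤ.* D i j))) (≡.cong (ℤ._+_ sddD) (∑-*ᶻ (+ 2) (λ j → deg j ℤ.* D i j))))
               (≡.trans (∑-+ᶻ deg (λ j → ℤ.- (+ 4 ℤ.* D i j))) (≡.cong (ℤ._+_ (DZ.∑ deg)) (≡.trans DZ.∑-neg (≡.cong ℤ.-_ (∑-*ᶻ (+ 4) (D i)))))) ⟨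
        DZ.∑ (λ j → deg j ℤ.* (D i j ℤ.* D i j) ℤ.+ + 2 ℤ.* (deg j ℤ.* D i j)) ℤ.+ DZ.∑ (λ j → deg j ℤ.+ ℤ.- (+ 4 ℤ.* D i j))
          ≡⟨ ∑-+ᶻ (λ j → deg j ℤ.* (D i j ℤ.* D i j) ℤ.+ + 2 ℤ.* (deg j ℤ.* D i j)) (λ j → deg j ℤ.+ ℤ.- (+ 4 ℤ.* D i j)) ⟨
        DZ.∑ (λ j → (deg j ℤ.* (D i j ℤ.* D i j) ℤ.+ + 2 ℤ.* (deg j ℤ.* D i j)) ℤ.+ (deg j ℤ.+ ℤ.- (+ 4 ℤ.* D i j)))
          ≡⟨ DZ.∑-cong (λ j → ≡.trans (solve 2 (λ d x → (d :* (x :* x) :+ con (+ 2) :* (d :* x)) :+ (d :+ :- (con (+ 4) :* x))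
                := d :* ((x :+ con ℤ.1ℤ) :* (x :+ con ℤ.1ℤ)) :- con (+ 4) :* x) ≡.refl (deg j) (D i j)) (≡.sym (neighbours-D² i j))) ⟩
        DZ.∑ (λ j → DZ.∑ λ k → a j k ℤ.* (D i k ℤ.* D i k))
          ≡⟨ ∑-edges (λ k → D i k ℤ.* D i k) ⟩
        sddD ∎

  -- τ τᵀ - (n - 1) times the Laplacian: 2 (n - 1) times the inverse of D.
  M : Fin n → Fin n → ℤ
  M e j = τ e ℤ.* τ j ℤ.- (+ n ℤ.- ℤ.1ℤ) ℤ.* (DZ.kron e j ℤ.* deg j ℤ.- a e j)

  -- This is the Graham-Lovász formula for the inverse. `∑-D-τ` evaluates D τ, `neighbours-D`
  -- evaluates D times the adjacency matrix, and all terms but the Kronecker one cancel.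
  D*M : ∀ i j → DZ.∑ (λ e → D i e ℤ.* M e j) ≡ + 2 ℤ.* (+ n ℤ.- ℤ.1ℤ) ℤ.* DZ.kron i j
  D*M i j = begin
    DZ.∑ (λ e → D i e ℤ.* M e j)
      ≡⟨ DZ.∑-cong (λ e → solve 7 (λ x t s m k d y → x :* (t :* s :- m :* (k :* d :- y)) := (s :* (x :* t) :+ (:- m :* d) :* (x :* k)) :+ m :* (y :* x))
            ≡.refl (D i e) (τ e) (τ j) m (DZ.kron e j) (deg j) (a e j)) ⟩
    DZ.∑ (λ e → (τ j ℤ.* (D i e ℤ.* τ e) ℤ.+ (ℤ.- m ℤ.* deg j) ℤ.* (D i e ℤ.* DZ.kron e j)) ℤ.+ m ℤ.* (a e j ℤ.* D i e))
      ≡⟨ ≡.trans (∑-+ᶻ (λ e → τ j ℤ.* (D i e ℤ.* τ e) ℤ.+ (ℤ.- m ℤ.* deg j) ℤ.* (D i e ℤ.* DZ.kron e j)) (λ e → m ℤ.* (a e j ℤ.* D i e)))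
           (≡.cong₂ ℤ._+_ (≡.trans (∑-+ᶻ (λ e → τ j ℤ.* (D i e ℤ.* τ e)) (λ e → (ℤ.- m ℤ.* deg j) ℤ.* (D i e ℤ.* DZ.kron e j)))
               (≡.cong₂ ℤ._+_ (≡.trans (∑-*ᶻ (τ j) (λ e → D i e ℤ.* τ e)) (≡.cong (τ j ℤ.*_) (∑-D-τ i)))
                              (≡.trans (∑-*ᶻ (ℤ.- m ℤ.* deg j) (λ e → D i e ℤ.* DZ.kron e j)) (≡.cong ((ℤ.- m ℤ.* deg j) ℤ.*_) (DZ.∑-kronʳ j (D i))))))
             (≡.trans (∑-*ᶻ m (λ e → a e j ℤ.* D i e)) (≡.cong (m ℤ.*_) (≡.trans (DZ.∑-cong λ e → ≡.cong (ℤ._* D i e) (a-sym e j)) (neighbours-D i j))))) ⟩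
    (τ j ℤ.* m ℤ.+ (ℤ.- m ℤ.* deg j) ℤ.* D i j) ℤ.+ m ℤ.* (deg j ℤ.* D i j ℤ.+ (deg j ℤ.- + 2 ℤ.+ + 2 ℤ.* DZ.kron i j))
      ≡⟨ solve 4 (λ m d x k → ((con (+ 2) :- d) :* m :+ (:- m :* d) :* x) :+ m :* (d :* x :+ (d :- con (+ 2) :+ con (+ 2) :* k)) := con (+ 2) :* m :* k)
            ≡.refl m (deg j) (D i j) (DZ.kron i j) ⟩
    + 2 ℤ.* m ℤ.* DZ.kron i j ∎
    where
    open ≡.≡-Reasoning
    m : ℤ
    m = + n ℤ.- ℤ.1ℤ

  M-sym : ∀ i j → M i j ≡ M j i
  M-sym i j = ≡.cong₂ ℤ._-_ (ℤₚ.*-comm (τ i) (τ j)) (≡.cong ((+ n ℤ.- ℤ.1ℤ) ℤ.*_) (≡.cong₂ ℤ._-_ (diag i j) (a-sym i j)))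
    where
    diag : ∀ i j → DZ.kron i j ℤ.* deg j ≡ DZ.kron j i ℤ.* deg i
    diag i j with i Fin.≟ j
    ... | yes ≡.refl = ≡.refl
    ... | no i≢j rewrite DZ.kron-off i≢j | DZ.kron-off (i≢j ∘ ≡.sym) = ≡.trans (ℤₚ.*-zeroˡ (deg j)) (≡.sym (ℤₚ.*-zeroˡ (deg i)))


-- Cofactors, edge vectors and the number of paths of length two

∑ᴸ-cartesianProduct : ∀ {I J : Set} (xs : List I) (ys : List J) (f : I × J → ℤ) →
                      CZ.∑ᴸ (cartesianProduct xs ys) f ≡ CZ.∑ᴸ xs (λ x → CZ.∑ᴸ ys λ y → f (x , y))
∑ᴸ-cartesianProduct []       ys f = ≡.refl
∑ᴸ-cartesianProduct (x ∷ xs) ys f = ≡.trans (CZ.∑ᴸ-++ (List.map (x ,_) ys) (cartesianProduct xs ys) {f})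
  (≡.cong₂ ℤ._+_ (∑ᴸ-map (x ,_) ys {f}) (∑ᴸ-cartesianProduct xs ys f))

∑ᴸ-allFin : ∀ n (f : Fin n → ℤ) → CZ.∑ᴸ (allFin n) f ≡ DZ.∑ f
∑ᴸ-allFin n f = CZ.∑ᴸ-tabulate (λ i → i) {f}

char-× : ∀ {P Q : Set} (p? : Dec P) (q? : Dec Q) → char (p? ×-dec q?) ≡ char p? ℤ.* char q?
char-× (yes _) (yes _) = ≡.refl
char-× (yes _) (no _)  = ≡.refl
char-× (no _)  (yes _) = ≡.refl
char-× (no _)  (no _)  = ≡.refl

length-filter : ∀ {A : Set} {P : A → Set} (P? : ∀ x → Dec (P x)) xs →
                + List.length (List.filter P? xs) ≡ CZ.∑ᴸ xs (λ x → char (P? x))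
length-filter P? []       = ≡.refl
length-filter P? (x ∷ xs) with P? x
... | yes _ = ≡.cong (ℤ._+_ ℤ.1ℤ) (length-filter P? xs)
... | no _  = ≡.trans (length-filter P? xs) (≡.sym (ℤₚ.+-identityˡ _))

trichotomy : ∀ {n} (u w : Fin n) → char (u Fin.<? w) ℤ.+ char (w Fin.<? u) ≡ ℤ.1ℤ ℤ.- DZ.kron u w
trichotomy u w with Finₚ.<-cmp u w | u Fin.<? w | w Fin.<? u
... | tri< _ u≢w _ | yes _   | no _    rewrite DZ.kron-off u≢w = ≡.refl
... | tri< p _ _   | no ¬p   | _       = contradiction p ¬p
... | tri< _ _ ¬q  | _       | yes q   = contradiction q ¬q
... | tri≈ _ ≡.refl _ | no _ | no _    rewrite DZ.kron-diagonal u = ≡.refl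
... | tri≈ ¬p _ _  | yes p   | _       = contradiction p ¬p
... | tri≈ _ _ ¬q  | _       | yes q   = contradiction q ¬q
... | tri> _ u≢w _ | no _    | yes _   rewrite DZ.kron-off u≢w = ≡.refl
... | tri> ¬p _ _  | yes p   | _       = contradiction p ¬p
... | tri> _ _ q   | _       | no ¬q   = contradiction q ¬q

Det-linear-head : ∀ {n m} (c : Fin m → ℤ) (R : Fin m → Fin (suc n) → ℤ) B →
                  DZ.Det ((λ j → DZ.∑ λ e → c e ℤ.* R e j) ⨾ B) ≡ DZ.∑ λ e → c e ℤ.* DZ.Det (R e ⨾ B)
Det-linear-head c R B = begin
  DZ.Det ((λ j → DZ.∑ λ e → c e ℤ.* R e j) ⨾ B)
    ≡⟨ DZ.laplace-cons (λ j → DZ.∑ λ e → c e ℤ.* R e j) B ⟩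
  DZ.∑ (λ j → DZ.sgn j ℤ.* (DZ.∑ (λ e → c e ℤ.* R e j) ℤ.* m j))
    ≡⟨ DZ.∑-cong (λ j → ≡.trans (solve 3 (λ s x y → s :* (x :* y) := (s :* y) :* x) ≡.refl (DZ.sgn j) (DZ.∑ λ e → c e ℤ.* R e j) (m j))
         (≡.trans (≡.sym (∑-*ᶻ (DZ.sgn j ℤ.* m j) (λ e → c e ℤ.* R e j)))
           (DZ.∑-cong λ e → solve 4 (λ s y c r → (s :* y) :* (c :* r) := c :* (s :* (r :* y))) ≡.refl (DZ.sgn j) (m j) (c e) (R e j)))) ⟩
  DZ.∑ (λ j → DZ.∑ λ e → c e ℤ.* (DZ.sgn j ℤ.* (R e j ℤ.* m j)))
    ≡⟨ ∑-swapᶻ (λ j e → c e ℤ.* (DZ.sgn j ℤ.* (R e j ℤ.* m j))) ⟩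
  DZ.∑ (λ e → DZ.∑ λ j → c e ℤ.* (DZ.sgn j ℤ.* (R e j ℤ.* m j)))
    ≡⟨ DZ.∑-cong (λ e → ≡.trans (∑-*ᶻ (c e) (λ j → DZ.sgn j ℤ.* (R e j ℤ.* m j))) (≡.cong (c e ℤ.*_) (≡.sym (DZ.laplace-cons (R e) B)))) ⟩
  DZ.∑ (λ e → c e ℤ.* DZ.Det (R e ⨾ B)) ∎
  where
  open ≡.≡-Reasoning
  m : ∀ j → ℤ
  m j = DZ.Det (λ r s → B r (punchIn j s))

-- Cramer's rule: `a` times the unit vector `v` is the combination of the rows of `A` with
-- coefficients `M v e`. Put in place of row `v`, every summand except e = v repeats a row.
principalCofactor : ∀ {n} (A M : Fin (suc n) → Fin (suc n) → ℤ) a → (∀ i j → DZ.∑ (λ e → M i e ℤ.* A e j) ≡ a ℤ.* DZ.kron i j) →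
                    ∀ v → a ℤ.* DZ.Det (deleteVertex A v) ≡ M v v ℤ.* DZ.Det A
principalCofactor A M a M*A v = begin
  a ℤ.* DZ.Det (deleteVertex A v)
    ≡⟨ ≡.cong (a ℤ.*_) (≡.trans (≡.sym (DZ.Det-insert-kron A v)) (DZ.Det-insertAt A′ v (DZ.kron v))) ⟩
  a ℤ.* (DZ.sgn v ℤ.* DZ.Det (DZ.kron v ⨾ A′))
    ≡⟨ solve 3 (λ a s x → a :* (s :* x) := s :* (a :* x)) ≡.refl a (DZ.sgn v) (DZ.Det (DZ.kron v ⨾ A′)) ⟩
  DZ.sgn v ℤ.* (a ℤ.* DZ.Det (DZ.kron v ⨾ A′))
    ≡⟨ ≡.cong (DZ.sgn v ℤ.*_) (≡.trans scaleHead (Det-linear-head (M v) A A′)) ⟩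
  DZ.sgn v ℤ.* DZ.∑ (λ e → M v e ℤ.* DZ.Det (A e ⨾ A′))
    ≡⟨ ≡.cong (DZ.sgn v ℤ.*_) (≡.trans (DZ.∑-cong only) (DZ.∑-kron v (λ e → M v v ℤ.* DZ.Det (A v ⨾ A′)))) ⟩
  DZ.sgn v ℤ.* (M v v ℤ.* DZ.Det (A v ⨾ A′))
    ≡⟨ solve 3 (λ s m x → s :* (m :* x) := m :* (s :* x)) ≡.refl (DZ.sgn v) (M v v) (DZ.Det (A v ⨾ A′)) ⟩
  M v v ℤ.* (DZ.sgn v ℤ.* DZ.Det (A v ⨾ A′))
    ≡⟨ ≡.cong (M v v ℤ.*_) (DZ.Det-expand A v) ⟨
  M v v ℤ.* DZ.Det A ∎
  where
  open ≡.≡-Reasoning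
  A′ = removeAt A v
  -- Scaling the first row is treated as a linear combination with a single summand, so that
  -- `Det-linear-head` covers it.
  scaleHead : a ℤ.* DZ.Det (DZ.kron v ⨾ A′) ≡ DZ.Det ((λ j → DZ.∑ λ e → M v e ℤ.* A e j) ⨾ A′)
  scaleHead = ≡.sym (≡.trans (DZ.Det-cong {B = (λ j → DZ.∑ {1} λ _ → a ℤ.* DZ.kron v j) ⨾ A′}
      λ { zero j → ≡.trans (M*A v j) (≡.sym (≡.trans DZ.∑-cons (≡.trans (≡.cong (ℤ._+_ (a ℤ.* DZ.kron v j)) DZ.∑-nil) (ℤₚ.+-identityʳ _)))) ; (suc r) j → ≡.refl })
    (≡.trans (Det-linear-head {m = 1} (λ _ → a) (λ _ → DZ.kron v) A′)
      (≡.trans DZ.∑-cons (≡.trans (≡.cong (ℤ._+_ (a ℤ.* DZ.Det (DZ.kron v ⨾ A′))) DZ.∑-nil) (ℤₚ.+-identityʳ _)))))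
  only : ∀ e → M v e ℤ.* DZ.Det (A e ⨾ A′) ≡ DZ.kron v e ℤ.* (M v v ℤ.* DZ.Det (A v ⨾ A′))
  only e with v Fin.≟ e
  ... | yes ≡.refl = ≡.trans (≡.sym (ℤₚ.*-identityˡ _)) (≡.cong (ℤ._* (M v v ℤ.* DZ.Det (A v ⨾ A′))) (≡.sym (DZ.kron-diagonal v)))
  ... | no v≢e = ≡.trans (≡.cong (M v e ℤ.*_) (≡.trans (DZ.Det-cong (λ { zero j → ≡.cong (λ x → A x j) (≡.sym (Finₚ.punchIn-punchOut v≢e)) ; (suc r) j → ≡.refl }))
      (DZ.Det-repeat-head A′ (punchOut v≢e))))
    (≡.trans (ℤₚ.*-zeroʳ (M v e)) (≡.sym (≡.trans (≡.cong (ℤ._* (M v v ℤ.* DZ.Det (A v ⨾ A′))) (DZ.kron-off v≢e)) (ℤₚ.*-zeroˡ (M v v ℤ.* DZ.Det (A v ⨾ A′))))))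

module TreeCounts {n : ℕ} (T : Tree n) where
  open Tree T
  open TreeMatrices T

  -- On an arc the value is +1 or -1 according to the side of the edge on which i lies; all other
  -- coordinates are 0.
  edgeVector : Fin n × Fin n → Fin n → ℤ
  edgeVector (u , v) i = a u v ℤ.* (D i u ℤ.- D i v)

  arcs : List (Fin n × Fin n)
  arcs = cartesianProduct (allFin n) (allFin n)

  ∑-arcs : ∀ f → CZ.∑ᴸ arcs f ≡ DZ.∑ (λ u → DZ.∑ λ v → f (u , v))
  ∑-arcs f = ≡.trans (∑ᴸ-cartesianProduct (allFin n) (allFin n) f)
    (≡.trans (∑ᴸ-allFin n (λ u → CZ.∑ᴸ (allFin n) λ v → f (u , v))) (DZ.∑-cong λ u → ∑ᴸ-allFin n (λ v → f (u , v))))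

  -- Summation by parts. Put x = D i - D o and y = D j - D o. By `neighbours-D` the graph Laplacian
  -- of y is 2 at o and -2 at j (both cancel if o = j), so only these two vertices contribute. The
  -- two orientations of an edge account for the two equal halves.
  gram : ∀ o i j → CZ.∑ᴸ arcs (λ e → (edgeVector e i ℤ.- edgeVector e o) ℤ.* (edgeVector e j ℤ.- edgeVector e o)) ≡
                   + 4 ℤ.* D i o ℤ.+ + 4 ℤ.* D o j ℤ.- + 4 ℤ.* D i j
  gram o i j = begin
    CZ.∑ᴸ arcs (λ e → (edgeVector e i ℤ.- edgeVector e o) ℤ.* (edgeVector e j ℤ.- edgeVector e o))
      ≡⟨ ∑-arcs (λ e → (edgeVector e i ℤ.- edgeVector e o) ℤ.* (edgeVector e j ℤ.- edgeVector e o)) ⟩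
    DZ.∑ (λ u → DZ.∑ λ v → (a u v ℤ.* (D i u ℤ.- D i v) ℤ.- a u v ℤ.* (D o u ℤ.- D o v)) ℤ.* (a u v ℤ.* (D j u ℤ.- D j v) ℤ.- a u v ℤ.* (D o u ℤ.- D o v)))
      ≡⟨ DZ.∑-cong (λ u → ≡.trans (DZ.∑-cong (split u)) (∑-+ᶻ (F u) (λ v → F v u))) ⟩
    DZ.∑ (λ u → DZ.∑ (F u) ℤ.+ DZ.∑ (λ v → F v u))
      ≡⟨ ≡.trans (∑-+ᶻ (λ u → DZ.∑ (F u)) (λ u → DZ.∑ λ v → F v u)) (≡.cong (ℤ._+_ (DZ.∑ λ u → DZ.∑ (F u))) (∑-swapᶻ (λ u v → F v u))) ⟩
    DZ.∑ (λ u → DZ.∑ (F u)) ℤ.+ DZ.∑ (λ u → DZ.∑ (F u))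
      ≡⟨ ≡.cong₂ ℤ._+_ total total ⟩
    (+ 2 ℤ.* x o ℤ.+ ℤ.- + 2 ℤ.* x j) ℤ.+ (+ 2 ℤ.* x o ℤ.+ ℤ.- + 2 ℤ.* x j)
      ≡⟨ ≡.cong (λ z → (+ 2 ℤ.* (D i o ℤ.- z) ℤ.+ ℤ.- + 2 ℤ.* x j) ℤ.+ (+ 2 ℤ.* (D i o ℤ.- z) ℤ.+ ℤ.- + 2 ℤ.* x j)) (D-diagonal o) ⟩
    (+ 2 ℤ.* (D i o ℤ.- ℤ.0ℤ) ℤ.+ ℤ.- + 2 ℤ.* x j) ℤ.+ (+ 2 ℤ.* (D i o ℤ.- ℤ.0ℤ) ℤ.+ ℤ.- + 2 ℤ.* x j)
      ≡⟨ solve 3 (λ p q r → (con (+ 2) :* (p :- con ℤ.0ℤ) :+ con (ℤ.- + 2) :* (q :- r)) :+ (con (+ 2) :* (p :- con ℤ.0ℤ) :+ con (ℤ.- + 2) :* (q :- r))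
            := con (+ 4) :* p :+ con (+ 4) :* r :- con (+ 4) :* q) ≡.refl (D i o) (D i j) (D o j) ⟩
    + 4 ℤ.* D i o ℤ.+ + 4 ℤ.* D o j ℤ.- + 4 ℤ.* D i j ∎
    where
    open ≡.≡-Reasoning
    x y : Fin n → ℤ
    x u = D i u ℤ.- D o u
    y u = D j u ℤ.- D o u
    F : Fin n → Fin n → ℤ
    F u v = x u ℤ.* (a u v ℤ.* (y u ℤ.- y v))
    split : ∀ u v → (a u v ℤ.* (D i u ℤ.- D i v) ℤ.- a u v ℤ.* (D o u ℤ.- D o v)) ℤ.* (a u v ℤ.* (D j u ℤ.- D j v) ℤ.- a u v ℤ.* (D o u ℤ.- D o v)) ≡ F u v ℤ.+ F v u
    split u v = begin
      _ ≡⟨ solve 7 (λ a i i′ j j′ o o′ → (a :* (i :- i′) :- a :* (o :- o′)) :* (a :* (j :- j′) :- a :* (o :- o′))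
             := (a :* a) :* ((i :- o) :* ((j :- o) :- (j′ :- o′)) :+ (i′ :- o′) :* ((j′ :- o′) :- (j :- o))))
             ≡.refl (a u v) (D i u) (D i v) (D j u) (D j v) (D o u) (D o v) ⟩
      (a u v ℤ.* a u v) ℤ.* (x u ℤ.* (y u ℤ.- y v) ℤ.+ x v ℤ.* (y v ℤ.- y u))
        ≡⟨ ≡.cong (ℤ._* (x u ℤ.* (y u ℤ.- y v) ℤ.+ x v ℤ.* (y v ℤ.- y u))) (a² u v) ⟩
      a u v ℤ.* (x u ℤ.* (y u ℤ.- y v) ℤ.+ x v ℤ.* (y v ℤ.- y u))
        ≡⟨ solve 5 (λ a p q r s → a :* (p :* q :+ r :* s) := p :* (a :* q) :+ r :* (a :* s)) ≡.refl (a u v) (x u) (y u ℤ.- y v) (x v) (y v ℤ.- y u) ⟩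
      F u v ℤ.+ x v ℤ.* (a u v ℤ.* (y v ℤ.- y u))
        ≡⟨ ≡.cong (λ t → F u v ℤ.+ x v ℤ.* (t ℤ.* (y v ℤ.- y u))) (a-sym u v) ⟩
      F u v ℤ.+ F v u ∎
    row : ∀ u → DZ.∑ (F u) ≡ DZ.kron o u ℤ.* (+ 2 ℤ.* x u) ℤ.+ DZ.kron j u ℤ.* (ℤ.- + 2 ℤ.* x u)
    row u = begin
      DZ.∑ (F u)
        ≡⟨ ∑-*ᶻ (x u) (λ v → a u v ℤ.* (y u ℤ.- y v)) ⟩
      x u ℤ.* DZ.∑ (λ v → a u v ℤ.* (y u ℤ.- y v))
        ≡⟨ ≡.cong (x u ℤ.*_) (≡.trans (DZ.∑-cong λ v → solve 4 (λ a y p q → a :* (y :- (p :- q)) := y :* a :+ (con ℤ.-1ℤ :* (a :* p) :+ a :* q)) ≡.refl (a u v) (y u) (D j v) (D o v))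
             (≡.trans (∑-+ᶻ (λ v → y u ℤ.* a u v) (λ v → ℤ.-1ℤ ℤ.* (a u v ℤ.* D j v) ℤ.+ a u v ℤ.* D o v))
               (≡.cong₂ ℤ._+_ (∑-*ᶻ (y u) (a u)) (≡.trans (∑-+ᶻ (λ v → ℤ.-1ℤ ℤ.* (a u v ℤ.* D j v)) (λ v → a u v ℤ.* D o v))
                 (≡.cong₂ ℤ._+_ (≡.trans (∑-*ᶻ ℤ.-1ℤ (λ v → a u v ℤ.* D j v)) (≡.cong (ℤ.-1ℤ ℤ.*_) (neighbours-D j u))) (neighbours-D o u)))))) ⟩
      x u ℤ.* (y u ℤ.* deg u ℤ.+ (ℤ.-1ℤ ℤ.* (deg u ℤ.* D j u ℤ.+ (deg u ℤ.- + 2 ℤ.+ + 2 ℤ.* DZ.kron j u)) ℤ.+ (deg u ℤ.* D o u ℤ.+ (deg u ℤ.- + 2 ℤ.+ + 2 ℤ.* DZ.kron o u))))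
        ≡⟨ solve 6 (λ x d p q k l → x :* ((p :- q) :* d :+ (con ℤ.-1ℤ :* (d :* p :+ (d :- con (+ 2) :+ con (+ 2) :* k)) :+ (d :* q :+ (d :- con (+ 2) :+ con (+ 2) :* l))))
              := l :* (con (+ 2) :* x) :+ k :* (con (ℤ.- + 2) :* x)) ≡.refl (x u) (deg u) (D j u) (D o u) (DZ.kron j u) (DZ.kron o u) ⟩
      DZ.kron o u ℤ.* (+ 2 ℤ.* x u) ℤ.+ DZ.kron j u ℤ.* (ℤ.- + 2 ℤ.* x u) ∎
    total : DZ.∑ (λ u → DZ.∑ (F u)) ≡ + 2 ℤ.* x o ℤ.+ ℤ.- + 2 ℤ.* x j
    total = ≡.trans (DZ.∑-cong row) (≡.trans (∑-+ᶻ (λ u → DZ.kron o u ℤ.* (+ 2 ℤ.* x u)) (λ u → DZ.kron j u ℤ.* (ℤ.- + 2 ℤ.* x u)))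
      (≡.cong₂ ℤ._+_ (DZ.∑-kron o (λ u → + 2 ℤ.* x u)) (DZ.∑-kron j (λ u → ℤ.- + 2 ℤ.* x u))))

  a-diagonal : ∀ v → a v v ≡ ℤ.0ℤ
  a-diagonal v with adj? v v
  ... | yes l = contradiction l loopless
  ... | no _  = ≡.refl

  -- Both sides count the walks u, v, w of length two: by their middle vertex on the left, and on
  -- the right split into u ≠ w, where each path occurs twice, and u = w.
  ∑-deg² : DZ.∑ (λ v → deg v ℤ.* deg v) ≡ + 2 ℤ.* + numP₃ T ℤ.+ DZ.∑ deg
  ∑-deg² = ≡.sym (begin
    + 2 ℤ.* + numP₃ T ℤ.+ DZ.∑ deg
      ≡⟨ ≡.cong (λ x → + 2 ℤ.* x ℤ.+ DZ.∑ deg) numP₃≡ ⟩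
    + 2 ℤ.* S lt ℤ.+ DZ.∑ deg
      ≡⟨ ≡.cong (ℤ._+ DZ.∑ deg) (≡.trans (solve 1 (λ x → con (+ 2) :* x := x :+ x) ≡.refl (S lt))
           (≡.trans (≡.cong (ℤ._+_ (S lt)) S-flip) (≡.sym (S-+ lt (λ u w → lt w u))))) ⟩
    S (λ u w → lt u w ℤ.+ lt w u) ℤ.+ DZ.∑ deg
      ≡⟨ ≡.cong (ℤ._+_ (S (λ u w → lt u w ℤ.+ lt w u))) (≡.sym S-kron) ⟩
    S (λ u w → lt u w ℤ.+ lt w u) ℤ.+ S DZ.kron
      ≡⟨ S-+ (λ u w → lt u w ℤ.+ lt w u) DZ.kron ⟨
    S (λ u w → (lt u w ℤ.+ lt w u) ℤ.+ DZ.kron u w)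
      ≡⟨ S-cong (λ u w → ≡.trans (≡.cong (ℤ._+ DZ.kron u w) (trichotomy u w)) (solve 1 (λ k → con ℤ.1ℤ :- k :+ k := con ℤ.1ℤ) ≡.refl (DZ.kron u w))) ⟩
    S (λ _ _ → ℤ.1ℤ)
      ≡⟨ S-one ⟩
    DZ.∑ (λ v → deg v ℤ.* deg v) ∎)
    where
    open ≡.≡-Reasoning
    lt : Fin n → Fin n → ℤ
    lt u w = char (u Fin.<? w)
    S : (Fin n → Fin n → ℤ) → ℤ
    S f = DZ.∑ λ u → DZ.∑ λ v → DZ.∑ λ w → f u w ℤ.* (a u v ℤ.* a v w)
    S-cong : ∀ {f g} → (∀ u w → f u w ≡ g u w) → S f ≡ S g
    S-cong h = DZ.∑-cong λ u → DZ.∑-cong λ v → DZ.∑-cong λ w → ≡.cong (ℤ._* (a u v ℤ.* a v w)) (h u w)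
    S-+ : ∀ f g → S (λ u w → f u w ℤ.+ g u w) ≡ S f ℤ.+ S g
    S-+ f g = ≡.trans (DZ.∑-cong λ u → ≡.trans (DZ.∑-cong λ v → ≡.trans
        (DZ.∑-cong λ w → ℤₚ.*-distribʳ-+ (a u v ℤ.* a v w) (f u w) (g u w))
        (∑-+ᶻ (λ w → f u w ℤ.* (a u v ℤ.* a v w)) (λ w → g u w ℤ.* (a u v ℤ.* a v w))))
        (∑-+ᶻ (λ v → DZ.∑ λ w → f u w ℤ.* (a u v ℤ.* a v w)) (λ v → DZ.∑ λ w → g u w ℤ.* (a u v ℤ.* a v w))))
      (∑-+ᶻ (λ u → DZ.∑ λ v → DZ.∑ λ w → f u w ℤ.* (a u v ℤ.* a v w)) (λ u → DZ.∑ λ v → DZ.∑ λ w → g u w ℤ.* (a u v ℤ.* a v w)))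
    numP₃≡ : + numP₃ T ≡ S lt
    numP₃≡ = begin
      + numP₃ T
        ≡⟨ length-filter (isP₃? T) (cartesianProduct (allFin n) (cartesianProduct (allFin n) (allFin n))) ⟩
      CZ.∑ᴸ (cartesianProduct (allFin n) (cartesianProduct (allFin n) (allFin n))) (λ t → char (isP₃? T t))
        ≡⟨ ∑ᴸ-cartesianProduct (allFin n) (cartesianProduct (allFin n) (allFin n)) (λ t → char (isP₃? T t)) ⟩
      CZ.∑ᴸ (allFin n) (λ u → CZ.∑ᴸ arcs λ e → char (isP₃? T (u , e)))
        ≡⟨ ∑ᴸ-allFin n (λ u → CZ.∑ᴸ arcs λ e → char (isP₃? T (u , e))) ⟩
      DZ.∑ (λ u → CZ.∑ᴸ arcs λ e → char (isP₃? T (u , e)))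
        ≡⟨ DZ.∑-cong (λ u → ≡.trans (∑-arcs (λ e → char (isP₃? T (u , e)))) (DZ.∑-cong λ v → DZ.∑-cong λ w →
             ≡.trans (char-× (u Fin.<? w) (adj? u v ×-dec adj? v w)) (≡.cong (lt u w ℤ.*_) (char-× (adj? u v) (adj? v w))))) ⟩
      S lt ∎
    S-flip : S lt ≡ S (λ u w → lt w u)
    S-flip = begin
      S lt
        ≡⟨ DZ.∑-cong (λ u → ∑-swapᶻ (λ v w → lt u w ℤ.* (a u v ℤ.* a v w))) ⟩
      DZ.∑ (λ u → DZ.∑ λ w → DZ.∑ λ v → lt u w ℤ.* (a u v ℤ.* a v w))
        ≡⟨ ∑-swapᶻ (λ u w → DZ.∑ λ v → lt u w ℤ.* (a u v ℤ.* a v w)) ⟩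
      DZ.∑ (λ w → DZ.∑ λ u → DZ.∑ λ v → lt u w ℤ.* (a u v ℤ.* a v w))
        ≡⟨ DZ.∑-cong (λ w → ≡.trans (∑-swapᶻ (λ u v → lt u w ℤ.* (a u v ℤ.* a v w))) (DZ.∑-cong λ v → DZ.∑-cong λ u →
             ≡.cong (lt u w ℤ.*_) (≡.trans (ℤₚ.*-comm (a u v) (a v w)) (≡.cong₂ ℤ._*_ (a-sym v w) (a-sym u v))))) ⟩
      S (λ u w → lt w u) ∎
    S-kron : S DZ.kron ≡ DZ.∑ deg
    S-kron = DZ.∑-cong λ u → DZ.∑-cong λ v → ≡.trans (DZ.∑-kron u (λ w → a u v ℤ.* a v w))
      (≡.trans (≡.cong (a u v ℤ.*_) (a-sym v u)) (a² u v))
    S-one : S (λ _ _ → ℤ.1ℤ) ≡ DZ.∑ (λ v → deg v ℤ.* deg v)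
    S-one = ≡.trans (DZ.∑-cong λ u → DZ.∑-cong λ v → ≡.trans (DZ.∑-cong λ w → ℤₚ.*-identityˡ (a u v ℤ.* a v w)) (∑-*ᶻ (a u v) (a v))) (∑-edges deg)

  1≤deg : 2 ℕ.≤ n → ∀ v → ℤ.1ℤ ℤ.≤ deg v
  1≤deg 2≤n v = positive (parent i v i≢v)
    where
    other : ∀ {n} → 2 ℕ.≤ n → (v : Fin n) → ∃[ i ] i ≢ v
    other (ℕ.s≤s (ℕ.s≤s _)) zero    = suc zero , λ ()
    other (ℕ.s≤s (ℕ.s≤s _)) (suc v) = zero , λ ()
    i = proj₁ (other 2≤n v)
    i≢v = proj₂ (other 2≤n v)
    positive : ∃[ p ] Adj p v × suc (ℓ i p) ≡ ℓ i v → ℤ.1ℤ ℤ.≤ deg v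
    positive (p , b , _) = ℤₚ.0≤i-j⇒j≤i (≡.subst (ℤ.0ℤ ℤ.≤_) sum≡ (∑-nonneg term))
      where
      term : ∀ k → ℤ.0ℤ ℤ.≤ a v k ℤ.+ ℤ.- DZ.kron p k
      term k with p Fin.≟ k | adj? v k
      ... | yes ≡.refl | yes _ rewrite DZ.kron-diagonal p = ℤₚ.≤-refl
      ... | yes ≡.refl | no ¬c = contradiction (adj-sym b) ¬c
      ... | no p≢k | yes _ rewrite DZ.kron-off p≢k = 0≤+ 1
      ... | no p≢k | no _  rewrite DZ.kron-off p≢k = ℤₚ.≤-refl
      sum≡ : DZ.∑ (λ k → a v k ℤ.+ ℤ.- DZ.kron p k) ≡ deg v ℤ.- ℤ.1ℤ
      sum≡ = ≡.trans (∑-+ᶻ (a v) (λ k → ℤ.- DZ.kron p k)) (≡.cong (ℤ._+_ (deg v)) (≡.trans (DZ.∑-neg {f = DZ.kron p}) (≡.cong ℤ.-_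
        (≡.trans (DZ.∑-cong λ k → ≡.sym (ℤₚ.*-identityʳ (DZ.kron p k))) (DZ.∑-kron p (λ _ → ℤ.1ℤ))))))

  deg≤ : ∀ v → deg v ℤ.≤ + n ℤ.- ℤ.1ℤ
  deg≤ v = ℤₚ.0≤i-j⇒j≤i (≡.subst (ℤ.0ℤ ℤ.≤_) sum≡ (∑-nonneg term))
    where
    term : ∀ k → ℤ.0ℤ ℤ.≤ (ℤ.1ℤ ℤ.+ ℤ.- DZ.kron v k) ℤ.+ ℤ.- a v k
    term k with v Fin.≟ k | adj? v k
    ... | yes ≡.refl | yes l = contradiction l loopless
    ... | yes ≡.refl | no _ rewrite DZ.kron-diagonal v = ℤₚ.≤-refl
    ... | no v≢k | yes _ rewrite DZ.kron-off v≢k = ℤₚ.≤-refl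
    ... | no v≢k | no _  rewrite DZ.kron-off v≢k = 0≤+ 1
    sum≡ : DZ.∑ (λ k → (ℤ.1ℤ ℤ.+ ℤ.- DZ.kron v k) ℤ.+ ℤ.- a v k) ≡ (+ n ℤ.- ℤ.1ℤ) ℤ.- deg v
    sum≡ = ≡.trans (∑-+ᶻ (λ k → ℤ.1ℤ ℤ.+ ℤ.- DZ.kron v k) (λ k → ℤ.- a v k)) (≡.cong₂ ℤ._+_
      (≡.trans (∑-+ᶻ (λ _ → ℤ.1ℤ) (λ k → ℤ.- DZ.kron v k)) (≡.cong₂ ℤ._+_ (≡.trans (∑-constᶻ n ℤ.1ℤ) (ℤₚ.*-identityʳ (+ n)))
        (≡.trans (DZ.∑-neg {f = DZ.kron v}) (≡.cong ℤ.-_ (≡.trans (DZ.∑-cong λ k → ≡.sym (ℤₚ.*-identityʳ (DZ.kron v k))) (DZ.∑-kron v (λ _ → ℤ.1ℤ)))))))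
      (DZ.∑-neg {f = a v}))

  module _ (2≤n : 2 ℕ.≤ n) where
    private
      N : ℤ
      N = + numP₃ T
      root : Fin n
      root = Fin.fromℕ< 2≤n′
        where
        2≤n′ : 0 ℕ.< n
        2≤n′ = ℕₚ.≤-trans (ℕ.s≤s ℕ.z≤n) 2≤n

    -- Sum of (deg v - 1) (n - 1 - deg v) ≥ 0 over all vertices, with equality for a star. In other
    -- words N ≤ C(n - 1, 2), so that every admissible ρ is at most 1.
    numP₃-bound : + 2 ℤ.* N ℤ.≤ (+ n ℤ.- ℤ.1ℤ) ℤ.* (+ n ℤ.- + 2)
    numP₃-bound = ℤₚ.0≤i-j⇒j≤i (≡.subst (ℤ.0ℤ ℤ.≤_) sum≡ (∑-nonneg {f = λ v → (deg v ℤ.- ℤ.1ℤ) ℤ.* ((+ n ℤ.- ℤ.1ℤ) ℤ.- deg v)} λ v →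
      *-nonneg (ℤₚ.i≤j⇒0≤j-i (1≤deg 2≤n v)) (ℤₚ.i≤j⇒0≤j-i (deg≤ v))))
      where
      open ≡.≡-Reasoning
      sum≡ : DZ.∑ (λ v → (deg v ℤ.- ℤ.1ℤ) ℤ.* ((+ n ℤ.- ℤ.1ℤ) ℤ.- deg v)) ≡ (+ n ℤ.- ℤ.1ℤ) ℤ.* (+ n ℤ.- + 2) ℤ.- + 2 ℤ.* N
      sum≡ = begin
        DZ.∑ (λ v → (deg v ℤ.- ℤ.1ℤ) ℤ.* ((+ n ℤ.- ℤ.1ℤ) ℤ.- deg v))
          ≡⟨ DZ.∑-cong (λ v → solve 2 (λ d n → (d :- con ℤ.1ℤ) :* ((n :- con ℤ.1ℤ) :- d) := (n :* d :+ con ℤ.-1ℤ :* (d :* d)) :+ (con ℤ.1ℤ :- n)) ≡.refl (deg v) (+ n)) ⟩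
        DZ.∑ (λ v → (+ n ℤ.* deg v ℤ.+ ℤ.-1ℤ ℤ.* (deg v ℤ.* deg v)) ℤ.+ (ℤ.1ℤ ℤ.- + n))
          ≡⟨ ≡.trans (∑-+ᶻ (λ v → + n ℤ.* deg v ℤ.+ ℤ.-1ℤ ℤ.* (deg v ℤ.* deg v)) (λ _ → ℤ.1ℤ ℤ.- + n))
               (≡.cong₂ ℤ._+_ (≡.trans (∑-+ᶻ (λ v → + n ℤ.* deg v) (λ v → ℤ.-1ℤ ℤ.* (deg v ℤ.* deg v))) (≡.cong₂ ℤ._+_ (∑-*ᶻ (+ n) deg) (∑-*ᶻ ℤ.-1ℤ (λ v → deg v ℤ.* deg v))))
                 (∑-constᶻ n (ℤ.1ℤ ℤ.- + n))) ⟩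
        (+ n ℤ.* DZ.∑ deg ℤ.+ ℤ.-1ℤ ℤ.* DZ.∑ (λ v → deg v ℤ.* deg v)) ℤ.+ + n ℤ.* (ℤ.1ℤ ℤ.- + n)
          ≡⟨ ≡.cong (λ x → (+ n ℤ.* DZ.∑ deg ℤ.+ ℤ.-1ℤ ℤ.* x) ℤ.+ + n ℤ.* (ℤ.1ℤ ℤ.- + n)) ∑-deg² ⟩
        (+ n ℤ.* DZ.∑ deg ℤ.+ ℤ.-1ℤ ℤ.* (+ 2 ℤ.* N ℤ.+ DZ.∑ deg)) ℤ.+ + n ℤ.* (ℤ.1ℤ ℤ.- + n)
          ≡⟨ ≡.cong (λ x → (+ n ℤ.* x ℤ.+ ℤ.-1ℤ ℤ.* (+ 2 ℤ.* N ℤ.+ x)) ℤ.+ + n ℤ.* (ℤ.1ℤ ℤ.- + n)) (∑-deg root) ⟩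
        (+ n ℤ.* (+ 2 ℤ.* + n ℤ.- + 2) ℤ.+ ℤ.-1ℤ ℤ.* (+ 2 ℤ.* N ℤ.+ (+ 2 ℤ.* + n ℤ.- + 2))) ℤ.+ + n ℤ.* (ℤ.1ℤ ℤ.- + n)
          ≡⟨ solve 2 (λ n N → (n :* (con (+ 2) :* n :- con (+ 2)) :+ con ℤ.-1ℤ :* (con (+ 2) :* N :+ (con (+ 2) :* n :- con (+ 2)))) :+ n :* (con ℤ.1ℤ :- n)
                := (n :- con ℤ.1ℤ) :* (n :- con (+ 2)) :- con (+ 2) :* N) ≡.refl (+ n) N ⟩
        (+ n ℤ.- ℤ.1ℤ) ℤ.* (+ n ℤ.- + 2) ℤ.- + 2 ℤ.* N ∎

    -- This is 2 (n - 1) times the trace of the inverse of D, hence what determines δ₁ / δ₀.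
    trace-M : DZ.∑ (λ v → M v v) ≡ ℤ.- (+ 2 ℤ.* + n ℤ.* (+ n ℤ.- ℤ.1ℤ) ℤ.- + 2 ℤ.* N ℤ.- + 4)
    trace-M = begin
      DZ.∑ (λ v → M v v)
        ≡⟨ DZ.∑-cong (λ v → ≡.trans (≡.cong₂ (λ k b → τ v ℤ.* τ v ℤ.- (+ n ℤ.- ℤ.1ℤ) ℤ.* (k ℤ.* deg v ℤ.- b)) (DZ.kron-diagonal v) (a-diagonal v))
             (solve 2 (λ d n → (con (+ 2) :- d) :* (con (+ 2) :- d) :- (n :- con ℤ.1ℤ) :* (con ℤ.1ℤ :* d :- con ℤ.0ℤ)
                := (d :* d :+ (con (ℤ.- + 3) :- n) :* d) :+ con (+ 4)) ≡.refl (deg v) (+ n))) ⟩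
      DZ.∑ (λ v → (deg v ℤ.* deg v ℤ.+ (ℤ.- + 3 ℤ.- + n) ℤ.* deg v) ℤ.+ + 4)
        ≡⟨ ≡.trans (∑-+ᶻ (λ v → deg v ℤ.* deg v ℤ.+ (ℤ.- + 3 ℤ.- + n) ℤ.* deg v) (λ _ → + 4))
             (≡.cong₂ ℤ._+_ (≡.trans (∑-+ᶻ (λ v → deg v ℤ.* deg v) (λ v → (ℤ.- + 3 ℤ.- + n) ℤ.* deg v)) (≡.cong₂ ℤ._+_ ∑-deg² (∑-*ᶻ (ℤ.- + 3 ℤ.- + n) deg))) (∑-constᶻ n (+ 4))) ⟩
      ((+ 2 ℤ.* N ℤ.+ DZ.∑ deg) ℤ.+ (ℤ.- + 3 ℤ.- + n) ℤ.* DZ.∑ deg) ℤ.+ + n ℤ.* + 4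
        ≡⟨ ≡.cong (λ x → ((+ 2 ℤ.* N ℤ.+ x) ℤ.+ (ℤ.- + 3 ℤ.- + n) ℤ.* x) ℤ.+ + n ℤ.* + 4) (∑-deg root) ⟩
      ((+ 2 ℤ.* N ℤ.+ (+ 2 ℤ.* + n ℤ.- + 2)) ℤ.+ (ℤ.- + 3 ℤ.- + n) ℤ.* (+ 2 ℤ.* + n ℤ.- + 2)) ℤ.+ + n ℤ.* + 4
        ≡⟨ solve 2 (λ n N → ((con (+ 2) :* N :+ (con (+ 2) :* n :- con (+ 2))) :+ (con (ℤ.- + 3) :- n) :* (con (+ 2) :* n :- con (+ 2))) :+ n :* con (+ 4)
              := :- (con (+ 2) :* n :* (n :- con ℤ.1ℤ) :- con (+ 2) :* N :- con (+ 4))) ≡.refl (+ n) N ⟩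
      ℤ.- (+ 2 ℤ.* + n ℤ.* (+ n ℤ.- ℤ.1ℤ) ℤ.- + 2 ℤ.* N ℤ.- + 4) ∎
      where open ≡.≡-Reasoning


-- The normalized coefficients beyond the peak

coeff-map : ∀ (f : ℤ → ℤ) → f ℤ.0ℤ ≡ ℤ.0ℤ → ∀ p k → coeff (List.map f p) k ≡ f (coeff p k)
coeff-map f f0 []      k       = ≡.sym f0
coeff-map f f0 (x ∷ p) zero    = ≡.refl
coeff-map f f0 (x ∷ p) (suc k) = coeff-map f f0 p k

coeff-+ : ∀ p q k → coeff (p +ᴾ q) k ≡ coeff p k ℤ.+ coeff q k
coeff-+ []      q       k       = ≡.sym (ℤₚ.+-identityˡ (coeff q k))
coeff-+ (x ∷ p) []      k       = ≡.sym (ℤₚ.+-identityʳ (coeff (x ∷ p) k))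
coeff-+ (x ∷ p) (y ∷ q) zero    = ≡.refl
coeff-+ (x ∷ p) (y ∷ q) (suc k) = coeff-+ p q k

coeff-* : ∀ p q k → coeff (p *ᴾ q) k ≡ PZ.conv (coeff p) (coeff q) k
coeff-* []      q k       = ≡.sym (PZ.conv-zeroˡ (coeff q) k)
coeff-* (x ∷ p) q zero    = ≡.trans (coeff-+ (List.map (x ℤ.*_) q) _ 0) (≡.trans (ℤₚ.+-identityʳ _)
  (≡.trans (coeff-map (x ℤ.*_) (ℤₚ.*-zeroʳ x) q 0) (≡.sym PZ.conv-zero)))
coeff-* (x ∷ p) q (suc k) = ≡.trans (coeff-+ (List.map (x ℤ.*_) q) _ (suc k))
  (≡.trans (≡.cong₂ ℤ._+_ (coeff-map (x ℤ.*_) (ℤₚ.*-zeroʳ x) q (suc k)) (coeff-* p q k)) (≡.sym (PZ.conv-suc k)))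

coeffHom : Hom polyRawRing ℤ⟦b⟧
coeffHom = record
  { ⟦_⟧ = coeff
  ; ⟦⟧-cong = λ p → p
  ; +-homo = coeff-+
  ; *-homo = coeff-*
  ; -‿homo = coeff-map ℤ.-_ ≡.refl
  ; 0-homo = λ _ → ≡.refl
  ; 1-homo = λ { zero → ≡.refl ; (suc k) → ≡.refl }
  }

xI-coeff : ∀ {n} (i j : Fin n) k → coeff (xI i j) k ≡ (DU.kron i j U.* PZ.X) k
xI-coeff i j k with i Fin.≟ j
... | yes ≡.refl = ≡.trans (X-coeff k) (≡.sym (≡.trans (U.*-congʳ {PZ.X} (U.reflexive (DU.kron-diagonal i)) k) (U.*-identityˡ PZ.X k)))
  where
  X-coeff : ∀ k → coeff (ℤ.0ℤ ∷ ℤ.1ℤ ∷ []) k ≡ PZ.X k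
  X-coeff zero          = ≡.refl
  X-coeff (suc zero)    = ≡.refl
  X-coeff (suc (suc k)) = ≡.refl
... | no i≢j = ≡.sym (≡.trans (U.*-congʳ {PZ.X} (U.reflexive (DU.kron-off i≢j)) k) (U.zeroˡ PZ.X k))

δ≡χ : ∀ {n} (T : Tree n) k → δ T k ≡ χ (TreeMatrices.D T) k
δ≡χ T k = ≡.trans (HomDet.det-homo coeffHom (λ i j → constᴾ (+ dist T i j) +ᴾ -ᴾ xI i j) k) (DU.Det-cong entry k)
  where
  const-coeff : ∀ x k → coeff (constᴾ x) k ≡ PZ.const x k
  const-coeff x zero    = ≡.refl
  const-coeff x (suc k) = ≡.refl
  entry : ∀ i j → coeff (constᴾ (+ dist T i j) +ᴾ -ᴾ xI i j) U.≈ pencil (TreeMatrices.D T) i j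
  entry i j k = ≡.trans (coeff-+ (constᴾ (+ dist T i j)) (-ᴾ xI i j) k) (≡.cong₂ ℤ._+_
    (≡.trans (const-coeff (+ dist T i j) k) (≡.cong (λ d → PZ.const (+ d) k) (≡.sym (TreeMatrices.ℓ≡dist T i j))))
    (≡.trans (coeff-map ℤ.-_ ≡.refl (xI i j) k) (≡.cong ℤ.-_ (xI-coeff i j k))))

Det-scalar : ∀ {s} x (A : Fin s → Fin s → ℤ) → DZ.Det (λ i j → x ℤ.* A i j) ≡ x ℤ.^ s ℤ.* DZ.Det A
Det-scalar {s} x A = ≡.trans (DZ.Det-scale (λ _ → x) A) (≡.cong (ℤ._* DZ.Det A) (∏-const x s))

^-pos : ∀ {x} s → ℤ.0ℤ ℤ.< x → ℤ.0ℤ ℤ.< x ℤ.^ s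
^-pos     zero    0<x = ℤ.+<+ (ℕ.s≤s ℕ.z≤n)
^-pos {x} (suc s) 0<x = *-pos {x} {x ℤ.^ s} 0<x (^-pos s 0<x)

cancel-≤ : ∀ {x y} z → ℤ.0ℤ ℤ.< z → z ℤ.* x ℤ.≤ z ℤ.* y → x ℤ.≤ y
cancel-≤ {x} {y} z 0<z = ℤₚ.*-cancelˡ-≤-pos x y z {{ℤ.positive 0<z}}

cancel-< : ∀ {x y} z → ℤ.0ℤ ℤ.< z → z ℤ.* x ℤ.< z ℤ.* y → x ℤ.< y
cancel-< {x} {y} z 0<z = ℤₚ.*-cancelˡ-<-nonNeg z {{ℤ.nonNegative (ℤₚ.<⇒≤ 0<z)}}

mono-≤ : ∀ {x y} z → ℤ.0ℤ ℤ.≤ z → x ℤ.≤ y → z ℤ.* x ℤ.≤ z ℤ.* y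
mono-≤ z 0≤z = ℤₚ.*-monoˡ-≤-nonNeg z {{ℤ.nonNegative 0≤z}}

mono-< : ∀ {x y} z → ℤ.0ℤ ℤ.< z → x ℤ.< y → z ℤ.* x ℤ.< z ℤ.* y
mono-< z 0<z = ℤₚ.*-monoˡ-<-pos z {{ℤ.positive 0<z}}

/-cancel-≤ : ∀ i j r .{{_ : ℕ.NonZero r}} → (i ℚ./ r) ℚ.≤ (j ℚ./ r) → i ℤ.≤ j
/-cancel-≤ i j (suc r) p = ℤₚ.*-cancelʳ-≤-pos i j (+ suc r) (ℚᵘₚ.drop-*≤* (ℚᵘₚ.≤-respˡ-≃ (ℚₚ.toℚᵘ-fromℚᵘ (ℚᵘ.mkℚᵘ i r))
  (ℚᵘₚ.≤-respʳ-≃ (ℚₚ.toℚᵘ-fromℚᵘ (ℚᵘ.mkℚᵘ j r)) (ℚₚ.toℚᵘ-mono-≤ p))))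

module Coefficients (t : ℕ) (T : Tree (3 ℕ.+ t)) where
  open TreeMatrices T
  open TreeCounts T

  n s : ℕ
  n = 3 ℕ.+ t
  s = 2 ℕ.+ t

  ε : ℤ
  ε = ℤ.-1ℤ ℤ.^ s

  ε² : ε ℤ.* ε ≡ ℤ.1ℤ
  ε² = square s
    where
    square : ∀ s → ℤ.-1ℤ ℤ.^ s ℤ.* ℤ.-1ℤ ℤ.^ s ≡ ℤ.1ℤ
    square zero    = ≡.refl
    square (suc s) = ≡.trans (solve 1 (λ e → (con ℤ.-1ℤ :* e) :* (con ℤ.-1ℤ :* e) := e :* e) ≡.refl (ℤ.-1ℤ ℤ.^ s)) (square s)

  -- The coefficients without their common sign.
  c′ : ℕ → ℤ
  c′ k = ε ℤ.* χ D k

  c′*c′ : ∀ k l → c′ k ℤ.* c′ l ≡ χ D k ℤ.* χ D l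
  c′*c′ k l = ≡.trans (solve 3 (λ e x y → (e :* x) :* (e :* y) := (e :* e) :* (x :* y)) ≡.refl ε (χ D k) (χ D l))
    (≡.trans (≡.cong (ℤ._* (χ D k ℤ.* χ D l)) ε²) (ℤₚ.*-identityˡ _))

  m : ℤ
  m = + n ℤ.- ℤ.1ℤ

  open StrictNewton D D-sym M (+ 2 ℤ.* m) (λ ()) D*M using (newton-strict; χ₀≢0)

  minor-sign : ∀ {s} (φ : Fin (suc s) → Fin n) → ℤ.0ℤ ℤ.≤ ℤ.-1ℤ ℤ.^ s ℤ.* DZ.Det (λ i j → D (φ i) (φ j))
  -- The integer vectors have half squared distances 4 D, so the sign is first found for 4 D and the
  -- factor 4^(s+1) is cancelled.
  minor-sign {s} φ = cancel-≤ ((+ 4) ℤ.^ suc s) (^-pos (suc s) (ℤ.+<+ (ℕ.s≤s ℕ.z≤n)))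
    (≡.subst₂ ℤ._≤_ (≡.sym (ℤₚ.*-zeroʳ ((+ 4) ℤ.^ suc s)))
      (≡.trans (≡.cong (ℤ.-1ℤ ℤ.^ s ℤ.*_) (Det-scalar (+ 4) (λ i j → D (φ i) (φ j))))
        (solve 3 (λ e f x → e :* (f :* x) := f :* (e :* x)) ≡.refl (ℤ.-1ℤ ℤ.^ s) ((+ 4) ℤ.^ suc s) (DZ.Det λ i j → D (φ i) (φ j))))
      (NegativeType.submatrix-sign (λ i j → + 4 ℤ.* D i j) (λ i → ≡.cong (+ 4 ℤ.*_) (D-diagonal i)) (λ i j → ≡.cong (+ 4 ℤ.*_) (D-sym i j))
        arcs edgeVector gram φ))

  c′-nonneg : ∀ k → suc k ℕ.≤ s → ℤ.0ℤ ℤ.≤ c′ k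
  c′-nonneg k k<s = χ-sign D minor-sign k (λ i → i) k<s

  -- If c′ (k + 1) were 0, strict log-concavity would make c′ k · c′ (k + 2) negative, although both
  -- factors are nonnegative. The right neighbour has to lie in the range of `c′-nonneg`, so one
  -- index is lost.
  c′-pos : ∀ k → suc (suc k) ℕ.≤ s → ℤ.0ℤ ℤ.< c′ k
  c′-pos k k<s = ℤₚ.≤∧≢⇒< (c′-nonneg k (ℕₚ.<⇒≤ k<s)) (nonzero k k<s)
    where
    nonzero : ∀ k → suc (suc k) ℕ.≤ s → ℤ.0ℤ ≢ c′ k
    nonzero zero    _   0≡ = χ₀≢0 ([ (λ ε≡0 → contradiction (≡.trans (≡.sym ε²) (≡.cong (λ e → e ℤ.* e) ε≡0)) λ ()) , (λ eq → eq) ]′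
      (ℤₚ.i*j≡0⇒i≡0∨j≡0 ε (≡.sym 0≡)))
    nonzero (suc k) k<s 0≡ = ℤₚ.<⇒≱ (≡.subst₂ ℤ._<_ (≡.sym (c′*c′ k (2 ℕ.+ k))) (≡.sym (c′*c′ (suc k) (suc k))) (newton-strict k (ℕₚ.≤-trans (ℕₚ.n≤1+n (suc k)) (ℕₚ.≤-trans (ℕₚ.<⇒≤ k<s) (ℕₚ.n≤1+n s)))))
      (ℤₚ.≤-trans (ℤₚ.≤-reflexive (≡.cong (λ x → x ℤ.* x) (≡.sym 0≡)))
        (*-nonneg (c′-nonneg k (ℕₚ.≤-trans (ℕₚ.n≤1+n (suc k)) (ℕₚ.<⇒≤ k<s))) (c′-nonneg (2 ℕ.+ k) k<s)))

  newton′ : ∀ k q → n ≡ suc k ℕ.+ q →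
            + suc (suc k) ℤ.* + suc q ℤ.* (c′ k ℤ.* c′ (suc (suc k))) ℤ.≤ + suc k ℤ.* + q ℤ.* (c′ (suc k) ℤ.* c′ (suc k))
  newton′ k q n≡ = ≡.subst₂ (λ x y → + suc (suc k) ℤ.* + suc q ℤ.* x ℤ.≤ + suc k ℤ.* + q ℤ.* y)
    (≡.sym (c′*c′ k (2 ℕ.+ k))) (≡.sym (c′*c′ (suc k) (suc k))) (Newton.newton D D-sym k q n≡)

  -- Newton's inequalities make c′ (k + 1) / c′ k times (k + 1) / (n - k) decrease in k.
  ratio : ∀ k q → n ≡ k ℕ.+ q → suc (suc k) ℕ.≤ s →
          + n ℤ.* + suc k ℤ.* (c′ (suc k) ℤ.* c′ 0) ℤ.≤ + q ℤ.* (c′ 1 ℤ.* c′ k)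
  ratio zero    q ≡.refl _   = ℤₚ.≤-reflexive (solve 3 (λ n x y → n :* con ℤ.1ℤ :* (x :* y) := n :* (x :* y)) ≡.refl (+ n) (c′ 1) (c′ 0))
  ratio (suc k) q n≡     k<s = cancel-≤ f 0<f (begin
    f ℤ.* (+ n ℤ.* + suc (suc k) ℤ.* (a₂ ℤ.* a₀))
      ≡⟨ solve 6 (λ q n k x y w → (q :* x) :* (n :* k :* (w :* y)) := (n :* y) :* (k :* q :* (x :* w))) ≡.refl (+ suc q) (+ n) (+ suc (suc k)) aₖ a₀ a₂ ⟩
    (+ n ℤ.* a₀) ℤ.* (+ suc (suc k) ℤ.* + suc q ℤ.* (aₖ ℤ.* a₂))
      ≤⟨ mono-≤ (+ n ℤ.* a₀) (*-nonneg (0≤+ n) (c′-nonneg 0 (ℕ.s≤s ℕ.z≤n))) (newton′ k q n≡) ⟩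
    (+ n ℤ.* a₀) ℤ.* (+ suc k ℤ.* + q ℤ.* (a₁ ℤ.* a₁))
      ≡⟨ solve 5 (λ n y k q x → (n :* y) :* (k :* q :* (x :* x)) := (q :* x) :* (n :* k :* (x :* y))) ≡.refl (+ n) a₀ (+ suc k) (+ q) a₁ ⟩
    (+ q ℤ.* a₁) ℤ.* (+ n ℤ.* + suc k ℤ.* (a₁ ℤ.* a₀))
      ≤⟨ mono-≤ (+ q ℤ.* a₁) (*-nonneg (0≤+ q) (c′-nonneg (suc k) (ℕₚ.<⇒≤ k<s))) (ratio k (suc q) (≡.trans n≡ (≡.sym (ℕₚ.+-suc k q))) (ℕₚ.<⇒≤ k<s)) ⟩
    (+ q ℤ.* a₁) ℤ.* (+ suc q ℤ.* (c′ 1 ℤ.* aₖ))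
      ≡⟨ solve 5 (λ q r x y w → (q :* x) :* (r :* (y :* w)) := (r :* w) :* (q :* (y :* x))) ≡.refl (+ q) (+ suc q) a₁ (c′ 1) aₖ ⟩
    f ℤ.* (+ q ℤ.* (c′ 1 ℤ.* a₁)) ∎)
    where
    open ℤₚ.≤-Reasoning
    a₀ aₖ a₁ a₂ f : ℤ
    a₀ = c′ 0
    aₖ = c′ k
    a₁ = c′ (suc k)
    a₂ = c′ (suc (suc k))
    f = + suc q ℤ.* aₖ
    0<f : ℤ.0ℤ ℤ.< f
    0<f = *-pos {+ suc q} {aₖ} (ℤ.+<+ (ℕ.s≤s ℕ.z≤n)) (c′-pos k (ℕₚ.<⇒≤ k<s))

  N W Z′ : ℤ
  N = + numP₃ T
  W = + 2 ℤ.* + n ℤ.* m ℤ.- + 2 ℤ.* N ℤ.- + 4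
  Z′ = m ℤ.* (+ n ℤ.- + 2)

  2≤n : 2 ℕ.≤ n
  2≤n = ℕ.s≤s (ℕ.s≤s ℕ.z≤n)

  -- By `χ-derivative`, δ₁ is minus the sum of the principal cofactors, and `principalCofactor`
  -- expresses these by the diagonal of `M`.
  c′-one : (+ 2 ℤ.* m) ℤ.* c′ 1 ≡ W ℤ.* c′ 0
  c′-one = begin
    μ ℤ.* (ε ℤ.* χ D 1)
      ≡⟨ ≡.cong (λ x → μ ℤ.* (ε ℤ.* x)) (≡.trans (≡.sym (ℤₚ.*-identityˡ (χ D 1))) (χ-derivative D 0)) ⟩
    μ ℤ.* (ε ℤ.* ℤ.- DZ.∑ f)
      ≡⟨ solve 3 (λ m e x → m :* (e :* (:- x)) := :- (e :* (m :* x))) ≡.refl μ ε (DZ.∑ f) ⟩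
    ℤ.- (ε ℤ.* (μ ℤ.* DZ.∑ f))
      ≡⟨ ≡.cong (λ x → ℤ.- (ε ℤ.* x)) sum≡ ⟩
    ℤ.- (ε ℤ.* (χ D 0 ℤ.* DZ.∑ (λ v → M v v)))
      ≡⟨ ≡.cong (λ x → ℤ.- (ε ℤ.* (χ D 0 ℤ.* x))) (trace-M 2≤n) ⟩
    ℤ.- (ε ℤ.* (χ D 0 ℤ.* ℤ.- W))
      ≡⟨ solve 3 (λ e x w → :- (e :* (x :* (:- w))) := w :* (e :* x)) ≡.refl ε (χ D 0) W ⟩
    W ℤ.* (ε ℤ.* χ D 0) ∎
    where
    open ≡.≡-Reasoning
    μ : ℤ
    μ = + 2 ℤ.* m
    f : Fin n → ℤ
    f v = χ (deleteVertex D v) 0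
    M*D : ∀ i j → DZ.∑ (λ e → M i e ℤ.* D e j) ≡ μ ℤ.* DZ.kron i j
    M*D i j = ≡.trans (DZ.∑-cong λ e → ≡.trans (ℤₚ.*-comm (M i e) (D e j)) (≡.cong₂ ℤ._*_ (D-sym e j) (M-sym i e)))
      (≡.trans (D*M j i) (≡.cong (μ ℤ.*_) (DZ.kron-sym j i)))
    sum≡ : μ ℤ.* DZ.∑ f ≡ χ D 0 ℤ.* DZ.∑ (λ v → M v v)
    sum≡ = ≡.trans (≡.sym (∑-*ᶻ μ f)) (≡.trans (DZ.∑-cong λ v → ≡.trans (≡.cong (μ ℤ.*_) (χ-zero (deleteVertex D v)))
      (≡.trans (principalCofactor D M μ M*D v) (≡.trans (ℤₚ.*-comm (M v v) (DZ.Det D)) (≡.cong (ℤ._* M v v) (≡.sym (χ-zero D))))))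
      (∑-*ᶻ (χ D 0) (λ v → M v v)))

  0<m : ℤ.0ℤ ℤ.< m
  0<m = ℤ.+<+ (ℕ.s≤s ℕ.z≤n)

  0<n-2 : ℤ.0ℤ ℤ.< + n ℤ.- + 2
  0<n-2 = ℤ.+<+ (ℕ.s≤s ℕ.z≤n)

  -- As W / (2 (n - 1)) is |δ₁ / δ₀|, the conclusion makes the bound of `ratio` smaller than 1/2.
  -- The last hypothesis is (n - k) (2 - ρ) ≤ k for ρ = 2 N / Z′. The proof splits (n - 2) W into n
  -- (2 Z′ - 2 N), bounded by that hypothesis, then 4 N, bounded by `rest`, and -4 (n - 2), which
  -- makes the inequality strict.
  W-bound : ∀ k q → n ≡ k ℕ.+ q → 0 ℕ.< q → + q ℤ.* (+ 2 ℤ.* Z′ ℤ.- + 2 ℤ.* N) ℤ.≤ + k ℤ.* Z′ →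
            + q ℤ.* W ℤ.< m ℤ.* + n ℤ.* + suc k
  W-bound k q n≡ 0<q cond = cancel-< (+ n ℤ.- + 2) 0<n-2 (begin-strict
    (+ n ℤ.- + 2) ℤ.* (+ q ℤ.* W)
      ≡⟨ solve 3 (λ n q N → (n :- con (+ 2)) :* (q :* (con (+ 2) :* n :* (n :- con ℤ.1ℤ) :- con (+ 2) :* N :- con (+ 4)))
           := (n :* (q :* (con (+ 2) :* ((n :- con ℤ.1ℤ) :* (n :- con (+ 2))) :- con (+ 2) :* N)) :+ q :* (con (+ 4) :* N)) :- con (+ 4) :* (q :* (n :- con (+ 2))))
           ≡.refl (+ n) (+ q) N ⟩
    (+ n ℤ.* (+ q ℤ.* (+ 2 ℤ.* Z′ ℤ.- + 2 ℤ.* N)) ℤ.+ + q ℤ.* (+ 4 ℤ.* N)) ℤ.- + 4 ℤ.* (+ q ℤ.* (+ n ℤ.- + 2))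
      ≤⟨ ℤₚ.+-monoˡ-≤ (ℤ.- (+ 4 ℤ.* (+ q ℤ.* (+ n ℤ.- + 2)))) (ℤₚ.+-mono-≤ (mono-≤ (+ n) (0≤+ n) cond) rest) ⟩
    (+ n ℤ.* (+ k ℤ.* Z′) ℤ.+ + n ℤ.* Z′) ℤ.- + 4 ℤ.* (+ q ℤ.* (+ n ℤ.- + 2))
      <⟨ ℤₚ.+-monoʳ-< (+ n ℤ.* (+ k ℤ.* Z′) ℤ.+ + n ℤ.* Z′) (ℤₚ.neg-mono-< (*-pos {+ 4} {+ q ℤ.* (+ n ℤ.- + 2)} (ℤ.+<+ (ℕ.s≤s ℕ.z≤n)) (*-pos (ℤ.+<+ 0<q) 0<n-2))) ⟩
    (+ n ℤ.* (+ k ℤ.* Z′) ℤ.+ + n ℤ.* Z′) ℤ.- ℤ.0ℤ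
      ≡⟨ solve 2 (λ n k → (n :* (k :* ((n :- con ℤ.1ℤ) :* (n :- con (+ 2)))) :+ n :* ((n :- con ℤ.1ℤ) :* (n :- con (+ 2)))) :- con ℤ.0ℤ
           := (n :- con (+ 2)) :* ((n :- con ℤ.1ℤ) :* n :* (con ℤ.1ℤ :+ k))) ≡.refl (+ n) (+ k) ⟩
    (+ n ℤ.- + 2) ℤ.* (m ℤ.* + n ℤ.* + suc k) ∎)
    where
    open ℤₚ.≤-Reasoning
    -- 2 N ≤ Z′ turns q (4 N) into q (3 Z′ - 2 N), which cond bounds.
    rest : + q ℤ.* (+ 4 ℤ.* N) ℤ.≤ + n ℤ.* Z′
    rest = begin
      + q ℤ.* (+ 4 ℤ.* N)
        ≡⟨ solve 2 (λ q N → q :* (con (+ 4) :* N) := q :* (con (+ 3) :* (con (+ 2) :* N) :- con (+ 2) :* N)) ≡.refl (+ q) N ⟩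
      + q ℤ.* (+ 3 ℤ.* (+ 2 ℤ.* N) ℤ.- + 2 ℤ.* N)
        ≤⟨ mono-≤ (+ q) (0≤+ q) (ℤₚ.+-monoˡ-≤ (ℤ.- (+ 2 ℤ.* N)) (mono-≤ (+ 3) (0≤+ 3) (numP₃-bound 2≤n))) ⟩
      + q ℤ.* (+ 3 ℤ.* Z′ ℤ.- + 2 ℤ.* N)
        ≡⟨ solve 3 (λ q z N → q :* (con (+ 3) :* z :- con (+ 2) :* N) := q :* (con (+ 2) :* z :- con (+ 2) :* N) :+ q :* z) ≡.refl (+ q) Z′ N ⟩
      + q ℤ.* (+ 2 ℤ.* Z′ ℤ.- + 2 ℤ.* N) ℤ.+ + q ℤ.* Z′
        ≤⟨ ℤₚ.+-monoˡ-≤ (+ q ℤ.* Z′) cond ⟩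
      + k ℤ.* Z′ ℤ.+ + q ℤ.* Z′
        ≡⟨ ≡.trans (≡.sym (ℤₚ.*-distribʳ-+ Z′ (+ k) (+ q))) (≡.cong (ℤ._* Z′) (≡.trans (≡.sym (ℤₚ.pos-+ k q)) (≡.cong +_ (≡.sym n≡)))) ⟩
      + n ℤ.* Z′ ∎

  descent : ∀ k q → n ≡ k ℕ.+ q → suc (suc k) ℕ.≤ s → + q ℤ.* (+ 2 ℤ.* Z′ ℤ.- + 2 ℤ.* N) ℤ.≤ + k ℤ.* Z′ →
            + 2 ℤ.* c′ (suc k) ℤ.< c′ k
  descent k q n≡ k<s cond = cancel-< y 0<y (cancel-< (c′ 0) (c′-pos 0 (ℕ.s≤s (ℕ.s≤s ℕ.z≤n))) (begin-strict
    c′ 0 ℤ.* (y ℤ.* (+ 2 ℤ.* c′ (suc k)))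
      ≡⟨ solve 5 (λ x m n k w → x :* (m :* n :* k :* (con (+ 2) :* w)) := (con (+ 2) :* m) :* (n :* k :* (w :* x))) ≡.refl (c′ 0) m (+ n) (+ suc k) (c′ (suc k)) ⟩
    (+ 2 ℤ.* m) ℤ.* (+ n ℤ.* + suc k ℤ.* (c′ (suc k) ℤ.* c′ 0))
      ≤⟨ mono-≤ (+ 2 ℤ.* m) (*-nonneg (0≤+ 2) (ℤₚ.<⇒≤ 0<m)) (ratio k q n≡ k<s) ⟩
    (+ 2 ℤ.* m) ℤ.* (+ q ℤ.* (c′ 1 ℤ.* c′ k))
      ≡⟨ solve 4 (λ m q x y → m :* (q :* (x :* y)) := (m :* x) :* (q :* y)) ≡.refl (+ 2 ℤ.* m) (+ q) (c′ 1) (c′ k) ⟩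
    (+ 2 ℤ.* m) ℤ.* c′ 1 ℤ.* (+ q ℤ.* c′ k)
      ≡⟨ ≡.cong (ℤ._* (+ q ℤ.* c′ k)) c′-one ⟩
    W ℤ.* c′ 0 ℤ.* (+ q ℤ.* c′ k)
      ≡⟨ solve 4 (λ w x q y → w :* x :* (q :* y) := x :* (y :* (q :* w))) ≡.refl W (c′ 0) (+ q) (c′ k) ⟩
    c′ 0 ℤ.* (c′ k ℤ.* (+ q ℤ.* W))
      <⟨ mono-< (c′ 0) (c′-pos 0 (ℕ.s≤s (ℕ.s≤s ℕ.z≤n))) (mono-< (c′ k) (c′-pos k k<s) (W-bound k q n≡ 0<q cond)) ⟩
    c′ 0 ℤ.* (c′ k ℤ.* y)
      ≡⟨ ≡.cong (c′ 0 ℤ.*_) (ℤₚ.*-comm (c′ k) y) ⟩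
    c′ 0 ℤ.* (y ℤ.* c′ k) ∎))
    where
    open ℤₚ.≤-Reasoning
    y : ℤ
    y = m ℤ.* + n ℤ.* + suc k
    0<y : ℤ.0ℤ ℤ.< y
    0<y = *-pos {m ℤ.* + n} {+ suc k} (*-pos {m} {+ n} 0<m (ℤ.+<+ (ℕ.s≤s ℕ.z≤n))) (ℤ.+<+ (ℕ.s≤s ℕ.z≤n))
    0<q : 0 ℕ.< q
    0<q = ℕₚ.n≢0⇒n>0 λ { ≡.refl → ℕₚ.<⇒≱ (ℕₚ.≤-trans k<s (ℕₚ.n≤1+n s)) (ℕₚ.≤-trans (ℕₚ.≤-reflexive (≡.trans n≡ (ℕₚ.+-identityʳ k))) (ℕₚ.n≤1+n k)) }

  ∣δ∣ : ∀ k → suc k ℕ.≤ s → + ℤ.∣ δ T k ∣ ≡ c′ k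
  ∣δ∣ k k<s = begin
    + ℤ.∣ δ T k ∣                      ≡⟨ ≡.cong (λ x → + ℤ.∣ x ∣) (δ≡χ T k) ⟩
    + ℤ.∣ χ D k ∣                      ≡⟨ ≡.cong +_ (ℕₚ.*-identityˡ ℤ.∣ χ D k ∣) ⟨
    + (1 ℕ.* ℤ.∣ χ D k ∣)              ≡⟨ ≡.cong (λ x → + (x ℕ.* ℤ.∣ χ D k ∣)) ∣ε∣ ⟨
    + (ℤ.∣ ε ∣ ℕ.* ℤ.∣ χ D k ∣)        ≡⟨ ≡.cong +_ (ℤₚ.abs-* ε (χ D k)) ⟨
    + ℤ.∣ c′ k ∣                       ≡⟨ ℤₚ.0≤i⇒+∣i∣≡i (c′-nonneg k k<s) ⟩
    c′ k ∎
    where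
    open ≡.≡-Reasoning
    ∣ε∣ : ℤ.∣ ε ∣ ≡ 1
    ∣ε∣ = abs s
      where
      abs : ∀ s → ℤ.∣ ℤ.-1ℤ ℤ.^ s ∣ ≡ 1
      abs zero    = ≡.refl
      abs (suc s) = ≡.trans (ℤₚ.abs-* ℤ.-1ℤ (ℤ.-1ℤ ℤ.^ s)) (≡.trans (ℕₚ.*-identityˡ _) (abs s))

  d-≤ : ∀ k → d T k ℚ.≤ d T (suc k) → + ℤ.∣ δ T k ∣ ℤ.≤ + 2 ℤ.* + ℤ.∣ δ T (suc k) ∣
  d-≤ k p = ≡.subst (+ ℤ.∣ δ T k ∣ ℤ.≤_) (ℤₚ.pos-* 2 ℤ.∣ δ T (suc k) ∣) (ℤ.+≤+ (ℕₚ.*-cancelˡ-≤ (2 ℕ.^ k) {{ℕₚ.m^n≢0 2 k}}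
    (≡.subst (2 ℕ.^ k ℕ.* ℤ.∣ δ T k ∣ ℕ.≤_)
      (≡.trans (≡.cong (ℕ._* ℤ.∣ δ T (suc k) ∣) (ℕₚ.*-comm 2 (2 ℕ.^ k))) (ℕₚ.*-assoc (2 ℕ.^ k) 2 ℤ.∣ δ T (suc k) ∣))
      (ℤ.drop‿+≤+ (/-cancel-≤ (+ x) (+ y) r {{r≢0}} p)))))
    where
    r x y : ℕ
    r = 2 ℕ.^ (n ∸ 2)
    x = 2 ℕ.^ k ℕ.* ℤ.∣ δ T k ∣
    y = 2 ℕ.^ suc k ℕ.* ℤ.∣ δ T (suc k) ∣
    r≢0 : ℕ.NonZero r
    r≢0 = ℕₚ.m^n≢0 2 (n ∸ 2)

  -- If l came before the peak k, the sequence would not fall from l to l + 1, against `descent` at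
  -- l. The bound k ≤ n - 2 keeps l in the range where `descent` applies.
  peak-≤ : ∀ k l → IsPeak (d T) (n ∸ 2) k → (+ n ℤ.- + l) ℤ.* (+ 2 ℤ.* Z′ ℤ.- + 2 ℤ.* N) ℤ.≤ + l ℤ.* Z′ → k ℕ.≤ l
  peak-≤ k l (k≤n-2 , up , _) cond = ℕₚ.≮⇒≥ λ l<k →
    let l+1<s : suc (suc l) ℕ.≤ s
        l+1<s = ℕ.s≤s (ℕₚ.≤-trans l<k k≤n-2)
        q = n ∸ l
        n≡ : n ≡ l ℕ.+ q
        n≡ = ≡.sym (ℕₚ.m+[n∸m]≡n (ℕₚ.≤-trans (ℕₚ.n≤1+n l) (ℕₚ.≤-trans (ℕₚ.n≤1+n (suc l)) (ℕₚ.≤-trans l+1<s (ℕₚ.n≤1+n s)))))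
        q≡ : + q ≡ + n ℤ.- + l
        q≡ = ≡.trans (solve 2 (λ l q → q := (l :+ q) :- l) ≡.refl (+ l) (+ q)) (≡.cong (ℤ._- + l) (≡.trans (≡.sym (ℤₚ.pos-+ l q)) (≡.cong +_ (≡.sym n≡))))
        strict = descent l q n≡ l+1<s (≡.subst (λ x → x ℤ.* (+ 2 ℤ.* Z′ ℤ.- + 2 ℤ.* N) ℤ.≤ + l ℤ.* Z′) (≡.sym q≡) cond)
    in ℤₚ.<⇒≱ strict (≡.subst₂ (λ x y → x ℤ.≤ + 2 ℤ.* y) (∣δ∣ l (ℕₚ.<⇒≤ l+1<s)) (∣δ∣ (suc l) l+1<s) (d-≤ l (up l l<k)))

open ℚSolver.+-*-Solver using () renaming (solve to solveℚ; con to conℚ; _:=_ to _:=ℚ_; _:+_ to _:+ℚ_; _:*_ to _:*ℚ_; :-_ to :-ℚ_; _:-_ to _:-ℚ_)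

-- Real bounds on the peak location

ι : ℤ → ℚ
ι i = i / 1

toℚᵘ-ι : ∀ i → ℚ.toℚᵘ (ι i) ℚᵘ.≃ ℚᵘ.mkℚᵘ i 0
toℚᵘ-ι i = ℚₚ.toℚᵘ-fromℚᵘ (ℚᵘ.mkℚᵘ i 0)

ι-+ : ∀ i j → ι (i ℤ.+ j) ≡ ι i ℚ.+ ι j
ι-+ i j = ℚₚ.toℚᵘ-injective (ℚᵘₚ.≃-trans (toℚᵘ-ι (i ℤ.+ j)) (ℚᵘₚ.≃-trans
  (ℚᵘ.*≡* (solve 2 (λ i j → (i :+ j) :* con (+ 1) := (i :* con (+ 1) :+ j :* con (+ 1)) :* con (+ 1)) ≡.refl i j))
  (ℚᵘₚ.≃-sym (ℚᵘₚ.≃-trans (ℚₚ.toℚᵘ-homo-+ (ι i) (ι j)) (ℚᵘₚ.+-cong (toℚᵘ-ι i) (toℚᵘ-ι j))))))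

ι-* : ∀ i j → ι (i ℤ.* j) ≡ ι i ℚ.* ι j
ι-* i j = ℚₚ.toℚᵘ-injective (ℚᵘₚ.≃-trans (toℚᵘ-ι (i ℤ.* j)) (ℚᵘₚ.≃-sym (ℚᵘₚ.≃-trans (ℚₚ.toℚᵘ-homo-* (ι i) (ι j)) (ℚᵘₚ.*-cong (toℚᵘ-ι i) (toℚᵘ-ι j)))))

ι-neg : ∀ i → ι (ℤ.- i) ≡ ℚ.- ι i
ι-neg i = ℚₚ.toℚᵘ-injective (ℚᵘₚ.≃-trans (toℚᵘ-ι (ℤ.- i)) (ℚᵘₚ.≃-sym (ℚᵘₚ.≃-trans (ℚₚ.toℚᵘ-homo‿- (ι i)) (ℚᵘₚ.-‿cong (toℚᵘ-ι i)))))

ι-mono-≤ : ∀ {i j} → i ℤ.≤ j → ι i ℚ.≤ ι j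
ι-mono-≤ {i} {j} i≤j = ℚₚ.toℚᵘ-cancel-≤ (ℚᵘₚ.≤-respˡ-≃ (ℚᵘₚ.≃-sym (toℚᵘ-ι i)) (ℚᵘₚ.≤-respʳ-≃ (ℚᵘₚ.≃-sym (toℚᵘ-ι j))
  (ℚᵘ.*≤* (≡.subst₂ ℤ._≤_ (≡.sym (ℤₚ.*-identityʳ i)) (≡.sym (ℤₚ.*-identityʳ j)) i≤j))))

ι-mono-< : ∀ {i j} → i ℤ.< j → ι i ℚ.< ι j
ι-mono-< {i} {j} i<j = ℚₚ.≰⇒> λ j≤i → ℤₚ.<⇒≱ i<j (/-cancel-≤ j i 1 j≤i)

floor-* : ∀ q → ℚ.floor q ℤ.* ℚ.↧ q ℤ.≤ ℚ.↥ q
floor-* q@record{} = ℤDivMod.[n/d]*d≤n (ℚ.↥ q) (ℚ.↧ q)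

≤-ceiling : ∀ q → q ℚ.≤ ι (ceiling q)
≤-ceiling q@record{} = ℚₚ.toℚᵘ-cancel-≤ (ℚᵘₚ.≤-respʳ-≃ (ℚᵘₚ.≃-sym (toℚᵘ-ι (ceiling q)))
  (ℚᵘ.*≤* (≡.subst₂ ℤ._≤_ (≡.sym (ℤₚ.*-identityʳ (ℚ.↥ q))) product numerators)))
  where
  f : ℤ
  f = ℚ.floor (ℚ.- q)
  product : ℤ.- f ℤ.* ℚ.↧ (ℚ.- q) ≡ ℤ.- f ℤ.* ℚ.↧ q
  product = ≡.cong (ℤ.- f ℤ.*_) (ℚₚ.↧-neg q)
  numerators : ℚ.↥ q ℤ.≤ ℤ.- f ℤ.* ℚ.↧ (ℚ.- q)
  numerators = ≡.subst₂ ℤ._≤_ (≡.trans (≡.cong ℤ.-_ (ℚₚ.↥-neg q)) (ℤₚ.neg-involutive (ℚ.↥ q))) (ℤₚ.neg-distribˡ-* f (ℚ.↧ (ℚ.- q)))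
    (ℤₚ.neg-mono-≤ (floor-* (ℚ.- q)))

ℚ-*-pos : ∀ {p q} → 0ℚ ℚ.< p → 0ℚ ℚ.< q → 0ℚ ℚ.< p ℚ.* q
ℚ-*-pos {p} {q} 0<p 0<q = ≡.subst (ℚ._< p ℚ.* q) (ℚₚ.*-zeroʳ p) (ℚₚ.*-monoʳ-<-pos p {{ℚ.positive 0<p}} 0<q)

quotient : ∀ {p r} → 0ℚ ℚ.< p → 0ℚ ℚ.< r → ∃[ η ] 0ℚ ℚ.< η × p ℚ.* η ≡ r
quotient {p} {r} 0<p 0<r = 1/p ℚ.* r , ℚ-*-pos (ℚₚ.positive⁻¹ 1/p {{ℚₚ.1/pos⇒pos p {{pos}}}}) 0<r ,
  ≡.trans (≡.sym (ℚₚ.*-assoc p 1/p r)) (≡.trans (≡.cong (ℚ._* r) (ℚₚ.*-inverseʳ p {{nz}})) (ℚₚ.*-identityˡ r))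
  where
  pos = ℚ.positive 0<p
  nz = ℚₚ.pos⇒nonZero p {{pos}}
  1/p = ℚ.1/_ p {{nz}}

*-invℚ : ∀ q → q ≢ 0ℚ → q ℚ.* invℚ q ≡ 1ℚ
*-invℚ q q≢0 with q ℚ.≟ 0ℚ
... | yes q≡0 = contradiction q≡0 q≢0
... | no q≢0′ = ℚₚ.*-inverseʳ q {{ℚ.≢-nonZero q≢0′}}

invℚ-pos : ∀ q → 0ℚ ℚ.< q → 0ℚ ℚ.< invℚ q
invℚ-pos q 0<q with q ℚ.≟ 0ℚ
... | yes ≡.refl = contradiction 0<q (ℚₚ.<-irrefl ≡.refl)
... | no q≢0 = ℚₚ.positive⁻¹ (ℚ.1/_ q {{ℚ.≢-nonZero q≢0}}) {{ℚₚ.1/pos⇒pos q {{ℚ.positive 0<q}}}}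

∣∣<⇒< : ∀ {x y δ} → ℚ.∣ x ℚ.- y ∣ ℚ.< δ → x ℚ.< y ℚ.+ δ
∣∣<⇒< {x} {y} {δ} h = begin-strict
  x                    ≡⟨ solveℚ 2 (λ x y → x :=ℚ y :+ℚ (x :-ℚ y)) ≡.refl x y ⟩
  y ℚ.+ (x ℚ.- y)      ≤⟨ ℚₚ.+-monoʳ-≤ y (below (x ℚ.- y)) ⟩
  y ℚ.+ ℚ.∣ x ℚ.- y ∣  <⟨ ℚₚ.+-monoʳ-< y h ⟩
  y ℚ.+ δ ∎
  where
  open ℚₚ.≤-Reasoning
  below : ∀ p → p ℚ.≤ ℚ.∣ p ∣
  below p with ℚₚ.≤-total 0ℚ p
  ... | inj₁ 0≤p = ℚₚ.≤-reflexive (≡.sym (ℚₚ.0≤p⇒∣p∣≡p 0≤p))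
  ... | inj₂ p≤0 = ℚₚ.≤-trans p≤0 (ℚₚ.0≤∣p∣ p)

-- x ≤ᴿ y is a negated statement; the Cauchy property of y - x turns it
-- into an eventual bound for every positive η.
≤ᴿ⇒eventually : ∀ x y → x ≤ᴿ y → ∀ {η} → 0ℚ ℚ.< η → ∃[ K ] ∀ i → K ℕ.≤ i → seq x i ℚ.< seq y i ℚ.+ η
≤ᴿ⇒eventually x y x≤y {η} 0<η = decide (z K ℚ.<? θ ℚ.+ θ)
  where
  open ℚₚ.≤-Reasoning
  -- With θ = η / 3, one rational comparison of z K with 2 θ decides. Passing from index K to any
  -- later one costs a further θ, so either x - y < 3 θ or x - y > θ from K on; the second is what x
  -- ≤ y refutes.
  third = quotient {+ 3 / 1} {η} (ℚₚ.positive⁻¹ (+ 3 / 1)) 0<η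
  θ = proj₁ third
  0<θ = proj₁ (proj₂ third)
  3θ≡η = proj₂ (proj₂ third)
  z : ℕ → ℚ
  z = seq (x -ᴿ y)
  K = proj₁ (cauchy (x -ᴿ y) θ 0<θ)
  close = proj₂ (cauchy (x -ᴿ y) θ 0<θ)
  decide : Dec (z K ℚ.< θ ℚ.+ θ) → ∃[ K ] ∀ i → K ℕ.≤ i → seq x i ℚ.< seq y i ℚ.+ η
  decide (yes small) = K , λ i K≤i → begin-strict
    seq x i                              ≡⟨ solveℚ 2 (λ x y → x :=ℚ y :+ℚ (x :-ℚ y)) ≡.refl (seq x i) (seq y i) ⟩
    seq y i ℚ.+ z i                      <⟨ ℚₚ.+-monoʳ-< (seq y i) (∣∣<⇒< {z i} {z K} (close i K K≤i ℕₚ.≤-refl)) ⟩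
    seq y i ℚ.+ (z K ℚ.+ θ)              <⟨ ℚₚ.+-monoʳ-< (seq y i) (ℚₚ.+-monoˡ-< θ small) ⟩
    seq y i ℚ.+ (θ ℚ.+ θ ℚ.+ θ)          ≡⟨ solveℚ 2 (λ y θ → y :+ℚ (θ :+ℚ θ :+ℚ θ) :=ℚ y :+ℚ conℚ (+ 3 / 1) :*ℚ θ) ≡.refl (seq y i) θ ⟩
    seq y i ℚ.+ (+ 3 / 1) ℚ.* θ          ≡⟨ ≡.cong (seq y i ℚ.+_) 3θ≡η ⟩
    seq y i ℚ.+ η ∎
  decide (no large) = contradiction (θ , 0<θ , K , λ i K≤i → begin-strict
    seq y i ℚ.+ θ                        ≡⟨ solveℚ 2 (λ y θ → y :+ℚ θ :=ℚ (y :+ℚ (θ :+ℚ θ)) :-ℚ θ) ≡.refl (seq y i) θ ⟩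
    (seq y i ℚ.+ (θ ℚ.+ θ)) ℚ.- θ        ≤⟨ ℚₚ.+-monoˡ-≤ (ℚ.- θ) (ℚₚ.+-monoʳ-≤ (seq y i) (ℚₚ.≮⇒≥ large)) ⟩
    (seq y i ℚ.+ z K) ℚ.- θ              <⟨ ℚₚ.+-monoˡ-< (ℚ.- θ) (ℚₚ.+-monoʳ-< (seq y i) (∣∣<⇒< {z K} {z i} (close K i ℕₚ.≤-refl K≤i))) ⟩
    (seq y i ℚ.+ (z i ℚ.+ θ)) ℚ.- θ      ≡⟨ solveℚ 3 (λ x y θ → (y :+ℚ ((x :-ℚ y) :+ℚ θ)) :-ℚ θ :=ℚ x) ≡.refl (seq x i) (seq y i) θ ⟩
    seq x i ∎) x≤y

twice-C₂ : ∀ l → + 2 ℤ.* + (suc (suc l) C 2) ≡ + suc (suc l) ℤ.* + suc l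
twice-C₂ l = ≡.trans (≡.sym (ℤₚ.pos-* 2 (suc (suc l) C 2))) (≡.trans (≡.cong +_ natural) (ℤₚ.pos-* (suc (suc l)) (suc l)))
  where
  u : ℕ
  u = suc (suc l)
  natural : 2 ℕ.* (u C 2) ≡ u ℕ.* suc l
  natural = ℕₚ.+-cancelʳ-≡ (1 ℕ.* (u C 1)) _ _ (≡.trans (C-recurrence u 1) (≡.trans (≡.cong (u ℕ.*_) (Combinatorics.nC1≡n u))
    (≡.trans (ℕₚ.*-suc u (suc l)) (≡.trans (ℕₚ.+-comm u (u ℕ.* suc l)) (≡.cong (u ℕ.* suc l ℕ.+_) (≡.sym (≡.trans (ℕₚ.*-identityˡ _) (Combinatorics.nC1≡n u))))))))

module Bounds (t : ℕ) (T : Tree (3 ℕ.+ t)) where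
  open Coefficients t T using (n; N; Z′; peak-≤; 0<m; 0<n-2; 2≤n)
  open TreeCounts T using (numP₃-bound)

  pairs : ℤ
  pairs = + ((n ∸ 1) C 2)

  2pairs≡Z′ : + 2 ℤ.* pairs ≡ Z′
  2pairs≡Z′ = twice-C₂ t

  0<Z′ : ℤ.0ℤ ℤ.< Z′
  0<Z′ = *-pos {+ n ℤ.- ℤ.1ℤ} {+ n ℤ.- + 2} 0<m 0<n-2

  0<pairs : ℤ.0ℤ ℤ.< pairs
  0<pairs = cancel-< (+ 2) (ℤ.+<+ (ℕ.s≤s ℕ.z≤n)) (≡.subst (ℤ.0ℤ ℤ.<_) (≡.sym 2pairs≡Z′) 0<Z′)

  N≤pairs : N ℤ.≤ pairs
  N≤pairs = cancel-≤ (+ 2) (ℤ.+<+ (ℕ.s≤s ℕ.z≤n)) (≡.subst (+ 2 ℤ.* N ℤ.≤_) (≡.sym 2pairs≡Z′) (numP₃-bound 2≤n))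

  -- The case ρ = 0, treated over the rationals because the ceiling can be computed here. With 3 l ≥
  -- 2 n, l ≤ n and N ≥ 0 the condition of `peak-≤` is a sum of nonnegative terms; l ≤ n is
  -- available since only the case in which the ceiling l is below k has to be refuted.
  universal : ∀ k → IsPeak (d T) (n ∸ 2) k → + k ℤ.≤ ceiling ((+ 2 / 3) ℚ.* (+ n / 1))
  universal k peak = decide (+ k ℤ.≤? M′)
    where
    M′ : ℤ
    M′ = ceiling ((+ 2 / 3) ℚ.* (+ n / 1))
    2n≤3M : + 2 ℤ.* + n ℤ.≤ + 3 ℤ.* M′
    2n≤3M = /-cancel-≤ (+ 2 ℤ.* + n) (+ 3 ℤ.* M′) 1 (begin
      ι (+ 2 ℤ.* + n)                                    ≡⟨ ι-* (+ 2) (+ n) ⟩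
      ι (+ 2) ℚ.* ι (+ n)                                ≡⟨ solveℚ 1 (λ n → conℚ (+ 2 / 1) :*ℚ n :=ℚ conℚ (+ 3 / 1) :*ℚ (conℚ (+ 2 / 3) :*ℚ n)) ≡.refl (ι (+ n)) ⟩
      ι (+ 3) ℚ.* ((+ 2 / 3) ℚ.* ι (+ n))                ≤⟨ ℚₚ.*-monoˡ-≤-nonNeg (ι (+ 3)) (≤-ceiling ((+ 2 / 3) ℚ.* (+ n / 1))) ⟩
      ι (+ 3) ℚ.* ι M′                                   ≡⟨ ι-* (+ 3) M′ ⟨
      ι (+ 3 ℤ.* M′) ∎)
      where open ℚₚ.≤-Reasoning
    natural : ∀ x → + 2 ℤ.* + n ℤ.≤ + 3 ℤ.* x → x ℤ.< + k → + k ℤ.≤ x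
    natural ℤ.-[1+ x ] ()
    natural (+ l) 2n≤3l l<k = ℤ.+≤+ (peak-≤ k l peak (ℤₚ.0≤i-j⇒j≤i (≡.subst (ℤ.0ℤ ℤ.≤_) expand
      (ℤₚ.+-mono-≤ (*-nonneg (ℤₚ.i≤j⇒0≤j-i 2n≤3l) (ℤₚ.<⇒≤ 0<Z′)) (*-nonneg (ℤₚ.i≤j⇒0≤j-i l≤n) (*-nonneg (0≤+ 2) (0≤+ (numP₃ T))))))))
      where
      l≤n : + l ℤ.≤ + n
      l≤n = ℤₚ.≤-trans (ℤₚ.<⇒≤ l<k) (ℤ.+≤+ (ℕₚ.≤-trans (proj₁ peak) (ℕₚ.m∸n≤m n 2)))
      expand : (+ 3 ℤ.* + l ℤ.- + 2 ℤ.* + n) ℤ.* Z′ ℤ.+ (+ n ℤ.- + l) ℤ.* (+ 2 ℤ.* N)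
             ≡ + l ℤ.* Z′ ℤ.- (+ n ℤ.- + l) ℤ.* (+ 2 ℤ.* Z′ ℤ.- + 2 ℤ.* N)
      expand = solve 4 (λ l n z N → (con (+ 3) :* l :- con (+ 2) :* n) :* z :+ (n :- l) :* (con (+ 2) :* N)
        := l :* z :- (n :- l) :* (con (+ 2) :* z :- con (+ 2) :* N)) ≡.refl (+ l) (+ n) Z′ N
    decide : Dec (+ k ℤ.≤ M′) → + k ℤ.≤ M′
    decide (yes k≤M) = k≤M
    decide (no k≰M)  = natural M′ 2n≤3M (ℤₚ.≰⇒> k≰M)

  module _ (ρ : ℝ) (0≤ρ : 0ᴿ ≤ᴿ ρ) (ρc≤N : ρ *ᴿ fromℕ ((n ∸ 1) C 2) ≤ᴿ fromℕ (numP₃ T)) where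
    open ℚₚ.≤-Reasoning
    private
      ĉ N̂ n̂ : ℚ
      ĉ = ι pairs
      N̂ = ι N
      n̂ = ι (+ n)

      0<ĉ : 0ℚ ℚ.< ĉ
      0<ĉ = ι-mono-< {ℤ.0ℤ} {pairs} 0<pairs

    upper : ∀ {η} → 0ℚ ℚ.< η → ∃[ K ] ∀ i → K ℕ.≤ i → seq ρ i ℚ.* ĉ ℚ.< N̂ ℚ.+ η
    upper = ≤ᴿ⇒eventually (ρ *ᴿ fromℕ ((n ∸ 1) C 2)) (fromℕ (numP₃ T)) ρc≤N

    -- N ≤ C(n - 1, 2) bounds ρ by 1, but a comparison of reals holds termwise only up to a slack.
    -- The slack `ĉ` turns the bound into 2, which still keeps 3 - ρ above 1.
    ρ<2 : ∃[ K ] ∀ i → K ℕ.≤ i → seq ρ i ℚ.< + 2 / 1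
    ρ<2 = let K , h = upper 0<ĉ in K , λ i K≤i → ℚₚ.*-cancelʳ-<-nonNeg ĉ {{ℚ.nonNegative (ℚₚ.<⇒≤ 0<ĉ)}} (begin-strict
      seq ρ i ℚ.* ĉ            <⟨ h i K≤i ⟩
      N̂ ℚ.+ ĉ                  ≤⟨ ℚₚ.+-monoˡ-≤ ĉ (ι-mono-≤ N≤pairs) ⟩
      ĉ ℚ.+ ĉ                  ≡⟨ solveℚ 1 (λ pairs → pairs :+ℚ pairs :=ℚ conℚ (+ 2 / 1) :*ℚ pairs) ≡.refl ĉ ⟩
      (+ 2 / 1) ℚ.* ĉ ∎)

    1<3-ρ : ∃[ K ] ∀ i → K ℕ.≤ i → 1ℚ ℚ.< seq (fromℕ 3 -ᴿ ρ) i
    1<3-ρ = let K , h = ρ<2 in K , λ i K≤i → ℚₚ.+-monoʳ-< (+ 3 / 1) (ℚₚ.neg-antimono-< (h i K≤i))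

    3-ρ≠0 : (fromℕ 3 -ᴿ ρ) ≠0
    3-ρ≠0 = inj₂ (1ℚ , ℚₚ.positive⁻¹ 1ℚ , 1<3-ρ)

    -- ρ ≥ 0 with slack 3. An eventual upper bound on 3 - ρ is what allows a uniform margin `ε` in
    -- `gap⇒<`.
    3-ρ<6 : ∃[ K ] ∀ i → K ℕ.≤ i → seq (fromℕ 3 -ᴿ ρ) i ℚ.< + 6 / 1
    3-ρ<6 = let K , h = ≤ᴿ⇒eventually 0ᴿ ρ 0≤ρ {+ 3 / 1} (ℚₚ.positive⁻¹ (+ 3 / 1)) in K , λ i K≤i → begin-strict
      (+ 3 / 1) ℚ.- seq ρ i                       ≡⟨ solveℚ 1 (λ r → conℚ (+ 3 / 1) :-ℚ r :=ℚ conℚ 0ℚ :+ℚ (conℚ (+ 3 / 1) :-ℚ r)) ≡.refl (seq ρ i) ⟩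
      0ℚ ℚ.+ ((+ 3 / 1) ℚ.- seq ρ i)              <⟨ ℚₚ.+-monoˡ-< ((+ 3 / 1) ℚ.- seq ρ i) (h i K≤i) ⟩
      (seq ρ i ℚ.+ + 3 / 1) ℚ.+ ((+ 3 / 1) ℚ.- seq ρ i)
        ≡⟨ solveℚ 1 (λ r → (r :+ℚ conℚ (+ 3 / 1)) :+ℚ (conℚ (+ 3 / 1) :-ℚ r) :=ℚ conℚ (+ 6 / 1)) ≡.refl (seq ρ i) ⟩
      + 6 / 1 ∎

    bound : ℝ
    bound = (fromℕ 2 -ᴿ ρ) *ᴿ inv (fromℕ 3 -ᴿ ρ) 3-ρ≠0 *ᴿ fromℕ n

    -- m < (2 - ρ) n / (3 - ρ), multiplied out, with N for ρ c.
    gap⇒< : ∀ m → m ℤ.< + n → m ℤ.* pairs ℤ.< (+ n ℤ.- m) ℤ.* (+ 2 ℤ.* pairs ℤ.- N) → fromℤ m <ᴿ bound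
    gap⇒< m m<n gap = ε , 0<ε , K₁ ℕ.⊔ (K₂ ℕ.⊔ K₃) , λ i K≤i → below i
      (proj₂ (upper 0<η) i (ℕₚ.m⊔n≤o⇒m≤o K₁ (K₂ ℕ.⊔ K₃) K≤i))
      (proj₂ 1<3-ρ i (ℕₚ.m⊔n≤o⇒m≤o K₂ K₃ (ℕₚ.m⊔n≤o⇒n≤o K₁ (K₂ ℕ.⊔ K₃) K≤i)))
      (proj₂ 3-ρ<6 i (ℕₚ.m⊔n≤o⇒n≤o K₂ K₃ (ℕₚ.m⊔n≤o⇒n≤o K₁ (K₂ ℕ.⊔ K₃) K≤i)))
      where
      m̂ p : ℚ
      m̂ = ι m
      p = n̂ ℚ.- m̂
      ι-- : ∀ i j → ι (i ℤ.- j) ≡ ι i ℚ.- ι j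
      ι-- i j = ≡.trans (ι-+ i (ℤ.- j)) (≡.cong (ι i ℚ.+_) (ι-neg j))
      0<p : 0ℚ ℚ.< p
      0<p = ≡.subst (0ℚ ℚ.<_) (ι-- (+ n) m) (ι-mono-< {ℤ.0ℤ} (≡.subst (ℤ._< + n ℤ.- m) (ℤₚ.+-inverseʳ m) (ℤₚ.+-monoˡ-< (ℤ.- m) m<n)))
      0<½ : 0ℚ ℚ.< ½
      0<½ = ℚₚ.positive⁻¹ ½
      -- The hypothesis `gap` is strict between integers, so the difference `g` is at least 1. One
      -- half of it pays for the slack `η` in ρ c ≤ N, which enters with the factor n - m; the other
      -- half pays for the margin `ε`, which enters with the factor ĉ (3 - ρ) < 6 ĉ.
      η : ℚ
      η = proj₁ (quotient 0<p 0<½)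
      0<η : 0ℚ ℚ.< η
      0<η = proj₁ (proj₂ (quotient 0<p 0<½))
      pη≡½ : p ℚ.* η ≡ ½
      pη≡½ = proj₂ (proj₂ (quotient 0<p 0<½))
      0<6ĉ : 0ℚ ℚ.< ĉ ℚ.* (+ 6 / 1)
      0<6ĉ = ℚ-*-pos 0<ĉ (ℚₚ.positive⁻¹ (+ 6 / 1))
      ε : ℚ
      ε = proj₁ (quotient 0<6ĉ 0<½)
      0<ε : 0ℚ ℚ.< ε
      0<ε = proj₁ (proj₂ (quotient 0<6ĉ 0<½))
      6ĉε≡½ : ĉ ℚ.* (+ 6 / 1) ℚ.* ε ≡ ½
      6ĉε≡½ = proj₂ (proj₂ (quotient 0<6ĉ 0<½))
      K₁ = proj₁ (upper 0<η)
      K₂ = proj₁ 1<3-ρ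
      K₃ = proj₁ 3-ρ<6
      g : ℤ
      g = (+ n ℤ.- m) ℤ.* (+ 2 ℤ.* pairs ℤ.- N) ℤ.- m ℤ.* pairs
      1≤g : 1ℚ ℚ.≤ ι g
      1≤g = ι-mono-≤ {+ 1} {g} (ℤₚ.i<j⇒suc[i]≤j (≡.subst (ℤ._< g) (ℤₚ.+-inverseʳ (m ℤ.* pairs)) (ℤₚ.+-monoˡ-< (ℤ.- (m ℤ.* pairs)) gap)))
      ιg : ι g ≡ p ℚ.* ((+ 2 / 1) ℚ.* ĉ ℚ.- N̂) ℚ.- m̂ ℚ.* ĉ
      ιg = ≡.trans (ι-- ((+ n ℤ.- m) ℤ.* (+ 2 ℤ.* pairs ℤ.- N)) (m ℤ.* pairs)) (≡.cong₂ ℚ._-_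
        (≡.trans (ι-* (+ n ℤ.- m) (+ 2 ℤ.* pairs ℤ.- N)) (≡.cong₂ ℚ._*_ (ι-- (+ n) m) (≡.trans (ι-- (+ 2 ℤ.* pairs) N) (≡.cong (ℚ._- N̂) (ι-* (+ 2) pairs)))))
        (ι-* m pairs))
      below : ∀ i → seq ρ i ℚ.* ĉ ℚ.< N̂ ℚ.+ η → 1ℚ ℚ.< seq (fromℕ 3 -ᴿ ρ) i → seq (fromℕ 3 -ᴿ ρ) i ℚ.< + 6 / 1 →
              m̂ ℚ.+ ε ℚ.< seq bound i
      below i rĉ<N̂+η 1<s s<6 = begin-strict
        m̂ ℚ.+ ε                             ≡⟨ ℚₚ.*-identityʳ (m̂ ℚ.+ ε) ⟨
        (m̂ ℚ.+ ε) ℚ.* 1ℚ                    ≡⟨ ≡.cong ((m̂ ℚ.+ ε) ℚ.*_) s*v≡1 ⟨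
        (m̂ ℚ.+ ε) ℚ.* (s ℚ.* v)             ≡⟨ ℚₚ.*-assoc (m̂ ℚ.+ ε) s v ⟨
        (m̂ ℚ.+ ε) ℚ.* s ℚ.* v               <⟨ ℚₚ.*-monoˡ-<-pos v {{ℚ.positive 0<v}} cleared ⟩
        ((+ 2 / 1) ℚ.- r) ℚ.* n̂ ℚ.* v
          ≡⟨ solveℚ 3 (λ x n v → x :*ℚ n :*ℚ v :=ℚ x :*ℚ v :*ℚ n) ≡.refl ((+ 2 / 1) ℚ.- r) n̂ v ⟩
        ((+ 2 / 1) ℚ.- r) ℚ.* v ℚ.* n̂ ∎
        where
        r s v : ℚ
        r = seq ρ i
        s = (+ 3 / 1) ℚ.- r
        v = invℚ s
        0<s : 0ℚ ℚ.< s
        0<s = ℚₚ.<-trans (ℚₚ.positive⁻¹ 1ℚ) 1<s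
        0<v : 0ℚ ℚ.< v
        0<v = invℚ-pos s 0<s
        s*v≡1 : s ℚ.* v ≡ 1ℚ
        s*v≡1 = *-invℚ s (λ s≡0 → ℚₚ.<-irrefl (≡.sym s≡0) 0<s)
        0<ĉε : 0ℚ ℚ.< ĉ ℚ.* ε
        0<ĉε = ℚ-*-pos 0<ĉ 0<ε
        cleared : (m̂ ℚ.+ ε) ℚ.* s ℚ.< ((+ 2 / 1) ℚ.- r) ℚ.* n̂
        cleared = ℚₚ.*-cancelˡ-<-nonNeg ĉ {{ℚ.nonNegative (ℚₚ.<⇒≤ 0<ĉ)}} (begin-strict
          ĉ ℚ.* ((m̂ ℚ.+ ε) ℚ.* s)
            ≡⟨ solveℚ 4 (λ pairs m e s → pairs :*ℚ ((m :+ℚ e) :*ℚ s) :=ℚ pairs :*ℚ m :*ℚ s :+ℚ pairs :*ℚ e :*ℚ s) ≡.refl ĉ m̂ ε s ⟩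
          ĉ ℚ.* m̂ ℚ.* s ℚ.+ ĉ ℚ.* ε ℚ.* s
            <⟨ ℚₚ.+-monoʳ-< (ĉ ℚ.* m̂ ℚ.* s) (ℚₚ.*-monoʳ-<-pos (ĉ ℚ.* ε) {{ℚ.positive 0<ĉε}} s<6) ⟩
          ĉ ℚ.* m̂ ℚ.* s ℚ.+ ĉ ℚ.* ε ℚ.* (+ 6 / 1)
            ≡⟨ ≡.cong (ĉ ℚ.* m̂ ℚ.* s ℚ.+_) (≡.trans (solveℚ 2 (λ pairs e → pairs :*ℚ e :*ℚ conℚ (+ 6 / 1) :=ℚ pairs :*ℚ conℚ (+ 6 / 1) :*ℚ e) ≡.refl ĉ ε) 6ĉε≡½) ⟩
          ĉ ℚ.* m̂ ℚ.* s ℚ.+ ½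
            ≡⟨ solveℚ 1 (λ x → x :+ℚ conℚ ½ :=ℚ (x :-ℚ conℚ ½) :+ℚ conℚ 1ℚ) ≡.refl (ĉ ℚ.* m̂ ℚ.* s) ⟩
          (ĉ ℚ.* m̂ ℚ.* s ℚ.- ½) ℚ.+ 1ℚ
            ≤⟨ ℚₚ.+-monoʳ-≤ (ĉ ℚ.* m̂ ℚ.* s ℚ.- ½) 1≤g ⟩
          (ĉ ℚ.* m̂ ℚ.* s ℚ.- ½) ℚ.+ ι g
            ≡⟨ ≡.cong₂ (λ x y → (ĉ ℚ.* m̂ ℚ.* s ℚ.- x) ℚ.+ y) (≡.sym pη≡½) ιg ⟩
          (ĉ ℚ.* m̂ ℚ.* s ℚ.- p ℚ.* η) ℚ.+ (p ℚ.* ((+ 2 / 1) ℚ.* ĉ ℚ.- N̂) ℚ.- m̂ ℚ.* ĉ)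
            ≡⟨ solveℚ 6 (λ pairs m r n N e → (pairs :*ℚ m :*ℚ (conℚ (+ 3 / 1) :-ℚ r) :-ℚ (n :-ℚ m) :*ℚ e) :+ℚ ((n :-ℚ m) :*ℚ (conℚ (+ 2 / 1) :*ℚ pairs :-ℚ N) :-ℚ m :*ℚ pairs)
                 :=ℚ (conℚ (+ 2 / 1) :*ℚ pairs :*ℚ n :-ℚ r :*ℚ pairs :*ℚ m) :-ℚ (n :-ℚ m) :*ℚ (N :+ℚ e)) ≡.refl ĉ m̂ r n̂ N̂ η ⟩
          ((+ 2 / 1) ℚ.* ĉ ℚ.* n̂ ℚ.- r ℚ.* ĉ ℚ.* m̂) ℚ.- p ℚ.* (N̂ ℚ.+ η)
            <⟨ ℚₚ.+-monoʳ-< ((+ 2 / 1) ℚ.* ĉ ℚ.* n̂ ℚ.- r ℚ.* ĉ ℚ.* m̂) (ℚₚ.neg-antimono-< (ℚₚ.*-monoʳ-<-pos p {{ℚ.positive 0<p}} rĉ<N̂+η)) ⟩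
          ((+ 2 / 1) ℚ.* ĉ ℚ.* n̂ ℚ.- r ℚ.* ĉ ℚ.* m̂) ℚ.- p ℚ.* (r ℚ.* ĉ)
            ≡⟨ solveℚ 4 (λ pairs m r n → (conℚ (+ 2 / 1) :*ℚ pairs :*ℚ n :-ℚ r :*ℚ pairs :*ℚ m) :-ℚ (n :-ℚ m) :*ℚ (r :*ℚ pairs) :=ℚ pairs :*ℚ ((conℚ (+ 2 / 1) :-ℚ r) :*ℚ n)) ≡.refl ĉ m̂ r n̂ ⟩
          ĉ ℚ.* (((+ 2 / 1) ℚ.- r) ℚ.* n̂) ∎)

    -- The real bound does not exceed m, so `gap⇒<` read backwards yields the integer inequality
    -- required by `peak-≤`. The decidable case distinction on k ≤ m supplies m < k, hence m < n,
    -- the assumption of `gap⇒<`.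
    ceiling-bound : ∀ m → IsCeiling bound m → ∀ k → IsPeak (d T) (n ∸ 2) k → + k ℤ.≤ m
    ceiling-bound m (_ , bound≤m) k peak = decide (+ k ℤ.≤? m)
      where
      module _ (m<k : m ℤ.< + k) where
        m<n : m ℤ.< + n
        m<n = ℤₚ.<-≤-trans m<k (ℤ.+≤+ (ℕₚ.≤-trans (proj₁ peak) (ℕₚ.m∸n≤m n 2)))
        no-gap : (+ n ℤ.- m) ℤ.* (+ 2 ℤ.* pairs ℤ.- N) ℤ.≤ m ℤ.* pairs
        no-gap = ℤₚ.≮⇒≥ λ gap → bound≤m (gap⇒< m m<n gap)
        natural : ∀ x → x ≡ m → + k ℤ.≤ x
        -- A negative m violates `no-gap`: m times the positive number `pairs` is negative, while
        -- the other side is nonnegative because m < n and N ≤ `pairs`.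
        natural ℤ.-[1+ x ] ≡.refl = contradiction no-gap (ℤₚ.<⇒≱ (ℤₚ.<-≤-trans
          (≡.subst (ℤ.-[1+ x ] ℤ.* pairs ℤ.<_) (ℤₚ.*-zeroʳ pairs) (≡.subst (ℤ._< pairs ℤ.* ℤ.0ℤ) (ℤₚ.*-comm pairs ℤ.-[1+ x ]) (mono-< pairs 0<pairs ℤ.-<+)))
          (*-nonneg (ℤₚ.i≤j⇒0≤j-i (ℤₚ.<⇒≤ m<n)) (ℤₚ.i≤j⇒0≤j-i
            (ℤₚ.≤-trans N≤pairs (≡.subst (ℤ._≤ + 2 ℤ.* pairs) (ℤₚ.*-identityˡ pairs) (ℤₚ.*-monoʳ-≤-nonNeg pairs {+ 1} {+ 2} (ℤ.+≤+ (ℕ.s≤s ℕ.z≤n)))))))))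
        natural (+ l) ≡.refl = ℤ.+≤+ (peak-≤ k l peak (≡.subst₂ ℤ._≤_ left right (mono-≤ (+ 2) (0≤+ 2) no-gap)))
          where
          left : + 2 ℤ.* ((+ n ℤ.- + l) ℤ.* (+ 2 ℤ.* pairs ℤ.- N)) ≡ (+ n ℤ.- + l) ℤ.* (+ 2 ℤ.* Z′ ℤ.- + 2 ℤ.* N)
          left = ≡.trans (solve 4 (λ n l pairs N → con (+ 2) :* ((n :- l) :* (con (+ 2) :* pairs :- N)) := (n :- l) :* (con (+ 2) :* (con (+ 2) :* pairs) :- con (+ 2) :* N)) ≡.refl (+ n) (+ l) pairs N)
            (≡.cong (λ z → (+ n ℤ.- + l) ℤ.* (+ 2 ℤ.* z ℤ.- + 2 ℤ.* N)) 2pairs≡Z′)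
          right : + 2 ℤ.* (+ l ℤ.* pairs) ≡ + l ℤ.* Z′
          right = ≡.trans (solve 2 (λ l pairs → con (+ 2) :* (l :* pairs) := l :* (con (+ 2) :* pairs)) ≡.refl (+ l) pairs) (≡.cong (+ l ℤ.*_) 2pairs≡Z′)
      decide : Dec (+ k ℤ.≤ m) → + k ℤ.≤ m
      decide (yes k≤m) = k≤m
      decide (no k≰m)  = natural (ℤₚ.≰⇒> k≰m) m ≡.refl

theorem3p3 : (n : ℕ) → 3 ≤ n → (T : Tree n) →
    ((ρ : ℝ) → 0ᴿ ≤ᴿ ρ →
    ρ *ᴿ fromℕ ((n ∸ 1) C 2) ≤ᴿ fromℕ (numP₃ T) →
    Σ[ 3-ρ≠0 ∈ (fromℕ 3 -ᴿ ρ) ≠0 ]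
    ((m : ℤ) →
    IsCeiling ((fromℕ 2 -ᴿ ρ) *ᴿ inv (fromℕ 3 -ᴿ ρ) 3-ρ≠0 *ᴿ fromℕ n) m →
    (k : ℕ) → IsPeak (d T) (n ∸ 2) k → + k ℤ.≤ m))
    × ((k : ℕ) → IsPeak (d T) (n ∸ 2) k → + k ℤ.≤ ceiling ((+ 2 / 3) ℚ.* (+ n / 1)))
theorem3p3 (suc (suc (suc t))) (ℕ.s≤s (ℕ.s≤s (ℕ.s≤s ℕ.z≤n))) T =
  (λ ρ 0≤ρ ρc≤N → Bounds.3-ρ≠0 t T ρ 0≤ρ ρc≤N , Bounds.ceiling-bound t T ρ 0≤ρ ρc≤N) , Bounds.universal t T
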